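{- Let $k\ge 1$, let $W^0$ be the set of affine Grassmannian permutations of the affine symmetric group $W$ of type $\tilde A_k$, and let $u,w\in W^0$. Define the quasisymmetric function $$K_{[u,w]}=\sum_{\omega} F_{D(\omega)},$$ where the sum runs over all directed paths $\omega$ from $u$ to $w$ in the affine $0$-Bruhat multigraph. Then $$K_{[u,w]}=\sum_{\lambda} c^{w}_{u,\lambda}\, S_\lambda,$$ where $S_\lambda$ is the Schur function and $c^w_{u,\lambda}$ is the coefficient of the dual $k$-Schur function $\mathfrak S^{(k)}_w$ in the expansion of the product $\mathfrak S^{(k)}_u\cdot S_\lambda$ (computed in $\Lambda^{(k)}$) in the basis of dual $k$-Schur functions.
   Context: Affine symmetric group: $W$ is the group of bijections $u:\mathbb Z\to\mathbb Z$ with $u(i+k+1)=u(i)+k+1$ for all $i$ and $u(1)+\cdots+u(k+1)=\binom{k+2}{2}$; product is composition $(uw)(i)=u(w(i))$. It is a Coxeter group generated by $s_0,\dots,s_k$, where $s_i$ swaps $i+m(k+1)$ and $i+1+m(k+1)$ for all $m\in\mathbb Z$; $\ell(u)$ denotes Coxeter length. $W^0$ is the set of $u\in W$ with $u^{ -1}(1)<u^{ -1}(2)<\cdots<u^{ -1}(k+1)$ (the values $1,\dots,k+1$ appear from left to right). The value $0$ is considered nonpositive. Operators $\mathbf t_{ab}$: for integers $a<b$ with $b-a\le k$, let $t_{a,b}\in W$ swap $a+m(k+1)$ and $b+m(k+1)$ for all $m$. For $u\in W$ define $u\mathbf t_{ab}=ut_{a,b}$ if $\ell(ut_{a,b})=\ell(u)+1$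 and $u(a)\le 0<u(b)$, and $u\mathbf t_{ab}=0$ otherwise (equivalently to the length condition: $u(a)<u(b)$ and no $a<i<b$ has $u(a)<u(i)<u(b)$). The affine $0$-Bruhat multigraph has vertex set $W^0$ and, for every such pair $(a,b)$ with $u\mathbf t_{ab}\neq 0$, an edge $u\to u\mathbf t_{ab}$ labeled $b$ (distinct pairs $(a,b)$ giving the same target give distinct edges). For a path $\omega$ with labels $b_1,\dots,b_n$, $D(\omega)$ is the composition $(d_1,\dots,d_s)$ of $n$ such that $b_i>b_{i+1}$ exactly for $i\in\{d_1,d_1+d_2,\dots,d_1+\cdots+d_{s-1}\}$. $F_\alpha$ is Gessel's fundamental quasisymmetric function: for a composition $\alpha$ of $n$ with descent set $S\subseteq\{1,\dots,n-1\}$, $F_\alpha=\sum x_{i_1}\cdots x_{i_n}$ over $i_1\le\cdots\le i_n$ with $i_j<i_{j+1}$ for $j\in S$. $k$-Schur functions: the weak order on $W$ has covers $u\lessdot us_i$ when $\ell(us_i)=\ell(u)+1$, labeled $i$. A sequence $(i_1,\dots,i_m)$ of labels is cyclically increasing if the $i_j$ are distinct, $1\le m\le k$, they appear in clockwise order on a clock with hours $0,1,\dots,k$, and the smallest $j\in\{0,\dots,k\}$ not among them lies (clockwise) between $i_m$ and $i_1$. For a $k$-bounded partition $\lambda=(\lambda_1,\dots,\lambda_\ell)$ (i.e. $\lambda_1\le k$) and $v\in W^0$, let $K_{\lambda,v}$ be the number of ways to go from the identity to $v$ in the weak order by successively following saturated chains with cyclically increasing labels of lengths $\lambda_1,\lambda_2,\dots,\lambda_\ell$.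 The $k$-Schur functions $S^{(k)}_v$ ($v\in W^0$) are the unique symmetric functions with $h_\lambda=\sum_v K_{\lambda,v}S^{(k)}_v$ for all $k$-bounded $\lambda$ (inverting the matrix $[K_{\lambda,v}]$). They form a basis of $\Lambda_{(k)}=\mathbb Z[h_1,\dots,h_k]$. Let $\Lambda^{(k)}=\Lambda/\langle m_\lambda:\lambda_1>k\rangle$, identified with the graded dual of $\Lambda_{(k)}$ via the Hall inner product $\langle h_\lambda,m_\mu\rangle=\delta_{\lambda\mu}$; the dual $k$-Schur functions $\mathfrak S^{(k)}_v$ form the basis of $\Lambda^{(k)}$ dual to $\{S^{(k)}_v\}$. -}

module Defs where

open import Data.Bool using (Bool; true; false; _∧_; _∨_; not; if_then_else_; T)
open import Data.Nat as ℕ using (ℕ; zero; suc; _≡ᵇ_; _<ᵇ_; _≤ᵇ_; _∸_; _⊓_)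
open import Data.Nat.Combinatorics using (_C_)
open import Data.Integer as ℤ using (ℤ; +_; _/ℕ_; _%ℕ_)
import Data.Integer.Properties as ℤP
open import Data.Fin using (toℕ)
open import Data.Maybe using (Maybe; just; nothing)
open import Data.List using (List; []; _∷_; map; length; concatMap; concat; foldr; upTo; applyUpTo; replicate; zipWith; filterᵇ)
open import Data.Bool.ListAction using (and; all; any)
open import Data.Nat.ListAction using (sum)
import Data.List.Properties as LP
open import Data.Vec as V using (Vec)
import Data.Vec.Properties as VP
open import Data.Product using (_×_; _,_; proj₁; proj₂)
open import Relation.Nullary using (does)
open import Relation.Binary.PropositionalEquality using (_≡_)
open import Data.List.Relation.Unary.Unique.Propositional using (Unique)

ltℤ : ℤ → ℤ → Bool
ltℤ x y = not (y ℤ.≤ᵇ x)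

sumℤ : List ℤ → ℤ
sumℤ = foldr ℤ._+_ (+ 0)

nthℤ : List ℤ → ℕ → ℤ
nthℤ []       _       = + 0
nthℤ (x ∷ _)  zero    = x
nthℤ (_ ∷ xs) (suc n) = nthℤ xs n

nthℕ : List ℕ → ℕ → ℕ
nthℕ []       _       = 0
nthℕ (x ∷ _)  zero    = x
nthℕ (_ ∷ xs) (suc n) = nthℕ xs n

eqListℕ : List ℕ → List ℕ → Bool
eqListℕ xs ys = does (LP.≡-dec ℕ._≟_ xs ys)

countℕ : ℕ → List ℕ → ℕ
countℕ v xs = length (filterᵇ (λ y → y ≡ᵇ v) xs)

seqs : ℕ → ℕ → List (List ℕ)
seqs zero    N = [] ∷ []
seqs (suc p) N = concatMap (λ x → map (x ∷_) (seqs p N)) (upTo N)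

-- Affine permutations of type Ã_k, given by their window [u(1),…,u(k+1)]

Window : ℕ → Set
Window k = Vec ℤ (suc k)

eqW : {k : ℕ} → Window k → Window k → Bool
eqW u v = does (VP.≡-dec ℤP._≟_ u v)

-- u(i) for arbitrary i ∈ ℤ, using u(i + m(k+1)) = u(i) + m(k+1)
ev : (k : ℕ) → Window k → ℤ → ℤ
ev k u i = nthℤ (V.toList u) ((i ℤ.- + 1) %ℕ suc k)
           ℤ.+ ((i ℤ.- + 1) /ℕ suc k) ℤ.* + suc k

-- u is a bijection ℤ → ℤ with the periodicity (window entries pairwise
-- distinct mod k+1) and u(1)+⋯+u(k+1) = binom(k+2,2)
IsAffPerm : (k : ℕ) → Window k → Set
IsAffPerm k u = Unique (map (λ x → x %ℕ suc k) (V.toList u))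
              × sumℤ (V.toList u) ≡ + (suc (suc k) C 2)

idW : (k : ℕ) → Window k
idW k = V.tabulate (λ r → + suc (toℕ r))

-- the reflection t_{a,b} of ℤ (swapping a+m(k+1) and b+m(k+1))
tr : (k : ℕ) → ℤ → ℤ → ℤ → ℤ
tr k a b i =
  if (i %ℕ suc k) ≡ᵇ (a %ℕ suc k) then i ℤ.+ (b ℤ.- a)
  else if (i %ℕ suc k) ≡ᵇ (b %ℕ suc k) then i ℤ.- (b ℤ.- a)
  else i

mulT : (k : ℕ) → Window k → ℤ × ℤ → Window k
mulT k u (a , b) = V.tabulate (λ r → ev k u (tr k a b (+ suc (toℕ r))))

invAt : (k : ℕ) → Window k → ℤ → ℤ
invAt k u v = go 1 (V.toList u)
  where
  go : ℕ → List ℤ → ℤ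
  go r []       = + 0
  go r (x ∷ xs) = if (x %ℕ suc k) ≡ᵇ (v %ℕ suc k)
                  then + r ℤ.+ ((v ℤ.- x) /ℕ suc k) ℤ.* + suc k
                  else go (suc r) xs

inW0 : (k : ℕ) → Window k → Bool
inW0 k u = and (applyUpTo (λ j → ltℤ (invAt k u (+ suc j)) (invAt k u (+ suc (suc j)))) k)

-- ℓ(u t_{a,b}) = ℓ(u)+1, via the criterion given in the context
-- (for a < b, b-a ≤ k): u(a) < u(b) and no a<i<b has u(a) < u(i) < u(b)
lenUp : (k : ℕ) → Window k → ℤ → ℤ → Bool
lenUp k u a b =
  ltℤ (ev k u a) (ev k u b) ∧
  all (λ j → not (ltℤ (ev k u a) (ev k u (a ℤ.+ + j)) ∧ ltℤ (ev k u (a ℤ.+ + j)) (ev k u b)))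
      (applyUpTo suc (ℤ.∣ b ℤ.- a ∣ ∸ 1))

zeroStep : (k : ℕ) → Window k → ℤ × ℤ → Bool
zeroStep k u (a , b) =
  ltℤ a b ∧ ((b ℤ.- a) ℤ.≤ᵇ + k) ∧ (ev k u a ℤ.≤ᵇ + 0) ∧ ltℤ (+ 0) (ev k u b) ∧ lenUp k u a b

-- A path is the list of the pairs (a,b) of its edges; distinct pairs are
-- distinct edges. All vertices lie in W^0.
PathFromTo : (k : ℕ) → Window k → List (ℤ × ℤ) → Window k → Set
PathFromTo k u []       w = u ≡ w
PathFromTo k u (e ∷ es) w =
  T (zeroStep k u e) × T (inW0 k (mulT k u e)) × PathFromTo k (mulT k u e) es w

labels : List (ℤ × ℤ) → List ℤ
labels = map proj₂

compOf : List ℤ → List ℕ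
compOf []       = []
compOf (x ∷ xs) = go x 1 xs
  where
  go : ℤ → ℕ → List ℤ → List ℕ
  go p c []       = c ∷ []
  go p c (y ∷ ys) = if ltℤ y p then c ∷ go y 1 ys else go y (suc c) ys

D : List (ℤ × ℤ) → List ℕ
D ω = compOf (labels ω)

-- Power series in finitely many variables x₁,…,x_N : a monomial is its
-- exponent vector a ∈ ℕ^N, a series is its coefficient function.

size : {N : ℕ} → Vec ℕ N → ℕ
size a = sum (V.toList a)

compDes : List ℕ → List ℕ
compDes = go 0
  where
  go : ℕ → List ℕ → List ℕ
  go acc []           = []
  go acc (x ∷ [])     = []
  go acc (x ∷ y ∷ r)  = (acc ℕ.+ x) ∷ go (acc ℕ.+ x) (y ∷ r)

-- coefficient of x^a in Gessel's F_α : the monomial x^a is x_{i₁}⋯x_{iₙ} for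
-- the unique weakly increasing (i_j); it occurs iff n = |α| and
-- i_j < i_{j+1} for every descent j of α.
Fcoeff : List ℕ → {N : ℕ} → Vec ℕ N → ℤ
Fcoeff α {N} a =
  let idx = concat (zipWith replicate (V.toList a) (upTo N)) in
  if (length idx ≡ᵇ sum α) ∧ all (λ j → nthℕ idx (j ∸ 1) <ᵇ nthℕ idx j) (compDes α)
  then + 1 else + 0

weakDec : List ℕ → Bool
weakDec []           = true
weakDec (x ∷ [])     = true
weakDec (x ∷ y ∷ r)  = (y ≤ᵇ x) ∧ weakDec (y ∷ r)

isPartition : List ℕ → Bool
isPartition la = all (λ x → 1 ≤ᵇ x) la ∧ weakDec la

kBounded : ℕ → List ℕ → Bool
kBounded k la = all (λ x → x ≤ᵇ k) la

-- partitions of n with all parts ≤ m (fuel ≥ n)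
partsMax : ℕ → ℕ → ℕ → List (List ℕ)
partsMax zero     zero    m = [] ∷ []
partsMax zero     (suc _) m = []
partsMax (suc f)  zero    m = [] ∷ []
partsMax (suc f)  (suc n) m =
  concatMap (λ p → map (p ∷_) (partsMax f (suc n ∸ p) p)) (applyUpTo suc (suc n ⊓ m))

partitions : ℕ → List (List ℕ)
partitions n = partsMax n n n

insertDesc : ℕ → List ℕ → List ℕ
insertDesc x []       = x ∷ []
insertDesc x (y ∷ ys) = if y ≤ᵇ x then x ∷ y ∷ ys else y ∷ insertDesc x ys

sortDesc : List ℕ → List ℕ
sortDesc = foldr insertDesc []

mCoeff : List ℕ → {N : ℕ} → Vec ℕ N → ℤ
mCoeff mu a = if eqListℕ (sortDesc (filterᵇ (λ x → 1 ≤ᵇ x) (V.toList a))) mu then + 1 else + 0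

-- Schur functions: coefficient of x^a in S_λ = number of semistandard
-- Young tableaux of shape λ with entries in {1..N} (encoded 0..N-1) and content a
weakInc : List ℕ → Bool
weakInc []           = true
weakInc (x ∷ [])     = true
weakInc (x ∷ y ∷ r)  = (x ≤ᵇ y) ∧ weakInc (y ∷ r)

colStrict : List (List ℕ) → Bool
colStrict []             = true
colStrict (R ∷ [])       = true
colStrict (R ∷ R' ∷ Rs)  = and (zipWith _<ᵇ_ R R') ∧ colStrict (R' ∷ Rs)

fillings : List ℕ → ℕ → List (List (List ℕ))
fillings []       N = [] ∷ []
fillings (p ∷ ps) N = concatMap (λ r → map (r ∷_) (fillings ps N)) (seqs p N)

schurCoeff : List ℕ → {N : ℕ} → Vec ℕ N → ℤ
schurCoeff la {N} a =
  + length (filterᵇ (λ Tab → all weakInc Tab ∧ colStrict Tab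
                            ∧ eqListℕ (map (λ v → countℕ v (concat Tab)) (upTo N)) (V.toList a))
                    (fillings la N))

below : {N : ℕ} → Vec ℕ N → List (Vec ℕ N)
below V.[]       = V.[] ∷ []
below (x V.∷ xs) = concatMap (λ y → map (y V.∷_) (below xs)) (upTo (suc x))

prodCoeff : {N : ℕ} → (Vec ℕ N → ℤ) → (Vec ℕ N → ℤ) → Vec ℕ N → ℤ
prodCoeff f g a = sumℤ (map (λ b → f b ℤ.* g (V.zipWith _∸_ a b)) (below a))

minMissing : ℕ → List ℕ → ℕ
minMissing k L = go (upTo (suc k))
  where
  go : List ℕ → ℕ
  go []       = suc k
  go (x ∷ xs) = if any (λ y → y ≡ᵇ x) L then go xs else x

strictInc : List ℕ → Bool
strictInc []           = true
strictInc (x ∷ [])     = true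
strictInc (x ∷ y ∷ r)  = (x <ᵇ y) ∧ strictInc (y ∷ r)

-- reading the clock clockwise starting right after the smallest missing
-- hour j, the labels appear in the order i₁,…,i_m (this also forces
-- distinctness and j lying between i_m and i₁)
cycInc : ℕ → List ℕ → Bool
cycInc k L =
  (1 ≤ᵇ length L) ∧ (length L ≤ᵇ k) ∧ all (λ x → x <ᵇ suc k) L ∧
  strictInc (map (λ x → (x ℕ.+ suc k ∸ suc (minMissing k L)) ℕ.% suc k) L)

-- follow u ⋖ u s_{i₁} ⋖ u s_{i₁} s_{i₂} ⋖ ⋯ in the weak order
-- (s_i = t_{i,i+1}); nothing if some step is not a cover
chainEnd : (k : ℕ) → Window k → List ℕ → Maybe (Window k)
chainEnd k u []       = just u
chainEnd k u (i ∷ is) =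
  if lenUp k u (+ i) (+ suc i) then chainEnd k (mulT k u (+ i , + suc i)) is else nothing

mutual
  Kfrom : (k : ℕ) → List ℕ → Window k → Window k → ℕ
  Kfrom k []       u v = if eqW u v then 1 else 0
  Kfrom k (m ∷ ms) u v = sum (map (λ L → Kstep k ms (cycInc k L) (chainEnd k u L) v) (seqs m (suc k)))

  Kstep : (k : ℕ) → List ℕ → Bool → Maybe (Window k) → Window k → ℕ
  Kstep k ms false _         v = 0
  Kstep k ms true  nothing   v = 0
  Kstep k ms true  (just u') v = Kfrom k ms u' v

Kmat : (k : ℕ) → List ℕ → Window k → ℕ
Kmat k la v = Kfrom k la (idW k) v

-- the dual k-Schur function 𝔖^{(k)}_v, represented in Λ by
-- Σ_{μ k-bounded} K_{μ,v} m_μ (coefficient of x^a)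
dualKSchurCoeff : (k : ℕ) → Window k → {N : ℕ} → Vec ℕ N → ℤ
dualKSchurCoeff k v a =
  sumℤ (map (λ mu → if kBounded k mu then + Kmat k mu v ℤ.* mCoeff mu a else + 0) (partitions (size a)))

-- coefficient of m_μ in 𝔖^{(k)}_u · S_λ  (for μ k-bounded this is the
-- coefficient in Λ^{(k)})
prodMCoeff : (k : ℕ) → Window k → List ℕ → List ℕ → ℤ
prodMCoeff k u la mu = prodCoeff (dualKSchurCoeff k u) (schurCoeff la) (V.fromList mu)

-- A permutation v in W⁰ is encoded by the function h j = ⌊(v j − 1)/n⌋ with
-- n = k + 1.  On functions of such h, the cyclically increasing weak chains of
-- length r give operators U r, which commute because U r is the trace of a
-- carrier satisfying a Yang–Baxter relation; the coefficients of dual k-Schur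
-- functions are the values of products of the U r at the identity.  The strong
-- covers with label b give operators Ξ b with Ξ b ∘ Ξ b = 0, and the paths whose
-- labels increase within m steps are counted by the coefficient H m of y^m in
-- the product of the 1 + y Ξ b.  The relation
-- U r ∘ H m = H m ∘ U r + U (r − 1) ∘ H (m − 1) says that H m is dual to
-- multiplying dual k-Schur functions by h_m.
-- By the Cauchy identity both sides of the theorem, as functions of w, then have
-- the same products of U r at the identity, and these separate functions on W⁰.

module Submission where

import Data.Integer.DivMod as DM
open import Data.Integer.Tactic.RingSolver using () renaming (solve-∀ to solve)
open import Data.Bool using (Bool; true; false; T; not; _∧_; if_then_else_)
open import Data.Bool.ListAction using (and; all; any)
open import Data.Fin as Fin using (Fin; toℕ; fromℕ<)
import Data.Fin.Properties as FP
open import Data.List as List using (List; []; _∷_; _++_; map; length; applyUpTo; upTo; replicate; reverse; concat; zipWith; filterᵇ)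
import Data.List.Properties as LP
open import Data.Nat.ListAction using (sum)
import Data.Nat.ListAction.Properties as SP
open import Data.List.Membership.Propositional using (_∈_)
open import Data.List.Relation.Unary.All as All using (All; []; _∷_)
open import Data.List.Relation.Unary.Any using (here; there)
open import Data.List.Relation.Unary.Unique.Propositional using (Unique)
open import Data.Vec as Vec using (Vec; []; _∷_; toList)
import Data.Vec.Properties as VP
open import Data.Product using (Σ; _×_; _,_) renaming (proj₁ to fst; proj₂ to snd)
open import Data.Sum using (_⊎_) renaming (inj₁ to inl; inj₂ to inr)
open import Data.Empty using (⊥) renaming (⊥-elim to exfalso)
open import Function using (_∘_)
open import Relation.Nullary using (Dec; yes; no; ¬_)
open import Relation.Nullary.Decidable using (_×-dec_; map′)
open import Relation.Binary using (tri<; tri≈; tri>)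
open import Relation.Binary.PropositionalEquality renaming (_≡_ to _==_; cong₂ to cong2; subst₂ to subst2)

-- The relation between `U r` and `H m` is the hard step. A single factor 1 - y `Ξ b` commutes with
-- `u i` only if b is not congruent to i or i + 1; for the two factors at i and i + 1 together the
-- failure is measured by the sign operators `Ng i` and `Ng (i + 1)`. To absorb it, functions of
-- states are enlarged to functions of a word and a state, and `Ξ b` is corrected by the derivation
-- `X b` of the word (`G`). Pairs of corrected factors are compatible with `u i`, and `X b`
-- disappears in the sum over all cyclically increasing words (`Ub-X0`). The product over all labels
-- is infinite. It is cut to a range whose length is divisible by n, which suffices on states that
-- are negative to the left of the range and nonnegative to the right of it. The cut separates
-- exactly one pair of residues, b and b + 1, and this defect produces the term `U (r − 1)` ∘
-- `H (m − 1)`. The computation is done for the inverse product of the factors 1 - y `Ξ b` and is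
-- inverted at the end, which is possible because `Ξ b` ∘ `Ξ b` = 0.

module N where
 open import Data.Nat public
 open import Data.Nat.Properties public
module Z where
 open import Data.Integer public
 open import Data.Integer.Properties public
open N using (ℕ; zero; suc; s≤s; z≤n; z<s; s≤s⁻¹; _∸_)
open Z using (ℤ; +_; -[1+_]; _+_; _*_; _-_; -_; _<_; _/ℕ_; _%ℕ_; -1ℤ)

infixr 5 _·_ _&_
infixr 6 _⊹_
infixl 6 _+1 _-¹

pattern _&_ x xs = x ∷ xs

_+1 _-¹ : ℤ -> ℤ
i +1 = i + + 1
i -¹ = i - + 1

_·_ : ∀ {A : Set} {x y z : A} -> x == y -> y == z -> x == z
_·_ = trans

_⊹_ : ∀ {a b c d} -> a == b -> c == d -> a + c == b + d
_⊹_ = cong2 _+_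

+0 : ∀ i -> i + + 0 == i
+0 = Z.+-identityʳ

+0ˡ : ∀ i -> + 0 + i == i
+0ˡ = Z.+-identityˡ

0≤+ : ∀ {m} -> + 0 Z.≤ + m
0≤+ = Z.+≤+ z≤n

-- Linear arithmetic over ℤ by reflection.

module Lin where
 open Z using (_≤_)
 open import Data.Fin using (suc; zero)
 open import Data.List.Relation.Unary.All.Properties using (++⁺)
 open import Data.Unit using (tt)

 -- A Fourier–Motzkin procedure for linear arithmetic over ℤ.

 infixl 7 _:+_ _:-_
 infix 6 _=<_ _:<_ _:=_

 data Term (m : ℕ) : Set where
  var  : Fin m -> Term m
  #_   : ℕ -> Term m
  _:+_  : Term m -> Term m -> Term m
  _:-_  : Term m -> Term m -> Term m

 0' 1' 2' : ∀ {m} -> Term m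
 0' = # 0
 1' = # 1
 2' = # 2

 x0 : ∀ {m} -> Term (suc m)
 x0 = var zero
 x1 : ∀ {m} -> Term (suc (suc m))
 x1 = var (suc zero)
 x2 : ∀ {m} -> Term (suc (suc (suc m)))
 x2 = var (suc (suc zero))
 x3 : ∀ {m} -> Term (suc (suc (suc (suc m))))
 x3 = var (suc (suc (suc zero)))
 x4 : ∀ {m} -> Term (suc (suc (suc (suc (suc m)))))
 x4 = var (suc (suc (suc (suc zero))))
 x5 : ∀ {m} -> Term (suc (suc (suc (suc (suc (suc m))))))
 x5 = var (suc (suc (suc (suc (suc zero)))))

 ⟦_⟧ : ∀ {m} -> Term m -> Vec ℤ m -> ℤ
 ⟦ var i ⟧ ρ = Vec.lookup ρ i
 ⟦ # c ⟧ ρ = + c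
 ⟦ e :+ f ⟧ ρ = ⟦ e ⟧ ρ + ⟦ f ⟧ ρ
 ⟦ e :- f ⟧ ρ = ⟦ e ⟧ ρ - ⟦ f ⟧ ρ

 data Atom (m : ℕ) : Set where
  _=<_ _:<_ _:=_ : Term m -> Term m -> Atom m

 ⟦_⟧ₐ : ∀ {m} -> Atom m -> Vec ℤ m -> Set
 ⟦ e =< f ⟧ₐ ρ = ⟦ e ⟧ ρ ≤ ⟦ f ⟧ ρ
 ⟦ e :< f ⟧ₐ ρ = ⟦ e ⟧ ρ < ⟦ f ⟧ ρ
 ⟦ e := f ⟧ₐ ρ = ⟦ e ⟧ ρ == ⟦ f ⟧ ρ

 Form : ℕ -> Set
 Form m = Vec ℤ m × ℤ

 evalV : ∀ {m} -> Vec ℤ m -> Vec ℤ m -> ℤ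
 evalV [] [] = + 0
 evalV (c ∷ cs) (x ∷ xs) = c * x + evalV cs xs

 eval : ∀ {m} -> Form m -> Vec ℤ m -> ℤ
 eval (cs , c) ρ = evalV cs ρ + c

 lcV : ∀ {m} -> ℤ -> Vec ℤ m -> ℤ -> Vec ℤ m -> Vec ℤ m
 lcV a [] b [] = []
 lcV a (x ∷ xs) b (y ∷ ys) = (a * x + b * y) ∷ lcV a xs b ys

 lc : ∀ {m} -> ℤ -> Form m -> ℤ -> Form m -> Form m
 lc a (p , c) b (q , d) = lcV a p b q , a * c + b * d

 evalV-lc : ∀ {m} a (p : Vec ℤ m) b q ρ -> evalV (lcV a p b q) ρ == a * evalV p ρ + b * evalV q ρ
 evalV-lc a [] b [] [] = eq a b
  where
  eq : ∀ a b -> + 0 == a * + 0 + b * + 0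
  eq = solve
 evalV-lc a (x ∷ p) b (y ∷ q) (r ∷ ρ) rewrite evalV-lc a p b q ρ = eq a b x y r (evalV p ρ) (evalV q ρ)
  where
  eq : ∀ a b x y r P Q -> (a * x + b * y) * r + (a * P + b * Q) == a * (x * r + P) + b * (y * r + Q)
  eq = solve

 eval-lc : ∀ {m} a (p : Form m) b q ρ -> eval (lc a p b q) ρ == a * eval p ρ + b * eval q ρ
 eval-lc a (p , c) b (q , d) ρ rewrite evalV-lc a p b q ρ = eq a b c d (evalV p ρ) (evalV q ρ)
  where
  eq : ∀ a b c d P Q -> a * P + b * Q + (a * c + b * d) == a * (P + c) + b * (Q + d)
  eq = solve

 zeroV : ∀ {m} -> Vec ℤ m
 zeroV = Vec.replicate _ (+ 0)

 unitV : ∀ {m} -> Fin m -> Vec ℤ m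
 unitV zero = + 1 ∷ zeroV
 unitV (suc i) = + 0 ∷ unitV i

 form : ∀ {m} -> Term m -> Form m
 form (var i) = unitV i , + 0
 form (# c) = zeroV , + c
 form (e :+ f) = lc (+ 1) (form e) (+ 1) (form f)
 form (e :- f) = lc (+ 1) (form e) -[1+ 0 ] (form f)

 evalV-zero : ∀ {m} (ρ : Vec ℤ m) -> evalV zeroV ρ == + 0
 evalV-zero [] = refl
 evalV-zero (x ∷ ρ) rewrite evalV-zero ρ | Z.*-zeroˡ x = refl

 evalV-unit : ∀ {m} (i : Fin m) ρ -> evalV (unitV i) ρ == Vec.lookup ρ i
 evalV-unit zero (x ∷ ρ) rewrite evalV-zero ρ = +0 _ · Z.*-identityˡ x
 evalV-unit (suc i) (x ∷ ρ) = +0ˡ _ · evalV-unit i ρ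

 eval-form : ∀ {m} (e : Term m) ρ -> eval (form e) ρ == ⟦ e ⟧ ρ
 eval-form (var i) ρ = +0 _ · evalV-unit i ρ
 eval-form (# c) ρ = cong (_+ + c) (evalV-zero ρ) · +0ˡ _
 eval-form (e :+ f) ρ = eval-lc (+ 1) (form e) (+ 1) (form f) ρ ·
  eq (eval (form e) ρ) (eval (form f) ρ) · eval-form e ρ ⊹ eval-form f ρ
  where
  eq : ∀ a b -> + 1 * a + + 1 * b == a + b
  eq = solve
 eval-form (e :- f) ρ = eval-lc (+ 1) (form e) -[1+ 0 ] (form f) ρ ·
  eq (eval (form e) ρ) (eval (form f) ρ) · cong2 _-_ (eval-form e ρ) (eval-form f ρ)
  where
  eq : ∀ a b -> + 1 * a + -[1+ 0 ] * b == a - b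
  eq = solve

 Holds : ∀ {m} -> Vec ℤ m -> Form m -> Set
 Holds ρ p = + 0 ≤ eval p ρ

 nonneg-lc : ∀ a b {x y} -> + 0 ≤ x -> + 0 ≤ y -> + 0 ≤ + a * x + + b * y
 nonneg-lc a b p q = Z.+-mono-≤ {+ 0} {_} {+ 0} (mul a p) (mul b q)
  where
  mul : ∀ c {z} -> + 0 ≤ z -> + 0 ≤ + c * z
  mul c {z} r = subst (_≤ + c * z) (Z.*-zeroʳ (+ c)) (Z.*-monoˡ-≤-nonNeg (+ c) r)

 combine : ∀ {m} -> Form (suc m) -> List (Form (suc m)) -> List (Form m)
 combine p [] = []
 combine p@(+ suc a ∷ ps , c) (q@(-[1+ b ] ∷ qs , d) ∷ r) =
  lc (+ suc b) (ps , c) (+ suc a) (qs , d) ∷ combine p r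
 combine p (q ∷ r) = combine p r

 combineAll : ∀ {m} -> List (Form (suc m)) -> List (Form (suc m)) -> List (Form m)
 combineAll [] r = []
 combineAll (p ∷ ps) r = combine p r ++ combineAll ps r

 keep0 : ∀ {m} -> List (Form (suc m)) -> List (Form m)
 keep0 [] = []
 keep0 ((+ 0 ∷ ps , c) ∷ r) = (ps , c) ∷ keep0 r
 keep0 (_ ∷ r) = keep0 r

 unsat : ∀ {m} -> List (Form m) -> Bool
 unsat {zero} [] = false
 unsat {zero} (([] , + _) ∷ r) = unsat r
 unsat {zero} (([] , -[1+ _ ]) ∷ r) = true
 unsat {suc m} cs = unsat (keep0 cs ++ combineAll cs cs)

 keep0-sound : ∀ {m} x (ρ : Vec ℤ m) cs -> All (Holds (x ∷ ρ)) cs -> All (Holds ρ) (keep0 cs)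
 keep0-sound x ρ [] [] = []
 keep0-sound x ρ ((+ 0 ∷ ps , c) ∷ r) (h ∷ hs) = subst (+ 0 ≤_) (cong (_+ c) (cong (_+ evalV ps ρ) (Z.*-zeroˡ x) · +0ˡ (evalV ps ρ))) h ∷ keep0-sound x ρ r hs
 keep0-sound x ρ ((+ suc _ ∷ ps , c) ∷ r) (h ∷ hs) = keep0-sound x ρ r hs
 keep0-sound x ρ ((-[1+ _ ] ∷ ps , c) ∷ r) (h ∷ hs) = keep0-sound x ρ r hs

 combine-sound : ∀ {m} x (ρ : Vec ℤ m) p cs -> Holds (x ∷ ρ) p -> All (Holds (x ∷ ρ)) cs -> All (Holds ρ) (combine p cs)
 combine-sound x ρ p [] hp [] = []
 combine-sound x ρ p@(+ 0 ∷ ps , c) (q ∷ r) hp (h ∷ hs) = combine-sound x ρ p r hp hs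
 combine-sound x ρ p@(-[1+ _ ] ∷ ps , c) (q ∷ r) hp (h ∷ hs) = combine-sound x ρ p r hp hs
 combine-sound x ρ p@(+ suc a ∷ ps , c) (q@(+ b ∷ qs , d) ∷ r) hp (h ∷ hs) = combine-sound x ρ p r hp hs
 combine-sound x ρ p@(+ suc a ∷ ps , c) (q@(-[1+ b ] ∷ qs , d) ∷ r) hp (h ∷ hs) =
  subst (+ 0 ≤_) (eq (+ suc a) (+ suc b) x (evalV ps ρ) c (evalV qs ρ) d · sym (eval-lc (+ suc b) (ps , c) (+ suc a) (qs , d) ρ))
   (nonneg-lc (suc b) (suc a) hp h) ∷ combine-sound x ρ p r hp hs
  where
  eq : ∀ a b x P c Q d -> b * (a * x + P + c) + a * ((- b) * x + Q + d) == b * (P + c) + a * (Q + d)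
  eq = solve

 combineAll-sound : ∀ {m} x (ρ : Vec ℤ m) ps cs -> All (Holds (x ∷ ρ)) ps -> All (Holds (x ∷ ρ)) cs -> All (Holds ρ) (combineAll ps cs)
 combineAll-sound x ρ [] cs _ _ = []
 combineAll-sound x ρ (p ∷ ps) cs (h ∷ hs) k = ++⁺ (combine-sound x ρ p cs h k) (combineAll-sound x ρ ps cs hs k)

 unsat-sound : ∀ {m} (ρ : Vec ℤ m) cs -> T (unsat cs) -> All (Holds ρ) cs -> ⊥
 unsat-sound [] (([] , + _) ∷ r) t (_ ∷ hs) = unsat-sound [] r t hs
 unsat-sound [] (([] , -[1+ _ ]) ∷ r) t (() ∷ hs)
 unsat-sound (x ∷ ρ) cs t hs = unsat-sound ρ _ t (++⁺ (keep0-sound x ρ cs hs) (combineAll-sound x ρ cs cs hs hs))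

 -- Over ℤ the inequality e < f can be tightened to f - e - 1 ≥ 0, so hypotheses and negated goals
 -- alike become affine forms asserted to be nonnegative.
 leForm ltForm : ∀ {m} -> Term m -> Term m -> Form m
 leForm e f = form (f :- e)
 ltForm e f = form (f :- e :- 1')

 leForm-sound : ∀ {m} (e f : Term m) ρ -> ⟦ e ⟧ ρ ≤ ⟦ f ⟧ ρ -> Holds ρ (leForm e f)
 leForm-sound e f ρ p = subst (+ 0 ≤_) (sym (eval-form (f :- e) ρ)) (Z.i≤j⇒0≤j-i p)

 ltForm-sound : ∀ {m} (e f : Term m) ρ -> ⟦ e ⟧ ρ < ⟦ f ⟧ ρ -> Holds ρ (ltForm e f)
 ltForm-sound e f ρ p = subst (+ 0 ≤_) (eq (⟦ e ⟧ ρ) (⟦ f ⟧ ρ) · sym (eval-form (f :- e :- 1') ρ)) (Z.i≤j⇒0≤j-i (Z.i<j⇒suc[i]≤j p))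
  where
  eq : ∀ a b -> b - (+ 1 + a) == b - a - + 1
  eq = solve

 forms : ∀ {m} -> List (Atom m) -> List (Form m)
 forms [] = []
 forms (e =< f ∷ r) = leForm e f ∷ forms r
 forms (e :< f ∷ r) = ltForm e f ∷ forms r
 forms (e := f ∷ r) = leForm e f ∷ leForm f e ∷ forms r

 Curry : ∀ {m} -> Vec ℤ m -> List (Atom m) -> Set -> Set
 Curry ρ [] A = A
 Curry ρ (h ∷ hs) A = ⟦ h ⟧ₐ ρ -> Curry ρ hs A

 curryAll : ∀ {m} (ρ : Vec ℤ m) hs {A : Set} -> (All (Holds ρ) (forms hs) -> A) -> Curry ρ hs A
 curryAll ρ [] f = f []
 curryAll ρ (e =< e' ∷ hs) f = \ p -> curryAll ρ hs (\ a -> f (leForm-sound e e' ρ p ∷ a))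
 curryAll ρ (e :< e' ∷ hs) f = \ p -> curryAll ρ hs (\ a -> f (ltForm-sound e e' ρ p ∷ a))
 curryAll ρ (e := e' ∷ hs) f = \ p -> curryAll ρ hs (\ a -> f (leForm-sound e e' ρ (Z.≤-reflexive p) ∷ leForm-sound e' e ρ (Z.≤-reflexive (sym p)) ∷ a))

 check : ∀ {m} -> List (Atom m) -> Atom m -> Bool
 check hs (e =< f) = unsat (ltForm f e ∷ forms hs)
 check hs (e :< f) = unsat (leForm f e ∷ forms hs)
 check hs (e := f) = unsat (ltForm f e ∷ forms hs) ∧ unsat (ltForm e f ∷ forms hs)

 split∧ : ∀ {a b} -> T (a ∧ b) -> T a × T b
 split∧ {true} {true} _ = tt , tt

 check-sound : ∀ {m} (ρ : Vec ℤ m) hs g -> T (check hs g) -> All (Holds ρ) (forms hs) -> ⟦ g ⟧ₐ ρ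
 check-sound ρ hs (e =< f) t a with ⟦ e ⟧ ρ Z.≤? ⟦ f ⟧ ρ
 ... | yes p = p
 ... | no ¬p = exfalso (unsat-sound ρ _ t (ltForm-sound f e ρ (Z.≰⇒> ¬p) ∷ a))
 check-sound ρ hs (e :< f) t a with ⟦ e ⟧ ρ Z.<? ⟦ f ⟧ ρ
 ... | yes p = p
 ... | no ¬p = exfalso (unsat-sound ρ _ t (leForm-sound f e ρ (Z.≮⇒≥ ¬p) ∷ a))
 check-sound ρ hs (e := f) t a = Z.≤-antisym (check-sound ρ hs (e =< f) (fst (split∧ t)) a) (check-sound ρ hs (f =< e) (snd (split∧ t)) a)

 opaque
  lin : ∀ {m} (ρ : Vec ℤ m) hs g {_ : T (check hs g)} -> Curry ρ hs (⟦ g ⟧ₐ ρ)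
  lin ρ hs g {t} = curryAll ρ hs (check-sound ρ hs g t)

  lin⊥ : ∀ {m} (ρ : Vec ℤ m) hs {_ : T (unsat (forms hs))} {A : Set} -> Curry ρ hs A
  lin⊥ ρ hs {t} = curryAll ρ hs (\ a -> exfalso (unsat-sound ρ _ t a))

open Lin

-- Finite sums and guarded terms.

module Sums where
 open import Defs using (sumℤ)
 open import Data.List using (concatMap)

 infixr 5 _»_

 cong+ʳ : ∀ a {b c} -> b == c -> a + b == a + c
 cong+ʳ a refl = refl

 -- The Iverson bracket, taken of a decision rather than of a Boolean, so that a guarded term can be
 -- rewritten with the proof of its guard at hand (`»-val`).
 _»_ : ∀ {ℓ} {P : Set ℓ} -> Dec P -> ℤ -> ℤ
 yes _ » x = x
 no  _ » x = + 0

 »-cong : ∀ {ℓ ℓ'} {P : Set ℓ} {Q : Set ℓ'} (d : Dec P) (e : Dec Q) {x y} -> (P -> Q) -> (Q -> P) -> (P -> Q -> x == y) -> (d » x) == (e » y)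
 »-cong (yes p) (yes q) f g h = h p q
 »-cong (yes p) (no ¬q) f g h = exfalso (¬q (f p))
 »-cong (no ¬p) (yes q) f g h = exfalso (¬p (g q))
 »-cong (no ¬p) (no ¬q) f g h = refl

 »-val : ∀ {ℓ} {P : Set ℓ} (d : Dec P) {x y} -> (P -> x == y) -> (d » x) == (d » y)
 »-val (yes p) h = h p
 »-val (no ¬p) h = refl

 »-yes : ∀ {ℓ} {P : Set ℓ} (d : Dec P) {x} -> P -> (d » x) == x
 »-yes (yes p) _ = refl
 »-yes (no ¬p) p = exfalso (¬p p)

 »-no : ∀ {ℓ} {P : Set ℓ} (d : Dec P) {x} -> ¬ P -> (d » x) == + 0
 »-no (yes p) ¬p = exfalso (¬p p)
 »-no (no ¬p) _ = refl

 »-0 : ∀ {ℓ} {P : Set ℓ} (d : Dec P) -> (d » + 0) == + 0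
 »-0 (yes p) = refl
 »-0 (no ¬p) = refl

 »-vanish : ∀ {ℓ} {P : Set ℓ} (d : Dec P) {x} -> (P -> x == + 0) -> (d » x) == + 0
 »-vanish (yes p) h = h p
 »-vanish (no ¬p) h = refl

 »-+ : ∀ {ℓ} {P : Set ℓ} (d : Dec P) x y -> (d » x + y) == (d » x) + (d » y)
 »-+ (yes p) x y = refl
 »-+ (no ¬p) x y = refl

 »-minus : ∀ {ℓ} {P : Set ℓ} (d : Dec P) x y -> (d » x - y) == (d » x) - (d » y)
 »-minus (yes p) x y = refl
 »-minus (no ¬p) x y = refl

 »-* : ∀ {ℓ} {P : Set ℓ} (d : Dec P) c x -> (d » c * x) == c * (d » x)
 »-* (yes p) c x = refl
 »-* (no ¬p) c x = sym (Z.*-zeroʳ c)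

 »-*1 : ∀ {ℓ} {P : Set ℓ} (d : Dec P) x -> (d » x) == (d » + 1) * x
 »-*1 (yes p) x = sym (Z.*-identityˡ x)
 »-*1 (no ¬p) x = sym (Z.*-zeroˡ x)

 »-comm : ∀ {ℓ ℓ'} {P : Set ℓ} {Q : Set ℓ'} (d : Dec P) (e : Dec Q) x -> (d » e » x) == (e » d » x)
 »-comm (yes p) e x = refl
 »-comm (no ¬p) e x = sym (»-0 e)

 Ʃ : ℕ -> (ℕ -> ℤ) -> ℤ
 Ʃ zero f = + 0
 Ʃ (suc m) f = f 0 + Ʃ m (f ∘ suc)

 Ʃ-cong : ∀ m {f g} -> (∀ i -> i N.< m -> f i == g i) -> Ʃ m f == Ʃ m g
 Ʃ-cong zero h = refl
 Ʃ-cong (suc m) h = h 0 z<s ⊹ Ʃ-cong m (\ i p -> h (suc i) (s≤s p))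

 Ʃ-ext : ∀ m {f g} -> (∀ i -> f i == g i) -> Ʃ m f == Ʃ m g
 Ʃ-ext m h = Ʃ-cong m (\ i _ -> h i)

 Ʃ-zero : ∀ m {f} -> (∀ i -> i N.< m -> f i == + 0) -> Ʃ m f == + 0
 Ʃ-zero zero h = refl
 Ʃ-zero (suc m) h = h 0 z<s ⊹ Ʃ-zero m (\ i p -> h (suc i) (s≤s p))

 +-interchange : ∀ a b c d -> (a + b) + (c + d) == (a + c) + (b + d)
 +-interchange = solve

 Ʃ-+ : ∀ m f g -> Ʃ m (\ i -> f i + g i) == Ʃ m f + Ʃ m g
 Ʃ-+ zero f g = refl
 Ʃ-+ (suc m) f g = cong+ʳ ((f 0 + g 0)) (Ʃ-+ m (f ∘ suc) (g ∘ suc)) · +-interchange (f 0) (g 0) _ _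

 Ʃ-* : ∀ m c f -> Ʃ m (\ i -> c * f i) == c * Ʃ m f
 Ʃ-* zero c f = sym (Z.*-zeroʳ c)
 Ʃ-* (suc m) c f = cong+ʳ (c * f 0) (Ʃ-* m c (f ∘ suc)) · sym (Z.*-distribˡ-+ c (f 0) _)

 Ʃ-swap : ∀ m p (f : ℕ -> ℕ -> ℤ) -> Ʃ m (\ i -> Ʃ p (f i)) == Ʃ p (\ j -> Ʃ m (\ i -> f i j))
 Ʃ-swap zero p f = sym (Ʃ-zero p (\ _ _ -> refl))
 Ʃ-swap (suc m) p f = cong+ʳ (Ʃ p (f 0)) (Ʃ-swap m p (f ∘ suc)) · sym (Ʃ-+ p (f 0) (\ j -> Ʃ m (\ i -> f (suc i) j)))

 Ʃ-last : ∀ m f -> Ʃ (suc m) f == Ʃ m f + f m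
 Ʃ-last zero f = Z.+-comm (f 0) (+ 0)
 Ʃ-last (suc m) f = cong+ʳ (f 0) (Ʃ-last m (f ∘ suc)) · sym (Z.+-assoc (f 0) _ _)

 Ʃ-split : ∀ m p f -> Ʃ (m N.+ p) f == Ʃ m f + Ʃ p (\ i -> f (m N.+ i))
 Ʃ-split zero p f = sym (+0ˡ _)
 Ʃ-split (suc m) p f = cong+ʳ (f 0) (Ʃ-split m p (f ∘ suc)) · sym (Z.+-assoc (f 0) _ _)

 Ʃ-rev : ∀ m f -> Ʃ m f == Ʃ m (\ i -> f (m ∸ suc i))
 Ʃ-rev zero f = refl
 Ʃ-rev (suc m) f = Ʃ-last m f · Z.+-comm _ (f m) · cong+ʳ (f m) (Ʃ-rev m f)

 Ʃ-pick : ∀ m {f} j -> j N.< m -> (∀ i -> i N.< m -> ¬ i == j -> f i == + 0) -> Ʃ m f == f j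
 Ʃ-pick (suc m) {f} zero p h = cong+ʳ (f 0) (Ʃ-zero m (\ i q -> h (suc i) (s≤s q) (\ ()))) · +0 _
 Ʃ-pick (suc m) (suc j) (s≤s p) h = h 0 z<s (\ ()) ⊹ Ʃ-pick m j p (\ i q ne -> h (suc i) (s≤s q) (\ e -> ne (N.suc-injective e))) · +0ˡ _

 »-Ʃ : ∀ {ℓ} {P : Set ℓ} (d : Dec P) m f -> (d » Ʃ m f) == Ʃ m (\ i -> d » f i)
 »-Ʃ (yes p) m f = refl
 »-Ʃ (no ¬p) m f = sym (Ʃ-zero m (\ _ _ -> refl))

 ƩL : ∀ {A : Set} -> List A -> (A -> ℤ) -> ℤ
 ƩL xs f = sumℤ (map f xs)

 ƩL-cong : ∀ {A : Set} (xs : List A) {f g} -> (∀ x -> x ∈ xs -> f x == g x) -> ƩL xs f == ƩL xs g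
 ƩL-cong [] h = refl
 ƩL-cong (x ∷ xs) h = h x (here refl) ⊹ ƩL-cong xs (\ y p -> h y (there p))

 ƩL-ext : ∀ {A : Set} (xs : List A) {f g} -> (∀ x -> f x == g x) -> ƩL xs f == ƩL xs g
 ƩL-ext xs h = ƩL-cong xs (\ x _ -> h x)

 ƩL-zero : ∀ {A : Set} (xs : List A) {f} -> (∀ x -> x ∈ xs -> f x == + 0) -> ƩL xs f == + 0
 ƩL-zero [] h = refl
 ƩL-zero (x ∷ xs) h = h x (here refl) ⊹ ƩL-zero xs (\ y p -> h y (there p))

 ƩL-+ : ∀ {A : Set} (xs : List A) f g -> ƩL xs (\ i -> f i + g i) == ƩL xs f + ƩL xs g
 ƩL-+ [] f g = refl
 ƩL-+ (x ∷ xs) f g = cong+ʳ ((f x + g x)) (ƩL-+ xs f g) · +-interchange (f x) (g x) _ _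

 ƩL-* : ∀ {A : Set} (xs : List A) c f -> ƩL xs (\ i -> c * f i) == c * ƩL xs f
 ƩL-* [] c f = sym (Z.*-zeroʳ c)
 ƩL-* (x ∷ xs) c f = cong+ʳ (c * f x) (ƩL-* xs c f) · sym (Z.*-distribˡ-+ c (f x) _)

 ƩL-swap : ∀ {A B : Set} (xs : List A) (ys : List B) (f : A -> B -> ℤ) -> ƩL xs (\ i -> ƩL ys (f i)) == ƩL ys (\ j -> ƩL xs (\ i -> f i j))
 ƩL-swap [] ys f = sym (ƩL-zero ys (\ _ _ -> refl))
 ƩL-swap (x ∷ xs) ys f = cong+ʳ (ƩL ys (f x)) (ƩL-swap xs ys f) · sym (ƩL-+ ys (f x) (\ j -> ƩL xs (\ i -> f i j)))

 ƩL-Ʃ-swap : ∀ {A : Set} (xs : List A) m (f : A -> ℕ -> ℤ) -> ƩL xs (\ x -> Ʃ m (f x)) == Ʃ m (\ i -> ƩL xs (\ x -> f x i))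
 ƩL-Ʃ-swap [] m f = sym (Ʃ-zero m (\ _ _ -> refl))
 ƩL-Ʃ-swap (x ∷ xs) m f = cong+ʳ (Ʃ m (f x)) (ƩL-Ʃ-swap xs m f) · sym (Ʃ-+ m (f x) (\ i -> ƩL xs (\ y -> f y i)))

 ƩL-++ : ∀ {A : Set} (xs ys : List A) f -> ƩL (xs ++ ys) f == ƩL xs f + ƩL ys f
 ƩL-++ [] ys f = sym (+0ˡ _)
 ƩL-++ (x ∷ xs) ys f = cong+ʳ (f x) (ƩL-++ xs ys f) · sym (Z.+-assoc (f x) _ _)

 ƩL-map : ∀ {A B : Set} (g : A -> B) xs f -> ƩL (map g xs) f == ƩL xs (f ∘ g)
 ƩL-map g [] f = refl
 ƩL-map g (x ∷ xs) f = cong+ʳ (f (g x)) (ƩL-map g xs f)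

 ƩL-concatMap : ∀ {A B : Set} (g : A -> List B) xs f -> ƩL (concatMap g xs) f == ƩL xs (\ x -> ƩL (g x) f)
 ƩL-concatMap g [] f = refl
 ƩL-concatMap g (x ∷ xs) f = ƩL-++ (g x) (concat (map g xs)) f · cong+ʳ (ƩL (g x) f) (ƩL-concatMap g xs f)

 ƩL-applyUpTo : ∀ {A : Set} (g : ℕ -> A) m f -> ƩL (applyUpTo g m) f == Ʃ m (f ∘ g)
 ƩL-applyUpTo g zero f = refl
 ƩL-applyUpTo g (suc m) f = cong+ʳ (f (g 0)) (ƩL-applyUpTo (g ∘ suc) m f)

 »-ƩL : ∀ {ℓ} {P : Set ℓ} {A : Set} (d : Dec P) (xs : List A) f -> (d » ƩL xs f) == ƩL xs (\ i -> d » f i)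
 »-ƩL (yes p) xs f = refl
 »-ƩL (no ¬p) xs f = sym (ƩL-zero xs (\ _ _ -> refl))

 -- take m β K sums K over the vectors obtained from β by removing m in total.

 take : ℤ -> List ℕ -> (List ℕ -> ℤ) -> ℤ
 take m [] K = (m Z.≟ + 0) » K []
 take m (q ∷ β) K = Ʃ (suc q) (\ i -> take (m - + i) β (\ β' -> K ((q ∸ i) ∷ β')))

open Sums

-- Horizontal strips and the Cauchy identity for Kostka numbers.

module Cauchy where
 open Z using (_≤_)
 open import Data.Nat using (_⊓_; _⊔_)
 open import Data.List using (drop)

 infix 4 _≤?_
 opaque
  _≤?_ : ∀ m n -> Dec (m N.≤ n)
  _≤?_ = N._≤?_

 -- Horizontal strips: IL c λ ρ says c ≥ λ₁ ≥ ρ₁ ≥ λ₂ ≥ ρ₂ ≥ …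

 data IL : ℕ -> List ℕ -> List ℕ -> Set where
  []   : ∀ {c} -> IL c [] []
  cons : ∀ {c x y λs ρ} -> x N.≤ c -> y N.≤ x -> IL y λs ρ -> IL c (x ∷ λs) (y ∷ ρ)

 il? : ∀ c λs ρ -> Dec (IL c λs ρ)
 il? c [] [] = yes []
 il? c [] (_ ∷ _) = no (\ ())
 il? c (_ ∷ _) [] = no (\ ())
 il? c (x ∷ λs) (y ∷ ρ) = map′ (\ (a , b , d) -> cons a b d) (\ { (cons a b d) -> a , b , d }) ((x ≤? c) ×-dec ((y ≤? x) ×-dec il? y λs ρ))

 il-sum : ∀ {c λs ρ} -> IL c λs ρ -> sum ρ N.≤ sum λs
 il-sum [] = z≤n
 il-sum (cons _ b d) = N.+-mono-≤ b (il-sum d)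

 opaque
  Ʃ≤ : ℕ -> (ℕ -> ℤ) -> ℤ
  Ʃ≤ B f = Ʃ (suc B) f

  Ʃ≤-def : ∀ B f -> Ʃ≤ B f == Ʃ (suc B) f
  Ʃ≤-def B f = refl

  Ʃ≤-cong : ∀ B {f g} -> (∀ i -> i N.≤ B -> f i == g i) -> Ʃ≤ B f == Ʃ≤ B g
  Ʃ≤-cong B h = Ʃ-cong (suc B) (\ i l -> h i (s≤s⁻¹ l))

  Ʃ≤-swap : ∀ B m (f : ℕ -> ℕ -> ℤ) -> Ʃ≤ B (\ i -> Ʃ m (f i)) == Ʃ m (\ j -> Ʃ≤ B (\ i -> f i j))
  Ʃ≤-swap B m f = Ʃ-swap (suc B) m f

  Ʃ≤-* : ∀ B c f -> Ʃ≤ B (\ i -> c * f i) == c * Ʃ≤ B f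
  Ʃ≤-* B c f = Ʃ-* (suc B) c f

  Ʃ≤-» : ∀ {P : Set} (d : Dec P) B f -> Ʃ≤ B (\ i -> d » f i) == (d » Ʃ≤ B f)
  Ʃ≤-» d B f = sym (»-Ʃ d (suc B) f)

 Ʃ≤-ext : ∀ B {f g} -> (∀ i -> f i == g i) -> Ʃ≤ B f == Ʃ≤ B g
 Ʃ≤-ext B h = Ʃ≤-cong B (\ i _ -> h i)

 -- Shapes are summed as arbitrary vectors of a fixed length with entries up to `B`, and all shape
 -- conditions sit in the guards. Exchanging sums over two shapes is then an exchange of independent
 -- finite sums.
 box : ℕ -> ℕ -> (List ℕ -> ℤ) -> ℤ
 box zero B f = f []
 box (suc L) B f = Ʃ≤ B (\ x -> box L B (\ l -> f (x ∷ l)))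

 box-cong : ∀ L B f g -> (∀ l -> length l == L -> All (N._≤ B) l -> f l == g l) -> box L B f == box L B g
 box-cong zero B f g h = h [] refl []
 box-cong (suc L) B f g h = Ʃ≤-cong B (\ x x≤ -> box-cong L B _ _ (\ l e a -> h (x ∷ l) (cong suc e) (x≤ ∷ a)))

 box-Ʃ : ∀ L B m (f : ℕ -> List ℕ -> ℤ) -> box L B (\ l -> Ʃ m (\ i -> f i l)) == Ʃ m (\ i -> box L B (f i))
 box-Ʃ zero B m f = refl
 box-Ʃ (suc L) B m f = Ʃ≤-ext B (\ x -> box-Ʃ L B m (\ i l -> f i (x ∷ l))) · Ʃ≤-swap B m (\ x i -> box L B (\ l -> f i (x ∷ l)))

 box-swap : ∀ L B L' (f : List ℕ -> List ℕ -> ℤ) -> box L B (\ l -> box L' B (f l)) == box L' B (\ l' -> box L B (\ l -> f l l'))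
 box-swap L B zero f = refl
 box-swap L B (suc L') f = box-cong L B _ _ (\ l _ _ -> Ʃ≤-def B (\ x -> box L' B (\ l' -> f l (x ∷ l')))) · box-Ʃ L B (suc B) (\ x l -> box L' B (\ l' -> f l (x ∷ l'))) · sym (Ʃ≤-def B (\ x -> box L B (\ l -> box L' B (\ l' -> f l (x ∷ l'))))) · Ʃ≤-ext B (\ x -> box-swap L B L' (\ l l' -> f l (x ∷ l')))

 box-* : ∀ L B c f -> box L B (\ l -> c * f l) == c * box L B f
 box-* zero B c f = refl
 box-* (suc L) B c f = Ʃ≤-ext B (\ x -> box-* L B c (\ l -> f (x ∷ l))) · Ʃ≤-* B c (\ x -> box L B (\ l -> f (x ∷ l)))

 box-» : ∀ {P : Set} (d : Dec P) L B f -> box L B (\ l -> d » f l) == (d » box L B f)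
 box-» d zero B f = refl
 box-» d (suc L) B f = Ʃ≤-ext B (\ x -> box-» d L B (\ l -> f (x ∷ l))) · Ʃ≤-» d B (\ x -> box L B (\ l -> f (x ∷ l)))

 private
  iv : ∀ l u M (f : ℕ -> ℤ) -> u N.< M -> Ʃ M (\ x -> (x ≤? u) » (l ≤? x) » f x) == Ʃ (suc u ∸ l) (\ i -> f (l N.+ i))
  iv zero zero (suc M) f _ = (»-yes (0 ≤? 0) z≤n · »-yes (0 ≤? 0) z≤n) ⊹ Ʃ-zero M {\ x -> (suc x ≤? 0) » (0 ≤? suc x) » f (suc x)} (\ x _ -> »-no (suc x ≤? 0) (\ ()))
  iv zero (suc u) (suc M) f (s≤s le) = (»-yes (0 ≤? suc u) z≤n · »-yes (0 ≤? 0) z≤n) ⊹ (Ʃ-ext M {\ x -> (suc x ≤? suc u) » (0 ≤? suc x) » f (suc x)} {\ x -> (x ≤? u) » (0 ≤? x) » f (suc x)} (\ x -> »-cong (suc x ≤? suc u) (x ≤? u) s≤s⁻¹ s≤s (\ _ _ -> »-cong (0 ≤? suc x) (0 ≤? x) (\ _ -> z≤n) (\ _ -> z≤n) (\ _ _ -> refl))) · iv zero u M (f ∘ suc) le)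
  iv (suc l) zero M f _ = Ʃ-zero M {\ x -> (x ≤? 0) » (suc l ≤? x) » f x} (\ x _ -> »-vanish (x ≤? 0) {(suc l ≤? x) » f x} (\ { z≤n -> »-no (suc l ≤? 0) {f 0} (\ ()) })) · cong (\ m -> Ʃ m (\ i -> f (suc l N.+ i))) (sym (N.0∸n≡0 l))
  iv (suc l) (suc u) (suc M) f (s≤s le) = »-vanish (0 ≤? suc u) {(suc l ≤? 0) » f 0} (\ _ -> »-no (suc l ≤? 0) {f 0} (\ ())) ⊹ Ʃ-ext M {\ x -> (suc x ≤? suc u) » (suc l ≤? suc x) » f (suc x)} {\ x -> (x ≤? u) » (l ≤? x) » f (suc x)} (\ x -> »-cong (suc x ≤? suc u) (x ≤? u) s≤s⁻¹ s≤s (\ _ _ -> »-cong (suc l ≤? suc x) (l ≤? x) s≤s⁻¹ s≤s (\ _ _ -> refl))) ·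
   +0ˡ (Ʃ M (\ x -> (x ≤? u) » (l ≤? x) » f (suc x))) · iv l u M (f ∘ suc) le

 »-interval : ∀ l u B f -> u N.≤ B -> Ʃ≤ B (\ x -> (x ≤? u) » (l ≤? x) » f x) == Ʃ (suc u ∸ l) (\ i -> f (l N.+ i))
 »-interval l u B f le = Ʃ≤-def B (\ x -> (x ≤? u) » (l ≤? x) » f x) · iv l u (suc B) f (s≤s le)

 -- Reversing the interval from `l` to `u` sends x to l + u - x. Done in every row, this is the
 -- piecewise linear toggle that turns common upper strips into common lower ones.
 reflect : ∀ l u (F : ℤ -> ℤ) -> Ʃ (suc u ∸ l) (\ i -> F (+ (l N.+ i))) == Ʃ (suc u ∸ l) (\ i -> F (+ l + + u - + (l N.+ i)))
 reflect l u F = Ʃ-rev (suc u ∸ l) (\ i -> F (+ (l N.+ i))) · Ʃ-cong (suc u ∸ l) {\ i -> F (+ (l N.+ (suc u ∸ l ∸ suc i)))} {\ i -> F (+ l + + u - + (l N.+ i))} (\ i i< -> cong F (lem i i<))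
  where
  lem : ∀ i -> i N.< suc u ∸ l -> + (l N.+ (suc u ∸ l ∸ suc i)) == + l + + u - + (l N.+ i)
  lem i i< = lin (+ l & + u & + i & + (suc u ∸ l ∸ suc i) & []) (x3 :+ (1' :+ x2) :+ x0 := 1' :+ x1 & []) (x0 :+ x3 := x0 :+ x1 :- (x0 :+ x2)) (cong +_ (cong (N._+ l) (N.m∸n+n≡m i<) · N.m∸n+n≡m {suc u} {l} (N.<⇒≤ (N.m∸n≢0⇒n<m (\ e -> N.n≮0 (subst (i N.<_) e i<))))))

 »4 : ∀ {P Q S T : Set} {z : ℤ} (p : Dec P) (q : Dec Q) (s : Dec S) (t : Dec T) -> (P -> Q -> S × T) -> (S -> T -> P × Q) -> (p » q » z) == (s » t » z)
 »4 (yes p) (yes q) s t f g = sym (»-yes s (fst (f p q)) · »-yes t (snd (f p q)))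
 »4 (yes p) (no ¬q) s t f g = sym (»-vanish s (\ a -> »-no t (\ b -> ¬q (snd (g a b)))))
 »4 (no ¬p) q s t f g = sym (»-vanish s (\ a -> »-no t (\ b -> ¬p (fst (g a b)))))

 ⊔⊓ : ∀ z z' -> (z ⊔ z') N.+ (z ⊓ z') == z N.+ z'
 ⊔⊓ z z' with N.≤-total z z'
 ... | inl p = cong2 N._+_ (N.m≤n⇒m⊔n≡n p) (N.m≤n⇒m⊓n≡m p) · N.+-comm z' z
 ... | inr p = cong2 N._+_ (N.m≥n⇒m⊔n≡m p) (N.m≥n⇒m⊓n≡n p)

 ∸≤⇒≤+ : ∀ m n {o} -> m ∸ n N.≤ o -> m N.≤ n N.+ o
 ∸≤⇒≤+ m zero p = p
 ∸≤⇒≤+ zero (suc n) p = z≤n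
 ∸≤⇒≤+ (suc m) (suc n) p = s≤s (∸≤⇒≤+ m n p)

 module Box (B : ℕ) where

  -- W: common upper strips with caps; R: common lower strips.
  W : ℕ -> ℕ -> List ℕ -> List ℕ -> (ℤ -> ℤ) -> ℤ
  W c c' λs μ F = box (length λs) B (\ ν -> il? c ν λs » il? c' ν μ » F (+ sum ν))

  R : ℕ -> List ℕ -> List ℕ -> (ℤ -> ℤ) -> ℤ
  R c λs μ F = box (length λs) B (\ ρ -> il? c λs ρ » il? c μ ρ » F (+ sum ρ))

  private
   meet : ∀ {c c' y y' : ℕ} x z -> (((x ≤? c) ×-dec (y ≤? x)) » ((x ≤? c') ×-dec (y' ≤? x)) » z) == ((x ≤? c ⊓ c') » (y ⊔ y' ≤? x) » z)
   meet {c} {c'} {y} {y'} x z = »4 ((x ≤? c) ×-dec (y ≤? x)) ((x ≤? c') ×-dec (y' ≤? x)) (x ≤? c ⊓ c') (y ⊔ y' ≤? x)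
    (\ (a , b) (a' , b') -> N.⊓-glb a a' , N.⊔-lub b b') (\ a b -> (N.m≤n⊓o⇒m≤n c c' a , N.m⊔n≤o⇒m≤o y y' b) , (N.m≤n⊓o⇒m≤o c c' a , N.m⊔n≤o⇒n≤o y y' b))
   pull : ∀ {P Q S T : Set} {z} (a : Dec P) (b : Dec Q) (c : Dec S) (d : Dec T) -> (a » b » c » d » z) == (a » c » b » d » z)
   pull (yes _) b c d = »-comm b c _
   pull (no _) b c d = refl
   unfold : ∀ c x y λs ρ {z} -> (il? c (x ∷ λs) (y ∷ ρ) » z) == (((x ≤? c) ×-dec (y ≤? x)) » il? y λs ρ » z)
   unfold c x y λs ρ = »-cong (il? c (x ∷ λs) (y ∷ ρ)) (((x ≤? c) ×-dec (y ≤? x)) ×-dec il? y λs ρ) (\ { (cons a b d) -> (a , b) , d }) (\ ((a , b) , d) -> cons a b d) (\ _ _ -> refl) · prod ((x ≤? c) ×-dec (y ≤? x)) (il? y λs ρ)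
    where
    prod : ∀ {P Q : Set} {x} (a : Dec P) (b : Dec Q) -> ((a ×-dec b) » x) == (a » b » x)
    prod (yes _) (yes _) = refl
    prod (yes _) (no _) = refl
    prod (no _) b = refl
   unfold2 : ∀ c c' x x' y y' λs ρ λs' ρ' z -> (il? c (x ∷ λs) (y ∷ ρ) » il? c' (x' ∷ λs') (y' ∷ ρ') » z) == (((x ≤? c) ×-dec (y ≤? x)) » ((x' ≤? c') ×-dec (y' ≤? x')) » il? y λs ρ » il? y' λs' ρ' » z)
   unfold2 c c' x x' y y' λs ρ λs' ρ' z = unfold c x y λs ρ · cong (\ w -> ((x ≤? c) ×-dec (y ≤? x)) » il? y λs ρ » w) (unfold c' x' y' λs' ρ') · pull ((x ≤? c) ×-dec (y ≤? x)) (il? y λs ρ) ((x' ≤? c') ×-dec (y' ≤? x')) (il? y' λs' ρ')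

  W-step : ∀ c c' y y' λs μ F -> c ⊓ c' N.≤ B -> W c c' (y ∷ λs) (y' ∷ μ) F == Ʃ (suc (c ⊓ c') ∸ (y ⊔ y')) (\ i -> W y y' λs μ (\ t -> F (+ (y ⊔ y' N.+ i) + t)))
  W-step c c' y y' λs μ F le = Ʃ≤-ext B (\ x -> box-cong (length λs) B _ (\ ν -> (x ≤? c ⊓ c') » (y ⊔ y' ≤? x) » il? y ν λs » il? y' ν μ » F (+ sum (x ∷ ν))) (\ ν _ _ -> unfold2 c c' x x y y' ν λs ν μ (F (+ sum (x ∷ ν))) · meet {c} {c'} {y} {y'} x (il? y ν λs » il? y' ν μ » F (+ sum (x ∷ ν)))) · box-» (x ≤? c ⊓ c') (length λs) B _ · cong (\ z -> (x ≤? c ⊓ c') » z) (box-» (y ⊔ y' ≤? x) (length λs) B _)) ·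
   »-interval (y ⊔ y') (c ⊓ c') B (\ x -> W y y' λs μ (\ t -> F (+ x + t))) le

  -- The sum `R` for the shapes y ∷ λs and y' ∷ μ without the bound of y and y' by `B`. In `W-R` the
  -- caps of the upper strips become these first rows.
  R′ : ℕ -> ℕ -> List ℕ -> List ℕ -> (ℤ -> ℤ) -> ℤ
  R′ y y' λs μ F = Ʃ≤ B (\ r -> box (length λs) B (\ ρ -> (r ≤? y ⊓ y') » il? r λs ρ » il? r μ ρ » F (+ r + + sum ρ)))

  R′-ext : ∀ z z' λs μ {F G : ℤ -> ℤ} -> (∀ t -> F t == G t) -> R′ z z' λs μ F == R′ z z' λs μ G
  R′-ext z z' λs μ h = Ʃ≤-ext B (\ r -> box-cong (length λs) B _ _ (\ ρ _ _ -> cong (\ w -> (r ≤? z ⊓ z') » il? r λs ρ » il? r μ ρ » w) (h _)))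

  R′-step : ∀ y y' z z' λs μ F -> y ⊓ y' N.≤ B -> R′ y y' (z ∷ λs) (z' ∷ μ) F == Ʃ (suc (y ⊓ y') ∸ (z ⊔ z')) (\ i -> R′ z z' λs μ (\ t -> F (+ (z ⊔ z' N.+ i) + t)))
  R′-step y y' z z' λs μ F le = Ʃ≤-ext B (\ r -> box-» (r ≤? y ⊓ y') (suc (length λs)) B (\ ρ -> il? r (z ∷ λs) ρ » il? r (z' ∷ μ) ρ » F (+ r + + sum ρ)) · cong (\ w -> (r ≤? y ⊓ y') » w) (Ʃ≤-ext B (\ x -> box-cong (length λs) B _ (\ ρ -> (z ⊔ z' ≤? r) » (x ≤? z ⊓ z') » il? x λs ρ » il? x μ ρ » F (+ r + (+ x + + sum ρ))) (\ ρ _ _ -> row r x ρ) · box-» (z ⊔ z' ≤? r) (length λs) B _) · Ʃ≤-» (z ⊔ z' ≤? r) B (\ x -> box (length λs) B (\ ρ -> (x ≤? z ⊓ z') » il? x λs ρ » il? x μ ρ » F (+ r + (+ x + + sum ρ)))))) ·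
   »-interval (z ⊔ z') (y ⊓ y') B (\ x -> R′ z z' λs μ (\ t -> F (+ x + t))) le
   where
   row : ∀ r x ρ -> (il? r (z ∷ λs) (x ∷ ρ) » il? r (z' ∷ μ) (x ∷ ρ) » F (+ r + + sum (x ∷ ρ))) == ((z ⊔ z' ≤? r) » (x ≤? z ⊓ z') » il? x λs ρ » il? x μ ρ » F (+ r + + sum (x ∷ ρ)))
   row r x ρ = unfold2 r r z z' x x λs ρ μ ρ (F (+ r + + sum (x ∷ ρ))) · »4 ((z ≤? r) ×-dec (x ≤? z)) ((z' ≤? r) ×-dec (x ≤? z')) (z ⊔ z' ≤? r) (x ≤? z ⊓ z')
    (\ (a , b) (a' , b') -> N.⊔-lub a a' , N.⊓-glb b b') (\ a b -> (N.m⊔n≤o⇒m≤o z z' a , N.m≤n⊓o⇒m≤n z z' b) , (N.m⊔n≤o⇒n≤o z z' a , N.m≤n⊓o⇒m≤o z z' b))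

  data Last0 : List ℕ -> Set where
   end  : Last0 (0 ∷ [])
   _∷_  : ∀ y {z λs} -> Last0 (z ∷ λs) -> Last0 (y ∷ z ∷ λs)

  -- A row of a common upper strip and a row of a common lower strip both run through the interval
  -- from z ⊔ z' to y ⊓ y', and `reflect` matches them; the sizes add up by z ⊔ z' + z ⊓ z' = z +
  -- z'. A last row 0 ensures that nothing is lost at the bottom.
  W-R : ∀ y y' λs μ F -> length λs == length μ -> All (N._≤ B) (y ∷ λs) -> Last0 (y ∷ λs) -> W y y' λs μ F == R′ y y' λs μ (\ t -> F (+ (y ⊓ y') + + sum λs + + sum μ - t))
  W-R .0 y' [] [] F _ _ end = sym (Ʃ≤-ext B (\ r -> »-val (r ≤? 0) (\ _ -> sym (»-yes (0 ≤? r) z≤n))) · »-interval 0 0 B (\ r -> F (+ 0 + + 0 + + 0 - (+ r + + 0))) z≤n · +0 (F (+ 0)))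
  W-R y y' (z ∷ λs) (z' ∷ μ) F e (by ∷ bz ∷ bl) (.y ∷ l0) = W-step y y' z z' λs μ F le · reflect (z ⊔ z') (y ⊓ y') (\ x -> W z z' λs μ (\ t -> F (x + t))) ·
   Ʃ-ext (suc (y ⊓ y') ∸ (z ⊔ z')) (\ i -> W-R z z' λs μ (\ t -> F (+ (z ⊔ z') + + (y ⊓ y') - + (z ⊔ z' N.+ i) + t)) (N.suc-injective e) (bz ∷ bl) l0 ·
    R′-ext z z' λs μ (\ t -> cong F (eq (+ (z ⊔ z')) (+ (y ⊓ y')) (+ i) (+ (z ⊓ z')) (+ sum λs) (+ sum μ) t · cong (\ w -> + (y ⊓ y') + w - (+ (z ⊔ z') + + i + t)) (sz z z') · fin i t))) ·
   sym (R′-step y y' z z' λs μ (\ t -> F (+ (y ⊓ y') + + sum (z ∷ λs) + + sum (z' ∷ μ) - t)) le)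
   where
   le = N.≤-trans (N.m⊓n≤m y y') by
   sz : ∀ z z' -> + (z ⊔ z') + + (z ⊓ z') + + sum λs + + sum μ == + sum (z ∷ λs) + + sum (z' ∷ μ)
   sz z z' = cong (\ w -> + w + + sum λs + + sum μ) (⊔⊓ z z') · eq' (+ z) (+ z') (+ sum λs) (+ sum μ)
    where
    eq' : ∀ a b c d -> a + b + c + d == a + c + (b + d)
    eq' = solve
   eq : ∀ mx mn i m l u t -> mx + mn - (mx + i) + (m + l + u - t) == mn + (mx + m + l + u) - (mx + i + t)
   eq = solve
   fin : ∀ i t -> + (y ⊓ y') + (+ sum (z ∷ λs) + + sum (z' ∷ μ)) - (+ (z ⊔ z') + + i + t) == + (y ⊓ y') + + sum (z ∷ λs) + + sum (z' ∷ μ) - (+ (z ⊔ z' N.+ i) + t)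
   fin i t = cong (\ w -> w - (+ (z ⊔ z') + + i + t)) (sym (Z.+-assoc (+ (y ⊓ y')) (+ sum (z ∷ λs)) (+ sum (z' ∷ μ))))

  R-R′ : ∀ y y' λs μ F -> y N.≤ B -> y' N.≤ B -> R B (y ∷ λs) (y' ∷ μ) F == R′ y y' λs μ F
  R-R′ y y' λs μ F by by' = Ʃ≤-ext B (\ r -> box-cong (length λs) B _ _ (\ ρ _ _ -> unfold2 B B y y' r r λs ρ μ ρ (F (+ sum (r ∷ ρ))) · go r (il? r λs ρ » il? r μ ρ » F (+ sum (r ∷ ρ)))))
   where
   go : ∀ r z -> (((y ≤? B) ×-dec (r ≤? y)) » ((y' ≤? B) ×-dec (r ≤? y')) » z) == ((r ≤? y ⊓ y') » z)
   go r z with r ≤? y ⊓ y'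
   ... | yes p = »-yes ((y ≤? B) ×-dec (r ≤? y)) (by , N.m≤n⊓o⇒m≤n y y' p) · »-yes ((y' ≤? B) ×-dec (r ≤? y')) (by' , N.m≤n⊓o⇒m≤o y y' p)
   ... | no ¬p = »-vanish ((y ≤? B) ×-dec (r ≤? y)) (\ (_ , a) -> »-no ((y' ≤? B) ×-dec (r ≤? y')) (\ (_ , b) -> ¬p (N.⊓-glb a b)))

  head : List ℕ -> ℕ
  head [] = 0
  head (x ∷ _) = x

  -- Fomin's local rule. The first row of the upper strip is capped only by `B`, and its excess i
  -- over the longer first row is a free parameter; the other rows are matched with lower strips by
  -- `W-R`. In generating functions, this free parameter is the factor 1/(1 - xy) in the commutation
  -- of adding and removing strips.
  local : ∀ λs μ F -> length λs == length μ -> All (N._≤ B) λs -> All (N._≤ B) μ -> Last0 λs ->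
   W B B λs μ F == Ʃ (suc B ∸ (head λs ⊔ head μ)) (\ i -> R B λs μ (\ t -> F (+ i + (+ sum λs + + sum μ) - t)))
  local (y ∷ λs) (y' ∷ μ) F e (by ∷ bl) (by' ∷ bu) l0 = W-step B B y y' λs μ F (N.≤-reflexive (N.⊓-idem B)) · cong (\ w -> Ʃ (suc w ∸ (y ⊔ y')) (\ i -> W y y' λs μ (\ t -> F (+ (y ⊔ y' N.+ i) + t)))) (N.⊓-idem B) ·
   Ʃ-ext (suc B ∸ (y ⊔ y')) (\ i -> W-R y y' λs μ (\ t -> F (+ (y ⊔ y' N.+ i) + t)) (N.suc-injective e) (by ∷ bl) l0 · sym (R-R′ y y' λs μ (\ t -> F (+ (y ⊔ y' N.+ i) + (+ (y ⊓ y') + + sum λs + + sum μ - t))) by by') · box-cong (suc (length λs)) B _ _ (\ ρ _ _ -> cong (\ w -> il? B (y ∷ λs) ρ » il? B (y' ∷ μ) ρ » F w) (fin i (+ sum ρ))))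
   where
   eq : ∀ mx i m l u t -> mx + i + (m + l + u - t) == i + (mx + m + (l + u)) - t
   eq = solve
   eq' : ∀ a b c d -> a + b + (c + d) == a + c + (b + d)
   eq' = solve
   fin : ∀ i t -> + (y ⊔ y' N.+ i) + (+ (y ⊓ y') + + sum λs + + sum μ - t) == + i + (+ sum (y ∷ λs) + + sum (y' ∷ μ)) - t
   fin i t = eq (+ (y ⊔ y')) (+ i) (+ (y ⊓ y')) (+ sum λs) (+ sum μ) t · cong (\ w -> + i + w - t) (cong (\ w -> + w + (+ sum λs + + sum μ)) (⊔⊓ y y') · eq' (+ y) (+ y') (+ sum λs) (+ sum μ))

  -- Kostka numbers: one horizontal strip is removed for each entry of the content, the head first.
  -- Shapes keep their length and are padded by zeros.
  SC : List ℕ -> List ℕ -> ℤ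
  SC λs [] = (sum λs N.≟ 0) » + 1
  SC λs (m ∷ a) = box (length λs) B (\ ρ -> il? B λs ρ » (+ sum λs Z.≟ + sum ρ + + m) » SC ρ a)

  take-cong : ∀ m ν {K K'} -> (∀ ν' -> K ν' == K' ν') -> take m ν K == take m ν K'
  take-cong m [] h = cong (\ z -> (m Z.≟ + 0) » z) (h [])
  take-cong m (q ∷ ν) {K} {K'} h = Ʃ-ext (suc q) {\ i -> take (m - + i) ν (\ ν' -> K ((q ∸ i) ∷ ν'))} {\ i -> take (m - + i) ν (\ ν' -> K' ((q ∸ i) ∷ ν'))} (\ i -> take-cong (m - + i) ν (\ ν' -> h ((q ∸ i) ∷ ν')))

  take-» : ∀ {P : Set} (d : Dec P) m ν K -> take m ν (\ ν' -> d » K ν') == (d » take m ν K)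
  take-» d m [] K = »-comm (m Z.≟ + 0) d _
  take-» d m (q ∷ ν) K = Ʃ-ext (suc q) {\ i -> take (m - + i) ν (\ ν' -> d » K ((q ∸ i) ∷ ν'))} {\ i -> d » take (m - + i) ν (\ ν' -> K ((q ∸ i) ∷ ν'))} (\ i -> take-» d (m - + i) ν (\ ν' -> K ((q ∸ i) ∷ ν'))) · sym (»-Ʃ d (suc q) (\ i -> take (m - + i) ν (\ ν' -> K ((q ∸ i) ∷ ν'))))

  take-* : ∀ c m ν K -> take m ν (\ ν' -> c * K ν') == c * take m ν K
  take-* c m [] K = »-* (m Z.≟ + 0) c (K [])
  take-* c m (q ∷ ν) K = Ʃ-ext (suc q) {\ i -> take (m - + i) ν (\ ν' -> c * K ((q ∸ i) ∷ ν'))} {\ i -> c * take (m - + i) ν (\ ν' -> K ((q ∸ i) ∷ ν'))} (\ i -> take-* c (m - + i) ν (\ ν' -> K ((q ∸ i) ∷ ν'))) · Ʃ-* (suc q) c (\ i -> take (m - + i) ν (\ ν' -> K ((q ∸ i) ∷ ν')))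

  take-box : ∀ L m ν (K : List ℕ -> List ℕ -> ℤ) -> take m ν (\ ν' -> box L B (\ l -> K l ν')) == box L B (\ l -> take m ν (K l))
  take-box L m [] K = sym (box-» (m Z.≟ + 0) L B (\ l -> K l []))
  take-box L m (q ∷ ν) K = Ʃ-ext (suc q) {\ i -> take (m - + i) ν (\ ν' -> box L B (\ l -> K l ((q ∸ i) ∷ ν')))} {\ i -> box L B (\ l -> take (m - + i) ν (\ ν' -> K l ((q ∸ i) ∷ ν')))} (\ i -> take-box L (m - + i) ν (\ l ν' -> K l ((q ∸ i) ∷ ν'))) · sym (box-Ʃ L B (suc q) (\ i l -> take (m - + i) ν (\ ν' -> K l ((q ∸ i) ∷ ν'))))

  zeros : ℕ -> List ℕ
  zeros L = replicate L 0

  sum-zeros : ∀ L -> sum (zeros L) == 0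
  sum-zeros zero = refl
  sum-zeros (suc L) = sum-zeros L

  box-zeros : ∀ L g -> (∀ l -> ¬ sum l == 0 -> g l == + 0) -> box L B g == g (zeros L)
  box-zeros zero g h = refl
  box-zeros (suc L) g h = Ʃ≤-def B (\ x -> box L B (\ l -> g (x ∷ l))) · Ʃ-pick (suc B) {\ x -> box L B (\ l -> g (x ∷ l))} 0 z<s (\ { zero _ ne -> exfalso (ne refl) ; (suc x) _ _ -> trans (box-cong L B _ (\ _ -> + 0 * + 0) (\ l _ _ -> h (suc x ∷ l) (\ ()))) (box-* L B (+ 0) (\ _ -> + 0)) }) · box-zeros L (\ l -> g (0 ∷ l)) (\ l -> h (0 ∷ l))

  il-zeros : ∀ {c ρ} -> sum ρ == 0 -> IL c (zeros (length ρ)) ρ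
  il-zeros {ρ = []} _ = []
  il-zeros {ρ = zero ∷ ρ} e = cons z≤n z≤n (il-zeros e)

  SC-zeros : ∀ L ν -> SC (zeros L) ν == ((sum ν N.≟ 0) » + 1)
  SC-zeros L [] = »-yes (sum (zeros L) N.≟ 0) (sum-zeros L) · refl
  SC-zeros L (m ∷ ν) = cong (\ l -> box l B g) (length-z L) · box-zeros L g (\ ρ ne -> »-vanish (il? B (zeros L) ρ) (\ d -> exfalso (ne (N.n≤0⇒n≡0 (subst (sum ρ N.≤_) (sum-zeros L) (il-sum d)))))) ·
   »-yes (il? B (zeros L) (zeros L)) (subst (\ l -> IL B (zeros l) (zeros L)) (length-z L) (il-zeros (sum-zeros L))) · go m
   where
   g : List ℕ -> ℤ
   g ρ = il? B (zeros L) ρ » (+ sum (zeros L) Z.≟ + sum ρ + + m) » SC ρ ν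
   length-z : ∀ L -> length (zeros L) == L
   length-z zero = refl
   length-z (suc L) = cong suc (length-z L)
   go : ∀ m -> ((+ sum (zeros L) Z.≟ + sum (zeros L) + + m) » SC (zeros L) ν) == ((m N.+ sum ν N.≟ 0) » + 1)
   go zero = »-yes (+ sum (zeros L) Z.≟ + sum (zeros L) + + 0) (sym (+0 _)) · SC-zeros L ν
   go (suc m) = »-no (+ sum (zeros L) Z.≟ + sum (zeros L) + + suc m) (\ e -> lin⊥ (+ sum (zeros L) & + m & []) (x0 := x0 :+ (1' :+ x1) & 0' =< x1 & []) e 0≤+) · sym (»-no (suc m N.+ sum ν N.≟ 0) {+ 1} (\ ()))

  head≤ : ∀ ρ -> head ρ N.≤ sum ρ
  head≤ [] = z≤n
  head≤ (x ∷ ρ) = N.m≤m+n x (sum ρ)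

  last0-il : ∀ {c λs ρ} -> Last0 λs -> IL c λs ρ -> Last0 ρ
  last0-il end (cons _ z≤n []) = end
  last0-il (_ ∷ l) (cons _ _ d@(cons _ _ _)) = _ ∷ last0-il l d

  Ʃ-extend : ∀ m m' f -> (∀ i -> m N.≤ i -> f i == + 0) -> (∀ i -> m' N.≤ i -> f i == + 0) -> Ʃ m f == Ʃ m' f
  Ʃ-extend m m' f h h' = sym (ext m h) · cong (\ z -> Ʃ z f) (N.+-comm m m') · ext m' h'
   where
   ext : ∀ m {j} -> (∀ i -> m N.≤ i -> f i == + 0) -> Ʃ (m N.+ j) f == Ʃ m f
   ext m {j} h = Ʃ-split m j f · cong+ʳ (Ʃ m f) (Ʃ-zero j (\ i _ -> h (m N.+ i) (N.m≤m+n m i))) · +0 (Ʃ m f)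

  -- Pieri's rule on coefficients, where `take m` is multiplication by the complete homogeneous
  -- function of degree m. By induction on ν, `local` exchanges the strip added to ρ with the strip
  -- removed for the head q, and its free parameter i is the amount that `take` removes from q. The
  -- last row 0 and the bound by `B` leave room for the new strip.
  pieri : ∀ ν ρ m -> All (N._≤ B) ρ -> Last0 ρ -> + sum ρ + m ≤ + B ->
   box (length ρ) B (\ λs -> il? B λs ρ » (+ sum λs Z.≟ + sum ρ + m) » SC λs ν) == take m ν (SC ρ)
  pieri [] ρ m _ _ _ = box-zeros (length ρ) g (\ l ne -> »-vanish (il? B l ρ) (\ _ -> »-vanish (+ sum l Z.≟ + sum ρ + m) (\ _ -> »-no (sum l N.≟ 0) ne))) ·
   cong (\ z -> il? B Z ρ » (+ sum Z Z.≟ + sum ρ + m) » z) (»-yes (sum Z N.≟ 0) sZ) · »4 (il? B Z ρ) (+ sum Z Z.≟ + sum ρ + m) (m Z.≟ + 0) (sum ρ N.≟ 0)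
    (\ d e -> lin (+ sum Z & + sum ρ & m & []) (x0 := x1 :+ x2 & x0 := 0' & x1 := 0' & []) (x2 := 0') e (cong +_ sZ) (cong +_ (sρ d)) , sρ d)
    (\ { refl e -> il-zeros e , trans (cong +_ (sZ · sym e)) (sym (+0 (+ sum ρ))) })
   where
   Z = zeros (length ρ)
   sZ = sum-zeros (length ρ)
   g : List ℕ -> ℤ
   g λs = il? B λs ρ » (+ sum λs Z.≟ + sum ρ + m) » SC λs []
   sρ : IL B Z ρ -> sum ρ == 0
   sρ d = N.n≤0⇒n≡0 (subst (sum ρ N.≤_) sZ (il-sum d))
  pieri (q ∷ ν) ρ m bρ l0 le = box-cong L B _ (\ λs -> box L B (\ μ -> il? B λs ρ » il? B λs μ » F μ (+ sum λs))) toW · box-swap L B L (\ λs μ -> il? B λs ρ » il? B λs μ » F μ (+ sum λs)) ·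
   box-cong L B _ (\ μ -> Ʃ (suc q) (G μ)) (\ μ lμ bμ -> local ρ μ (F μ) (sym lμ) bρ bμ l0 · Ʃ-extend (suc B ∸ (head ρ ⊔ head μ)) (suc q) (G μ) (van₁ μ) (van₂ μ)) ·
   box-Ʃ L B (suc q) (\ i μ -> G μ i) · Ʃ-cong (suc q) {\ i -> box L B (\ μ -> G μ i)} {\ i -> take (m - + i) ν (\ ν' -> SC ρ ((q ∸ i) ∷ ν'))} (\ i i≤ -> term i (s≤s⁻¹ i≤))
   where
   L = length ρ
   F : List ℕ -> ℤ -> ℤ
   F μ t = (t Z.≟ + sum ρ + m) » (t Z.≟ + sum μ + + q) » SC μ ν
   G : List ℕ -> ℕ -> ℤ
   G μ i = R B ρ μ (\ t -> F μ (+ i + (+ sum ρ + + sum μ) - t))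
   toW : ∀ λs -> length λs == L -> All (N._≤ B) λs -> (il? B λs ρ » (+ sum λs Z.≟ + sum ρ + m) » SC λs (q ∷ ν)) == box L B (\ μ -> il? B λs ρ » il? B λs μ » F μ (+ sum λs))
   toW λs e _ = sym (box-cong L B _ _ (\ μ _ _ -> cong (\ z -> il? B λs ρ » z) (»-comm (il? B λs μ) (+ sum λs Z.≟ + sum ρ + m) ((+ sum λs Z.≟ + sum μ + + q) » SC μ ν))) ·
    box-» (il? B λs ρ) L B _ · cong (\ z -> il? B λs ρ » z) (box-» (+ sum λs Z.≟ + sum ρ + m) L B _ · cong (\ l -> (+ sum λs Z.≟ + sum ρ + m) » box l B (\ μ -> il? B λs μ » (+ sum λs Z.≟ + sum μ + + q) » SC μ ν)) (sym e)))
   -- `local` and `take` let i run through different ranges. Beyond either bound the two size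
   -- conditions contradict the containment of τ in ρ and μ or the bound by `B`, so one range can
   -- replace the other.
   vanish : ∀ μ i -> (∀ τ -> IL B ρ τ -> IL B μ τ -> + i + (+ sum ρ + + sum μ) - + sum τ == + sum ρ + m -> + i + (+ sum ρ + + sum μ) - + sum τ == + sum μ + + q -> ⊥) -> G μ i == + 0
   vanish μ i h = box-cong L B _ (\ _ -> + 0 * + 0) (\ τ _ _ -> »-vanish (il? B ρ τ) (\ a -> »-vanish (il? B μ τ) (\ b -> »-vanish (_ Z.≟ + sum ρ + m) (\ e -> »-no (_ Z.≟ + sum μ + + q) (\ e' -> h τ a b e e'))))) · box-* L B (+ 0) (\ _ -> + 0)
   van₂ : ∀ μ i -> suc q N.≤ i -> G μ i == + 0
   van₂ μ i l = vanish μ i (\ τ a b e e' -> lin⊥ (+ i & + sum ρ & + sum μ & + sum τ & + q & []) (x0 :+ (x1 :+ x2) :- x3 := x2 :+ x4 & x3 =< x1 & 1' :+ x4 =< x0 & []) e' (Z.+≤+ (il-sum a)) (Z.+≤+ l))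
   van₁ : ∀ μ i -> suc B ∸ (head ρ ⊔ head μ) N.≤ i -> G μ i == + 0
   van₁ μ i l = vanish μ i (\ τ a b e e' -> N.<-irrefl refl (N.<-≤-trans (bnd τ a b e) (∸≤⇒≤+ (suc B) (head ρ ⊔ head μ) l)))
    where
    bnd : ∀ τ -> IL B ρ τ -> IL B μ τ -> + i + (+ sum ρ + + sum μ) - + sum τ == + sum ρ + m -> (head ρ ⊔ head μ) N.+ i N.< suc B
    bnd τ a b e = s≤s (subst (N._≤ B) (sym (N.+-distribʳ-⊔ i (head ρ) (head μ))) (N.⊔-lub
     (Z.drop‿+≤+ (lin (+ i & + sum ρ & + sum μ & + sum τ & m & + head ρ & []) (x0 :+ (x1 :+ x2) :- x3 := x1 :+ x4 & x3 =< x2 & x5 =< x1 & []) (x5 :+ x0 =< x1 :+ x4) e (Z.+≤+ (il-sum b)) (Z.+≤+ (head≤ ρ)) ⟨≤⟩ le))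
     (Z.drop‿+≤+ (lin (+ i & + sum ρ & + sum μ & + sum τ & m & + head μ & []) (x0 :+ (x1 :+ x2) :- x3 := x1 :+ x4 & x3 =< x1 & x5 =< x2 & []) (x5 :+ x0 =< x1 :+ x4) e (Z.+≤+ (il-sum a)) (Z.+≤+ (head≤ μ)) ⟨≤⟩ le))))
     where
     _⟨≤⟩_ = Z.≤-trans
   term : ∀ i -> i N.≤ q -> box L B (\ μ -> G μ i) == take (m - + i) ν (\ ν' -> SC ρ ((q ∸ i) ∷ ν'))
   term i i≤ = box-swap L B L (\ μ τ -> il? B ρ τ » il? B μ τ » F μ (+ i + (+ sum ρ + + sum μ) - + sum τ)) · box-cong L B _ (\ τ -> take (m - + i) ν (\ ν' -> il? B ρ τ » (+ sum ρ Z.≟ + sum τ + + (q ∸ i)) » SC τ ν')) inner · sym (take-box L (m - + i) ν (\ τ ν' -> il? B ρ τ » (+ sum ρ Z.≟ + sum τ + + (q ∸ i)) » SC τ ν'))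
    where
    qi : + (q ∸ i) + + i == + q
    qi = cong +_ (N.m∸n+n≡m i≤)
    inner : ∀ τ -> length τ == L -> All (N._≤ B) τ -> box L B (\ μ -> il? B ρ τ » il? B μ τ » F μ (+ i + (+ sum ρ + + sum μ) - + sum τ)) == take (m - + i) ν (\ ν' -> il? B ρ τ » (+ sum ρ Z.≟ + sum τ + + (q ∸ i)) » SC τ ν')
    inner τ lτ bτ = box-» (il? B ρ τ) L B _ · »-val (il? B ρ τ) (\ d -> box-cong L B _ (\ μ -> (+ sum ρ Z.≟ + sum τ + + (q ∸ i)) » il? B μ τ » (+ sum μ Z.≟ + sum τ + (m - + i)) » SC μ ν) (\ μ _ _ -> re μ) ·
      box-» (+ sum ρ Z.≟ + sum τ + + (q ∸ i)) L B _ · cong (\ z -> (+ sum ρ Z.≟ + sum τ + + (q ∸ i)) » z) (cong (\ l -> box l B (\ μ -> il? B μ τ » (+ sum μ Z.≟ + sum τ + (m - + i)) » SC μ ν)) (sym lτ) · pieri ν τ (m - + i) bτ (last0-il l0 d) (lin (+ sum τ & + sum ρ & m & + i & + B & []) (x1 :+ x2 =< x4 & x0 =< x1 & 0' =< x3 & []) (x0 :+ (x2 :- x3) =< x4) le (Z.+≤+ (il-sum d)) 0≤+)) ·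
       sym (take-» (+ sum ρ Z.≟ + sum τ + + (q ∸ i)) (m - + i) ν (SC τ))) ·
     sym (take-» (il? B ρ τ) (m - + i) ν (\ ν' -> (+ sum ρ Z.≟ + sum τ + + (q ∸ i)) » SC τ ν'))
     where
     re : ∀ μ -> (il? B μ τ » F μ (+ i + (+ sum ρ + + sum μ) - + sum τ)) == ((+ sum ρ Z.≟ + sum τ + + (q ∸ i)) » il? B μ τ » (+ sum μ Z.≟ + sum τ + (m - + i)) » SC μ ν)
     re μ = cong (\ z -> il? B μ τ » z) (»4 (t Z.≟ + sum ρ + m) (t Z.≟ + sum μ + + q) (+ sum ρ Z.≟ + sum τ + + (q ∸ i)) (+ sum μ Z.≟ + sum τ + (m - + i))
        (\ e e' -> lin V (x0 :+ (x1 :+ x2) :- x3 := x2 :+ (x4 :+ x0) & []) (x1 := x3 :+ x4) (e' · cong+ʳ (+ sum μ) (sym qi)) , lin V (x0 :+ (x1 :+ x2) :- x3 := x1 :+ x5 & []) (x2 := x3 :+ (x5 :- x0)) e)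
        (\ e e' -> lin V (x2 := x3 :+ (x5 :- x0) & []) (x0 :+ (x1 :+ x2) :- x3 := x1 :+ x5) e' , lin V (x1 := x3 :+ x4 & []) (x0 :+ (x1 :+ x2) :- x3 := x2 :+ (x4 :+ x0)) e · cong+ʳ (+ sum μ) qi) · refl) · »-comm (il? B μ τ) (+ sum ρ Z.≟ + sum τ + + (q ∸ i)) _
      where
      t = + i + (+ sum ρ + + sum μ) - + sum τ
      V = + i ∷ + sum ρ ∷ + sum μ ∷ + sum τ ∷ + (q ∸ i) ∷ m ∷ []

  -- A content with ℓ entries fills only shapes with at most ℓ nonzero rows. Outside of this support
  -- both sides of the Cauchy step vanish; inside, the last row is 0, as `pieri` demands.
  Supp : List ℕ -> List ℕ -> Set
  Supp ρ a = sum (drop (length a) ρ) == 0 × sum ρ == sum a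

  il-drop : ∀ j {c λs ρ} -> IL c λs ρ -> sum (drop (suc j) λs) N.≤ sum (drop j ρ)
  il-drop j [] = z≤n
  il-drop zero (cons _ _ d) = low d
   where
   low : ∀ {y λs ρ} -> IL y λs ρ -> sum λs N.≤ y N.+ sum ρ
   low [] = z≤n
   low (cons a _ d) = N.+-mono-≤ a (low d)
  il-drop (suc j) (cons _ _ d) = il-drop j d

  SC-supp : ∀ ρ a -> ¬ Supp ρ a -> SC ρ a == + 0
  SC-supp ρ [] ne = »-no (sum ρ N.≟ 0) (\ e -> ne (e , e))
  SC-supp λs (m ∷ a) ne = box-cong (length λs) B _ (\ _ -> + 0 * + 0) (\ ρ _ _ -> »-vanish (il? B λs ρ) (\ d -> »-vanish (+ sum λs Z.≟ + sum ρ + + m) (\ e -> go ρ d e))) · box-* (length λs) B (+ 0) (\ _ -> + 0)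
   where
   go : ∀ ρ -> IL B λs ρ -> + sum λs == + sum ρ + + m -> SC ρ a == + 0
   go ρ d e = SC-supp ρ a (\ (z , t) -> ne (N.n≤0⇒n≡0 (subst (sum (drop (suc (length a)) λs) N.≤_) z (il-drop (length a) d)) , Z.+-injective e · N.+-comm (sum ρ) m · cong (m N.+_) t))

  last0-supp : ∀ j ρ -> j N.< length ρ -> sum (drop j ρ) == 0 -> Last0 ρ
  last0-supp zero (zero ∷ []) _ _ = end
  last0-supp zero (zero ∷ y ∷ ρ) _ e = 0 ∷ last0-supp zero (y ∷ ρ) z<s e
  last0-supp (suc j) (x ∷ y ∷ ρ) (s≤s l) e = x ∷ last0-supp j (y ∷ ρ) l e

  -- The number of matrices of nonnegative integers with row sums `a` and column sums `ν`: each
  -- `take` chooses one row.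
  Mat : List ℕ -> List ℕ -> ℤ
  Mat [] ν = (sum ν N.≟ 0) » + 1
  Mat (m ∷ a) ν = take (+ m) ν (Mat a)

  -- The strip for the head m is peeled off the first factor; with the smaller shape ρ held fixed,
  -- `pieri` performs the sum over the larger shape and takes m out of ν. One row more than `a` has
  -- entries keeps the last row empty.
  cauchy : ∀ L a ν -> length a N.< L -> sum a N.≤ B -> box L B (\ λs -> SC λs a * SC λs ν) == Mat a ν
  cauchy L [] ν _ _ = box-zeros L (\ λs -> SC λs [] * SC λs ν) (\ l ne -> cong (\ z -> z * SC l ν) (»-no (sum l N.≟ 0) ne) · Z.*-zeroˡ (SC l ν)) · cong (\ z -> z * SC (zeros L) ν) (»-yes (sum (zeros L) N.≟ 0) (sum-zeros L)) · Z.*-identityˡ (SC (zeros L) ν) · SC-zeros L ν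
  cauchy L (m ∷ a) ν la sa = box-cong L B _ (\ λs -> box L B (\ ρ -> SC ρ a * (il? B λs ρ » (+ sum λs Z.≟ + sum ρ + + m) » SC λs ν))) (\ λs e _ -> expand λs e) ·
   box-swap L B L (\ λs ρ -> SC ρ a * (il? B λs ρ » (+ sum λs Z.≟ + sum ρ + + m) » SC λs ν)) ·
   box-cong L B _ (\ ρ -> take (+ m) ν (\ ν' -> SC ρ a * SC ρ ν')) step · sym (take-box L (+ m) ν (\ ρ ν' -> SC ρ a * SC ρ ν')) · take-cong (+ m) ν (\ ν' -> cauchy L a ν' (N.<-trans (N.n<1+n _) la) (N.≤-trans (N.m≤n+m (sum a) m) sa))
   where
   expand : ∀ λs -> length λs == L -> SC λs (m ∷ a) * SC λs ν == box L B (\ ρ -> SC ρ a * (il? B λs ρ » (+ sum λs Z.≟ + sum ρ + + m) » SC λs ν))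
   expand λs e = Z.*-comm (SC λs (m ∷ a)) (SC λs ν) · cong (\ l -> SC λs ν * box l B (\ ρ -> il? B λs ρ » (+ sum λs Z.≟ + sum ρ + + m) » SC ρ a)) e · sym (box-* L B (SC λs ν) _) · box-cong L B _ _ (\ ρ _ _ -> mv (il? B λs ρ) (+ sum λs Z.≟ + sum ρ + + m) (SC λs ν) (SC ρ a))
    where
    mv : ∀ {P Q : Set} (p : Dec P) (q : Dec Q) x y -> x * (p » q » y) == y * (p » q » x)
    mv (yes _) (yes _) x y = Z.*-comm x y
    mv (yes _) (no _) x y = Z.*-zeroʳ x · sym (Z.*-zeroʳ y)
    mv (no _) q x y = Z.*-zeroʳ x · sym (Z.*-zeroʳ y)
   step : ∀ ρ -> length ρ == L -> All (N._≤ B) ρ -> box L B (\ λs -> SC ρ a * (il? B λs ρ » (+ sum λs Z.≟ + sum ρ + + m) » SC λs ν)) == take (+ m) ν (\ ν' -> SC ρ a * SC ρ ν')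
   step ρ e bρ = box-* L B (SC ρ a) _ · go ((sum (drop (length a) ρ) N.≟ 0) ×-dec (sum ρ N.≟ sum a)) · sym (take-* (SC ρ a) (+ m) ν (SC ρ))
    where
    P = box L B (\ λs -> il? B λs ρ » (+ sum λs Z.≟ + sum ρ + + m) » SC λs ν)
    go : Dec (Supp ρ a) -> SC ρ a * P == SC ρ a * take (+ m) ν (SC ρ)
    go (no ne) = cong (\ z -> z * P) (SC-supp ρ a ne) · Z.*-zeroˡ P · sym (cong (\ z -> z * take (+ m) ν (SC ρ)) (SC-supp ρ a ne) · Z.*-zeroˡ (take (+ m) ν (SC ρ)))
    go (yes (z , t)) = cong (\ w -> SC ρ a * w) (cong (\ l -> box l B (\ λs -> il? B λs ρ » (+ sum λs Z.≟ + sum ρ + + m) » SC λs ν)) (sym e) · pieri ν ρ (+ m) bρ (last0-supp (length a) ρ (subst (length a N.<_) (sym e) (N.<-trans (N.n<1+n _) la)) z) (Z.+≤+ (subst (\ w -> w N.+ m N.≤ B) (sym t) (subst (N._≤ B) (N.+-comm m (sum a)) sa))))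

-- Semistandard tableaux and the removal of their largest entry.

module Tab where
 open import Defs
 open Cauchy
 import Data.Nat.ListAction.Properties as NLA
 import Data.Bool as Bool
 import Data.Bool.Properties as BP

 bi : Bool -> ℤ
 bi b = if b then + 1 else + 0

 bi-∧ : ∀ a b -> bi (a ∧ b) == bi a * bi b
 bi-∧ true b = sym (Z.*-identityˡ (bi b))
 bi-∧ false b = sym (Z.*-zeroˡ (bi b))

 length-filter : ∀ {A : Set} (P : A -> Bool) xs -> + length (filterᵇ P xs) == ƩL xs (\ x -> bi (P x))
 length-filter P [] = refl
 length-filter P (x ∷ xs) with P x
 ... | true = cong (\ z -> + 1 + z) (length-filter P xs)
 ... | false = length-filter P xs · sym (+0ˡ _)

 Ʃ-seqs : ∀ p N f -> ƩL (seqs (suc p) N) f == Ʃ N (\ x -> ƩL (seqs p N) (\ r -> f (x ∷ r)))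
 Ʃ-seqs p N f = ƩL-concatMap (\ x -> map (x ∷_) (seqs p N)) (upTo N) f · ƩL-applyUpTo (\ x -> x) N _ · Ʃ-ext N (\ x -> ƩL-map (x ∷_) (seqs p N) f)

 -- The tableaux are built row by row with `prev` as the row above. An empty `prev` imposes no
 -- condition, since `zipWith` stops at the shorter row.
 S′ : ℕ -> List ℕ -> List ℕ -> (List (List ℕ) -> ℤ) -> ℤ
 S′ N prev [] K = K []
 S′ N prev (p ∷ ps) K = ƩL (seqs p N) (\ r -> bi (weakInc r) * (bi (and (zipWith N._<ᵇ_ prev r)) * S′ N r ps (\ Tb -> K (r ∷ Tb))))

 fillings-S′ : ∀ N prev la K -> ƩL (fillings la N) (\ Tb -> bi (all weakInc Tb ∧ colStrict (prev ∷ Tb)) * K Tb) == S′ N prev la K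
 fillings-S′ N prev [] K = +0 (+ 1 * K []) · Z.*-identityˡ (K [])
 fillings-S′ N prev (p ∷ ps) K = ƩL-concatMap (\ r -> map (r ∷_) (fillings ps N)) (seqs p N) _ · ƩL-ext (seqs p N) (\ r -> ƩL-map (r ∷_) (fillings ps N) _ ·
   ƩL-ext (fillings ps N) (row r) · ƩL-* (fillings ps N) (bi (weakInc r)) _ · cong (\ z -> bi (weakInc r) * z) (ƩL-* (fillings ps N) (bi (and (zipWith N._<ᵇ_ prev r))) _ · cong (\ z -> bi (and (zipWith N._<ᵇ_ prev r)) * z) (fillings-S′ N r ps (\ Tb -> K (r ∷ Tb)))))
  where
  alg : ∀ w z c d k -> ((w * d) * (z * c)) * k == w * (z * ((d * c) * k))
  alg = solve
  row : ∀ r Tb -> bi ((weakInc r ∧ all weakInc Tb) ∧ (and (zipWith N._<ᵇ_ prev r) ∧ colStrict (r ∷ Tb))) * K (r ∷ Tb) == bi (weakInc r) * (bi (and (zipWith N._<ᵇ_ prev r)) * (bi (all weakInc Tb ∧ colStrict (r ∷ Tb)) * K (r ∷ Tb)))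
  row r Tb rewrite bi-∧ (weakInc r ∧ all weakInc Tb) (and (zipWith N._<ᵇ_ prev r) ∧ colStrict (r ∷ Tb)) | bi-∧ (weakInc r) (all weakInc Tb) | bi-∧ (and (zipWith N._<ᵇ_ prev r)) (colStrict (r ∷ Tb)) | bi-∧ (all weakInc Tb) (colStrict (r ∷ Tb)) =
   alg (bi (weakInc r)) (bi (and (zipWith N._<ᵇ_ prev r))) (bi (colStrict (r ∷ Tb))) (bi (all weakInc Tb)) (K (r ∷ Tb))

 S′-cong : ∀ N prev la {K K'} -> (∀ Tb -> K Tb == K' Tb) -> S′ N prev la K == S′ N prev la K'
 S′-cong N prev [] h = h []
 S′-cong N prev (p ∷ ps) h = ƩL-ext (seqs p N) (\ r -> cong (\ z -> bi (weakInc r) * (bi (and (zipWith N._<ᵇ_ prev r)) * z)) (S′-cong N r ps (\ Tb -> h (r ∷ Tb))))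

 content : ℕ -> List (List ℕ) -> List ℕ
 content N Tb = map (\ v -> countℕ v (concat Tb)) (upTo N)

 Sch : ℕ -> List ℕ -> List ℕ -> ℤ
 Sch N la a = S′ N [] la (\ Tb -> bi (eqListℕ (content N Tb) a))

 schur-Sch : ∀ la {N} (a : Vec ℕ N) -> schurCoeff la a == Sch N la (toList a)
 schur-Sch la {N} a = length-filter _ (fillings la N) · ƩL-ext (fillings la N) (\ Tb -> cong bi (cong (\ z -> all weakInc Tb ∧ (z ∧ E Tb)) (cs Tb) · sym (BP.∧-assoc (all weakInc Tb) (colStrict ([] ∷ Tb)) (E Tb))) · bi-∧ (all weakInc Tb ∧ colStrict ([] ∷ Tb)) (E Tb)) · fillings-S′ N [] la (\ Tb -> bi (E Tb))
  where
  E : List (List ℕ) -> Bool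
  E Tb = eqListℕ (content N Tb) (toList a)
  cs : ∀ Tb -> colStrict Tb == colStrict ([] ∷ Tb)
  cs [] = refl
  cs (r ∷ Tb) = refl

 hd : ℕ -> List ℕ -> Bool
 hd x [] = true
 hd x (y ∷ _) = x N.≤ᵇ y

 weakInc-∷ : ∀ x r -> weakInc (x ∷ r) == hd x r ∧ weakInc r
 weakInc-∷ x [] = refl
 weakInc-∷ x (y ∷ r) = refl

 T⇒≡ : ∀ {b} -> T b -> b == true
 T⇒≡ {true} _ = refl

 ¬T⇒≡ : ∀ {b} -> ¬ T b -> b == false
 ¬T⇒≡ {true} h = exfalso (h _)
 ¬T⇒≡ {false} _ = refl

 -- The copies of the largest letter `N` stand at the end of a weakly increasing row; l counts the
 -- letters before them.
 rows : ∀ N p G -> ƩL (seqs p (suc N)) (\ r -> bi (weakInc r) * G r) == Ʃ (suc p) (\ l -> ƩL (seqs l N) (\ r -> bi (weakInc r) * G (r ++ replicate (p ∸ l) N)))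
 rows N zero G = sym (+0 (+ 1 * G [] + + 0))
 rows N (suc p) G = Ʃ-seqs p (suc N) _ · Ʃ-last N _ · Z.+-comm _ (ƩL (seqs p (suc N)) (\ r -> bi (weakInc (N ∷ r)) * G (N ∷ r))) · top ⊹ (Ʃ-cong N low · Ʃ-swap N (suc p) (\ x l -> ƩL (seqs l N) (Q l x)) · Ʃ-ext (suc p) {\ l -> Ʃ N (\ x -> ƩL (seqs l N) (Q l x))} {\ l -> ƩL (seqs (suc l) N) (\ r -> bi (weakInc r) * G (r ++ replicate (p ∸ l) N))} (\ l -> sym (Ʃ-seqs l N (\ r -> bi (weakInc r) * G (r ++ replicate (p ∸ l) N))))) 
  where
  Q : ℕ -> ℕ -> List ℕ -> ℤ
  Q l x r = bi (weakInc (x ∷ r)) * G ((x ∷ r) ++ replicate (p ∸ l) N)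
  push : ∀ x -> ƩL (seqs p (suc N)) (\ r -> bi (weakInc (x ∷ r)) * G (x ∷ r)) == Ʃ (suc p) (\ l -> ƩL (seqs l N) (\ r -> bi (weakInc r) * (bi (hd x (r ++ replicate (p ∸ l) N)) * G (x ∷ r ++ replicate (p ∸ l) N))))
  push x = ƩL-ext (seqs p (suc N)) (\ r -> cong (\ z -> z * G (x ∷ r)) (cong bi (weakInc-∷ x r) · bi-∧ (hd x r) (weakInc r)) · alg (bi (hd x r)) (bi (weakInc r)) (G (x ∷ r))) · rows N p (\ r -> bi (hd x r) * G (x ∷ r))
   where
   alg : ∀ a b c -> (a * b) * c == b * (a * c)
   alg = solve
  low : ∀ x -> x N.< N -> ƩL (seqs p (suc N)) (\ r -> bi (weakInc (x ∷ r)) * G (x ∷ r)) == Ʃ (suc p) (\ l -> ƩL (seqs l N) (\ r -> bi (weakInc (x ∷ r)) * G ((x ∷ r) ++ replicate (p ∸ l) N)))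
  low x x<N = push x · Ʃ-ext (suc p) (\ l -> ƩL-ext (seqs l N) (\ r -> cong (\ z -> bi (weakInc r) * (bi z * G (x ∷ r ++ replicate (p ∸ l) N))) (hd-rep r (p ∸ l)) · alg (bi (weakInc r)) (bi (hd x r)) (G (x ∷ r ++ replicate (p ∸ l) N)) · cong (\ z -> z * G (x ∷ r ++ replicate (p ∸ l) N)) (sym (bi-∧ (hd x r) (weakInc r)) · cong bi (sym (weakInc-∷ x r)))))
   where
   alg : ∀ a b c -> a * (b * c) == (b * a) * c
   alg = solve
   hd-rep : ∀ r j -> hd x (r ++ replicate j N) == hd x r
   hd-rep [] zero = refl
   hd-rep [] (suc j) = T⇒≡ (N.≤⇒≤ᵇ (N.<⇒≤ x<N))
   hd-rep (y ∷ r) j = refl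
  top : ƩL (seqs p (suc N)) (\ r -> bi (weakInc (N ∷ r)) * G (N ∷ r)) == ƩL (seqs 0 N) (\ r -> bi (weakInc r) * G (r ++ replicate (suc p) N))
  top = push N · cong (\ z -> + 1 * z + + 0) (cong (\ z -> bi z * G (N ∷ replicate p N)) (hdN p) · Z.*-identityˡ (G (N ∷ replicate p N))) ⊹ Ʃ-zero p (\ l _ -> Ʃ-seqs l N _ · Ʃ-zero N (\ y y<N -> ƩL-zero (seqs l N) (\ r _ -> cong (\ z -> bi (weakInc (y ∷ r)) * (bi z * G (N ∷ y ∷ r ++ replicate (p ∸ suc l) N))) (¬T⇒≡ (\ t -> N.<⇒≱ y<N (N.≤ᵇ⇒≤ N y t))) · Z.*-zeroʳ (bi (weakInc (y ∷ r)))))) · +0 (+ 1 * G (N ∷ replicate p N) + + 0)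
   where
   hdN : ∀ p -> hd N (replicate p N) == true
   hdN zero = refl
   hdN (suc p) = T⇒≡ (N.≤⇒≤ᵇ (N.≤-refl {N}))

 Letters : ℕ -> List ℕ -> Set
 Letters N = All (N._< N)

 seqs-letters : ∀ l N f g -> (∀ r -> Letters N r -> length r == l -> f r == g r) -> ƩL (seqs l N) f == ƩL (seqs l N) g
 seqs-letters zero N f g h = cong (\ z -> z + + 0) (h [] [] refl)
 seqs-letters (suc l) N f g h = Ʃ-seqs l N f · Ʃ-cong N (\ x x<N -> seqs-letters l N _ _ (\ r a e -> h (x ∷ r) (x<N ∷ a) (cong suc e))) · sym (Ʃ-seqs l N g)

 -- Nothing can stand below the largest letter `N`, and `N` can stand below anything smaller. So the
 -- whole lower row must fit under the part `P` of the upper row without `N`: this is the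
 -- interlacing condition of a horizontal strip.
 zip-rep : ∀ N P i r j -> Letters N P -> Letters N r -> length r N.+ j N.≤ length P N.+ i ->
  bi (and (zipWith N._<ᵇ_ (P ++ replicate i N) (r ++ replicate j N))) == ((length r N.+ j ≤? length P) » bi (and (zipWith N._<ᵇ_ P r)))
 zip-rep N [] zero [] zero _ _ _ = sym (»-yes (0 ≤? 0) z≤n)
 zip-rep N [] (suc i) [] zero _ _ _ = sym (»-yes (0 ≤? 0) z≤n)
 zip-rep N [] (suc i) [] (suc j) _ _ _ = cong (\ b -> bi (b ∧ and (zipWith N._<ᵇ_ (replicate i N) (replicate j N)))) (¬T⇒≡ (\ t -> N.<-irrefl refl (N.<ᵇ⇒< N N t))) · sym (»-no (suc j ≤? 0) (\ ()))
 zip-rep N [] (suc i) (y ∷ r) j _ (l ∷ _) _ = cong (\ b -> bi (b ∧ and (zipWith N._<ᵇ_ (replicate i N) (r ++ replicate j N)))) (¬T⇒≡ (\ t -> N.<-asym l (N.<ᵇ⇒< N y t))) · sym (»-no (suc (length r N.+ j) ≤? 0) (\ ()))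
 zip-rep N (x ∷ P) i [] zero _ _ _ = sym (»-yes (0 ≤? suc (length P)) z≤n)
 zip-rep N (x ∷ P) i [] (suc j) (l ∷ a) [] (s≤s le) = cong (\ b -> bi (b ∧ and (zipWith N._<ᵇ_ (P ++ replicate i N) (replicate j N)))) (T⇒≡ (N.<⇒<ᵇ l)) · zip-rep N P i [] j a [] le · »-cong (j ≤? length P) (suc j ≤? suc (length P)) s≤s s≤s⁻¹ (\ _ _ -> cong bi (zip[] P))
  where
  zip[] : ∀ P -> and (zipWith N._<ᵇ_ P []) == true
  zip[] [] = refl
  zip[] (_ ∷ _) = refl
 zip-rep N (x ∷ P) i (y ∷ r) j (_ ∷ a) (_ ∷ a') (s≤s le) = bi-∧ (x N.<ᵇ y) _ · cong (\ z -> bi (x N.<ᵇ y) * z) (zip-rep N P i r j a a' le) · sym (»-* (length r N.+ j ≤? length P) (bi (x N.<ᵇ y)) _) · »-cong (length r N.+ j ≤? length P) (suc (length r N.+ j) ≤? suc (length P)) s≤s s≤s⁻¹ (\ _ _ -> sym (bi-∧ (x N.<ᵇ y) (and (zipWith N._<ᵇ_ P r))))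

 app : ℕ -> List ℕ -> List (List ℕ) -> List (List ℕ)
 app N (p ∷ ps) (r ∷ Tb) = (r ++ replicate (p ∸ length r) N) ∷ app N ps Tb
 app N _ Tb = []

 WD : ℕ -> List ℕ -> Set
 WD m [] = ⊤ where open import Data.Unit using (⊤)
 WD m (x ∷ xs) = x N.≤ m × WD x xs

 wd? : ∀ m xs -> Dec (WD m xs)
 wd? m [] = yes _
 wd? m (x ∷ xs) = (x ≤? m) ×-dec wd? x xs

 WD-mono : ∀ {m m'} xs -> m N.≤ m' -> WD m xs -> WD m' xs
 WD-mono [] _ _ = _
 WD-mono (x ∷ xs) l (a , b) = N.≤-trans a l , b

 WD-All : ∀ {m} xs -> WD m xs -> All (N._≤ m) xs
 WD-All [] _ = []
 WD-All (x ∷ xs) (a , b) = a ∷ All.map (\ q -> N.≤-trans q a) (WD-All xs b)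

 module _ (B N : ℕ) where
  Ʃ≤-cut : ∀ p f -> p N.≤ B -> Ʃ≤ B (\ l -> (l ≤? p) » f l) == Ʃ (suc p) f
  Ʃ≤-cut p f le = Ʃ≤-ext B (\ l -> »-val (l ≤? p) (\ _ -> sym (»-yes (0 ≤? l) z≤n))) · »-interval 0 p B f le

  il-cons : ∀ {c p l ps ρ} {z : ℤ} -> (il? c (p ∷ ps) (l ∷ ρ) » z) == ((l ≤? p) » (p ≤? c) » il? l ps ρ » z)
  il-cons {c} {p} {l} {ps} {ρ} = »-cong (il? c (p ∷ ps) (l ∷ ρ)) ((l ≤? p) ×-dec ((p ≤? c) ×-dec il? l ps ρ)) (\ { (cons a b d) -> b , a , d }) (\ (b , a , d) -> cons a b d) (\ _ _ -> refl) · prod3 (l ≤? p) (p ≤? c) (il? l ps ρ)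
   where
   prod3 : ∀ {P Q R : Set} {x} (a : Dec P) (b : Dec Q) (d : Dec R) -> ((a ×-dec (b ×-dec d)) » x) == (a » b » d » x)
   prod3 (yes _) (yes _) (yes _) = refl
   prod3 (yes _) (yes _) (no _) = refl
   prod3 (yes _) (no _) d = refl
   prod3 (no _) b d = refl

  -- Deleting the copies of `N` leaves a tableau whose shape ρ differs from `la` by a horizontal
  -- strip, and `app` puts them back. The row above has the form `P` followed by copies of `N`, so
  -- `length P` is the cap on the next row.
  S′-split : ∀ la P i K -> Letters N P -> WD (length P N.+ i) la -> All (N._≤ B) la ->
   S′ (suc N) (P ++ replicate i N) la K == box (length la) B (\ ρ -> il? (length P) la ρ » S′ N P ρ (\ Tb -> K (app N la Tb)))
  first : ∀ (g : List ℕ -> ℤ) p ps (K : List (List ℕ) -> ℤ) -> WD p ps -> p N.≤ B -> All (N._≤ B) ps -> ∀ l -> l N.≤ p ->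
   ƩL (seqs l N) (\ r -> bi (weakInc r) * (g r * S′ (suc N) (r ++ replicate (p ∸ l) N) ps (\ Tb -> K ((r ++ replicate (p ∸ l) N) ∷ Tb))))
   == box (length ps) B (\ ρ -> il? l ps ρ » ƩL (seqs l N) (\ r -> bi (weakInc r) * (g r * S′ N r ρ (\ Tb -> K (app N (p ∷ ps) (r ∷ Tb))))))
  first g p ps K wd p≤ a l l≤ = seqs-letters l N _ (\ r -> box (length ps) B (f r)) each ·
    go (length ps) f · box-cong (length ps) B _ _ (\ ρ _ _ -> sym (»-ƩL (il? l ps ρ) (seqs l N) (\ r -> bi (weakInc r) * (g r * M r ρ))))
   where
   M : List ℕ -> List ℕ -> ℤ
   M r ρ = S′ N r ρ (\ Tb -> K (app N (p ∷ ps) (r ∷ Tb)))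
   f : List ℕ -> List ℕ -> ℤ
   f r ρ = il? l ps ρ » bi (weakInc r) * (g r * M r ρ)
   go : ∀ L (f : List ℕ -> List ℕ -> ℤ) -> ƩL (seqs l N) (\ r -> box L B (f r)) == box L B (\ ρ -> ƩL (seqs l N) (\ r -> f r ρ))
   go zero f = refl
   go (suc L) f = ƩL-ext (seqs l N) (\ r -> Ʃ≤-def B (\ x -> box L B (\ ρ -> f r (x ∷ ρ)))) · ƩL-Ʃ-swap (seqs l N) (suc B) (\ r x -> box L B (\ ρ -> f r (x ∷ ρ))) · sym (Ʃ≤-def B (\ x -> ƩL (seqs l N) (\ r -> box L B (\ ρ -> f r (x ∷ ρ))))) · Ʃ≤-ext B (\ x -> go L (\ r ρ -> f r (x ∷ ρ)))
   each : ∀ r -> Letters N r -> length r == l -> bi (weakInc r) * (g r * S′ (suc N) (r ++ replicate (p ∸ l) N) ps (\ Tb -> K ((r ++ replicate (p ∸ l) N) ∷ Tb))) == box (length ps) B (f r)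
   each r lr refl = cong (\ z -> bi (weakInc r) * (g r * z)) (S′-split ps r (p ∸ l) (\ Tb -> K ((r ++ replicate (p ∸ l) N) ∷ Tb)) lr (subst (\ z -> WD z ps) (sym (N.m+[n∸m]≡n l≤)) wd) a) ·
    cong (\ z -> bi (weakInc r) * z) (sym (box-* (length ps) B (g r) (\ ρ -> il? l ps ρ » M r ρ))) · sym (box-* (length ps) B (bi (weakInc r)) (\ ρ -> g r * (il? l ps ρ » M r ρ))) · box-cong (length ps) B _ _ (\ ρ _ _ -> cong (\ z -> bi (weakInc r) * z) (sym (»-* (il? l ps ρ) (g r) (M r ρ))) · sym (»-* (il? l ps ρ) (bi (weakInc r)) (g r * M r ρ)))
  S′-split [] P i K _ _ _ = refl
  S′-split (p ∷ ps) P i K lP (pl , wd) (p≤ ∷ a) = rows N p (\ r -> bi (and (zipWith N._<ᵇ_ (P ++ replicate i N) r)) * S′ (suc N) r ps (\ Tb -> K (r ∷ Tb))) · Ʃ-cong (suc p) {_} {\ l -> box (length ps) B (Hf l)} (\ l l≤ -> seqs-letters l N _ _ (\ r lr e -> cong (\ z -> bi (weakInc r) * z) (zr r lr l e (s≤s⁻¹ l≤))) · first g p ps K wd p≤ a l (s≤s⁻¹ l≤)) ·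
   sym (Ʃ≤-cut p (\ l -> box (length ps) B (Hf l)) p≤) · Ʃ≤-ext B (\ l -> sym (box-» (l ≤? p) (length ps) B (Hf l)) · box-cong (length ps) B _ _ (\ ρ _ _ -> fin l ρ · sym (il-cons {length P} {p} {l} {ps} {ρ})))
   where
   g : List ℕ -> ℤ
   g r = (p ≤? length P) » bi (and (zipWith N._<ᵇ_ P r))
   Hf : ℕ -> List ℕ -> ℤ
   Hf l ρ = il? l ps ρ » ƩL (seqs l N) (\ r -> bi (weakInc r) * (g r * S′ N r ρ (\ Tb -> K (app N (p ∷ ps) (r ∷ Tb)))))
   zr : ∀ r -> Letters N r -> ∀ l -> length r == l -> l N.≤ p -> bi (and (zipWith N._<ᵇ_ (P ++ replicate i N) (r ++ replicate (p ∸ l) N))) * S′ (suc N) (r ++ replicate (p ∸ l) N) ps (\ Tb -> K ((r ++ replicate (p ∸ l) N) ∷ Tb)) == ((p ≤? length P) » bi (and (zipWith N._<ᵇ_ P r))) * S′ (suc N) (r ++ replicate (p ∸ l) N) ps (\ Tb -> K ((r ++ replicate (p ∸ l) N) ∷ Tb))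
   zr r lr l refl l≤ = cong (\ z -> z * S′ (suc N) (r ++ replicate (p ∸ l) N) ps (\ Tb -> K ((r ++ replicate (p ∸ l) N) ∷ Tb))) (zip-rep N P i r (p ∸ l) lP lr (subst (N._≤ length P N.+ i) (sym (N.m+[n∸m]≡n l≤)) pl) · cong (\ z -> (z ≤? length P) » bi (and (zipWith N._<ᵇ_ P r))) (N.m+[n∸m]≡n l≤))
   fin : ∀ l ρ -> ((l ≤? p) » il? l ps ρ » ƩL (seqs l N) (\ r -> bi (weakInc r) * (((p ≤? length P) » bi (and (zipWith N._<ᵇ_ P r))) * S′ N r ρ (\ Tb -> K (app N (p ∷ ps) (r ∷ Tb)))))) == ((l ≤? p) » (p ≤? length P) » il? l ps ρ » S′ N P (l ∷ ρ) (\ Tb -> K (app N (p ∷ ps) Tb)))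
   fin l ρ = cong (\ z -> (l ≤? p) » z) (cong (\ z -> il? l ps ρ » z) (pullout (p ≤? length P)) · »-comm (il? l ps ρ) (p ≤? length P) _)
    where
    pullout : ∀ (d : Dec (p N.≤ length P)) -> ƩL (seqs l N) (\ r -> bi (weakInc r) * ((d » bi (and (zipWith N._<ᵇ_ P r))) * S′ N r ρ (\ Tb -> K (app N (p ∷ ps) (r ∷ Tb))))) == (d » S′ N P (l ∷ ρ) (\ Tb -> K (app N (p ∷ ps) Tb)))
    pullout (yes _) = refl
    pullout (no _) = ƩL-zero (seqs l N) (\ r _ -> cong (\ z -> bi (weakInc r) * z) (Z.*-zeroˡ (S′ N r ρ (\ Tb -> K (app N (p ∷ ps) (r ∷ Tb))))) · Z.*-zeroʳ (bi (weakInc r)))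

  Sch-split : ∀ la K -> WD B la -> S′ (suc N) [] la K == box (length la) B (\ ρ -> il? B la ρ » S′ N [] ρ (\ Tb -> K (app N la Tb)))
  Sch-split [] K _ = refl
  Sch-split (p ∷ ps) K (p≤ , wd) = rows N p (\ r -> + 1 * S′ (suc N) r ps (\ Tb -> K (r ∷ Tb))) · Ʃ-cong (suc p) {_} {\ l -> box (length ps) B (Hf l)} (\ l l≤ -> first (\ _ -> + 1) p ps K wd p≤ (All.map (\ q -> N.≤-trans q p≤) (WD-All ps wd)) l (s≤s⁻¹ l≤)) ·
   sym (Ʃ≤-cut p (\ l -> box (length ps) B (Hf l)) p≤) · Ʃ≤-ext B (\ l -> sym (box-» (l ≤? p) (length ps) B (Hf l)) · box-cong (length ps) B _ _ (\ ρ _ _ -> sym (il-cons {B} {p} {l} {ps} {ρ} · cong (\ z -> (l ≤? p) » z) (»-yes (p ≤? B) p≤))))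
   where
   Hf : ℕ -> List ℕ -> ℤ
   Hf l ρ = il? l ps ρ » ƩL (seqs l N) (\ r -> bi (weakInc r) * (+ 1 * S′ N r ρ (\ Tb -> K (app N (p ∷ ps) (r ∷ Tb)))))

-- Schur coefficients as chains of horizontal strips, and sums over partitions.

module Tab2 where
 open import Defs
 open Cauchy
 open Tab
 open import Data.Nat using (_⊓_)
 open import Data.List.Membership.Propositional.Properties using (∈-concatMap⁻; ∈-map⁻; ∈-applyUpTo⁻)
 open import Data.List.Properties using (++-identityʳ; concat-++; length-reverse; map-++; reverse-involutive; unfold-reverse; upTo-∷ʳ; ∷ʳ-injective; ≡-dec)
 open import Relation.Nullary using (does)
 open import Data.List.Relation.Binary.Permutation.Propositional.Properties using (↭-reverse)

 bi-does : ∀ {P : Set} (d : Dec P) -> bi (does d) == (d » + 1)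
 bi-does (yes _) = refl
 bi-does (no _) = refl

 count-++ : ∀ v xs ys -> countℕ v (xs ++ ys) == countℕ v xs N.+ countℕ v ys
 count-++ v [] ys = refl
 count-++ v (x ∷ xs) ys with x N.≡ᵇ v
 ... | true = cong suc (count-++ v xs ys)
 ... | false = count-++ v xs ys

 count-≠ : ∀ v xs -> All (\ x -> ¬ x == v) xs -> countℕ v xs == 0
 count-≠ v [] [] = refl
 count-≠ v (x ∷ xs) (p ∷ ps) with x N.≡ᵇ v in e
 ... | true = exfalso (p (N.≡ᵇ⇒≡ x v (subst T (sym e) _)))
 ... | false = count-≠ v xs ps

 count-rep : ∀ N j -> countℕ N (replicate j N) == j
 count-rep N zero = refl
 count-rep N (suc j) with N N.≡ᵇ N in e
 ... | true = cong suc (count-rep N j)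
 ... | false = exfalso (subst T e (N.≡⇒≡ᵇ N N refl))

 All-rep : ∀ {P : ℕ -> Set} j {x} -> P x -> All P (replicate j x)
 All-rep zero p = []
 All-rep (suc j) p = p ∷ All-rep j p

 data Fill (N : ℕ) : List ℕ -> List (List ℕ) -> Set where
  []  : Fill N [] []
  row : ∀ {r ρ Tb} -> Letters N r -> Fill N ρ Tb -> Fill N (length r ∷ ρ) (r ∷ Tb)

 S′-fill : ∀ N prev la {K K'} -> (∀ Tb -> Fill N la Tb -> K Tb == K' Tb) -> S′ N prev la K == S′ N prev la K'
 S′-fill N prev [] h = h [] []
 S′-fill N prev (p ∷ ps) h = seqs-letters p N _ _ (\ { r lr refl -> cong (\ z -> bi (weakInc r) * (bi (and (zipWith N._<ᵇ_ prev r)) * z)) (S′-fill N r ps (\ Tb f -> h (r ∷ Tb) (row lr f))) })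

 S′-* : ∀ N prev la c K -> S′ N prev la (\ Tb -> c * K Tb) == c * S′ N prev la K
 S′-* N prev [] c K = refl
 S′-* N prev (p ∷ ps) c K = ƩL-ext (seqs p N) (\ r -> cong (\ z -> bi (weakInc r) * (bi (and (zipWith N._<ᵇ_ prev r)) * z)) (S′-* N r ps c (\ Tb -> K (r ∷ Tb))) · alg (bi (weakInc r)) (bi (and (zipWith N._<ᵇ_ prev r))) c (S′ N r ps (\ Tb -> K (r ∷ Tb)))) · ƩL-* (seqs p N) c _
  where
  alg : ∀ a b c d -> a * (b * (c * d)) == c * (a * (b * d))
  alg = solve

 count-app-low : ∀ N v la {c ρ Tb} -> v N.< N -> IL c la ρ -> Fill N ρ Tb -> countℕ v (concat (app N la Tb)) == countℕ v (concat Tb)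
 count-app-low N v [] l [] [] = refl
 count-app-low N v (p ∷ la) l (cons _ _ d) (row {r} {ρ} {Tb} lr f) = count-++ v (r ++ replicate (p ∸ length r) N) _ · cong2 N._+_ (count-++ v r _ · cong (countℕ v r N.+_) (count-≠ v (replicate (p ∸ length r) N) (All-rep (p ∸ length r) (\ { refl -> N.<-irrefl refl l }))) · N.+-identityʳ _) (count-app-low N v la l d f) · sym (count-++ v r (concat Tb))

 count-app-top : ∀ N la {c ρ Tb} -> IL c la ρ -> Fill N ρ Tb -> sum ρ N.+ countℕ N (concat (app N la Tb)) == sum la
 count-app-top N [] [] [] = refl
 count-app-top N (p ∷ la) (cons _ b d) (row {r} {ρ} {Tb} lr f) = cong (length r N.+ sum ρ N.+_) (count-++ N (r ++ replicate (p ∸ length r) N) _ · cong (N._+ C) (count-++ N r _ · cong2 N._+_ (count-≠ N r (All.map (\ l e -> N.<-irrefl e l) lr)) (count-rep N (p ∸ length r)))) ·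
  ar (length r) (sum ρ) (p ∸ length r) C · cong2 N._+_ (N.m+[n∸m]≡n b) (count-app-top N la d f)
  where
  C = countℕ N (concat (app N la Tb))
  ar : ∀ a b c d -> a N.+ b N.+ (c N.+ d) == a N.+ c N.+ (b N.+ d)
  ar a b c d = N.+-assoc a b (c N.+ d) · cong (a N.+_) (sym (N.+-assoc b c d) · cong (N._+ d) (N.+-comm b c) · N.+-assoc c b d) · sym (N.+-assoc a c (b N.+ d))

 upTo-∈ : ∀ N (f g : ℕ -> ℕ) -> (∀ v -> v N.< N -> f v == g v) -> map f (upTo N) == map g (upTo N)
 upTo-∈ zero f g h = refl
 upTo-∈ (suc N) f g h = cong (map f) (sym (upTo-∷ʳ N)) · map-++ f (upTo N) _ · cong2 (\ a b -> a ++ b ∷ []) (upTo-∈ N f g (\ v l -> h v (N.m≤n⇒m≤1+n l))) (h N N.≤-refl) · sym (cong (map g) (sym (upTo-∷ʳ N)) · map-++ g (upTo N) _)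

 content-app : ∀ N la {c ρ Tb} -> IL c la ρ -> Fill N ρ Tb -> content (suc N) (app N la Tb) == content N Tb ++ countℕ N (concat (app N la Tb)) ∷ []
 content-app N la {Tb = Tb} d f = cong (map _) (sym (upTo-∷ʳ N)) · map-++ _ (upTo N) _ · cong (\ z -> z ++ countℕ N (concat (app N la Tb)) ∷ []) (upTo-∈ N (\ v -> countℕ v (concat (app N la Tb))) (\ v -> countℕ v (concat Tb)) (\ v l -> count-app-low N v la l d f))

 -- The last entry of the content counts the copies of the largest letter, that is, the size of the
 -- strip deleted by `Sch-split`.
 Sch-step : ∀ B N la A m -> WD B la -> Sch (suc N) la (A ++ m ∷ []) == box (length la) B (\ ρ -> il? B la ρ » (+ sum la Z.≟ + sum ρ + + m) » Sch N ρ A)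
 Sch-step B N la A m wd = Sch-split B N la _ wd · box-cong (length la) B _ _ (\ ρ _ _ -> »-val (il? B la ρ) (\ d -> S′-fill N [] ρ (\ Tb f -> pt ρ d Tb f) · S′-* N [] ρ (E ρ » + 1) (\ Tb -> bi (eqListℕ (content N Tb) A)) · sym (»-*1 (E ρ) (Sch N ρ A))))
  where
  E : ∀ ρ -> Dec (+ sum la == + sum ρ + + m)
  E ρ = + sum la Z.≟ + sum ρ + + m
  pt : ∀ ρ -> IL B la ρ -> ∀ Tb -> Fill N ρ Tb -> bi (eqListℕ (content (suc N) (app N la Tb)) (A ++ m ∷ [])) == (E ρ » + 1) * bi (eqListℕ (content N Tb) A)
  pt ρ d Tb f = bi-does (≡-dec N._≟_ _ _) · »-cong (≡-dec N._≟_ (content (suc N) (app N la Tb)) (A ++ m ∷ [])) (E ρ ×-dec ≡-dec N._≟_ (content N Tb) A) to from (\ _ _ -> refl) · prod (E ρ) (≡-dec N._≟_ (content N Tb) A) · cong (\ z -> (E ρ » + 1) * z) (sym (bi-does (≡-dec N._≟_ (content N Tb) A)))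
   where
   c = countℕ N (concat (app N la Tb))
   to : content (suc N) (app N la Tb) == A ++ m ∷ [] -> + sum la == + sum ρ + + m × content N Tb == A
   to e = let (a , b) = ∷ʳ-injective (content N Tb) A (sym (content-app N la d f) · e) in cong +_ (sym (count-app-top N la d f) · cong (sum ρ N.+_) b) , a
   from : + sum la == + sum ρ + + m × content N Tb == A -> content (suc N) (app N la Tb) == A ++ m ∷ []
   from (e , a) = content-app N la d f · cong2 (\ x y -> x ++ y ∷ []) a (N.+-cancelˡ-≡ (sum ρ) c m (count-app-top N la d f · Z.+-injective e))
   prod : ∀ {P Q : Set} (a : Dec P) (b : Dec Q) -> ((a ×-dec b) » + 1) == (a » + 1) * (b » + 1)
   prod (yes _) (yes _) = refl
   prod (yes _) (no _) = refl
   prod (no _) b = sym (Z.*-zeroˡ (b » + 1))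

 il-WD : ∀ {c la ρ} -> IL c la ρ -> WD c ρ
 il-WD [] = _
 il-WD (cons a b d) = N.≤-trans b a , il-WD d

 -- The content is reversed because the strip of the largest letter is removed first.
 Sch-SC : ∀ B la ra -> WD B la -> Sch (length ra) la (reverse ra) == Box.SC B la ra
 Sch-SC B la [] _ = base la []
  where
  base : ∀ la prev -> S′ 0 prev la (\ Tb -> bi (eqListℕ [] [])) == ((sum la N.≟ 0) » + 1)
  base [] prev = refl
  base (zero ∷ la) prev = +0 (+ 1 * (bi (and (zipWith N._<ᵇ_ prev [])) * Z)) · Z.*-identityˡ (bi (and (zipWith N._<ᵇ_ prev [])) * Z) · cong (\ b -> bi b * Z) (z[] prev) · Z.*-identityˡ Z · base la []
   where
   Z = S′ 0 [] la (\ Tb -> bi (eqListℕ [] []))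
   z[] : ∀ P -> and (zipWith N._<ᵇ_ P []) == true
   z[] [] = refl
   z[] (_ ∷ _) = refl
  base (suc p ∷ la) prev = Ʃ-seqs p 0 (\ r -> bi (weakInc r) * (bi (and (zipWith N._<ᵇ_ prev r)) * S′ 0 r la (\ Tb -> bi (eqListℕ [] [])))) · sym (»-no (suc p N.+ sum la N.≟ 0) {+ 1} (\ ()))
 Sch-SC B la (m ∷ ra) wd = cong (Sch (suc (length ra)) la) (unfold-reverse m ra) · Sch-step B (length ra) la (reverse ra) m wd · box-cong (length la) B _ _ (\ ρ _ _ -> »-val (il? B la ρ) (\ d -> cong (\ z -> (+ sum la Z.≟ + sum ρ + + m) » z) (Sch-SC B ρ ra (il-WD d))))

 pad : ℕ -> List ℕ -> List ℕ
 pad zero la = []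
 pad (suc L) [] = 0 ∷ pad L []
 pad (suc L) (p ∷ la) = p ∷ pad L la

 pad≡ : ∀ L la -> length la N.≤ L -> pad L la == la ++ replicate (L ∸ length la) 0
 pad≡ zero [] _ = refl
 pad≡ (suc L) [] _ = cong (0 ∷_) (pad≡ L [] z≤n)
 pad≡ (suc L) (p ∷ la) (s≤s l) = cong (p ∷_) (pad≡ L la l)

 S′-pad : ∀ N prev la j K -> S′ N prev (la ++ replicate j 0) K == S′ N prev la (\ Tb -> K (Tb ++ replicate j []))
 S′-pad N prev [] zero K = refl
 S′-pad N prev [] (suc j) K = +0 (+ 1 * (bi (and (zipWith N._<ᵇ_ prev [])) * Z)) · Z.*-identityˡ (bi (and (zipWith N._<ᵇ_ prev [])) * Z) · cong (\ b -> bi b * Z) (z[] prev) · Z.*-identityˡ Z · S′-pad N [] [] j (\ Tb -> K ([] ∷ Tb))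
  where
  Z = S′ N [] (replicate j 0) (\ Tb -> K ([] ∷ Tb))
  z[] : ∀ P -> and (zipWith N._<ᵇ_ P []) == true
  z[] [] = refl
  z[] (_ ∷ _) = refl
 S′-pad N prev (p ∷ la) j K = ƩL-ext (seqs p N) (\ r -> cong (\ z -> bi (weakInc r) * (bi (and (zipWith N._<ᵇ_ prev r)) * z)) (S′-pad N r la j (\ Tb -> K (r ∷ Tb))))

 Sch-pad : ∀ N L la a -> length la N.≤ L -> Sch N (pad L la) a == Sch N la a
 Sch-pad N L la a l = cong (\ z -> Sch N z a) (pad≡ L la l) · S′-pad N [] la (L ∸ length la) _ · S′-cong N [] la (\ Tb -> cong (\ z -> bi (eqListℕ (map (\ v -> countℕ v z) (upTo N)) a)) (sym (concat-++ Tb _) · cong (concat Tb ++_) (cr (L ∸ length la)) · ++-identityʳ (concat Tb)))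
  where
  cr : ∀ j -> concat {A = ℕ} (replicate j []) == []
  cr zero = refl
  cr (suc j) = cr j

 WD-pad : ∀ L m la -> WD m la -> WD m (pad L la)
 WD-pad zero m la _ = _
 WD-pad (suc L) m [] _ = z≤n , WD-pad L 0 [] _
 WD-pad (suc L) m (p ∷ la) (a , b) = a , WD-pad L p la b

 schur-SC : ∀ B L la {N} (a : Vec ℕ N) -> length la N.≤ L -> WD B la -> schurCoeff la a == Box.SC B (pad L la) (reverse (toList a))
 schur-SC B L la {N} a l wd = schur-Sch la a · sym (Sch-pad N L la (toList a) l) · cong2 (\ x y -> Sch x (pad L la) y) (sym (lenV a) · sym (length-reverse (toList a))) (sym (reverse-involutive (toList a))) · Sch-SC B (pad L la) (reverse (toList a)) (WD-pad L B la wd)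
  where
  lenV : ∀ {N} (a : Vec ℕ N) -> length (toList a) == N
  lenV [] = refl
  lenV (x ∷ a) = cong suc (lenV a)

 -- Carries the enumeration of partitions over to the `box` sums in which the Cauchy identity holds;
 -- order and size become guards. The enumeration wants positive parts, and this is automatic: a
 -- decreasing vector that starts with 0 has sum 0.
 parts-box : ∀ f n m L B (G : List ℕ -> ℤ) -> n N.≤ f -> n N.≤ L -> m N.≤ B -> ƩL (partsMax f n m) (\ la -> G (pad L la)) == box L B (\ λs -> wd? m λs » (sum λs N.≟ n) » G λs)
 parts-box f zero m L B G _ _ mB = base f · sym (Box.box-zeros B L _ (\ l ne -> »-vanish (wd? m l) (\ _ -> »-no (sum l N.≟ 0) ne)) · »-yes (wd? m (replicate L 0)) (wz L m) · »-yes (sum (replicate L 0) N.≟ 0) (Box.sum-zeros B L))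
  where
  wz : ∀ L m -> WD m (replicate L 0)
  wz zero m = _
  wz (suc L) m = z≤n , wz L 0
  pz : ∀ L -> pad L [] == replicate L 0
  pz zero = refl
  pz (suc L) = cong (0 ∷_) (pz L)
  base : ∀ f -> ƩL (partsMax f 0 m) (\ la -> G (pad L la)) == G (replicate L 0)
  base zero = +0 _ · cong G (pz L)
  base (suc f) = +0 _ · cong G (pz L)
 parts-box (suc f) (suc n) m (suc L) B G (s≤s nf) (s≤s nL) mB = ƩL-concatMap (\ p -> map (p ∷_) (partsMax f (suc n ∸ p) p)) (applyUpTo suc (suc n ⊓ m)) _ · ƩL-applyUpTo suc (suc n ⊓ m) _ ·
  Ʃ-cong (suc n ⊓ m) {_} {\ i -> Hp (suc i)} (\ i i< -> ƩL-map (suc i ∷_) (partsMax f (n ∸ i) (suc i)) _ · parts-box f (n ∸ i) (suc i) L B (\ l -> G (suc i ∷ l)) (N.≤-trans (N.m∸n≤m n i) nf) (N.≤-trans (N.m∸n≤m n i) nL) (N.≤-trans (N.m<n⊓o⇒m<o (suc n) m i<) mB)) ·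
  sym (»-interval 1 (suc n ⊓ m) B Hp (N.≤-trans (N.m⊓n≤n (suc n) m) mB)) · Ʃ≤-ext B row′
  where
  Hp : ℕ -> ℤ
  Hp x = box L B (\ l -> wd? x l » (sum l N.≟ suc n ∸ x) » G (x ∷ l))
  row′ : ∀ x -> ((x ≤? suc n ⊓ m) » (1 ≤? x) » Hp x) == box L B (\ l -> wd? m (x ∷ l) » (x N.+ sum l N.≟ suc n) » G (x ∷ l))
  row′ x = sym (box-cong L B _ (\ l -> (x ≤? suc n ⊓ m) » (1 ≤? x) » wd? x l » (sum l N.≟ suc n ∸ x) » G (x ∷ l)) (\ l _ _ -> e l) · box-» (x ≤? suc n ⊓ m) L B _ · cong (\ z -> (x ≤? suc n ⊓ m) » z) (box-» (1 ≤? x) L B _))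
   where
   sum0 : ∀ l -> WD 0 l -> sum l == 0
   sum0 [] _ = refl
   sum0 (.0 ∷ l) (z≤n , w) = sum0 l w
   e : ∀ l -> (wd? m (x ∷ l) » (x N.+ sum l N.≟ suc n) » G (x ∷ l)) == ((x ≤? suc n ⊓ m) » (1 ≤? x) » wd? x l » (sum l N.≟ suc n ∸ x) » G (x ∷ l))
   e l = g4 (wd? m (x ∷ l)) (x N.+ sum l N.≟ suc n) (x ≤? suc n ⊓ m) (1 ≤? x) (wd? x l) (sum l N.≟ suc n ∸ x)
    (\ (a , b) q -> N.⊓-glb (subst (x N.≤_) q (N.m≤m+n x (sum l))) a , ≥1 b q , b , sym (N.m+n∸m≡n x (sum l)) · cong (N._∸ x) q)
    (\ a _ b q -> (N.m≤n⊓o⇒m≤o (suc n) m a , b) , cong (x N.+_) q · N.m+[n∸m]≡n (N.m≤n⊓o⇒m≤n (suc n) m a))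
    where
    ≥1 : ∀ {x} -> WD x l -> x N.+ sum l == suc n -> 1 N.≤ x
    ≥1 {suc _} b q = s≤s z≤n
    ≥1 {zero} b q = exfalso (N.0≢1+n (sym (sum0 l b) · q))
    g4 : ∀ {P Q R S U V : Set} {z : ℤ} (p : Dec P) (q : Dec Q) (r : Dec R) (s : Dec S) (u : Dec U) (v : Dec V) -> (P -> Q -> R × S × U × V) -> (R -> S -> U -> V -> P × Q) -> (p » q » z) == (r » s » u » v » z)
    g4 (yes p) (yes q) r s u v f g = let (a , b , c , d) = f p q in sym (»-yes r a · »-yes s b · »-yes u c · »-yes v d)
    g4 (yes p) (no ¬q) r s u v f g = sym (»-vanish r (\ a -> »-vanish s (\ b -> »-vanish u (\ c -> »-no v (\ d -> ¬q (snd (g a b c d)))))))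
    g4 (no ¬p) q r s u v f g = sym (»-vanish r (\ a -> »-vanish s (\ b -> »-vanish u (\ c -> »-no v (\ d -> ¬p (fst (g a b c d)))))))

 record IsPart (n m : ℕ) (la : List ℕ) : Set where
  constructor isPart
  field
   positive : All (1 N.≤_) la
   decreasing : WD m la
   size≡ : sum la == n
   short : length la N.≤ n

 partsMax-sound : ∀ f n m {la} -> la ∈ partsMax f n m -> IsPart n m la
 partsMax-sound zero zero m (here refl) = isPart [] _ refl z≤n
 partsMax-sound (suc f) zero m (here refl) = isPart [] _ refl z≤n
 partsMax-sound (suc f) (suc n) m h with ∈-concatMap⁻ (\ p -> map (p ∷_) (partsMax f (suc n ∸ p) p)) {xs = applyUpTo suc (suc n ⊓ m)} h
 ... | q = go (Data.List.Membership.Propositional.find q)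
  where
  import Data.List.Membership.Propositional
  go : ∀ {la} -> (Σ ℕ \ p -> p ∈ applyUpTo suc (suc n ⊓ m) × la ∈ map (p ∷_) (partsMax f (suc n ∸ p) p)) -> IsPart (suc n) m la
  go (p , p∈ , la∈) with ∈-applyUpTo⁻ suc p∈ | ∈-map⁻ (p ∷_) la∈
  ... | i , i< , refl | la' , la'∈ , refl with partsMax-sound f (n ∸ i) (suc i) la'∈
  ...   | isPart a b c d = isPart (s≤s z≤n ∷ a) (N.m<n⊓o⇒m<o (suc n) m i< , b) (cong suc (cong (i N.+_) c · N.m+[n∸m]≡n i≤n)) (s≤s (N.≤-trans d (N.m∸n≤m n i)))
   where
   i≤n : i N.≤ n
   i≤n = s≤s⁻¹ (N.m<n⊓o⇒m<n (suc n) m i<)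

 SC-WD : ∀ B λs a -> ¬ WD B λs -> Box.SC B λs a == + 0
 SC-WD B λs [] ne = »-no (sum λs N.≟ 0) (\ e -> ne (wd0 B λs e))
  where
  wd0 : ∀ m l -> sum l == 0 -> WD m l
  wd0 m [] _ = _
  wd0 m (zero ∷ l) e = z≤n , wd0 0 l e
 SC-WD B λs (m ∷ a) ne = box-cong (length λs) B _ (\ _ -> + 0 * + 0) (\ ρ _ _ -> »-no (il? B λs ρ) (\ d -> ne (w d))) · box-* (length λs) B (+ 0) (\ _ -> + 0)
  where
  w : ∀ {c la ρ} -> IL c la ρ -> WD c la
  w [] = _
  w (cons a b d) = a , WD-mono _ b (w d)

 schur-cauchy : ∀ {N N'} (a : Vec ℕ N) (ν : Vec ℕ N') -> ƩL (partitions (size a)) (\ la -> schurCoeff la a * schurCoeff la ν) == Box.Mat (size a) (reverse (toList a)) (reverse (toList ν))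
 schur-cauchy {N} a ν = ƩL-cong (partitions n) (\ la m -> cong2 _*_ (schur-SC n L la a (lL m) (dec m)) (schur-SC n L la ν (lL m) (dec m))) · parts-box n n n L n (\ l -> SC l ra * SC l rν) N.≤-refl (N.≤-trans (N.m≤m+n n (length ra)) (N.n≤1+n _)) N.≤-refl ·
  box-cong L n _ _ (\ l _ _ -> g1 l) · cauchy L ra rν (s≤s (N.m≤n+m (length ra) n)) (N.≤-reflexive sumr)
  where
  n = size a
  open Box n
  ra = reverse (toList a)
  rν = reverse (toList ν)
  L = suc (n N.+ length ra)
  sumr : sum ra == n
  sumr = SP.sum-↭ (↭-reverse (toList a))
  lL : ∀ {la} -> la ∈ partitions n -> length la N.≤ L
  lL m = N.≤-trans (IsPart.short (partsMax-sound n n n m)) (N.≤-trans (N.m≤m+n n (length ra)) (N.n≤1+n _))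
  dec : ∀ {la} -> la ∈ partitions n -> WD n la
  dec m = IsPart.decreasing (partsMax-sound n n n m)
  g1 : ∀ l -> (wd? n l » (sum l N.≟ n) » SC l ra * SC l rν) == SC l ra * SC l rν
  g1 l with wd? n l | sum l N.≟ n
  ... | yes _ | yes _ = refl
  ... | no ne | _ = sym (cong (\ z -> z * SC l rν) (SC-WD n l ra ne) · Z.*-zeroˡ (SC l rν))
  ... | yes _ | no ne = sym (cong (\ z -> z * SC l rν) (SC-supp l ra (\ (_ , e) -> ne (e · sumr))) · Z.*-zeroˡ (SC l rν))

-- Names for the local recursions inside the definitions.

module Hidden where
 open import Defs

 invGo : ℕ -> ℤ -> ℕ -> List ℤ -> ℤ
 invGo k v r [] = + 0
 invGo k v r (x ∷ xs) = if (x %ℕ suc k) N.≡ᵇ (v %ℕ suc k) then + r Z.+ ((v Z.- x) /ℕ suc k) Z.* + suc k else invGo k v (suc r) xs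

 -- The loop of `invAt` is local to its definition and cannot be named. `invAt-go′` leaves a hole
 -- for it, which the call from here determines once the list and the starting index are
 -- generalised. The other recursions below are treated in the same way.
 invAt-go : ∀ k (u : Window k) v -> invAt k u v == invGo k v 1 (toList u)
 invAt-go′ : ∀ k (u : Window k) v r xs -> _ == invGo k v r xs
 invAt-go k u v with toList u | 1
 ... | xs | r = invAt-go′ k u v r xs
 invAt-go′ k u v r [] = refl
 invAt-go′ k u v r (x ∷ xs) = cong (\ z -> if (x %ℕ suc k) N.≡ᵇ (v %ℕ suc k) then + r Z.+ ((v Z.- x) /ℕ suc k) Z.* + suc k else z) (invAt-go′ k u v (suc r) xs)

 mmGo : ℕ -> List ℕ -> List ℕ -> ℕ
 mmGo k L [] = suc k
 mmGo k L (x ∷ xs) = if any (\ y -> y N.≡ᵇ x) L then mmGo k L xs else x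

 minMissing-go : ∀ k L -> minMissing k L == mmGo k L (upTo (suc k))
 minMissing-go′ : ∀ k L xs -> _ == mmGo k L xs
 minMissing-go k L with applyUpTo suc k
 ... | xs = cong (\ z -> if any (\ y -> y N.≡ᵇ 0) L then z else 0) (minMissing-go′ k L xs)
 minMissing-go′ k L [] = refl
 minMissing-go′ k L (x ∷ xs) = cong (\ z -> if any (\ y -> y N.≡ᵇ x) L then z else x) (minMissing-go′ k L xs)

 coGo : ℤ -> ℕ -> List ℤ -> List ℕ
 coGo p c [] = c ∷ []
 coGo p c (y ∷ ys) = if ltℤ y p then c ∷ coGo y 1 ys else coGo y (suc c) ys

 compOf-go : ∀ x xs -> compOf (x ∷ xs) == coGo x 1 xs
 compOf-go′ : ∀ x₀ xs₀ x c xs -> _ == coGo x c xs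
 compOf-go x [] = refl
 compOf-go x (y ∷ ys) with ltℤ y x | 1 | y ∷ ys
 ... | true | c | zs = cong (c ∷_) (compOf-go′ x zs y c ys)
 ... | false | c | zs = compOf-go′ x zs y 2 ys
 compOf-go′ x₀ xs₀ x c [] = refl
 compOf-go′ x₀ xs₀ x c (y ∷ ys) with ltℤ y x
 ... | true = cong (c ∷_) (compOf-go′ x₀ xs₀ y 1 ys)
 ... | false = compOf-go′ x₀ xs₀ y (suc c) ys

 cdGo : ℕ -> List ℕ -> List ℕ
 cdGo acc [] = []
 cdGo acc (x ∷ []) = []
 cdGo acc (x ∷ y ∷ r) = (acc N.+ x) ∷ cdGo (acc N.+ x) (y ∷ r)

 compDes-go : ∀ xs -> compDes xs == cdGo 0 xs
 compDes-go′ : ∀ acc xs -> _ == cdGo acc xs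
 compDes-go xs with 0
 ... | acc = compDes-go′ acc xs
 compDes-go′ acc [] = refl
 compDes-go′ acc (x ∷ []) = refl
 compDes-go′ acc (x ∷ y ∷ r) = cong ((acc N.+ x) ∷_) (compDes-go′ (acc N.+ x) (y ∷ r))

-- Quasi-periodic functions, congruence modulo n, reflections and states.

module Base (k' : ℕ) where
 open Z using (_≤_)
 open import Defs using (nthℤ; tr)

 k n : ℕ
 k = suc k'
 n = suc k

 N : ℤ
 N = + n

 0<N : + 0 < N
 0<N = Z.+<+ z<s

 mulN-< : ∀ {q q'} -> q < q' -> q * N + N ≤ q' * N
 mulN-< {q} {q'} p = subst (_≤ q' * N) (eq q N) (Z.*-monoʳ-≤-nonNeg N (Z.i<j⇒suc[i]≤j p))
  where
  eq : ∀ q N -> (+ 1 + q) * N == q * N + N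
  eq = solve

 divMod-unique : ∀ {r r'} q q' -> r N.< n -> r' N.< n -> + r + q * N == + r' + q' * N -> r == r' × q == q'
 divMod-unique {r} {r'} q q' r<n r'<n e with Z.<-cmp q q'
 ... | tri≈ _ refl _ = Z.+-injective (lin (+ r & + r' & q * N & []) (x0 :+ x2 := x1 :+ x2 & []) (x0 := x1) e) , refl
 ... | tri< p _ _ = lin⊥ (+ r & + r' & q * N & q' * N & N & [])
     (x0 :+ x2 := x1 :+ x3 & x2 :+ x4 =< x3 & x0 :< x4 & 0' =< x1 & []) e (mulN-< p) (Z.+<+ r<n) 0≤+
 ... | tri> _ _ p = lin⊥ (+ r & + r' & q * N & q' * N & N & [])
     (x0 :+ x2 := x1 :+ x3 & x3 :+ x4 =< x2 & x1 :< x4 & 0' =< x0 & []) e (mulN-< p) (Z.+<+ r'<n) 0≤+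

 divMod-≡ : ∀ i -> i == + (i %ℕ n) + (i /ℕ n) * N
 divMod-≡ i = DM.a≡a%ℕn+[a/ℕn]*n i n

 rem-unique : ∀ {i r} q -> r N.< n -> i == + r + q * N -> i %ℕ n == r
 rem-unique {i} q r<n e = fst (divMod-unique (i /ℕ n) q (DM.n%ℕd<d i n) r<n (sym (divMod-≡ i) · e))

 quot-unique : ∀ {i r} q -> r N.< n -> i == + r + q * N -> i /ℕ n == q
 quot-unique {i} q r<n e = snd (divMod-unique (i /ℕ n) q (DM.n%ℕd<d i n) r<n (sym (divMod-≡ i) · e))

 opaque
  pos-decomp : ∀ i -> Σ ℕ \ r -> Σ ℤ \ q -> r N.< n × i == + suc r + q * N
  pos-decomp i = (i -¹) %ℕ n , (i -¹) /ℕ n , DM.n%ℕd<d (i -¹) n ,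
   lin (i & + ((i -¹) %ℕ n) & (i -¹) /ℕ n * N & []) (x0 :- 1' := x1 :+ x2 & []) (x0 := 1' :+ x1 :+ x2) (divMod-≡ (i -¹))

 opaque
  -- One period of values is continued with the increment c per period. Windows have c = n and
  -- states c = 1, so both share the lemmas on `QP`.
  gev : ℤ -> List ℤ -> ℤ -> ℤ
  gev c xs i = nthℤ xs ((i -¹) %ℕ n) + ((i -¹) /ℕ n) * c

  gev-at : ∀ c xs {r} q -> r N.< n -> gev c xs (+ suc r + q * N) == nthℤ xs r + q * c
  gev-at c xs {r} q r<n = cong2 (\ a b -> nthℤ xs a + b * c) (rem-unique q r<n e) (quot-unique q r<n e)
   where
   e : + suc r + q * N -¹ == + r + q * N
   e = lin (+ r & q * N & []) [] (1' :+ x0 :+ x1 :- 1' := x0 :+ x1)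

  gev-def : ∀ c xs i -> gev c xs i == nthℤ xs ((i -¹) %ℕ n) + ((i -¹) /ℕ n) * c
  gev-def c xs i = refl

 record QP (c : ℤ) (g : ℤ -> ℤ) : Set where
  constructor qp
  field step : ∀ i -> g (i + N) == g i + c
 open QP public

 QP-mul : ∀ {c g} -> QP c g -> ∀ i m -> g (i + m * N) == g i + m * c
 QP-mul {c} {g} h i (+ zero) = cong g (+0 i) · sym (+0 (g i))
 QP-mul {c} {g} h i (+ suc m) = cong g (eq i (+ m) N) · step h (i + + m * N) · cong (\ z -> z + c) (QP-mul h i (+ m)) · sym (eq (g i) (+ m) c)
  where
  eq : ∀ i m N -> i + (+ 1 + m) * N == i + m * N + N
  eq = solve
 QP-mul {c} {g} h i -[1+ zero ] = lin (g (i + -1ℤ * N) & g i & c & []) (x1 := x0 :+ x2 & []) (x0 := x1 :- x2) (cong g (eq i N) · step h (i + -1ℤ * N)) · eq₂ (g i) c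
  where
  eq : ∀ i N -> i == i + -[1+ 0 ] * N + N
  eq = solve
  eq₂ : ∀ i N -> i - N == i + -[1+ 0 ] * N
  eq₂ = solve
 QP-mul {c} {g} h i -[1+ suc m ] = lin (g (i + -[1+ suc m ] * N) & g i & c & -[1+ m ] * c & []) (x1 :+ x3 := x0 :+ x2 & []) (x0 := x1 :+ x3 :- x2) (sym (QP-mul h i -[1+ m ]) · cong g (eq i (-[1+ m ]) N) · step h (i + -[1+ suc m ] * N)) · eq₂ (g i) -[1+ m ] c
  where
  eq : ∀ i m N -> i + m * N == i + (-[1+ 0 ] + m) * N + N
  eq = solve
  eq₂ : ∀ g m c -> g + m * c - c == g + (-[1+ 0 ] + m) * c
  eq₂ = solve

 gev-QP : ∀ c xs -> QP c (gev c xs)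
 gev-QP c xs = qp go
  where
  eq : ∀ r q N -> r + q * N + N == r + (q + + 1) * N
  eq = solve
  go : ∀ i -> gev c xs (i + N) == gev c xs i + c
  go i with pos-decomp i
  ... | r , q , r<n , e = cong (\ z -> gev c xs (z + N)) e · cong (gev c xs) (eq (+ suc r) q N) ·
   gev-at c xs (q +1) r<n · sym (eq (nthℤ xs r) q c) · cong (\ z -> z + c) (sym (gev-at c xs q r<n)) · cong (\ z -> gev c xs z + c) (sym e)

 mk : (ℤ -> ℤ) -> Vec ℤ n
 mk g = Vec.tabulate (\ r -> g (+ suc (toℕ r)))

 nth-tabulate : ∀ {m} (f : ℕ -> ℤ) {r} -> r N.< m -> nthℤ (toList (Vec.tabulate {n = m} (\ i -> f (toℕ i)))) r == f r
 nth-tabulate {suc m} f {zero} (s≤s p) = refl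
 nth-tabulate {suc m} f {suc r} (s≤s p) = nth-tabulate (f ∘ suc) p

 gev-mk : ∀ {c g} -> QP c g -> ∀ i -> gev c (toList (mk g)) i == g i
 gev-mk {c} {g} h i with pos-decomp i
 ... | r , q , r<n , refl = gev-at c (toList (mk g)) q r<n · cong (\ z -> z + q * c) (nth-tabulate (\ r -> g (+ suc r)) r<n) · sym (QP-mul h (+ suc r) q)

 nth-ext : ∀ {m} (s t : Vec ℤ m) -> (∀ r -> r N.< m -> nthℤ (toList s) r == nthℤ (toList t) r) -> s == t
 nth-ext [] [] h = refl
 nth-ext (x ∷ s) (y ∷ t) h = cong2 _∷_ (h 0 z<s) (nth-ext s t (\ r p -> h (suc r) (s≤s p)))

 gev-ext : ∀ c (s t : Vec ℤ n) -> (∀ i -> gev c (toList s) i == gev c (toList t) i) -> s == t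
 gev-ext c s t h = nth-ext s t (\ r p -> sym (at s r p) · h (+ suc r + + 0 * N) · at t r p)
  where
  at : ∀ s r -> r N.< n -> gev c (toList s) (+ suc r + + 0 * N) == nthℤ (toList s) r
  at s r p = gev-at c (toList s) (+ 0) p · +0 (nthℤ (toList s) r)

 infix 4 _~_ _~?_
 record _~_ (i j : ℤ) : Set where
  constructor _,_
  field
   mult : ℤ
   mult-≡ : j == i + mult * N

 rem-~ : ∀ {i j} -> i %ℕ n == j %ℕ n -> i ~ j
 rem-~ {i} {j} e = (j /ℕ n - i /ℕ n) , divMod-≡ j · cong (\ z -> + z + j /ℕ n * N) (sym e) · eq (+ (i %ℕ n)) (i /ℕ n) (j /ℕ n) N · cong (\ z -> z + (j /ℕ n - i /ℕ n) * N) (sym (divMod-≡ i))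
  where
  eq : ∀ r q q' N -> r + q' * N == r + q * N + (q' - q) * N
  eq = solve

 ~-rem : ∀ {i j} -> i ~ j -> i %ℕ n == j %ℕ n
 ~-rem {i} (m , refl) = sym (rem-unique (i /ℕ n + m) (DM.n%ℕd<d i n) (cong (\ z -> z + m * N) (divMod-≡ i) · eq (+ (i %ℕ n)) (i /ℕ n) m N))
  where
  eq : ∀ r q m N -> r + q * N + m * N == r + (q + m) * N
  eq = solve

 _~?_ : ∀ i j -> Dec (i ~ j)
 i ~? j with (i %ℕ n) N.≟ (j %ℕ n)
 ... | yes p = yes (rem-~ p)
 ... | no ¬p = no (¬p ∘ ~-rem)

 ~-refl : ∀ {i} -> i ~ i
 ~-refl {i} = + 0 , sym (+0 i)

 ~-sym : ∀ {i j} -> i ~ j -> j ~ i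
 ~-sym {i} (m , refl) = - m , eq i m N
  where
  eq : ∀ i m N -> i == i + m * N + (- m) * N
  eq = solve

 ~-trans : ∀ {i j l} -> i ~ j -> j ~ l -> i ~ l
 ~-trans {i} (m , refl) (m' , refl) = m + m' , eq i m m' N
  where
  eq : ∀ i m m' N -> i + m * N + m' * N == i + (m + m') * N
  eq = solve

 ~-shift : ∀ i m -> i ~ i + m * N
 ~-shift i m = m , refl

 ~-+ : ∀ {i j} c -> i ~ j -> i + c ~ j + c
 ~-+ {i} c (m , refl) = m , eq i (m * N) c
  where
  eq : ∀ i m c -> i + m + c == i + c + m
  eq = solve

 ~-near : ∀ {i j} -> i ~ j -> i - N < j -> j < i + N -> i == j
 ~-near {i} (m , refl) p q with Z.<-cmp (+ 0) m
 ... | tri≈ _ refl _ = sym (+0 i)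
 ... | tri< l _ _ = lin⊥ (i & N & m * N & []) (x0 :+ x2 :< x0 :+ x1 & 0' :+ x1 =< x2 & []) q (mulN-< l)
 ... | tri> _ _ l = lin⊥ (i & N & m * N & []) (x0 :- x1 :< x0 :+ x2 & x2 :+ x1 =< 0' & []) p (mulN-< l)

 ¬~-lt : ∀ {i j} -> i < j -> j < i + N -> ¬ i ~ j
 ¬~-lt {i} {j} p q e = lin⊥ (i & j & []) (x0 :< x1 & x0 := x1 & []) p
  (~-near e (lin (i & j & N & []) (x0 :< x1 & 0' :< x2 & []) (x0 :- x2 :< x1) p 0<N) q)

 ¬~-gt : ∀ {i j} -> j < i -> i < j + N -> ¬ i ~ j
 ¬~-gt p q e = ¬~-lt p q (~-sym e)

 ¬~-suc : ∀ i -> ¬ i ~ i +1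
 ¬~-suc i = ¬~-lt (lin (i & []) [] (x0 :< x0 :+ 1')) (Z.+-monoʳ-< i (Z.+<+ (s≤s z<s)))

 data Cases (a b j : ℤ) : Set where
  is-a  : ∀ m -> j == a + m * N -> Cases a b j
  is-b  : ∀ m -> j == b + m * N -> Cases a b j
  other : ¬ a ~ j -> ¬ b ~ j -> Cases a b j

 cases : ∀ a b j -> Cases a b j
 cases a b j with a ~? j
 ... | yes (m , e) = is-a m e
 ... | no na with b ~? j
 ...   | yes (m , e) = is-b m e
 ...   | no nb = other na nb

 private
  T⇒true : ∀ {b} -> T b -> b == true
  T⇒true {true} _ = refl
  ¬T⇒false : ∀ {b} -> ¬ T b -> b == false
  ¬T⇒false {true} h = exfalso (h _)
  ¬T⇒false {false} _ = refl

 rem-true : ∀ {i j} -> i ~ j -> ((j %ℕ n) N.≡ᵇ (i %ℕ n)) == true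
 rem-true {i} {j} e = T⇒true (N.≡⇒≡ᵇ (j %ℕ n) (i %ℕ n) (sym (~-rem e)))

 rem-false : ∀ {i j} -> ¬ i ~ j -> ((j %ℕ n) N.≡ᵇ (i %ℕ n)) == false
 rem-false {i} {j} e = ¬T⇒false (\ t -> e (rem-~ (sym (N.≡ᵇ⇒≡ (j %ℕ n) (i %ℕ n) t))))

 tr-a : ∀ a b m -> tr k a b (a + m * N) == b + m * N
 tr-a a b m rewrite rem-true {a} {a + m * N} (m , refl) = eq a b (m * N)
  where
  eq : ∀ a b m -> a + m + (b - a) == b + m
  eq = solve

 tr-b : ∀ a b m -> ¬ a ~ b -> tr k a b (b + m * N) == a + m * N
 tr-b a b m ne rewrite rem-false {a} {b + m * N} (\ e -> ne (~-trans e (~-sym (~-shift b m)))) | rem-true {b} {b + m * N} (m , refl) = eq a b (m * N)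
  where
  eq : ∀ a b m -> b + m - (b - a) == a + m
  eq = solve

 tr-o : ∀ a b {j} -> ¬ a ~ j -> ¬ b ~ j -> tr k a b j == j
 tr-o a b {j} na nb rewrite rem-false {a} {j} na | rem-false {b} {j} nb = refl

 tr-a0 : ∀ a b -> tr k a b a == b
 tr-a0 a b = cong (tr k a b) (sym (+0 a)) · tr-a a b (+ 0) · +0 b

 tr-b0 : ∀ a b -> ¬ a ~ b -> tr k a b b == a
 tr-b0 a b ne = cong (tr k a b) (sym (+0 b)) · tr-b a b (+ 0) ne · +0 a

 tr-shift : ∀ a b -> ¬ a ~ b -> ∀ j m -> tr k a b (j + m * N) == tr k a b j + m * N
 tr-shift a b ne j m with cases a b j
 ... | is-a m' refl = cong (tr k a b) (eq a m' m N) · tr-a a b (m' + m) · sym (eq b m' m N) · cong (\ z -> z + m * N) (sym (tr-a a b m'))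
  where
  eq : ∀ a m m' N -> a + m * N + m' * N == a + (m + m') * N
  eq = solve
 ... | is-b m' refl = cong (tr k a b) (eq b m' m N) · tr-b a b (m' + m) ne · sym (eq a m' m N) · cong (\ z -> z + m * N) (sym (tr-b a b m' ne))
  where
  eq : ∀ a m m' N -> a + m * N + m' * N == a + (m + m') * N
  eq = solve
 ... | other na nb = tr-o a b (\ e -> na (~-trans e (~-sym (~-shift j m)))) (\ e -> nb (~-trans e (~-sym (~-shift j m)))) · cong (\ z -> z + m * N) (sym (tr-o a b na nb))

 tr-invol : ∀ a b -> ¬ a ~ b -> ∀ j -> tr k a b (tr k a b j) == j
 tr-invol a b ne j with cases a b j
 ... | is-a m refl = cong (tr k a b) (tr-a a b m) · tr-b a b m ne
 ... | is-b m refl = cong (tr k a b) (tr-b a b m ne) · tr-a a b m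
 ... | other na nb = cong (tr k a b) (tr-o a b na nb) · tr-o a b na nb

 tr-~ : ∀ a b -> ¬ a ~ b -> ∀ {i j} -> i ~ j -> tr k a b i ~ tr k a b j
 tr-~ a b ne {i} (m , refl) = m , tr-shift a b ne i m

 tr-~⁻ : ∀ a b -> ¬ a ~ b -> ∀ {i j} -> tr k a b i ~ tr k a b j -> i ~ j
 tr-~⁻ a b ne {i} {j} e = subst2 _~_ (tr-invol a b ne i) (tr-invol a b ne j) (tr-~ a b ne e)

 tr-conj : ∀ p q -> ¬ p ~ q -> ∀ a b -> ¬ a ~ b -> ∀ j ->
  tr k (tr k p q a) (tr k p q b) (tr k p q j) == tr k p q (tr k a b j)
 tr-conj p q npq a b nab j with cases a b j
 ... | is-a m refl = cong (tr k (tr k p q a) (tr k p q b)) (tr-shift p q npq a m) · tr-a (tr k p q a) (tr k p q b) m · sym (tr-shift p q npq b m) · cong (tr k p q) (sym (tr-a a b m))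
 ... | is-b m refl = cong (tr k (tr k p q a) (tr k p q b)) (tr-shift p q npq b m) · tr-b (tr k p q a) (tr k p q b) m (nab ∘ tr-~⁻ p q npq) · sym (tr-shift p q npq a m) · cong (tr k p q) (sym (tr-b a b m nab))
 ... | other na nb = tr-o (tr k p q a) (tr k p q b) (na ∘ tr-~⁻ p q npq) (nb ∘ tr-~⁻ p q npq) · cong (tr k p q) (sym (tr-o a b na nb))

 tr-period : ∀ a b -> ¬ a ~ b -> ∀ m j -> tr k (a + m * N) (b + m * N) j == tr k a b j
 tr-period a b ne m j with cases a b j
 ... | is-a m' refl = cong (tr k (a + m * N) (b + m * N)) (eq a m m' N) · tr-a (a + m * N) (b + m * N) (m' - m) · sym (eq b m m' N) · sym (tr-a a b m')
  where
  eq : ∀ a m m' N -> a + m' * N == a + m * N + (m' - m) * N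
  eq = solve
 ... | is-b m' refl = cong (tr k (a + m * N) (b + m * N)) (eq b m m' N) · tr-b (a + m * N) (b + m * N) (m' - m) (\ e -> ne (~-trans (~-shift a m) (~-trans e (~-sym (~-shift b m))))) · sym (eq a m m' N) · sym (tr-b a b m' ne)
  where
  eq : ∀ a m m' N -> a + m' * N == a + m * N + (m' - m) * N
  eq = solve
 ... | other na nb = tr-o _ _ (\ e -> na (~-trans (~-shift a m) e)) (\ e -> nb (~-trans (~-shift b m) e)) · sym (tr-o a b na nb)

 -- A state is a function h : ℤ → ℤ with h (j + n) = h j + 1, stored as its
 -- values at 1, …, n.  A window v ∈ W⁰ is encoded by h j = ⌊(v j − 1)/n⌋.

 State : Set
 State = Vec ℤ n

 opaque
  hv : State -> ℤ -> ℤ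
  hv s = gev (+ 1) (toList s)

  mkS : (ℤ -> ℤ) -> State
  mkS = mk

  hv-QP : ∀ s -> QP (+ 1) (hv s)
  hv-QP s = gev-QP (+ 1) (toList s)

  hv-mk : ∀ {g} -> QP (+ 1) g -> ∀ i -> hv (mkS g) i == g i
  hv-mk h = gev-mk h

  hv-ext : ∀ s t -> (∀ i -> hv s i == hv t i) -> s == t
  hv-ext = gev-ext (+ 1)

 hv-shift : ∀ s i m -> hv s (i + m * N) == hv s i + m
 hv-shift s i m = QP-mul (hv-QP s) i m · cong (\ z -> hv s i + z) (Z.*-identityʳ m)

 opaque
  sw : ℤ -> ℤ -> State -> State
  sw a b s = mkS (\ j -> hv s (tr k a b j))

  hv-sw : ∀ a b -> ¬ a ~ b -> ∀ s j -> hv (sw a b s) j == hv s (tr k a b j)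
  hv-sw a b ne s = hv-mk (qp \ i -> cong (hv s) (cong (\ z -> tr k a b (i + z)) (sym (Z.*-identityˡ N)) · tr-shift a b ne i (+ 1)) · hv-shift s (tr k a b i) (+ 1))

 hv-sw-a : ∀ {a b} -> ¬ a ~ b -> ∀ s -> hv (sw a b s) a == hv s b
 hv-sw-a {a} {b} ne s = hv-sw a b ne s a · cong (hv s) (tr-a0 a b)

 hv-sw-b : ∀ {a b} -> ¬ a ~ b -> ∀ s -> hv (sw a b s) b == hv s a
 hv-sw-b {a} {b} ne s = hv-sw a b ne s b · cong (hv s) (tr-b0 a b ne)

 hv-sw-o : ∀ {a b} -> ¬ a ~ b -> ∀ s {j} -> ¬ a ~ j -> ¬ b ~ j -> hv (sw a b s) j == hv s j
 hv-sw-o {a} {b} ne s {j} na nb = hv-sw a b ne s j · cong (hv s) (tr-o a b na nb)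

 sw-invol : ∀ {a b} -> ¬ a ~ b -> ∀ s -> sw a b (sw a b s) == s
 sw-invol {a} {b} ne s = hv-ext _ _ (\ j -> hv-sw a b ne (sw a b s) j · hv-sw a b ne s _ · cong (hv s) (tr-invol a b ne j))

 sw-conj : ∀ {a b p q} -> ¬ a ~ b -> ¬ p ~ q -> ∀ s -> sw a b (sw p q s) == sw p q (sw (tr k p q a) (tr k p q b) s)
 sw-conj {a} {b} {p} {q} nab npq s = hv-ext _ _ (\ j ->
  hv-sw a b nab (sw p q s) j · hv-sw p q npq s _ · cong (hv s) (sym (tr-conj p q npq a b nab j)) ·
  sym (hv-sw _ _ (nab ∘ tr-~⁻ p q npq) s _) · sym (hv-sw p q npq _ j))

 sw-period : ∀ {a b} -> ¬ a ~ b -> ∀ m s -> sw (a + m * N) (b + m * N) s == sw a b s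
 sw-period {a} {b} ne m s = hv-ext _ _ (\ j -> hv-sw _ _ (\ e -> ne (~-trans (~-shift a m) (~-trans e (~-sym (~-shift b m))))) s j · cong (hv s) (tr-period a b ne m j) · sym (hv-sw a b ne s j))

-- Strong covers against weak steps at other residues.

module Strong (k' : ℕ) where
 open Z using (_≤_)
 open import Defs using (tr)
 open Base k'
 open import Relation.Nullary.Decidable using (_⊎-dec_)

 Fun : Set
 Fun = State -> ℤ

 »»-cong : ∀ {P Q R S : Set} (p : Dec P) (q : Dec Q) (r : Dec R) (s : Dec S) {x y} ->
  (P -> Q -> R × S) -> (R -> S -> P × Q) -> (P -> Q -> x == y) -> (p » q » x) == (r » s » y)
 »»-cong (yes p) (yes q) r s f g h = h p q · sym (»-yes r (fst (f p q)) · »-yes s (snd (f p q)))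
 »»-cong (yes p) (no ¬q) r s f g h = sym (»-vanish r (\ x -> »-no s (\ y -> ¬q (snd (g x y)))))
 »»-cong (no ¬p) q r s f g h = sym (»-vanish r (\ x -> »-no s (\ y -> ¬p (fst (g x y)))))

 -- The weak-order and strong-order operators on functions of states: u i
 -- follows an ascent, Ξ b removes a strong cover with label b.

 Asc : ℤ -> State -> Set
 Asc i s = hv s i < hv s (i +1)

 asc? : ∀ i s -> Dec (Asc i s)
 asc? i s = hv s i Z.<? hv s (i +1)

 u : ℤ -> Fun -> Fun
 u i φ s = asc? i s » φ (sw i (i +1) s)

 neg? : ∀ b s -> Dec (hv s b < + 0)
 neg? b s = hv s b Z.<? + 0

 Ng : ℤ -> Fun -> Fun
 Ng b φ s = neg? b s » φ s

 -- An edge seen from its upper element: there position a holds a positive value and b a nonpositive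
 -- one, and `sw a b s` is the lower element. The inequalities in `btw` are strict in h because a
 -- tie with position a or b would take the lower element out of W⁰; see `Up⇒Cover` and
 -- `FromCover.down-W0`.
 record Cover (a b : ℤ) (s : State) : Set where
  constructor cover
  field
   pos : + 0 ≤ hv s a
   neg : hv s b < + 0
   btw : ∀ j -> a < j -> j < b -> hv s j < hv s b ⊎ hv s a < hv s j
 open Cover public

 gap : ∀ {a j} -> a < j -> Σ ℕ \ e -> j == a + + suc e
 gap {a} {j} p with j - a in eq
 ... | + zero = lin⊥ (a & j & []) (x0 :< x1 & x1 :- x0 := 0' & []) p eq
 ... | + suc e = e , lin (a & j & + suc e & []) (x1 :- x0 := x2 & []) (x1 := x0 :+ x2) eq
 ... | -[1+ e ] = exfalso (neg-absurd (subst (+ 0 ≤_) eq (Z.i≤j⇒0≤j-i (Z.<⇒≤ p))))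
  where
  neg-absurd : ¬ (+ 0 ≤ -[1+ e ])
  neg-absurd ()

 btw? : ∀ a b s -> Dec (∀ j -> a < j -> j < b -> hv s j < hv s b ⊎ hv s a < hv s j)
 btw? a b s with a Z.<? b
 ... | no ¬p = yes (\ j p q -> exfalso (¬p (Z.<-trans p q)))
 ... | yes p with gap p
 ...   | d , refl with N.allUpTo? (\ e -> (hv s (a + + suc e) Z.<? hv s (a + + suc d)) ⊎-dec (hv s a Z.<? hv s (a + + suc e))) d
 ...     | no ¬h = no (\ h -> ¬h (\ {e} e<d -> h (a + + suc e) (pos< e) (Z.+-monoʳ-< a (Z.+<+ (s≤s e<d)))))
  where
  pos< : ∀ e -> a < a + + suc e
  pos< e = lin (a & + e & []) (0' =< x1 & []) (x0 :< x0 :+ (1' :+ x1)) 0≤+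
 ...     | yes h = yes go
  where
  go : ∀ j -> a < j -> j < a + + suc d -> hv s j < hv s (a + + suc d) ⊎ hv s a < hv s j
  go j p q with gap p
  ... | e , refl = h (s≤s⁻¹ (Z.drop‿+<+ (lin (a & + suc e & + suc d & []) (x0 :+ x1 :< x0 :+ x2 & []) (x1 :< x2) q)))

 Cover? : ∀ a b s -> Dec (Cover a b s)
 Cover? a b s = map′ (\ { (p , q , r) -> cover p q r }) (\ { (cover p q r) -> p , q , r })
  ((+ 0 Z.≤? hv s a) ×-dec ((hv s b Z.<? + 0) ×-dec btw? a b s))

 opaque
  Tt : ℤ -> ℤ -> Fun -> Fun
  Tt a b φ s = Cover? a b s » φ (sw a b s)

  Tt-def : ∀ a b φ s -> Tt a b φ s == (Cover? a b s » φ (sw a b s))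
  Tt-def a b φ s = refl

 Tt-vanish : ∀ a b φ s -> (Cover a b s -> φ (sw a b s) == + 0) -> Tt a b φ s == + 0
 Tt-vanish a b φ s h = Tt-def a b φ s · »-vanish (Cover? a b s) h

 Tt-no : ∀ a b φ s -> ¬ Cover a b s -> Tt a b φ s == + 0
 Tt-no a b φ s h = Tt-vanish a b φ s (exfalso ∘ h)

 Tt-cong : ∀ a b φ ψ s -> (Cover a b s -> φ (sw a b s) == ψ (sw a b s)) -> Tt a b φ s == Tt a b ψ s
 Tt-cong a b φ ψ s h = Tt-def a b φ s · »-val (Cover? a b s) h · sym (Tt-def a b ψ s)

 Ξ : ℤ -> Fun -> Fun
 Ξ b φ s = Ʃ k (\ d -> Tt (b - + suc d) b φ s)

 u-cong : ∀ i φ ψ s -> (Asc i s -> φ (sw i (i +1) s) == ψ (sw i (i +1) s)) -> u i φ s == u i ψ s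
 u-cong i φ ψ s h = »-val (asc? i s) h

 u-vanish : ∀ i φ s -> (Asc i s -> φ (sw i (i +1) s) == + 0) -> u i φ s == + 0
 u-vanish i φ s h = »-vanish (asc? i s) h

 u-Ʃ : ∀ i m (φ : ℕ -> Fun) s -> u i (\ s -> Ʃ m (\ d -> φ d s)) s == Ʃ m (\ d -> u i (φ d) s)
 u-Ʃ i m φ s = »-Ʃ (asc? i s) m _

 u-+ : ∀ i φ ψ s -> u i (\ s -> φ s + ψ s) s == u i φ s + u i ψ s
 u-+ i φ ψ s = »-+ (asc? i s) _ _

 module _ (i : ℤ) (s : State) where
  private s' = sw i (i +1) s

  swap-i : hv s' i == hv s (i +1)
  swap-i = hv-sw-a (¬~-suc i) s

  swap-i+1 : hv s' (i +1) == hv s i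
  swap-i+1 = hv-sw-b (¬~-suc i) s

  swap-o : ∀ {j} -> ¬ i ~ j -> ¬ i +1 ~ j -> hv s' j == hv s j
  swap-o = hv-sw-o (¬~-suc i) s

  swap-invol : sw i (i +1) s' == s
  swap-invol = sw-invol (¬~-suc i) s

  swap-far : ∀ {j} -> i +1 < j -> j < i + N -> hv s' j == hv s j
  swap-far {j} p q = swap-o (¬~-lt (lin (i & j & []) (x0 :+ 1' :< x1 & []) (x0 :< x1) p) q)
   (¬~-lt p (lin (i & j & N & []) (x1 :< x0 :+ x2 & []) (x1 :< x0 :+ 1' :+ x2) q))

  swap-near : ∀ {j} -> j < i -> i +1 < j + N -> hv s' j == hv s j
  swap-near {j} p q = swap-o (¬~-gt p (lin (i & j & N & []) (x0 :+ 1' :< x1 :+ x2 & []) (x0 :< x1 :+ x2) q))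
   (¬~-gt (lin (i & j & []) (x1 :< x0 & []) (x1 :< x0 :+ 1') p) q)

  asc-swap : Asc i s -> hv s' (i +1) < hv s' i
  asc-swap = subst2 _<_ (sym swap-i+1) (sym swap-i)

 u-period : ∀ i m φ s -> u (i + m * N) φ s == u i φ s
 u-period i m φ s = »-cong (asc? (i + m * N) s) (asc? i s)
  (\ p -> lin (hv s i & hv s (i +1) & m & []) (x0 :+ x2 :< x1 :+ x2 & []) (x0 :< x1) (subst2 _<_ (hv-shift s i m) e p))
  (\ p -> subst2 _<_ (sym (hv-shift s i m)) (sym e) (Z.+-monoˡ-< m p))
  (\ _ _ -> cong φ (cong (\ z -> sw (i + m * N) z s) (eq i (m * N)) · sw-period (¬~-suc i) m s))
  where
  eq : ∀ i m -> i + m + + 1 == i + + 1 + m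
  eq = solve
  e : hv s (i + m * N +1) == hv s (i +1) + m
  e = cong (hv s) (eq i (m * N)) · hv-shift s (i +1) m

 Ʃ-swap-adj : ∀ m d {f g : ℕ -> ℤ} -> suc d N.< m -> f d == g (suc d) -> f (suc d) == g d ->
  (∀ j -> j N.< m -> ¬ j == d -> ¬ j == suc d -> f j == g j) -> Ʃ m f == Ʃ m g
 Ʃ-swap-adj (suc (suc m)) zero {f} {g} _ p q h = p ⊹ (q ⊹ Ʃ-cong m (\ j l -> h (suc (suc j)) (s≤s (s≤s l)) (\ ()) (\ ()))) · eq (g 1) (g 0) _
  where
  eq : ∀ a b c -> a + (b + c) == b + (a + c)
  eq = solve
 Ʃ-swap-adj (suc m) (suc d) (s≤s l) p q h = h 0 z<s (\ ()) (\ ()) ⊹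
  Ʃ-swap-adj m d l p q (\ j j<m a b -> h (suc j) (s≤s j<m) (\ e -> a (N.suc-injective e)) (\ e -> b (N.suc-injective e)))

 module _ (i b : ℤ) (lo : i +1 < b) (hi : b < i + N) (φ : Fun) (s : State) where
  private
   s' = sw i (i +1) s
   i<b : i < b
   i<b = lin (i & b & []) (x0 :+ 1' :< x1 & []) (x0 :< x1) lo
   n1 : ¬ i ~ b
   n1 = ¬~-lt i<b hi
   n2 : ¬ i +1 ~ b
   n2 = ¬~-lt lo (lin (i & b & N & []) (x1 :< x0 :+ x2 & []) (x1 :< x0 :+ 1' :+ x2) hi)
   fixb : tr k i (i +1) b == b
   fixb = tr-o i (i +1) n1 n2
   s'b : hv s' b == hv s b
   s'b = swap-far i s lo hi

  -- The weak step exchanges the positions i and i + 1 and therefore the covers starting there.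
  -- Since i + 1 lies strictly between i and b, `btw` applies to it: one alternative contradicts the
  -- ascent after the cover, the other is the ascent before it.
  Tt-u-low : Tt i b (u i φ) s == u i (Tt (i +1) b φ) s
  Tt-u-low = Tt-def i b (u i φ) s · »»-cong (Cover? i b s) (asc? i (sw i b s)) (asc? i s) (Cover? (i +1) b s') f g st ·
    »-val (asc? i s) (\ _ -> sym (Tt-def (i +1) b φ s'))
   where
   e1 : hv (sw i b s) i == hv s b
   e1 = hv-sw-a n1 s
   e2 : hv (sw i b s) (i +1) == hv s (i +1)
   e2 = hv-sw-o n1 s (¬~-suc i) (n2 ∘ ~-sym)
   f : Cover i b s -> Asc i (sw i b s) -> Asc i s × Cover (i +1) b s'
   f (cover p q r) a with r (i +1) (lin (i & []) [] (x0 :< x0 :+ 1')) lo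
   ... | inl x = exfalso (Z.<-asym x (subst2 _<_ e1 e2 a))
   ... | inr y = y , cover (subst (+ 0 ≤_) (sym (swap-i+1 i s)) p) (subst (_< + 0) (sym s'b) q)
    (\ j l m -> subst₃ (\ x y z -> x < y ⊎ z < x) (sym (swap-far i s l (Z.<-trans m hi))) (sym s'b) (sym (swap-i+1 i s))
      (r j (lin (i & j & []) (x0 :+ 1' :< x1 & []) (x0 :< x1) l) m))
    where
    subst₃ : ∀ {A B C : Set} (P : A -> B -> C -> Set) {a a' b b' c c'} -> a == a' -> b == b' -> c == c' -> P a b c -> P a' b' c'
    subst₃ P refl refl refl x = x
   g : Asc i s -> Cover (i +1) b s' -> Cover i b s × Asc i (sw i b s)
   g a (cover p q r) = cover p' q' r' , subst2 _<_ (sym e1) (sym e2) (lin (hv s b & hv s i & hv s (i +1) & []) (x0 :< 0' & 0' =< x1 & x1 :< x2 & []) (x0 :< x2) q' p' a)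
    where
    p' = subst (+ 0 ≤_) (swap-i+1 i s) p
    q' = subst (_< + 0) s'b q
    r' : ∀ j -> i < j -> j < b -> hv s j < hv s b ⊎ hv s i < hv s j
    r' j l m with i +1 Z.<? j
    ... | yes l' = Data.Sum.map (subst2 _<_ (swap-far i s l' (Z.<-trans m hi)) s'b) (subst2 _<_ (swap-i+1 i s) (swap-far i s l' (Z.<-trans m hi))) (r j l' m)
    ... | no ¬l rewrite lin (i & j & []) (x0 :< x1 & x1 =< x0 :+ 1' & []) (x1 := x0 :+ 1') l (Z.≮⇒≥ ¬l) = inr a
   st : Cover i b s -> Asc i (sw i b s) -> φ (sw i (i +1) (sw i b s)) == φ (sw (i +1) b s')
   st _ _ = cong φ (sym (sw-conj n2 (¬~-suc i) s · cong2 (\ x y -> sw i (i +1) (sw x y s)) (tr-b0 i (i +1) (¬~-suc i)) fixb))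

  Tt-u-high : Tt (i +1) b (u i φ) s == u i (Tt i b φ) s
  Tt-u-high = Tt-def (i +1) b (u i φ) s · »»-cong (Cover? (i +1) b s) (asc? i (sw (i +1) b s)) (asc? i s) (Cover? i b s') f g st ·
    »-val (asc? i s) (\ _ -> sym (Tt-def i b φ s'))
   where
   e1 : hv (sw (i +1) b s) (i +1) == hv s b
   e1 = hv-sw-a n2 s
   e2 : hv (sw (i +1) b s) i == hv s i
   e2 = hv-sw-o n2 s (¬~-suc i ∘ ~-sym) (n1 ∘ ~-sym)
   f : Cover (i +1) b s -> Asc i (sw (i +1) b s) -> Asc i s × Cover i b s'
   f (cover p q r) a = lin (hv s b & hv s i & hv s (i +1) & []) (x0 :< 0' & 0' =< x2 & x1 :< x0 & []) (x1 :< x2) q p a' ,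
    cover (subst (+ 0 ≤_) (sym (swap-i i s)) p) (subst (_< + 0) (sym s'b) q) r'
    where
    a' = subst2 _<_ e2 e1 a
    r' : ∀ j -> i < j -> j < b -> hv s' j < hv s' b ⊎ hv s' i < hv s' j
    r' j l m with i +1 Z.<? j
    ... | yes l' = Data.Sum.map (subst2 _<_ (sym (swap-far i s l' (Z.<-trans m hi))) (sym s'b)) (subst2 _<_ (sym (swap-i i s)) (sym (swap-far i s l' (Z.<-trans m hi)))) (r j l' m)
    ... | no ¬l rewrite lin (i & j & []) (x0 :< x1 & x1 =< x0 :+ 1' & []) (x1 := x0 :+ 1') l (Z.≮⇒≥ ¬l) = inl (subst2 _<_ (sym (swap-i+1 i s)) (sym s'b) a')
   g : Asc i s -> Cover i b s' -> Cover (i +1) b s × Asc i (sw (i +1) b s)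
   g a (cover p q r) = cover (subst (+ 0 ≤_) (swap-i i s) p) (subst (_< + 0) s'b q)
    (\ j l m -> Data.Sum.map (subst2 _<_ (swap-far i s l (Z.<-trans m hi)) s'b) (subst2 _<_ (swap-i i s) (swap-far i s l (Z.<-trans m hi))) (r j (lin (i & j & []) (x0 :+ 1' :< x1 & []) (x0 :< x1) l) m)) ,
    h (r (i +1) (lin (i & []) [] (x0 :< x0 :+ 1')) lo)
    where
    h : hv s' (i +1) < hv s' b ⊎ hv s' i < hv s' (i +1) -> Asc i (sw (i +1) b s)
    h (inl x) = subst2 _<_ (swap-i+1 i s · sym e2) (s'b · sym e1) x
    h (inr y) = exfalso (Z.<-asym y (asc-swap i s a))
   st : Cover (i +1) b s -> Asc i (sw (i +1) b s) -> φ (sw i (i +1) (sw (i +1) b s)) == φ (sw i b s')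
   st _ _ = cong φ (sym (sw-conj n1 (¬~-suc i) s · cong2 (\ x y -> sw i (i +1) (sw x y s)) (tr-a0 i (i +1)) fixb))

  module _ (a : ℤ) (a<b : a < b) (b<a : b < a + N) (a≠i : ¬ a == i) (a≠i+1 : ¬ a == i +1) where
   private
    nab : ¬ a ~ b
    nab = ¬~-lt a<b b<a
    ni : ∀ {j} -> b - N < j -> j < b -> ¬ j == i -> ¬ i ~ j
    ni {j} l m ne e = ne (sym (~-near e (lin (i & b & j & N & []) (x0 :< x1 & x1 :- x3 :< x2 & []) (x0 :- x3 :< x2) i<b l) (Z.<-trans m hi)))
    ni+1 : ∀ {j} -> b - N < j -> j < b -> ¬ j == i +1 -> ¬ i +1 ~ j
    ni+1 {j} l m ne e = ne (sym (~-near e (lin (i & b & j & N & []) (x0 :+ 1' :< x1 & x1 :- x3 :< x2 & []) (x0 :+ 1' :- x3 :< x2) lo l) (lin (i & b & j & N & []) (x1 :< x0 :+ x3 & x2 :< x1 & []) (x2 :< x0 :+ 1' :+ x3) hi m)))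
    b-N<a : b - N < a
    b-N<a = lin (a & b & N & []) (x1 :< x0 :+ x2 & []) (x1 :- x2 :< x0) b<a
    nia = ni b-N<a a<b a≠i
    nia+1 = ni+1 b-N<a a<b a≠i+1
    e1 : hv (sw a b s) i == hv s i
    e1 = hv-sw-o nab s (nia ∘ ~-sym) (n1 ∘ ~-sym)
    e2 : hv (sw a b s) (i +1) == hv s (i +1)
    e2 = hv-sw-o nab s (nia+1 ∘ ~-sym) (n2 ∘ ~-sym)
    toC : ∀ s -> Cover a b s -> Cover a b (sw i (i +1) s)
    toC s (cover p q r) = cover (subst (+ 0 ≤_) (sym ea) p) (subst (_< + 0) (sym eb) q) r'
     where
     ea : hv (sw i (i +1) s) a == hv s a
     ea = swap-o i s nia nia+1
     eb : hv (sw i (i +1) s) b == hv s b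
     eb = swap-o i s n1 n2
     r' : ∀ j -> a < j -> j < b -> hv (sw i (i +1) s) j < hv (sw i (i +1) s) b ⊎ hv (sw i (i +1) s) a < hv (sw i (i +1) s) j
     r' j l m with j Z.≟ i | j Z.≟ i +1
     ... | yes refl | _ = Data.Sum.map (subst2 _<_ (sym (swap-i i s)) (sym eb)) (subst2 _<_ (sym ea) (sym (swap-i i s))) (r (i +1) (lin (a & i & []) (x0 :< x1 & []) (x0 :< x1 :+ 1') l) lo)
     ... | no _ | yes refl = Data.Sum.map (subst2 _<_ (sym (swap-i+1 i s)) (sym eb)) (subst2 _<_ (sym ea) (sym (swap-i+1 i s))) (r i (Z.≤∧≢⇒< (lin (a & i & []) (x0 :< x1 :+ 1' & []) (x0 =< x1) l) a≠i) i<b)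
     ... | no ne | no ne' = Data.Sum.map (subst2 _<_ (sym ej) (sym eb)) (subst2 _<_ (sym ea) (sym ej)) (r j l m)
      where
      ej : hv (sw i (i +1) s) j == hv s j
      ej = swap-o i s (ni (Z.<-trans b-N<a l) m ne) (ni+1 (Z.<-trans b-N<a l) m ne')

   Tt-u-other : Tt a b (u i φ) s == u i (Tt a b φ) s
   Tt-u-other = Tt-def a b (u i φ) s · »»-cong (Cover? a b s) (asc? i (sw a b s)) (asc? i s) (Cover? a b s')
     (\ c x -> subst2 _<_ e1 e2 x , toC s c)
     (\ x c -> subst (Cover a b) (swap-invol i s) (toC s' c) , subst2 _<_ (sym e1) (sym e2) x) st ·
    »-val (asc? i s) (\ _ -> sym (Tt-def a b φ s'))
    where
    st : Cover a b s -> Asc i (sw a b s) -> φ (sw i (i +1) (sw a b s)) == φ (sw a b s')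
    st _ _ = cong φ (sym (sw-conj nab (¬~-suc i) s · cong2 (\ x y -> sw i (i +1) (sw x y s)) (tr-o i (i +1) nia nia+1) fixb))

 representative : ∀ i b -> Σ ℕ \ d -> Σ ℤ \ m -> d N.< n × i + m * N == b - + suc d
 representative i b with pos-decomp (b - i)
 ... | r , q , r<n , e = r , q , r<n , lin (i & b & + suc r & q * N & []) (x1 :- x0 := x2 :+ x3 & []) (x0 :+ x3 := x1 :- x2) e

 b-k~ : ∀ b -> b - + suc k ~ b
 b-k~ b = + 1 , eq b N
  where
  eq : ∀ b N -> b == b - N + + 1 * N
  eq = solve

 -- Translate i by a multiple of n to the position just below b. Of the k covers with label b, the
 -- step at i exchanges the two that start at i and i + 1 and commutes with each of the others.
 T-u-comm : ∀ i b -> ¬ i ~ b -> ¬ i +1 ~ b -> ∀ φ s -> Ξ b (u i φ) s == u i (Ξ b φ) s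
 T-u-comm i b n1 n2 φ s with representative i b
 ... | zero , m , _ , e = exfalso (n2 (m , lin (i & b & m * N & []) (x0 :+ x2 := x1 :- 1' & []) (x1 := x0 :+ 1' :+ x2) e))
 ... | suc d , m , d<n , e with suc d N.≟ k
 ...   | yes refl = exfalso (n1 (~-trans (m , sym e) (b-k~ b)))
 ...   | no ne = Ʃ-ext k (\ d -> Tt-def _ b (u i φ) s · »-val (Cover? _ b s) (\ _ -> sym (u-period i m φ (sw (b - + suc d) b s))) · sym (Tt-def _ b (u (i + m * N) φ) s)) ·
    subst (\ i -> Ξ b (u i φ) s == u i (Ξ b φ) s) (sym e) main · u-period i m (Ξ b φ) s
  where
  i' = b - + suc (suc d)
  d<k : suc d N.< k
  d<k = N.≤∧≢⇒< (s≤s⁻¹ d<n) ne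
  lo : i' +1 < b
  lo = lin (b & + d & []) (0' =< x1 & []) (x0 :- (2' :+ x1) :+ 1' :< x0) 0≤+
  hi : b < i' + N
  hi = lin (b & + d & N & []) (2' :+ x1 :< x2 & []) (x0 :< x0 :- (2' :+ x1) :+ x2) (Z.+<+ (s≤s d<k))
  i'+1 : b - + suc d == i' +1
  i'+1 = lin (b & + d & []) [] (x0 :- (1' :+ x1) := x0 :- (2' :+ x1) :+ 1')
  main : Ξ b (u i' φ) s == u i' (Ξ b φ) s
  main = Ʃ-swap-adj k d d<k
   (cong (\ z -> Tt z b (u i' φ) s) i'+1 · Tt-u-high i' b lo hi φ s)
   (Tt-u-low i' b lo hi φ s · cong (\ z -> u i' (Tt z b φ) s) (sym i'+1))
   (\ j j<k a c -> Tt-u-other i' b lo hi φ s (b - + suc j)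
     (lin (b & + j & []) (0' =< x1 & []) (x0 :- (1' :+ x1) :< x0) 0≤+)
     (lin (b & + j & N & []) (1' :+ x1 :< x2 & []) (x0 :< x0 :- (1' :+ x1) :+ x2) (Z.+<+ (s≤s j<k)))
     (\ e -> c (Z.+-injective (lin (b & + j & + d & []) (x0 :- (1' :+ x1) := x0 :- (2' :+ x2) & []) (x1 := 1' :+ x2) e)))
     (\ e -> a (Z.+-injective (lin (b & + j & + d & []) (x0 :- (1' :+ x1) := x0 :- (2' :+ x2) :+ 1' & []) (x1 := x2) e)))) ·
   sym (u-Ʃ i' k (\ d -> Tt (b - + suc d) b φ) s)

 Ng-u-comm : ∀ i b -> ¬ i ~ b -> ¬ i +1 ~ b -> ∀ φ s -> Ng b (u i φ) s == u i (Ng b φ) s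
 Ng-u-comm i b n1 n2 φ s = »»-cong (neg? b s) (asc? i s) (asc? i s) (neg? b _)
  (\ p q -> q , subst (_< + 0) (sym e) p) (\ q p -> subst (_< + 0) e p , q) (\ _ _ -> refl)
  where
  e = swap-o i s n1 n2

 Ng-u-low : ∀ i φ s -> Ng i (u i φ) s == u i (Ng (i +1) φ) s
 Ng-u-low i φ s = »»-cong (neg? i s) (asc? i s) (asc? i s) (neg? (i +1) _)
  (\ p q -> q , subst (_< + 0) (sym (swap-i+1 i s)) p) (\ q p -> subst (_< + 0) (swap-i+1 i s) p , q) (\ _ _ -> refl)

 Ng-u-high : ∀ i φ s -> Ng (i +1) (u i φ) s == u i (Ng i φ) s
 Ng-u-high i φ s = »»-cong (neg? (i +1) s) (asc? i s) (asc? i s) (neg? i _)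
  (\ p q -> q , subst (_< + 0) (sym (swap-i i s)) p) (\ q p -> subst (_< + 0) (swap-i i s) p , q) (\ _ _ -> refl)

-- Strong covers with the labels i and i + 1 against the weak step at i.

module Pair (k' : ℕ) where
 open Z using (_≤_)
 open import Defs using (tr)
 open Base k'
 open Strong k'

 split-≤ : ∀ j i -> j < i +1 -> j < i ⊎ j == i
 split-≤ j i p with j Z.<? i
 ... | yes q = inl q
 ... | no ¬q = inr (lin (j & i & []) (x0 :< x1 :+ 1' & x1 =< x0 & []) (x0 := x1) p (Z.≮⇒≥ ¬q))

 -- The identities that make F i ∘ F (i + 1) compatible with u i.

 module _ (i : ℤ) (s : State) where
  private
   s' = sw i (i +1) s
   i<i+1 : i < i +1
   i<i+1 = lin (i & []) [] (x0 :< x0 :+ 1')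

  module _ (a : ℤ) (a<i : a < i) (hi : i +1 < a + N) where
   private
    na : ¬ a ~ i
    na = ¬~-lt a<i (Z.<-trans i<i+1 hi)
    na+1 : ¬ a ~ i +1
    na+1 = ¬~-lt (Z.<-trans a<i i<i+1) hi
    s'a : hv s' a == hv s a
    s'a = swap-near i s a<i hi
    s'j : ∀ {j} -> a < j -> j < i -> hv s' j == hv s j
    s'j {j} l m = swap-near i s m (lin (a & i & j & N & []) (x0 :< x2 & x1 :+ 1' :< x0 :+ x3 & []) (x1 :+ 1' :< x2 :+ x3) l hi)
    fixa : tr k i (i +1) a == a
    fixa = tr-o i (i +1) (na ∘ ~-sym) (na+1 ∘ ~-sym)

   swap-low : sw i (i +1) (sw a i s) == sw a (i +1) s'
   swap-low = sym (sw-conj na+1 (¬~-suc i) s · cong2 (\ x y -> sw i (i +1) (sw x y s)) fixa (tr-b0 i (i +1) (¬~-suc i)))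

   swap-high : sw i (i +1) (sw a (i +1) s) == sw a i s'
   swap-high = sym (sw-conj na (¬~-suc i) s · cong2 (\ x y -> sw i (i +1) (sw x y s)) fixa (tr-a0 i (i +1)))

   cover-low : Asc i s -> Cover a (i +1) s' -> Cover a i s × Asc i (sw a i s)
   cover-low A (cover p q r) = cover (subst (+ 0 ≤_) s'a p) (subst (_< + 0) (swap-i+1 i s) q)
    (\ j l m -> Data.Sum.map (subst2 _<_ (s'j l m) (swap-i+1 i s)) (subst2 _<_ s'a (s'j l m)) (r j l (Z.<-trans m i<i+1))) ,
    h (r i a<i i<i+1)
    where
    h : hv s' i < hv s' (i +1) ⊎ hv s' a < hv s' i -> Asc i (sw a i s)
    h (inl x) = exfalso (Z.<-asym x (asc-swap i s A))
    h (inr y) = subst2 _<_ (s'a · sym (hv-sw-b na s)) (swap-i i s · sym (hv-sw-o na s na+1 (¬~-suc i))) y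

   Tt-low : ∀ φ -> Tt a i (u i φ) s == u i (Tt a (i +1) φ) s
   Tt-low φ = Tt-def a i (u i φ) s · »»-cong (Cover? a i s) (asc? i (sw a i s)) (asc? i s) (Cover? a (i +1) s') f cover-low (\ _ _ -> cong φ swap-low) ·
    »-val (asc? i s) (\ _ -> sym (Tt-def a (i +1) φ s'))
    where
    f : Cover a i s -> Asc i (sw a i s) -> Asc i s × Cover a (i +1) s'
    f (cover p q r) x = lin (hv s i & hv s a & hv s (i +1) & []) (x0 :< 0' & 0' =< x1 & x1 :< x2 & []) (x0 :< x2) q p x' ,
     cover (subst (+ 0 ≤_) (sym s'a) p) (subst (_< + 0) (sym (swap-i+1 i s)) q) r'
     where
     x' : hv s a < hv s (i +1)
     x' = subst2 _<_ (hv-sw-b na s) (hv-sw-o na s na+1 (¬~-suc i)) x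
     r' : ∀ j -> a < j -> j < i +1 -> hv s' j < hv s' (i +1) ⊎ hv s' a < hv s' j
     r' j l m with split-≤ j i m
     ... | inr refl = inr (subst2 _<_ (sym s'a) (sym (swap-i i s)) x')
     ... | inl m' = Data.Sum.map (subst2 _<_ (sym (s'j l m')) (sym (swap-i+1 i s))) (subst2 _<_ (sym s'a) (sym (s'j l m'))) (r j l m')

   cover-high : Asc i s -> Cover a i s' -> Cover a (i +1) s × Asc i (sw a (i +1) s)
   cover-high A (cover p q r) = cover p' q' r' ,
    subst2 _<_ (sym (hv-sw-o na+1 s na (¬~-suc i ∘ ~-sym))) (sym (hv-sw-b na+1 s)) (lin (hv s i & hv s (i +1) & hv s a & []) (x0 :< x1 & x1 :< 0' & 0' =< x2 & []) (x0 :< x2) A q' p')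
    where
    p' = subst (+ 0 ≤_) s'a p
    q' = subst (_< + 0) (swap-i i s) q
    r' : ∀ j -> a < j -> j < i +1 -> hv s j < hv s (i +1) ⊎ hv s a < hv s j
    r' j l m with split-≤ j i m
    ... | inr refl = inl A
    ... | inl m' = Data.Sum.map (subst2 _<_ (s'j l m') (swap-i i s)) (subst2 _<_ s'a (s'j l m')) (r j l m')

   cover-high⁻ : Cover a (i +1) s -> hv s i < hv s a -> Asc i s × Cover a i s'
   cover-high⁻ (cover p q r) x with r i a<i i<i+1
   ... | inr y = exfalso (Z.<-asym x y)
   ... | inl y = y , cover (subst (+ 0 ≤_) (sym s'a) p) (subst (_< + 0) (sym (swap-i i s)) q)
    (\ j l m -> Data.Sum.map (subst2 _<_ (sym (s'j l m)) (sym (swap-i i s))) (subst2 _<_ (sym s'a) (sym (s'j l m))) (r j l (Z.<-trans m i<i+1)))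

   asc-high : Asc i (sw a (i +1) s) -> hv s i < hv s a
   asc-high = subst2 _<_ (hv-sw-o na+1 s na (¬~-suc i ∘ ~-sym)) (hv-sw-b na+1 s)

   Tt-high : ∀ φ -> Tt a (i +1) (u i φ) s == u i (Tt a i φ) s
   Tt-high φ = Tt-def a (i +1) (u i φ) s · »»-cong (Cover? a (i +1) s) (asc? i (sw a (i +1) s)) (asc? i s) (Cover? a i s')
     (\ c x -> cover-high⁻ c (asc-high x)) cover-high (\ _ _ -> cong φ swap-high) ·
    »-val (asc? i s) (\ _ -> sym (Tt-def a i φ s'))

   Tt-high-pos : + 0 ≤ hv s i -> ∀ φ -> Tt a (i +1) (u i φ) s == + 0
   Tt-high-pos p φ = Tt-vanish a (i +1) (u i φ) s (\ c -> u-vanish i φ (sw a (i +1) s) (\ x -> exfalso (h c (fst (cover-high⁻ c (asc-high x))))))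
    where
    h : Cover a (i +1) s -> ¬ Asc i s
    h c x = lin⊥ (hv s i & hv s (i +1) & []) (0' =< x0 & x0 :< x1 & x1 :< 0' & []) p x (neg c)

   Ng-Tt-high : ∀ φ -> Ng i (Tt a (i +1) (u i φ)) s == u i (Tt a i (Ng (i +1) φ)) s
   Ng-Tt-high φ = cong (\ z -> neg? i s » z) (Tt-high φ) · drop (neg? i s) (asc? i s) ·
    u-cong i (Tt a i φ) (Tt a i (Ng (i +1) φ)) s (\ A -> Tt-cong a i φ (Ng (i +1) φ) s' (\ c -> sym (»-yes (neg? (i +1) (sw a i s')) (subst (_< + 0) (sym (hv-sw-o na s' na+1 (¬~-suc i) · swap-i+1 i s)) (lt A c)))))
    where
    lt : Asc i s -> Cover a i s' -> hv s i < + 0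
    lt A c = Z.<-trans A (subst (_< + 0) (swap-i i s) (neg c))
    drop : ∀ (d : Dec (hv s i < + 0)) (e : Dec (Asc i s)) -> (d » e » Tt a i φ s') == (e » Tt a i φ s')
    drop (yes _) e = refl
    drop (no _) (no _) = refl
    drop (no ¬p) (yes A) = sym (Tt-no a i φ s' (\ c -> ¬p (lt A c)))

   -- The reflection identity t_{a,i+1} = s_i t_{a,i} s_i. When h i is negative, the last factor s_i
   -- is itself a cover from i to i + 1, because the cover from a to i has just put the nonnegative
   -- value h a at position i.
   Ng-T-T : ∀ φ -> Ng i (Tt a (i +1) φ) s == u i (Tt a i (Tt i (i +1) φ)) s
   Ng-T-T φ = »-val (neg? i s) (\ _ -> Tt-def a (i +1) φ s) · »»-cong (neg? i s) (Cover? a (i +1) s) (asc? i s) (Cover? a i s')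
     (\ p c -> cover-high⁻ c (lin (hv s i & hv s a & []) (x0 :< 0' & 0' =< x1 & []) (x0 :< x1) p (pos c)))
     (\ A c -> Z.<-trans A (subst (_< + 0) (swap-i i s) (neg c)) , fst (cover-high A c)) eq ·
    »-val (asc? i s) (\ _ -> sym (Tt-def a i (Tt i (i +1) φ) s'))
    where
    s'' = sw a i s'
    eq : hv s i < + 0 -> Cover a (i +1) s -> φ (sw a (i +1) s) == Tt i (i +1) φ s''
    eq p c = sym (Tt-def i (i +1) φ s'' · »-yes (Cover? i (i +1) s'') cv · cong φ st)
     where
     cv : Cover i (i +1) s''
     cv = cover (subst (+ 0 ≤_) (sym (hv-sw-b na s' · s'a)) (pos c))
      (subst (_< + 0) (sym (hv-sw-o na s' na+1 (¬~-suc i) · swap-i+1 i s)) p)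
      (\ j l m -> lin⊥ (i & j & []) (x0 :< x1 & x1 :< x0 :+ 1' & []) l m)
     st : sw i (i +1) s'' == sw a (i +1) s
     st = cong (sw i (i +1)) (sym swap-high) · sw-invol (¬~-suc i) (sw a (i +1) s)

   -- Position i now holds the nonnegative value from a, and a holds a negative one. By `btw` at i,
   -- the value at c would have to be below that at i; then position a refutes c ≤ a, and `btw` of
   -- the first cover at c refutes c > a. Hence of `Ξ (i + 1)` only the term of `Ng-T-T` survives.
   Tt-after-high : ∀ c -> c < i -> i +1 < c + N -> ∀ φ -> Cover a i s' -> Asc i s -> Tt c (i +1) φ (sw a i s') == + 0
   Tt-after-high c c<i hc φ cv A = Tt-no c (i +1) φ s'' h
    where
    s'' = sw a i s'
    vi : hv s'' i == hv s a
    vi = hv-sw-b na s' · s'a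
    vi+1 : hv s'' (i +1) == hv s i
    vi+1 = hv-sw-o na s' na+1 (¬~-suc i) · swap-i+1 i s
    va : hv s'' a == hv s (i +1)
    va = hv-sw-a na s' · swap-i i s
    q<0 : hv s (i +1) < + 0
    q<0 = subst (_< + 0) (swap-i i s) (neg cv)
    0≤z : + 0 ≤ hv s a
    0≤z = subst (+ 0 ≤_) s'a (pos cv)
    h : ¬ Cover c (i +1) s''
    h (cover p q r) with r i c<i i<i+1
    ... | inl x = lin⊥ (hv s'' i & hv s'' (i +1) & hv s a & []) (x0 :< x1 & x1 :< 0' & x0 := x2 & 0' =< x2 & []) x q vi 0≤z
    ... | inr y with Z.<-cmp c a
    ...   | tri≈ _ refl _ = lin⊥ (hv s'' c & hv s (i +1) & []) (0' =< x0 & x0 := x1 & x1 :< 0' & []) p va q<0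
    ...   | tri< l _ _ with r a l (Z.<-trans a<i i<i+1)
    ...     | inl x = Z.<-asym A (subst2 _<_ va vi+1 x)
    ...     | inr y' = lin⊥ (hv s'' c & hv s'' a & hv s (i +1) & []) (0' =< x0 & x0 :< x1 & x1 := x2 & x2 :< 0' & []) p y' va q<0
    h (cover p q r) | inr y | tri> _ _ l = g (btw cv c l c<i)
     where
     vc : hv s'' c == hv s' c
     vc = hv-sw-o na s' (¬~-lt l (lin (a & c & i & N & []) (x1 :< x2 & x2 :+ 1' :< x0 :+ x3 & []) (x1 :< x0 :+ x3) c<i hi)) (¬~-gt c<i (Z.<-trans i<i+1 hc))
     g : hv s' c < hv s' i ⊎ hv s' a < hv s' c -> ⊥
     g (inl x) = lin⊥ (hv s'' c & hv s' c & hv s' i & []) (0' =< x0 & x0 := x1 & x1 :< x2 & x2 :< 0' & []) p vc x (neg cv)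
     g (inr x) = lin⊥ (hv s'' c & hv s' c & hv s' a & hv s'' i & hv s a & []) (x0 := x1 & x2 :< x1 & x0 :< x3 & x3 := x4 & x2 := x4 & []) vc x y vi s'a

  private
   e-k = i - + suc k'
   shiftval : ∀ s -> hv s (i +1) == hv s e-k +1
   shiftval s = cong (hv s) (eq i (+ suc k')) · hv-shift s e-k (+ 1)
    where
    eq : ∀ i m -> i + + 1 == i - m + + 1 * (+ 1 + m)
    eq = solve
   nek : ¬ e-k ~ i
   nek = ¬~-lt (lin (i & + k' & []) (0' =< x1 & []) (x0 :- (1' :+ x1) :< x0) 0≤+) (lin (i & + k' & []) [] (x0 :< x0 :- (1' :+ x1) :+ (2' :+ x1)))

  -- Here a = i - k is congruent to i + 1, so the value at i + 1 is that at a plus 1, and the signs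
  -- required by the cover contradict the ascent.
  Tt-wrap-u : ∀ φ -> Tt e-k i (u i φ) s == + 0
  Tt-wrap-u φ = Tt-vanish e-k i (u i φ) s (\ c -> u-vanish i φ (sw e-k i s) (\ A -> exfalso (h c A)))
   where
   h : Cover e-k i s -> ¬ Asc i (sw e-k i s)
   h (cover p q _) A = lin⊥ (hv s e-k & hv s i & hv (sw e-k i s) i & hv (sw e-k i s) (i +1) & hv (sw e-k i s) e-k & [])
    (0' =< x0 & x1 :< 0' & x2 := x0 & x3 := x4 :+ 1' & x4 := x1 & x2 :< x3 & []) p q (hv-sw-b nek s) (shiftval _) (hv-sw-a nek s) A

  u-Tt-wrap : ∀ φ -> u i (Tt e-k i φ) s == + 0
  u-Tt-wrap φ = u-vanish i (Tt e-k i φ) s (\ A -> Tt-no e-k i φ s' (\ c -> lin⊥ (hv s' e-k & hv s' i & hv s' (i +1) & [])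
   (0' =< x0 & x1 :< 0' & x2 := x0 :+ 1' & x2 :< x1 & []) (pos c) (neg c) (shiftval s') (asc-swap i s A)))

  private
   vac : ∀ {s : State} j -> i < j -> j < i +1 -> hv s j < hv s (i +1) ⊎ hv s i < hv s j
   vac j l m = lin⊥ (i & j & []) (x0 :< x1 & x1 :< x0 :+ 1' & []) l m

  Tt-top-u : ∀ φ -> Tt i (i +1) (u i φ) s == (neg? (i +1) s » ((+ 0 Z.≤? hv s i) » φ s))
  Tt-top-u φ = Tt-def i (i +1) (u i φ) s · »-val (Cover? i (i +1) s) (\ c -> »-yes (asc? i s') (subst2 _<_ (sym (swap-i i s)) (sym (swap-i+1 i s)) (lin (hv s i & hv s (i +1) & []) (0' =< x0 & x1 :< 0' & []) (x1 :< x0) (pos c) (neg c))) · cong φ (swap-invol i s)) ·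
   »-both (Cover? i (i +1) s) (neg? (i +1) s) (+ 0 Z.≤? hv s i) (\ c -> neg c , pos c) (\ q p -> cover p q vac)
   where
   »-both : ∀ {P Q R : Set} (p : Dec P) (q : Dec Q) (r : Dec R) {x} -> (P -> Q × R) -> (Q -> R -> P) -> (p » x) == (q » r » x)
   »-both (yes p) q r f g = sym (»-yes q (fst (f p)) · »-yes r (snd (f p)))
   »-both (no ¬p) q r f g = sym (»-vanish q (\ x -> »-no r (\ y -> ¬p (g x y))))

  u-Tt-top : ∀ φ -> u i (Tt i (i +1) φ) s == (neg? i s » ((+ 0 Z.≤? hv s (i +1)) » φ s))
  u-Tt-top φ = »-val (asc? i s) (\ _ -> Tt-def i (i +1) φ s') · »»-cong (asc? i s) (Cover? i (i +1) s') (neg? i s) (+ 0 Z.≤? hv s (i +1))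
   (\ _ c -> subst (_< + 0) (swap-i+1 i s) (neg c) , subst (+ 0 ≤_) (swap-i i s) (pos c))
   (\ p q -> lin (hv s i & hv s (i +1) & []) (x0 :< 0' & 0' =< x1 & []) (x0 :< x1) p q , cover (subst (+ 0 ≤_) (sym (swap-i i s)) q) (subst (_< + 0) (sym (swap-i+1 i s)) p) vac)
   (\ _ _ -> cong φ (swap-invol i s)) · refl

  -- The cover from i to i + 1 and the weak step undo each other and leave only sign conditions:
  -- both sides are φ s if h i or h (i + 1) is negative, and 0 otherwise. This is where the
  -- operators `Ng` originate.
  Tt-top-exchange : ∀ φ -> Tt i (i +1) (u i φ) s + Ng i φ s == u i (Tt i (i +1) φ) s + Ng (i +1) φ s
  Tt-top-exchange φ = cong (\ z -> z + Ng i φ s) (Tt-top-u φ) · go (neg? i s) (neg? (i +1) s) (+ 0 Z.≤? hv s i) (+ 0 Z.≤? hv s (i +1)) · cong (\ z -> z + Ng (i +1) φ s) (sym (u-Tt-top φ))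
   where
   go : (a : Dec (hv s i < + 0)) (b : Dec (hv s (i +1) < + 0)) (a' : Dec (+ 0 ≤ hv s i)) (b' : Dec (+ 0 ≤ hv s (i +1))) ->
    (b » a' » φ s) + (a » φ s) == (a » b' » φ s) + (b » φ s)
   go (yes p) _ (yes q) _ = exfalso (Z.≤⇒≯ q p)
   go _ (yes p) _ (yes q) = exfalso (Z.≤⇒≯ q p)
   go (no p) _ (no q) _ = exfalso (q (Z.≮⇒≥ p))
   go _ (no p) _ (no q) = exfalso (q (Z.≮⇒≥ p))
   go (yes _) (yes _) (no _) (no _) = refl
   go (yes _) (no _) (no _) (yes _) = Z.+-comm (+ 0) (φ s)
   go (no _) (yes _) (yes _) (no _) = Z.+-comm (φ s) (+ 0)
   go (no _) (no _) (yes _) (yes _) = refl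

  private
   at : ℕ -> ℤ
   at d = i - + suc d
   at< : ∀ d -> at d < i
   at< d = lin (i & + d & []) (0' =< x1 & []) (x0 :- (1' :+ x1) :< x0) 0≤+
   at-hi : ∀ {d} -> d N.< k' -> i +1 < at d + N
   at-hi {d} p = lin (i & + d & + k' & []) (x1 :< x2 & []) (x0 :+ 1' :< x0 :- (1' :+ x1) :+ (2' :+ x2)) (Z.+<+ p)

  T-high-split : ∀ φ s -> Ξ (i +1) φ s == Tt i (i +1) φ s + Ʃ k' (\ d -> Tt (at d) (i +1) φ s)
  T-high-split φ s = cong (\ z -> Tt z (i +1) φ s) (lin (i & []) [] (x0 :+ 1' :- 1' := x0)) ⊹
   Ʃ-ext k' (\ d -> cong (\ z -> Tt z (i +1) φ s) (lin (i & + d & []) [] (x0 :+ 1' :- (2' :+ x1) := x0 :- (1' :+ x1))))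

  -- For each start below i, `Tt-low` and `Tt-high` exchange the covers with labels i and i + 1. The
  -- wrapped covers vanish on both sides, and the cover from i to i + 1 contributes the two terms
  -- `Ng`.
  T-pair-u : ∀ φ -> Ξ i (u i φ) s + Ξ (i +1) (u i φ) s + Ng i φ s == u i (\ s -> Ξ i φ s + Ξ (i +1) φ s) s + Ng (i +1) φ s
  T-pair-u φ = cong2 (\ x y -> x + y + Ng i φ s) (Ʃ-last k' _) (T-high-split (u i φ) s) ·
   cong2 (\ x y -> x + Tt e-k i (u i φ) s + (Tt i (i +1) (u i φ) s + y) + Ng i φ s) (Ʃ-cong k' (\ d p -> Tt-low (at d) (at< d) (at-hi p) φ)) (Ʃ-cong k' (\ d p -> Tt-high (at d) (at< d) (at-hi p) φ)) ·
   eq A (Tt e-k i (u i φ) s) (Tt i (i +1) (u i φ) s) B (Ng i φ s) · cong2 (\ x y -> A + (x + (B + y))) (Tt-wrap-u φ · sym (u-Tt-wrap φ)) (Tt-top-exchange φ) · eq' A B (u i (Tt e-k i φ) s) (u i (Tt i (i +1) φ) s) (Ng (i +1) φ s) · cong (\ z -> z + Ng (i +1) φ s) (sym rhs)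
   where
   A = Ʃ k' (\ d -> u i (Tt (at d) (i +1) φ) s)
   B = Ʃ k' (\ d -> u i (Tt (at d) i φ) s)
   eq : ∀ a w t b g -> a + w + (t + b) + g == a + (w + (b + (t + g)))
   eq = solve
   eq' : ∀ a b w t g -> a + (w + (b + (t + g))) == b + w + (t + a) + g
   eq' = solve
   rhs : u i (\ s -> Ξ i φ s + Ξ (i +1) φ s) s == B + u i (Tt e-k i φ) s + (u i (Tt i (i +1) φ) s + A)
   rhs = u-+ i (Ξ i φ) (Ξ (i +1) φ) s · (u-Ʃ i k (\ d -> Tt (at d) i φ) s · Ʃ-last k' _) ⊹
    (u-cong i (Ξ (i +1) φ) (\ s -> Tt i (i +1) φ s + Ʃ k' (\ d -> Tt (at d) (i +1) φ s)) s (\ _ -> T-high-split φ s') · u-+ i (Tt i (i +1) φ) (\ s -> Ʃ k' (\ d -> Tt (at d) (i +1) φ s)) s · cong+ʳ (u i (Tt i (i +1) φ) s) (u-Ʃ i k' (\ d -> Tt (at d) (i +1) φ) s))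

  T-high-pos : + 0 ≤ hv s i -> ∀ φ -> Ξ (i +1) (u i φ) s == Ng (i +1) φ s
  T-high-pos p φ = T-high-split (u i φ) s · (Tt-top-u φ · cong (\ z -> neg? (i +1) s » z) (»-yes (+ 0 Z.≤? hv s i) p)) ⊹ Ʃ-zero k' (\ d l -> Tt-high-pos (at d) (at< d) (at-hi l) p φ) · +0 (Ng (i +1) φ s)

  u-Ng-T : ∀ φ -> u i (Ng i (Ξ (i +1) φ)) s == + 0
  u-Ng-T φ = u-vanish i (Ng i (Ξ (i +1) φ)) s (\ A -> »-vanish (neg? i s') (\ q -> T-high-split φ s' · Tt-no i (i +1) φ s' (\ c -> Z.≤⇒≯ (pos c) q) ⊹ Ʃ-zero k' (\ d l -> Tt-no (at d) (i +1) φ s' (h A q (at d) (at< d)))))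
   where
   h : Asc i s -> hv s' i < + 0 -> ∀ a -> a < i -> ¬ Cover a (i +1) s'
   h A q a l (cover p _ r) with r i l i<i+1
   ... | inl x = Z.<-asym x (asc-swap i s A)
   ... | inr y = lin⊥ (hv s' a & hv s' i & []) (0' =< x0 & x0 :< x1 & x1 :< 0' & []) p y q

  private
   top-0 : ∀ φ -> hv s i < + 0 -> Tt i (i +1) φ s == + 0
   top-0 φ p = Tt-no i (i +1) φ s (\ c -> Z.≤⇒≯ (pos c) p)
   low-part : ∀ φ -> Ng i (Ξ (i +1) φ) s == Ʃ k' (\ d -> Ng i (Tt (at d) (i +1) φ) s)
   low-part φ = »-val (neg? i s) (\ p -> T-high-split φ s · cong (\ z -> z + Ʃ k' (\ d -> Tt (at d) (i +1) φ s)) (top-0 φ p) · +0ˡ (Ʃ k' (\ d -> Tt (at d) (i +1) φ s))) · »-Ʃ (neg? i s) k' _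
   u-T-low : ∀ φ -> u i (Ξ i φ) s == Ʃ k' (\ d -> u i (Tt (at d) i φ) s)
   u-T-low φ = u-Ʃ i k (\ d -> Tt (at d) i φ) s · Ʃ-last k' _ · cong+ʳ (Ʃ k' (\ d -> u i (Tt (at d) i φ) s)) (u-Tt-wrap φ) · +0 (Ʃ k' (\ d -> u i (Tt (at d) i φ) s))

  Ng-T-u : ∀ φ -> Ng i (Ξ (i +1) (u i φ)) s == u i (Ξ i (Ng (i +1) φ)) s
  Ng-T-u φ = low-part (u i φ) · Ʃ-cong k' (\ d l -> Ng-Tt-high (at d) (at< d) (at-hi l) φ) · sym (u-T-low (Ng (i +1) φ))

  Ng-T : ∀ φ -> Ng i (Ξ (i +1) φ) s == u i (Ξ i (Ξ (i +1) φ)) s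
  Ng-T φ = low-part φ · Ʃ-cong k' (\ d l -> Ng-T-T (at d) (at< d) (at-hi l) φ · u-cong i (Tt (at d) i (Tt i (i +1) φ)) (Tt (at d) i (Ξ (i +1) φ)) s (\ A -> Tt-cong (at d) i (Tt i (i +1) φ) (Ξ (i +1) φ) s' (\ c ->
    sym (T-high-split φ (sw (at d) i s') · cong+ʳ (Tt i (i +1) φ (sw (at d) i s')) (Ʃ-zero k' (\ d' l' -> Tt-after-high (at d) (at< d) (at-hi l) (at d') (at< d') (at-hi l') φ c A)) · +0 (Tt i (i +1) φ (sw (at d) i s')))))) ·
   sym (u-T-low (Ξ (i +1) φ))

-- Functions of words and the derivations `X j`.

module Words (k' : ℕ) where
 open import Defs using (tr)
 open Base k'
 open Strong k'
 open Pair k'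

 record Linear (A : Fun -> Fun) : Set where
  field
   ext : ∀ φ ψ -> (∀ s -> φ s == ψ s) -> ∀ s -> A φ s == A ψ s
   lin+ : ∀ c φ ψ s -> A (\ s -> φ s + c * ψ s) s == A φ s + c * A ψ s
   lin0 : ∀ s -> A (\ _ -> + 0) s == + 0
 open Linear public

 »-lin : ∀ {P : Set} (d : Dec P) c x y -> (d » x + c * y) == (d » x) + c * (d » y)
 »-lin d c x y = »-+ d x (c * y) · cong+ʳ (d » x) (»-* d c y)

 Ʃ-lin : ∀ m c f g -> Ʃ m (\ i -> f i + c * g i) == Ʃ m f + c * Ʃ m g
 Ʃ-lin m c f g = Ʃ-+ m f (\ i -> c * g i) · cong+ʳ (Ʃ m f) (Ʃ-* m c g)

 u-linear : ∀ i -> Linear (u i)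
 u-linear i .ext φ ψ h s = »-val (asc? i s) (\ _ -> h _)
 u-linear i .lin+ c φ ψ s = »-lin (asc? i s) c _ _
 u-linear i .lin0 s = »-0 (asc? i s)

 Ng-linear : ∀ b -> Linear (Ng b)
 Ng-linear b .ext φ ψ h s = »-val (neg? b s) (\ _ -> h s)
 Ng-linear b .lin+ c φ ψ s = »-lin (neg? b s) c _ _
 Ng-linear b .lin0 s = »-0 (neg? b s)

 Tt-linear : ∀ a b -> Linear (Tt a b)
 Tt-linear a b .ext φ ψ h s = Tt-cong a b φ ψ s (\ _ -> h _)
 Tt-linear a b .lin+ c φ ψ s = Tt-def a b (\ s -> φ s + c * ψ s) s · »-lin (Cover? a b s) c (φ (sw a b s)) (ψ (sw a b s)) ·
  cong2 (\ x y -> x + c * y) (sym (Tt-def a b φ s)) (sym (Tt-def a b ψ s))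
 Tt-linear a b .lin0 s = Tt-vanish a b (\ _ -> + 0) s (\ _ -> refl)

 T-linear : ∀ b -> Linear (Ξ b)
 T-linear b .ext φ ψ h s = Ʃ-ext k (\ d -> Tt-linear (b - + suc d) b .ext φ ψ h s)
 T-linear b .lin+ c φ ψ s = Ʃ-ext k (\ d -> Tt-linear (b - + suc d) b .lin+ c φ ψ s) · Ʃ-lin k c (\ d -> Tt (b - + suc d) b φ s) (\ d -> Tt (b - + suc d) b ψ s)
 T-linear b .lin0 s = Ʃ-zero k (\ d _ -> Tt-linear (b - + suc d) b .lin0 s)

 ∘-linear : ∀ {A B} -> Linear A -> Linear B -> Linear (A ∘ B)
 ∘-linear {A} {B} a b .ext φ ψ h = a .ext (B φ) (B ψ) (b .ext φ ψ h)
 ∘-linear {A} {B} a b .lin+ c φ ψ s = a .ext _ _ (b .lin+ c φ ψ) s · a .lin+ c (B φ) (B ψ) s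
 ∘-linear {A} {B} a b .lin0 s = a .ext _ _ (b .lin0) s · a .lin0 s

 one : ∀ x -> + 1 * x == x
 one = Z.*-identityˡ

 linear-+ : ∀ {A} -> Linear A -> ∀ φ ψ s -> A (\ s -> φ s + ψ s) s == A φ s + A ψ s
 linear-+ {A} a φ ψ s = a .ext _ _ (\ s -> cong+ʳ (φ s) (sym (one (ψ s)))) s · a .lin+ (+ 1) φ ψ s · cong+ʳ (A φ s) (one (A ψ s))

 minus-one : ∀ x y -> x + -[1+ 0 ] * y == x - y
 minus-one = solve

 linear-minus : ∀ {A} -> Linear A -> ∀ φ ψ s -> A (\ s -> φ s - ψ s) s == A φ s - A ψ s
 linear-minus {A} a φ ψ s = a .ext _ _ (\ s -> sym (minus-one (φ s) (ψ s))) s · a .lin+ -1ℤ φ ψ s · minus-one (A φ s) (A ψ s)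

 linear-Ʃ : ∀ {A} -> Linear A -> ∀ m (φ : ℕ -> Fun) s -> A (\ s -> Ʃ m (\ i -> φ i s)) s == Ʃ m (\ i -> A (φ i) s)
 linear-Ʃ a zero φ s = a .lin0 s
 linear-Ʃ {A} a (suc m) φ s = linear-+ a (φ 0) (\ s -> Ʃ m (\ i -> φ (suc i) s)) s · cong+ʳ (A (φ 0) s) (linear-Ʃ a m (φ ∘ suc) s)

 Word : Set
 Word = List ℤ

 Fn : Set
 Fn = Word -> Fun

 sg : ℤ -> ℤ -> ℤ
 sg i j = tr k i (i +1) j

 sg-o : ∀ i {j} -> ¬ i ~ j -> ¬ i +1 ~ j -> sg i j == j
 sg-o i = tr-o i (i +1)

 opaque
  δ : ℤ -> ℤ -> ℤ
  δ i j = ((i ~? j) » + 1) - ((i +1 ~? j) » + 1)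

  δ-o : ∀ i {j} -> ¬ i ~ j -> ¬ i +1 ~ j -> δ i j == + 0
  δ-o i {j} a b = cong2 _-_ (»-no (i ~? j) a) (»-no (i +1 ~? j) b)

  δ-low : ∀ {i j} -> i ~ j -> δ i j == + 1
  δ-low {i} {j} e = cong2 _-_ (»-yes (i ~? j) e) (»-no (i +1 ~? j) (\ e' -> ¬~-suc i (~-trans e (~-sym e'))))

  δ-high : ∀ {i j} -> i +1 ~ j -> δ i j == -1ℤ
  δ-high {i} {j} e = cong2 _-_ (»-no (i ~? j) (\ e' -> ¬~-suc i (~-trans e' (~-sym e)))) (»-yes (i +1 ~? j) e)

 δ-congʳ : ∀ i {j j'} -> j ~ j' -> δ i j == δ i j'
 δ-congʳ i {j} {j'} e with cases i (i +1) j
 ... | is-a m x = δ-low (m , x) · sym (δ-low (~-trans (m , x) e))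
 ... | is-b m x = δ-high (m , x) · sym (δ-high (~-trans (m , x) e))
 ... | other a b = δ-o i a b · sym (δ-o i (\ x -> a (~-trans x (~-sym e))) (\ x -> b (~-trans x (~-sym e))))

 δ-congˡ : ∀ {i i'} j -> i ~ i' -> δ i j == δ i' j
 δ-congˡ {i} {i'} j e with cases i (i +1) j
 ... | is-a m x = δ-low (m , x) · sym (δ-low (~-trans (~-sym e) (m , x)))
 ... | is-b m x = δ-high (m , x) · sym (δ-high (~-trans (~-+ (+ 1) (~-sym e)) (m , x)))
 ... | other a b = δ-o i a b · sym (δ-o i' (\ x -> a (~-trans e x)) (\ x -> b (~-trans (~-+ (+ 1) e) x)))

 -- X j differentiates a word: it is the correction needed to move Ξ j past
 -- the weak-order operators spelled by the word.

 X : ℤ -> Fn -> Fn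
 X j f [] s = + 0
 X j f (i ∷ w) s = X (sg i j) (\ v -> f (i ∷ v)) w s + δ i j * f w s

 X-cong : ∀ j f g w s -> (∀ v -> f v s == g v s) -> X j f w s == X j g w s
 X-cong j f g [] s h = refl
 X-cong j f g (i ∷ w) s h = cong2 (\ x y -> x + δ i j * y) (X-cong (sg i j) _ _ w s (\ v -> h (i ∷ v))) (h w)

 X-linear : ∀ {A} -> Linear A -> ∀ j f w s -> X j (\ v -> A (f v)) w s == A (X j f w) s
 X-linear a j f [] s = sym (a .lin0 s)
 X-linear a j f (i ∷ w) s = cong (\ z -> z + δ i j * _) (X-linear a (sg i j) (\ v -> f (i ∷ v)) w s) · sym (a .lin+ (δ i j) (X (sg i j) (\ v -> f (i ∷ v)) w) (f w) s)

 X-lin+ : ∀ j c f g w s -> X j (\ v s -> f v s + c * g v s) w s == X j f w s + c * X j g w s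
 X-lin+ j c f g [] s = sym (+0ˡ (c * + 0) · Z.*-zeroʳ c)
 X-lin+ j c f g (i ∷ w) s = cong (\ z -> z + δ i j * (f w s + c * g w s)) (X-lin+ (sg i j) c (\ v -> f (i ∷ v)) (\ v -> g (i ∷ v)) w s) · eq (X (sg i j) (\ v -> f (i ∷ v)) w s) (X (sg i j) (\ v -> g (i ∷ v)) w s) c (δ i j) (f w s) (g w s)
  where
  eq : ∀ a b c d x y -> a + c * b + d * (x + c * y) == a + d * x + c * (b + d * y)
  eq = solve

 X-+ : ∀ j f g w s -> X j (\ v s -> f v s + g v s) w s == X j f w s + X j g w s
 X-+ j f g w s = X-cong j _ _ w s (\ v -> cong+ʳ (f v s) (sym (one (g v s)))) · X-lin+ j (+ 1) f g w s · cong+ʳ (X j f w s) (one (X j g w s))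

 X-minus : ∀ j f g w s -> X j (\ v s -> f v s - g v s) w s == X j f w s - X j g w s
 X-minus j f g w s = X-cong j _ _ w s (\ v -> sym (minus-one (f v s) (g v s))) · X-lin+ j -1ℤ f g w s · minus-one (X j f w s) (X j g w s)

 X-~ : ∀ {j j'} -> j ~ j' -> ∀ f w s -> X j f w s == X j' f w s
 X-~ e f [] s = refl
 X-~ e f (i ∷ w) s = cong2 (\ x y -> x + y * f w s) (X-~ (tr-~ i (i +1) (¬~-suc i) e) (\ v -> f (i ∷ v)) w s) (δ-congʳ i e)

 -- At a letter l the twofold derivations agree by induction, and the rest is δ l j · X (sg l i) + δ
 -- l i · X j. An index away from l and l + 1 has δ = 0 and is fixed by `sg l`; if both indices are
 -- in these two classes, `sg l` exchanges the classes and X depends only on the class, so the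
 -- expression is symmetric.
 X-comm : ∀ i j f w s -> X i (X j f) w s == X j (X i f) w s
 X-comm i j f [] s = refl
 X-comm i j f (l ∷ w) s = expand i j · cong (\ z -> z + δ l j * X (sg l i) f w s + δ l i * X j f w s) (X-comm (sg l i) (sg l j) (\ v -> f (l ∷ v)) w s) · main (cases l (l +1) i) (cases l (l +1) j) · sym (expand j i)
  where
  expand : ∀ i j -> X i (X j f) (l ∷ w) s == X (sg l i) (X (sg l j) (\ v -> f (l ∷ v))) w s + δ l j * X (sg l i) f w s + δ l i * X j f w s
  expand i j = cong (\ z -> z + δ l i * X j f w s) (X-lin+ (sg l i) (δ l j) (X (sg l j) (\ v -> f (l ∷ v))) f w s)
  A = X (sg l j) (X (sg l i) (\ v -> f (l ∷ v))) w s
  lowσ : ∀ {i} m -> i == l + m * N -> sg l i ~ l +1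
  lowσ m refl = ~-sym (m , tr-a l (l +1) m)
  highσ : ∀ {i} m -> i == l +1 + m * N -> sg l i ~ l
  highσ m refl = ~-sym (m , tr-b l (l +1) m (¬~-suc l))
  cmp : ∀ {a b} -> a ~ b -> X a f w s == X b f w s
  cmp e = X-~ e f w s
  Goal : ∀ di dj xi xj yi yj -> Set
  Goal di dj xi xj yi yj = A + dj * xi + di * yj == A + di * xj + dj * yi
  eq1 : ∀ A d x y z -> A + d * x + + 0 * y == A + + 0 * z + d * x
  eq1 = solve
  eq2 : ∀ A d x y z -> A + + 0 * x + d * y == A + d * y + + 0 * z
  eq2 = solve
  eq3 : ∀ A x y -> A + -[1+ 0 ] * x + + 1 * x == A + + 1 * y + -[1+ 0 ] * y
  eq3 = solve
  eq4 : ∀ A x y -> A + + 1 * x + -[1+ 0 ] * x == A + -[1+ 0 ] * y + + 1 * y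
  eq4 = solve
  case-i : ∀ {di} dj {xi} xj {yi} yj -> di == + 0 -> xi == yi -> Goal di dj xi xj yi yj
  case-i dj xj {yi} yj refl refl = eq1 A dj yi yj xj
  case-j : ∀ di {dj} xi {xj} yi {yj} -> dj == + 0 -> xj == yj -> Goal di dj xi xj yi yj
  case-j di xi yi {yj} refl refl = eq2 A di xi yj yi
  case-= : ∀ {di dj d xi xj yi yj} -> di == d -> dj == d -> xi == xj -> yj == yi -> Goal di dj xi xj yi yj
  case-= refl refl refl refl = refl
  case-+ : ∀ {di dj xi xj yi yj} -> di == + 1 -> dj == -1ℤ -> xi == yj -> xj == yi -> Goal di dj xi xj yi yj
  case-+ {yi = yi} {yj} refl refl refl refl = eq3 A yj yi
  case-- : ∀ {di dj xi xj yi yj} -> di == -1ℤ -> dj == + 1 -> xi == yj -> xj == yi -> Goal di dj xi xj yi yj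
  case-- {yi = yi} {yj} refl refl refl refl = eq4 A yj yi
  main : Cases l (l +1) i -> Cases l (l +1) j -> Goal (δ l i) (δ l j) (X (sg l i) f w s) (X (sg l j) f w s) (X i f w s) (X j f w s)
  main (other a b) _ = case-i (δ l j) (X (sg l j) f w s) (X j f w s) (δ-o l a b) (cong (\ z -> X z f w s) (sg-o l a b))
  main (is-a _ _) (other a b) = case-j (δ l i) (X (sg l i) f w s) (X i f w s) (δ-o l a b) (cong (\ z -> X z f w s) (sg-o l a b))
  main (is-b _ _) (other a b) = case-j (δ l i) (X (sg l i) f w s) (X i f w s) (δ-o l a b) (cong (\ z -> X z f w s) (sg-o l a b))
  main (is-a m e) (is-a m' e') = case-= (δ-low (m , e)) (δ-low (m' , e')) (cmp (~-trans (lowσ m e) (~-sym (lowσ m' e')))) (cmp (~-trans (~-sym {l} (m' , e')) (m , e)))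
  main (is-b m e) (is-b m' e') = case-= (δ-high (m , e)) (δ-high (m' , e')) (cmp (~-trans (highσ m e) (~-sym (highσ m' e')))) (cmp (~-trans (~-sym {l + + 1} (m' , e')) (m , e)))
  main (is-a m e) (is-b m' e') = case-+ (δ-low (m , e)) (δ-high (m' , e')) (cmp (~-trans (lowσ m e) (m' , e'))) (cmp (~-trans (highσ m' e') (m , e)))
  main (is-b m e) (is-a m' e') = case-- (δ-high (m , e)) (δ-low (m' , e')) (cmp (~-trans (highσ m e) (m' , e'))) (cmp (~-trans (lowσ m' e') (m , e)))

 -- Functions of words that only depend on the class of the word modulo
 -- commutations and modulo shifting letters by n.

 record Far (i j : ℤ) : Set where
  constructor far
  field
   ≠0 : ¬ i ~ j
   ≠+ : ¬ i +1 ~ j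
   ≠- : ¬ j +1 ~ i
 open Far public

 record Nice (f : Fn) : Set where
  constructor nice
  field
   per  : ∀ v i m w s -> f (v ++ (i + m * N) ∷ w) s == f (v ++ i ∷ w) s
   comm : ∀ v i j w s -> Far i j -> f (v ++ i ∷ j ∷ w) s == f (v ++ j ∷ i ∷ w) s
 open Nice public

 nice-∷ : ∀ {f} i -> Nice f -> Nice (\ v -> f (i ∷ v))
 nice-∷ i h .per v = h .per (i ∷ v)
 nice-∷ i h .comm v = h .comm (i ∷ v)

 nice-linear : ∀ {A} -> Linear A -> ∀ {f} -> Nice f -> Nice (\ v -> A (f v))
 nice-linear a h .per v i m w s = a .ext _ _ (h .per v i m w) s
 nice-linear a h .comm v i j w s p = a .ext _ _ (\ s -> h .comm v i j w s p) s

 far-sym : ∀ {i j} -> Far i j -> Far j i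
 far-sym (far a b c) = far (a ∘ ~-sym) c b

 ~-pred : ∀ {i l} -> i +1 ~ l +1 -> i ~ l
 ~-pred {i} {l} e = subst2 _~_ (p1 i) (p1 l) (~-+ (- + 1) e)
  where
  p1 : ∀ l -> l + + 1 + - + 1 == l
  p1 = solve

 far-δ : ∀ {i l} -> Far i l -> ∀ j -> δ l (sg i j) == δ l j
 far-δ {i} {l} (far a b c) j with cases i (i +1) j
 ... | other p q = cong (δ l) (sg-o i p q)
 ... | is-a m refl = cong (δ l) (tr-a i (i +1) m) · sym (δ-congʳ l (~-shift (i +1) m)) · δ-o l (b ∘ ~-sym) (\ e -> a (~-sym (~-pred e))) · sym (sym (δ-congʳ l (~-shift i m)) · δ-o l (a ∘ ~-sym) c)
 ... | is-b m refl = cong (δ l) (tr-b i (i +1) m (¬~-suc i)) · sym (δ-congʳ l (~-shift i m)) · δ-o l (a ∘ ~-sym) c · sym (sym (δ-congʳ l (~-shift (i +1) m)) · δ-o l (b ∘ ~-sym) (\ e -> a (~-sym (~-pred e))))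

 far-sg : ∀ {i l} -> Far i l -> ∀ j -> sg l (sg i j) == sg i (sg l j)
 far-sg {i} {l} (far a b c) j = cong2 (\ x y -> tr k x y (sg i j)) (sym (sg-o i a b)) (sym (sg-o i (c ∘ ~-sym) (\ e -> a (~-pred e)))) · tr-conj i (i +1) (¬~-suc i) l (l +1) (¬~-suc l) j

 X-nice : ∀ j {f} -> Nice f -> Nice (X j f)
 X-nice j {f} h .per = go j f h
  where
  go : ∀ j f -> Nice f -> ∀ v i m w s -> X j f (v ++ (i + m * N) ∷ w) s == X j f (v ++ i ∷ w) s
  go j f h (l ∷ v) i m w s = cong2 (\ x y -> x + δ l j * y) (go (sg l j) _ (nice-∷ l h) v i m w s) (h .per v i m w s)
  go j f h [] i m w s = cong2 (\ x y -> x + y * f w s)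
   (X-cong (sg (i + m * N) j) _ _ w s (\ v -> h .per [] i m v s) · cong (\ z -> X z (\ v -> f (i ∷ v)) w s) sg-per)
   (sym (δ-congˡ j (~-shift i m)))
   where
   eq : ∀ i m -> i + m + + 1 == i + + 1 + m
   eq = solve
   sg-per : sg (i + m * N) j == sg i j
   sg-per = cong (\ z -> tr k (i + m * N) z j) (eq i (m * N)) · tr-period i (i +1) (¬~-suc i) m j
 X-nice j {f} h .comm = go j f h
  where
  go : ∀ j f -> Nice f -> ∀ v i l w s -> Far i l -> X j f (v ++ i ∷ l ∷ w) s == X j f (v ++ l ∷ i ∷ w) s
  go j f h (p ∷ v) i l w s fr = cong2 (\ x y -> x + δ p j * y) (go (sg p j) _ (nice-∷ p h) v i l w s fr) (h .comm v i l w s fr)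
  go j f h [] i l w s fr = cong2 (\ x y -> X x (\ v -> f (i ∷ l ∷ v)) w s + y * f (i ∷ w) s + δ i j * f (l ∷ w) s) (far-sg fr j) (far-δ fr j) ·
   cong (\ z -> z + δ l j * f (i ∷ w) s + δ i j * f (l ∷ w) s) (X-cong _ _ _ w s (\ v -> h .comm [] i l v s fr)) ·
   eq (X (sg i (sg l j)) (\ v -> f (l ∷ i ∷ v)) w s) (δ l j * f (i ∷ w) s) (δ i j * f (l ∷ w) s) · cong (\ y -> X (sg i (sg l j)) (\ v -> f (l ∷ i ∷ v)) w s + y * f (l ∷ w) s + δ l j * f (i ∷ w) s) (sym (far-δ (far-sym fr) j))
   where
   eq : ∀ a b c -> a + b + c == a + c + b
   eq = solve

-- The corrected operators `G b` and their compatibility with a letter.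

module Balance (k' : ℕ) where
 open Z using (_≤_)
 open Base k'
 open Strong k'
 open Pair k'
 open Words k'

 -- At the empty word the correction vanishes and `Ξ b` is left; on longer words it compensates the
 -- `Ng` terms of `T-pair-u`.
 G : ℤ -> Fn -> Fn
 G b f w s = Ξ b (f w) s + Ng b (X b f w) s

 G-nice : ∀ b {f} -> Nice f -> Nice (G b f)
 G-nice b h .per v i m w s = nice-linear (T-linear b) h .per v i m w s ⊹ nice-linear (Ng-linear b) (X-nice b h) .per v i m w s
 G-nice b h .comm v i j w s p = nice-linear (T-linear b) h .comm v i j w s p ⊹ nice-linear (Ng-linear b) (X-nice b h) .comm v i j w s p

 sg-low : ∀ i -> sg i i == i +1
 sg-low i = tr-a0 i (i +1)

 sg-high : ∀ i -> sg i (i +1) == i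
 sg-high i = tr-b0 i (i +1) (¬~-suc i)

 T-cong : ∀ (B : State -> Set) b φ ψ s -> (∀ d -> d N.< k -> Cover (b - + suc d) b s -> B (sw (b - + suc d) b s)) -> (∀ s -> B s -> φ s == ψ s) -> Ξ b φ s == Ξ b ψ s
 T-cong B b φ ψ s st h = Ʃ-cong k (\ d d<k -> Tt-cong (b - + suc d) b φ ψ s (\ c -> h _ (st d d<k c)))

 -- B is a set of states closed under the moves of the operators Ξ b.

 module _ (B : State -> Set) (stable : ∀ b d s -> d N.< k -> B s -> Cover (b - + suc d) b s -> B (sw (b - + suc d) b s)) where

  -- The word holds weak steps still to be carried out: for a function balanced at all its letters,
  -- f w is `uw w` applied to f []. The condition is confined to `B` because the truncated product
  -- of labels behaves correctly only on bounded states.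
  Bal : ℤ -> Fn -> Set
  Bal i f = ∀ w s -> B s -> f (i ∷ w) s == u i (f w) s

  module _ (i : ℤ) (f : Fn) (bal : Bal i f) where
   private
    T-bal : ∀ b w s -> B s -> Ξ b (f (i ∷ w)) s == Ξ b (u i (f w)) s
    T-bal b w s p = T-cong B b _ _ s (\ d d<k -> stable b d s d<k p) (bal w)
    X-bal : ∀ j w s -> B s -> X j (\ v -> f (i ∷ v)) w s == u i (X j f w) s
    X-bal j w s p = X-cong j _ (\ v -> u i (f v)) w s (\ v -> bal v s p) · X-linear (u-linear i) j f w s

   G-far : ∀ b -> ¬ i ~ b -> ¬ i +1 ~ b -> Bal i (G b f)
   G-far b n1 n2 w s p = (T-bal b w s p · T-u-comm i b n1 n2 (f w) s) ⊹ (»-val (neg? b s) (\ _ -> x) · Ng-u-comm i b n1 n2 (X b f w) s) ·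
    sym (u-+ i (Ξ b (f w)) (Ng b (X b f w)) s)
    where
    x : X b f (i ∷ w) s == u i (X b f w) s
    x = cong2 (\ y z -> X y (\ v -> f (i ∷ v)) w s + z * f w s) (sg-o i n1 n2) (δ-o i n1 n2) · +0 (X b (\ v -> f (i ∷ v)) w s) · X-bal b w s p

   G-low : ∀ w s -> B s -> G i f (i ∷ w) s == Ξ i (u i (f w)) s + (u i (Ng (i +1) (X (i +1) f w)) s + Ng i (f w) s)
   G-low w s p = T-bal i w s p ⊹ (»-val (neg? i s) (\ _ -> x) · »-+ (neg? i s) (u i (X (i +1) f w) s) (f w s) · cong (\ z -> z + Ng i (f w) s) (Ng-u-low i (X (i +1) f w) s))
    where
    x : X i f (i ∷ w) s == u i (X (i +1) f w) s + f w s
    x = (cong (\ y -> X y (\ v -> f (i ∷ v)) w s) (sg-low i) · X-bal (i +1) w s p) ⊹ (cong (\ z -> z * f w s) (δ-low {i} ~-refl) · one (f w s))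

   private
    X-high : ∀ w s -> B s -> X (i +1) f (i ∷ w) s == u i (X i f w) s - f w s
    X-high w s p = (cong (\ y -> X y (\ v -> f (i ∷ v)) w s) (sg-high i) · X-bal i w s p) ⊹ (cong (\ z -> z * f w s) (δ-high {i} ~-refl) · neg1 (f w s))
     where
     neg1 : ∀ x -> -[1+ 0 ] * x == - x
     neg1 = solve

   G-high₀ : ∀ w s -> B s -> G (i +1) f (i ∷ w) s == Ξ (i +1) (u i (f w)) s + (Ng (i +1) (u i (X i f w)) s - Ng (i +1) (f w) s)
   G-high₀ w s p = T-bal (i +1) w s p ⊹ (»-val (neg? (i +1) s) (\ _ -> X-high w s p) · »-minus (neg? (i +1) s) (u i (X i f w) s) (f w s))

   G-high : ∀ w s -> B s -> G (i +1) f (i ∷ w) s == Ξ (i +1) (u i (f w)) s + (u i (Ng i (X i f w)) s - Ng (i +1) (f w) s)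
   G-high w s p = G-high₀ w s p · cong (\ z -> Ξ (i +1) (u i (f w)) s + (z - Ng (i +1) (f w) s)) (Ng-u-high i (X i f w) s)

   -- The letter i exchanges `X i` and `X (i + 1)` up to + f w and - f w, the two values of `δ`.
   -- Guarded by `Ng i` and `Ng (i + 1)`, these are exactly the defect in `T-pair-u`.
   G-pair : Bal i (\ w s -> G i f w s + G (i +1) f w s)
   G-pair w s p = G-low w s p ⊹ G-high w s p · eq (Ξ i (u i (f w)) s) A (Ng i (f w) s) (Ξ (i +1) (u i (f w)) s) C (Ng (i +1) (f w) s) ·
    cong (\ z -> z - Ng (i +1) (f w) s + (A + C)) (T-pair-u i s (f w)) · eq' (u i (\ s -> Ξ i (f w) s + Ξ (i +1) (f w) s) s) (Ng (i +1) (f w) s) A C · rhs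
    where
    A = u i (Ng (i +1) (X (i +1) f w)) s
    C = u i (Ng i (X i f w)) s
    eq : ∀ t a n t' c n' -> t + (a + n) + (t' + (c - n')) == t + t' + n - n' + (a + c)
    eq = solve
    eq' : ∀ t n a c -> t + n - n + (a + c) == t + (c + a)
    eq' = solve
    rhs : u i (\ s -> Ξ i (f w) s + Ξ (i +1) (f w) s) s + (C + A) == u i (\ s -> G i f w s + G (i +1) f w s) s
    rhs = cong+ʳ (u i (\ s -> Ξ i (f w) s + Ξ (i +1) (f w) s) s) (sym (u-+ i (Ng i (X i f w)) (Ng (i +1) (X (i +1) f w)) s)) ·
     sym (u-+ i (\ s -> Ξ i (f w) s + Ξ (i +1) (f w) s) (\ s -> Ng i (X i f w) s + Ng (i +1) (X (i +1) f w) s) s) ·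
      u-linear i .ext _ _ (\ s -> +-interchange (Ξ i (f w) s) (Ξ (i +1) (f w) s) (Ng i (X i f w) s) (Ng (i +1) (X (i +1) f w) s)) s

   G-high-pos : ∀ w s -> B s -> + 0 ≤ hv s i -> G (i +1) f (i ∷ w) s == + 0
   G-high-pos w s p q = G-high w s p · cong2 (\ x y -> x + (y - Ng (i +1) (f w) s)) (T-high-pos i s q (f w)) z · eq (Ng (i +1) (f w) s)
    where
    z : u i (Ng i (X i f w)) s == + 0
    z = u-vanish i (Ng i (X i f w)) s (\ A -> »-no (neg? i _) (\ l -> lin⊥ (hv s i & hv s (i +1) & hv (sw i (i +1) s) i & []) (0' =< x0 & x0 :< x1 & x2 := x1 & x2 :< 0' & []) q A (swap-i i s) l))
    eq : ∀ x -> x + (+ 0 - x) == + 0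
    eq = solve

   -- The y² coefficient of (1 - y G i)(1 - y G (i + 1)). The term with `Ξ i` outermost vanishes:
   -- after a cover with label i is removed, h i is nonnegative and `G-high-pos` applies. The terms
   -- under `Ng i` are matched one by one through `Ng-T-u`, the commuting signs and `Ng-T`; on the
   -- right, `u-Ng-T` kills the surplus term.
   G-pair² : Bal i (G i (G (i +1) f))
   G-pair² w s p = t0 ⊹ »-val (neg? i s) (\ _ -> x) · +0ˡ _ · split · sym rhs
    where
    g = G (i +1) f
    i1 = i +1
    t0 : Ξ i (g (i ∷ w)) s == + 0
    t0 = Ʃ-zero k (\ d d<k -> Tt-vanish (i - + suc d) i (g (i ∷ w)) s (\ c -> G-high-pos w _ (stable i d s d<k p c)
     (subst (+ 0 ≤_) (sym (hv-sw-b (¬~-lt (lin (i & + d & []) (0' =< x1 & []) (x0 :- (1' :+ x1) :< x0) 0≤+) (lin (i & + d & N & []) (1' :+ x1 :< x2 & []) (x0 :< x0 :- (1' :+ x1) :+ x2) (Z.+<+ (s≤s d<k)))) s)) (pos c))))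
    P1 = Ξ i1 (u i (X i1 f w)) s
    P2 = Ng i1 (u i (X i1 (X i f) w)) s
    P3 = Ξ i1 (f w) s
    N1 = Ng i1 (X i1 f w) s
    x : X i g (i ∷ w) s == P1 + P2 + P3
    x = (cong (\ y -> X y (\ v -> g (i ∷ v)) w s) (sg-low i) · x') ⊹ (cong (\ z -> z * g w s) (δ-low {i} ~-refl) · one (g w s)) · eq P1 P2 N1 P3
     where
     eq : ∀ a b c d -> a + (b - c) + (d + c) == a + b + d
     eq = solve
     x' : X i1 (\ v -> g (i ∷ v)) w s == P1 + (P2 - N1)
     x' = X-cong i1 _ (\ v s -> Ξ i1 (u i (f v)) s + (Ng i1 (u i (X i f v)) s - Ng i1 (f v) s)) w s (\ v -> G-high₀ v s p) ·
      X-+ i1 (\ v -> Ξ i1 (u i (f v))) (\ v s -> Ng i1 (u i (X i f v)) s - Ng i1 (f v) s) w s ·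
      X-linear (∘-linear (T-linear i1) (u-linear i)) i1 f w s ⊹
       (X-minus i1 (\ v -> Ng i1 (u i (X i f v))) (\ v -> Ng i1 (f v)) w s ·
        cong2 _-_ (X-linear (∘-linear (Ng-linear i1) (u-linear i)) i1 (X i f) w s) (X-linear (Ng-linear i1) i1 f w s))
    Q1 = u i (Ξ i (Ng i1 (X i1 f w))) s
    Q2 = u i (Ng i (Ng i1 (X i1 (X i f) w))) s
    Q3 = u i (Ξ i (Ξ i1 (f w))) s
    split : (neg? i s » P1 + P2 + P3) == Q1 + Q2 + Q3
    split = »-+ (neg? i s) (P1 + P2) P3 · (»-+ (neg? i s) P1 P2 · Ng-T-u i s (X i1 f w) ⊹ e2) ⊹ Ng-T i s (f w)
     where
     ψ = X i1 (X i f) w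
     e2 : (neg? i s » P2) == Q2
     e2 = »-val (neg? i s) (\ _ -> Ng-u-high i ψ s) · Ng-u-low i (Ng i ψ) s · u-linear i .ext _ _ (\ s -> »-comm (neg? i1 s) (neg? i s) (ψ s)) s
    rhs : u i (G i g w) s == Q1 + Q2 + Q3
    rhs = u-+ i (Ξ i (g w)) (Ng i (X i g w)) s · r1 ⊹ r2 · eq Q1 Q2 Q3
     where
     eq : ∀ a b c -> c + a + (+ 0 + b) == a + b + c
     eq = solve
     r1 : u i (Ξ i (g w)) s == Q3 + Q1
     r1 = u-linear i .ext _ _ (linear-+ (T-linear i) (Ξ i1 (f w)) (Ng i1 (X i1 f w))) s · u-+ i (Ξ i (Ξ i1 (f w))) (Ξ i (Ng i1 (X i1 f w))) s
     xg : ∀ s -> X i g w s == Ξ i1 (X i f w) s + Ng i1 (X i1 (X i f) w) s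
     xg s = X-+ i (\ v -> Ξ i1 (f v)) (\ v -> Ng i1 (X i1 f v)) w s · X-linear (T-linear i1) i f w s ⊹ (X-linear (Ng-linear i1) i (X i1 f) w s · »-val (neg? i1 s) (\ _ -> X-comm i i1 f w s))
     r2 : u i (Ng i (X i g w)) s == + 0 + Q2
     r2 = ∘-linear (u-linear i) (Ng-linear i) .ext _ _ xg s · linear-+ (∘-linear (u-linear i) (Ng-linear i)) (Ξ i1 (X i f w)) (Ng i1 (X i1 (X i f) w)) s · cong (\ z -> z + Q2) (u-Ng-T i s (X i f w))

-- Sums over cyclically increasing words.

module WordSums (k' : ℕ) where
 open Z using (_≤_)
 open Base k'
 open Strong k'
 open Pair k'
 open Words k'
 open Balance k'
 open import Data.List.Relation.Unary.All.Properties using (++⁺)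
 open import Data.List.Properties using (++-assoc; ++-identityʳ)

 -- inc p m r f sums f over the increasing words of length r in the letters
 -- p, …, p + m − 1; dsum p m r h splits such a word, not using all letters,
 -- into its maximal initial run v starting at p and the rest w.

 inc : ℤ -> ℕ -> ℤ -> (Word -> ℤ) -> ℤ
 inc p zero r f = (r Z.≟ + 0) » f []
 inc p (suc m) r f = inc (p +1) m r f + inc (p +1) m (r -¹) (\ v -> f (p ∷ v))

 full : ℤ -> ℕ -> ℤ -> (Word -> ℤ) -> ℤ
 full p zero r f = (r Z.≟ + 0) » f []
 full p (suc m) r f = full (p +1) m (r -¹) (\ v -> f (p ∷ v))

 dsum : ℤ -> ℕ -> ℤ -> (Word -> Word -> ℤ) -> ℤ
 dsum p zero r h = + 0
 dsum p (suc m) r h = inc (p +1) m r (h []) + dsum (p +1) m (r -¹) (\ v -> h (p ∷ v))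

 -- Cyclically increasing words seen from the residue b: those without b, and those with b, where
 -- the run starting at b is placed behind the remaining letters. As `dsum` omits the word of all
 -- its letters, only proper subsets of the residues occur.
 Ub : ℤ -> ℤ -> (Word -> ℤ) -> ℤ
 Ub b r f = inc (b +1) k r f + dsum (b +1) k (r -¹) (\ v w -> f (w ++ b ∷ v))

 record In (p : ℤ) (m : ℕ) (i : ℤ) : Set where
  constructor within
  field
   lower : p ≤ i
   upper : i < p + + m
 open In public

 in-suc : ∀ {p m i} -> In (p +1) m i -> In p (suc m) i
 in-suc {p} {m} {i} (within a b) = within (lin (p & i & []) (x0 :+ 1' =< x1 & []) (x0 =< x1) a) (lin (p & i & + m & []) (x1 :< x0 :+ 1' :+ x2 & []) (x1 :< x0 :+ (1' :+ x2)) b)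

 in-head : ∀ {p m} -> In p (suc m) p
 in-head {p} {m} = within Z.≤-refl (lin (p & + m & []) (0' =< x1 & []) (x0 :< x0 :+ (1' :+ x1)) 0≤+)

 data Split : ℤ -> ℕ -> Word -> Word -> Set where
  here  : ∀ {p m w} -> All (In (p +1) m) w -> length w N.≤ m -> Split p (suc m) [] w
  there : ∀ {p m v w} -> Split (p +1) m v w -> Split p (suc m) (p ∷ v) w

 split-v : ∀ {p m v w} -> Split p (suc m) v w -> All (In p m) v
 split-v (here _ _) = []
 split-v {m = suc m} (there d) = in-head ∷ All.map in-suc (split-v d)

 split-w : ∀ {p m v w} -> Split p (suc m) v w -> All (In (p +1) m) w
 split-w (here a _) = a
 split-w {m = suc m} (there d) = All.map in-suc (split-w d)

 split-length : ∀ {p m v w} -> Split p m v w -> length v N.+ length w N.< m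
 split-length (here _ l) = s≤s l
 split-length (there d) = s≤s (split-length d)

 Apart : ℕ -> ℤ -> ℤ -> Set
 Apart m i j = i +1 < j × j - i ≤ + m

 split-apart : ∀ {p m v w} -> Split p (suc m) v w -> All (\ i -> All (Apart m i) w) v
 split-apart (here _ _) = []
 split-apart {p} {suc m} (there d) = All.map (\ {j} (within a b) -> lin (p & j & []) (x0 :+ 1' :+ 1' =< x1 & []) (x0 :+ 1' :< x1) a , lin (p & j & + m & []) (x1 :< x0 :+ 1' :+ 1' :+ x2 & []) (x1 :- x0 =< 1' :+ x2) b) (split-w d)
  ∷ All.map (\ {i} -> All.map (\ {j} (a , b) -> a , lin (i & j & + m & []) (x1 :- x0 =< x2 & []) (x1 :- x0 =< 1' :+ x2) b)) (split-apart d)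

 apart-far : ∀ {m i j} -> m N.≤ k' -> Apart m i j -> Far i j
 apart-far {m} {i} {j} m≤ (a , b) = far
  (¬~-lt (lin (i & j & []) (x0 :+ 1' :< x1 & []) (x0 :< x1) a) (lin (i & j & + m & + k' & []) (x1 :- x0 =< x2 & x2 =< x3 & []) (x1 :< x0 :+ (2' :+ x3)) b (Z.+≤+ m≤)))
  (¬~-lt a (lin (i & j & + m & + k' & []) (x1 :- x0 =< x2 & x2 =< x3 & []) (x1 :< x0 :+ 1' :+ (2' :+ x3)) b (Z.+≤+ m≤)))
  (¬~-gt (lin (i & j & []) (x0 :+ 1' :< x1 & []) (x0 :< x1 :+ 1') a) (lin (i & j & + m & + k' & []) (x1 :- x0 =< x2 & x2 =< x3 & []) (x1 :+ 1' :< x0 :+ (2' :+ x3)) b (Z.+≤+ m≤)))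

 inc-cong : ∀ p m r f g -> (∀ w -> All (In p m) w -> length w N.≤ m -> f w == g w) -> inc p m r f == inc p m r g
 inc-cong p zero r f g h = cong (\ z -> (r Z.≟ + 0) » z) (h [] [] z≤n)
 inc-cong p (suc m) r f g h = inc-cong (p +1) m r f g (\ w a l -> h w (All.map in-suc a) (N.m≤n⇒m≤1+n l)) ⊹
  inc-cong (p +1) m (r -¹) _ _ (\ w a l -> h (p ∷ w) (in-head ∷ All.map in-suc a) (s≤s l))

 inc-ext : ∀ p m r f g -> (∀ w -> f w == g w) -> inc p m r f == inc p m r g
 inc-ext p m r f g h = inc-cong p m r f g (\ w _ _ -> h w)

 inc-0 : ∀ p m r -> inc p m r (\ _ -> + 0) == + 0
 inc-0 p zero r = »-0 (r Z.≟ + 0)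
 inc-0 p (suc m) r = inc-0 (p +1) m r ⊹ inc-0 (p +1) m (r -¹)

 inc-lin : ∀ p m r c f g -> inc p m r (\ w -> f w + c * g w) == inc p m r f + c * inc p m r g
 inc-lin p zero r c f g = »-lin (r Z.≟ + 0) c (f []) (g [])
 inc-lin p (suc m) r c f g = inc-lin (p +1) m r c f g ⊹ inc-lin (p +1) m (r -¹) c (\ v -> f (p ∷ v)) (\ v -> g (p ∷ v)) · eq (inc (p +1) m r f) (inc (p +1) m r g) (inc (p +1) m (r -¹) (\ v -> f (p ∷ v))) (inc (p +1) m (r -¹) (\ v -> g (p ∷ v))) c
  where
  eq : ∀ a b a' b' c -> a + c * b + (a' + c * b') == a + a' + c * (b + b')
  eq = solve

 dsum-cong : ∀ p m r h h' -> (∀ v w -> Split p m v w -> h v w == h' v w) -> dsum p m r h == dsum p m r h'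
 dsum-cong p zero r h h' e = refl
 dsum-cong p (suc m) r h h' e = inc-cong (p +1) m r (h []) (h' []) (\ w a l -> e [] w (here a l)) ⊹
  dsum-cong (p +1) m (r -¹) _ _ (\ v w d -> e (p ∷ v) w (there d))

 dsum-lin : ∀ p m r c f g -> dsum p m r (\ v w -> f v w + c * g v w) == dsum p m r f + c * dsum p m r g
 dsum-lin p zero r c f g = sym (+0ˡ (c * + 0) · Z.*-zeroʳ c)
 dsum-lin p (suc m) r c f g = inc-lin (p +1) m r c (f []) (g []) ⊹ dsum-lin (p +1) m (r -¹) c (\ v -> f (p ∷ v)) (\ v -> g (p ∷ v)) · eq (inc (p +1) m r (f [])) (inc (p +1) m r (g [])) (dsum (p +1) m (r -¹) (\ v -> f (p ∷ v))) (dsum (p +1) m (r -¹) (\ v -> g (p ∷ v))) c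
  where
  eq : ∀ a b a' b' c -> a + c * b + (a' + c * b') == a + a' + c * (b + b')
  eq = solve

 Ub-lin : ∀ b r c f g -> Ub b r (\ w -> f w + c * g w) == Ub b r f + c * Ub b r g
 Ub-lin b r c f g = inc-lin (b +1) k r c f g ⊹ dsum-lin (b +1) k (r -¹) c (\ v w -> f (w ++ b ∷ v)) (\ v w -> g (w ++ b ∷ v)) · eq (inc (b +1) k r f) (inc (b +1) k r g) (dsum (b +1) k (r -¹) (\ v w -> f (w ++ b ∷ v))) (dsum (b +1) k (r -¹) (\ v w -> g (w ++ b ∷ v))) c
  where
  eq : ∀ a b a' b' c -> a + c * b + (a' + c * b') == a + a' + c * (b + b')
  eq = solve

 Ub-ext : ∀ b r f g -> (∀ w -> f w == g w) -> Ub b r f == Ub b r g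
 Ub-ext b r f g h = inc-ext (b +1) k r f g h ⊹ dsum-cong (b +1) k (r -¹) _ _ (\ v w _ -> h (w ++ b ∷ v))

 inc-last : ∀ p m r f -> inc p (suc m) r f == inc p m r f + inc p m (r -¹) (\ w -> f (w ++ (p + + m) ∷ []))
 inc-last p zero r f = cong (\ z -> inc p 0 r f + ((r -¹ Z.≟ + 0) » f (z ∷ []))) (sym (+0 p))
 inc-last p (suc m) r f = inc-last (p +1) m r f ⊹ inc-last (p +1) m (r -¹) (\ v -> f (p ∷ v)) ·
  +-interchange (inc (p +1) m r f) (inc (p +1) m (r -¹) (\ w -> f (w ++ (p +1 + + m) ∷ []))) (inc (p +1) m (r -¹) (\ v -> f (p ∷ v))) (inc (p +1) m (r -¹ -¹) (\ w -> f (p ∷ w ++ (p +1 + + m) ∷ []))) ·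
   cong+ʳ (inc p (suc m) r f) (cong (\ z -> inc (p +1) m (r -¹) (\ w -> f (w ++ z ∷ [])) + inc (p +1) m (r -¹ -¹) (\ w -> f (p ∷ w ++ z ∷ []))) (Z.+-assoc p (+ 1) (+ m)))

 dsum-last : ∀ p m r h -> dsum p (suc m) r h == dsum p m r h + dsum p m (r -¹) (\ v w -> h v (w ++ (p + + m) ∷ [])) + full p m r (\ v -> h v [])
 dsum-last p zero r h = Z.+-comm ((r Z.≟ + 0) » h [] []) (+ 0)
 dsum-last p (suc m) r h = inc-last (p +1) m r (h []) ⊹ dsum-last (p +1) m (r -¹) (\ v -> h (p ∷ v)) ·
  eq (inc (p +1) m r (h [])) (B (p +1 + + m)) (dsum (p +1) m (r -¹) (\ v -> h (p ∷ v))) (D (p +1 + + m)) (full p (suc m) r (\ v -> h v [])) ·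
   cong (\ z -> dsum p (suc m) r h + (B z + D z) + full p (suc m) r (\ v -> h v [])) (Z.+-assoc p (+ 1) (+ m))
  where
  B : ℤ -> ℤ
  B z = inc (p +1) m (r -¹) (\ w -> h [] (w ++ z ∷ []))
  D : ℤ -> ℤ
  D z = dsum (p +1) m (r -¹ -¹) (\ v w -> h (p ∷ v) (w ++ z ∷ []))
  eq : ∀ a b c d e -> a + b + (c + d + e) == a + c + (b + d) + e
  eq = solve

 dsum-inc : ∀ p m r f -> dsum p m r (\ v w -> f (v ++ w)) + full p m r f == inc p m r f
 dsum-inc p zero r f = +0ˡ _
 dsum-inc p (suc m) r f = Z.+-assoc (inc (p +1) m r f) (dsum (p +1) m (r -¹) (\ v w -> f (p ∷ v ++ w))) (full (p +1) m (r -¹) (\ v -> f (p ∷ v))) · cong+ʳ (inc (p +1) m r f) (dsum-inc (p +1) m (r -¹) (\ v -> f (p ∷ v)))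

 full-0 : ∀ p m r f -> ¬ r == + m -> full p m r f == + 0
 full-0 p zero r f ne = »-no (r Z.≟ + 0) ne
 full-0 p (suc m) r f ne = full-0 (p +1) m (r -¹) (\ v -> f (p ∷ v)) (\ e -> ne (lin (r & + m & []) (x0 :- 1' := x1 & []) (x0 := 1' :+ x1) e))

 comm-letter : ∀ {f} -> Nice f -> ∀ x i w y s -> All (Far i) w -> f (x ++ w ++ i ∷ y) s == f (x ++ i ∷ w ++ y) s
 comm-letter h x i [] y s [] = refl
 comm-letter {f} h x i (j ∷ w) y s (p ∷ ps) = cong (\ z -> f z s) (sym (++-assoc x (j ∷ []) (w ++ i ∷ y))) ·
  comm-letter h (x ++ j ∷ []) i w y s ps · cong (\ z -> f z s) (++-assoc x (j ∷ []) (i ∷ w ++ y)) · h .comm x j i (w ++ y) s (far-sym p)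

 comm-words : ∀ {f} -> Nice f -> ∀ x v w y s -> All (\ i -> All (Far i) w) v -> f (x ++ w ++ v ++ y) s == f (x ++ v ++ w ++ y) s
 comm-words h x [] w y s [] = refl
 comm-words {f} h x (i ∷ v) w y s (p ∷ ps) = comm-letter h x i w (v ++ y) s p · cong (\ z -> f z s) (sym (++-assoc x (i ∷ []) (w ++ v ++ y))) ·
  comm-words h (x ++ i ∷ []) v w y s ps · cong (\ z -> f z s) (++-assoc x (i ∷ []) (v ++ w ++ y))

 comm-end : ∀ {f} -> Nice f -> ∀ v w s -> All (\ i -> All (Far i) w) v -> f (w ++ v) s == f (v ++ w) s
 comm-end {f} h v w s p = cong (\ z -> f (w ++ z) s) (sym (++-identityʳ v)) · comm-words h [] v w [] s p · cong (\ z -> f (v ++ z) s) (++-identityʳ w)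

 Avoid : ℤ -> ℤ -> Set
 Avoid j i = ¬ i ~ j × ¬ i +1 ~ j

 X-pass : ∀ j f w y s -> All (Avoid j) w -> X j f (w ++ y) s == X j (\ v -> f (w ++ v)) y s
 X-pass j f [] y s [] = refl
 X-pass j f (i ∷ w) y s ((a , b) ∷ ps) = cong2 (\ x z -> X x (\ v -> f (i ∷ v)) (w ++ y) s + z * f (w ++ y) s) (sg-o i a b) (δ-o i a b) ·
  +0 (X j (\ v -> f (i ∷ v)) (w ++ y) s) · X-pass j (\ v -> f (i ∷ v)) w y s ps

 X-avoid : ∀ j f w s -> All (Avoid j) w -> X j f w s == + 0
 X-avoid j f w s a = cong (\ z -> X j f z s) (sym (++-identityʳ w)) · X-pass j f w [] s a

 avoid-in : ∀ {p q m i} -> p < q -> q + + m < p + N -> In q m i -> Avoid p i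
 avoid-in {p} {q} {m} {i} a b (within l u) =
  ¬~-gt (Z.<-≤-trans a l) (lin (p & q & i & + m & N & []) (x2 :< x1 :+ x3 & x1 :+ x3 :< x0 :+ x4 & []) (x2 :< x0 :+ x4) u b) ,
  ¬~-gt (lin (p & q & i & []) (x0 :< x1 & x1 =< x2 & []) (x0 :< x2 :+ 1') a l) (lin (p & q & i & + m & N & []) (x2 :< x1 :+ x3 & x1 :+ x3 :< x0 :+ x4 & []) (x2 :+ 1' :< x0 :+ x4) u b)

 X-low : ∀ i f w s -> X i f (i ∷ w) s == X (i +1) (\ v -> f (i ∷ v)) w s + f w s
 X-low i f w s = cong (\ y -> X y (\ v -> f (i ∷ v)) w s) (sg-low i) ⊹ (cong (\ z -> z * f w s) (δ-low {i} ~-refl) · one (f w s))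

 X-high : ∀ i f w s -> X (i +1) f (i ∷ w) s == X i (\ v -> f (i ∷ v)) w s - f w s
 X-high i f w s = cong (\ y -> X y (\ v -> f (i ∷ v)) w s) (sg-high i) ⊹ (cong (\ z -> z * f w s) (δ-high {i} ~-refl) · neg1 (f w s))
  where
  neg1 : ∀ x -> -[1+ 0 ] * x == - x
  neg1 = solve

 -- A word that does not begin with p avoids the class of p and contributes 0. A word p ∷ w
 -- contributes f w and passes `X (p + 1)` on to w. The sum telescopes to all words with one letter
 -- less, except the run of all m letters.
 inc-X : ∀ p m r f s -> m N.≤ k -> inc p m r (\ w -> X p f w s) + full p m (r -¹) (\ w -> f w s) == inc p m (r -¹) (\ w -> f w s)
 inc-X p zero r f s _ = cong (\ z -> z + full p 0 (r -¹) (\ w -> f w s)) (»-0 (r Z.≟ + 0)) · +0ˡ _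
 inc-X p (suc m) r f s m<k = cong (\ z -> z + Fl) (e1 ⊹ e2) · eq I J₀ Fl ·
   cong+ʳ J₀ (inc-X (p +1) m (r -¹) (\ v -> f (p ∷ v)) s (N.<⇒≤ m<k)) · refl
  where
  Fl = full p (suc m) (r -¹) (\ w -> f w s)
  I = inc (p +1) m (r -¹) (\ w -> X (p +1) (\ v -> f (p ∷ v)) w s)
  J₀ = inc (p +1) m (r -¹) (\ w -> f w s)
  eq : ∀ a b c -> + 0 + (a + b) + c == b + (a + c)
  eq = solve
  e1 : inc (p +1) m r (\ w -> X p f w s) == + 0
  e1 = inc-cong (p +1) m r _ (\ _ -> + 0) (\ w a _ -> X-avoid p f w s (All.map (avoid-in (lin (p & []) [] (x0 :< x0 :+ 1')) (lin (p & + m & + k' & []) (1' :+ x1 =< 1' :+ x2 & []) (x0 :+ 1' :+ x1 :< x0 :+ (2' :+ x2)) (Z.+≤+ m<k))) a)) · inc-0 (p +1) m r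
  e2 : inc (p +1) m (r -¹) (\ w -> X p f (p ∷ w) s) == I + J₀
  e2 = inc-ext (p +1) m (r -¹) _ (\ w -> X (p +1) (\ v -> f (p ∷ v)) w s + + 1 * f w s) (\ w -> X-low p f w s · cong+ʳ (X (p +1) (\ v -> f (p ∷ v)) w s) (sym (one (f w s)))) ·
   inc-lin (p +1) m (r -¹) (+ 1) (\ w -> X (p +1) (\ v -> f (p ∷ v)) w s) (\ w -> f w s) · cong+ʳ I (one J₀)

 private
  b+1+m : ∀ b -> b < b +1
  b+1+m b = lin (b & []) [] (x0 :< x0 :+ 1')

 split-far : ∀ {p m v w} -> m N.≤ k -> Split p m v w -> All (\ i -> All (Far i) w) v
 split-far {m = suc m} (s≤s le) d = All.map (All.map (apart-far le)) (split-apart d)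

 -- In a word containing b only that letter is touched, with δ = -1, and its deletion produces, up
 -- to commuting letters, every proper word with one letter less. By `inc-X` the words without b
 -- produce the same words with the opposite sign.
 Ub-X : ∀ b r {f} -> Nice f -> ∀ s -> Ub b r (\ w -> X (b +1) f w s) == + 0
 Ub-X b r {f} nf s = cong+ʳ A e · eq A D Fl · cong2 _-_ (inc-X (b +1) k r f s N.≤-refl) (dsum-inc (b +1) k (r -¹) (\ w -> f w s)) · Z.+-inverseʳ (inc (b +1) k (r -¹) (\ w -> f w s))
  where
  A = inc (b +1) k r (\ w -> X (b +1) f w s)
  D = dsum (b +1) k (r -¹) (\ v w -> f (v ++ w) s)
  Fl = full (b +1) k (r -¹) (\ w -> f w s)
  eq : ∀ a d l -> a + (+ 0 + -[1+ 0 ] * d) == a + l - (d + l)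
  eq = solve
  term : ∀ v w -> Split (b +1) k v w -> X (b +1) f (w ++ b ∷ v) s == + 0 + -1ℤ * f (v ++ w) s
  term v w d = X-pass (b +1) f w (b ∷ v) s (All.map (avoid-in (lin (b & []) [] (x0 :+ 1' :< x0 :+ 1' :+ 1')) (lin (b & + k' & []) [] (x0 :+ 1' :+ 1' :+ x1 :< x0 :+ 1' :+ (2' :+ x1)))) (split-w d)) ·
   X-high b (\ v -> f (w ++ v)) v s · cong2 (\ x y -> x - y) (X-avoid b _ v s (All.map (avoid-in (b+1+m b) (lin (b & + k' & []) [] (x0 :+ 1' :+ x1 :< x0 :+ (2' :+ x1)))) (split-v d))) (comm-end nf v w s (split-far N.≤-refl d)) · eq' (f (v ++ w) s)
   where
   eq' : ∀ x -> + 0 - x == + 0 + -[1+ 0 ] * x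
   eq' = solve
  e : dsum (b +1) k (r -¹) (\ v w -> X (b +1) f (w ++ b ∷ v) s) == + 0 + -1ℤ * D
  e = dsum-cong (b +1) k (r -¹) _ _ term · dsum-lin (b +1) k (r -¹) -1ℤ (\ _ _ -> + 0) (\ v w -> f (v ++ w) s) · cong (\ z -> z + -1ℤ * D) (dsum-0 (b +1) k (r -¹))
   where
   dsum-0 : ∀ p m r -> dsum p m r (\ _ _ -> + 0) == + 0
   dsum-0 p zero r = refl
   dsum-0 p (suc m) r = inc-0 (p +1) m r ⊹ dsum-0 (p +1) m (r -¹)

 -- The word attached to a proper subset of the residues depends on the base only up to commuting
 -- far letters and translating letters by n, and a `Nice` function sees neither.
 Ub-rotate : ∀ b r {f} -> Nice f -> ∀ s -> Ub b r (\ w -> f w s) == Ub (b +1) r (\ w -> f w s)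
 Ub-rotate b r {f} nf s = eq A P B C · sym (i-last ⊹ d-last)
  where
  p = b +1
  A = inc (p +1) k' r (\ w -> f w s)
  P = inc (p +1) k' (r -¹) (\ w -> f (p ∷ w) s)
  B = inc (p +1) k' (r -¹) (\ w -> f (w ++ b ∷ []) s)
  C = dsum (p +1) k' (r -¹ -¹) (\ v w -> f (w ++ b ∷ p ∷ v) s)
  eq : ∀ a p b c -> a + p + (b + c) == a + b + (p + c)
  eq = solve
  wrap : p +1 + + k' == b + + 1 * N
  wrap = lin (b & + k' & []) [] (x0 :+ 1' :+ 1' :+ x1 := x0 :+ (2' :+ x1)) · cong (\ z -> b + z) (sym (Z.*-identityˡ N))
  per′ : ∀ w y -> f (w ++ (p +1 + + k') ∷ y) s == f (w ++ b ∷ y) s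
  per′ w y = cong (\ z -> f (w ++ z ∷ y) s) wrap · nf .per w b (+ 1) y s
  i-last : inc (p +1) k r (\ w -> f w s) == A + B
  i-last = inc-last (p +1) k' r (\ w -> f w s) · cong+ʳ A (inc-ext (p +1) k' (r -¹) _ _ (\ w -> per′ w []))
  Q = dsum (p +1) k' (r -¹) (\ v w -> f (w ++ p ∷ v) s)
  Fl = full (p +1) k' (r -¹) (\ v -> f (p ∷ v) s)
  Q≡ : Q == dsum (p +1) k' (r -¹) (\ v w -> f (p ∷ v ++ w) s)
  Q≡ = dsum-cong (p +1) k' (r -¹) _ _ (\ v w d -> comm-end nf (p ∷ v) w s (split-far {p} N.≤-refl (there d)))
  d-last : dsum (p +1) k (r -¹) (\ v w -> f (w ++ p ∷ v) s) == P + C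
  d-last = dsum-last (p +1) k' (r -¹) (\ v w -> f (w ++ p ∷ v) s) ·
   cong (\ z -> Q + z + Fl) (dsum-cong (p +1) k' (r -¹ -¹) _ (\ v w -> f (w ++ b ∷ p ∷ v) s) (\ v w _ -> cong (\ z -> f z s) (++-assoc w ((p +1 + + k') ∷ []) (p ∷ v)) · per′ w (p ∷ v))) ·
   eq' Q C Fl · cong (\ z -> z + C) (cong (\ z -> z + Fl) Q≡ · dsum-inc (p +1) k' (r -¹) (\ w -> f (p ∷ w) s))
   where
   eq' : ∀ q c l -> q + c + l == q + l + c
   eq' = solve

 Ub-rotate* : ∀ b m r {f} -> Nice f -> ∀ s -> Ub b r (\ w -> f w s) == Ub (b + + m) r (\ w -> f w s)
 Ub-rotate* b zero r {f} nf s = cong (\ z -> Ub z r (\ w -> f w s)) (sym (+0 b))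
 Ub-rotate* b (suc m) r {f} nf s = Ub-rotate b r nf s · Ub-rotate* (b +1) m r nf s · cong (\ z -> Ub z r (\ w -> f w s)) (Z.+-assoc b (+ 1) (+ m))

 Ub-base : ∀ b b' r {f} -> Nice f -> ∀ s -> Ub b r (\ w -> f w s) == Ub b' r (\ w -> f w s)
 Ub-base b b' r {f} nf s with Z.<-cmp b b'
 ... | tri≈ _ refl _ = refl
 ... | tri< l _ _ with gap l
 ...   | e , refl = Ub-rotate* b (suc e) r nf s
 Ub-base b b' r {f} nf s | tri> _ _ l with gap l
 ...   | e , refl = sym (Ub-rotate* b' (suc e) r nf s)

 Ub-X0 : ∀ b j r {f} -> Nice f -> ∀ s -> Ub b r (\ w -> X j f w s) == + 0
 Ub-X0 b j r {f} nf s = Ub-base b (j -¹) r (X-nice j nf) s · Ub-ext (j -¹) r _ _ (\ w -> cong (\ z -> X z f w s) (lin (j & []) [] (x0 := x0 :- 1' :+ 1'))) · Ub-X (j -¹) r nf s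

 record Below (p : ℤ) (m : ℕ) (i : ℤ) : Set where
  constructor below
  field
   lt : i < p
   ge : p + + m ≤ i + N

 -- The derivation walks along the initial run, and `x` collects the letters already passed.
 -- Deleting p breaks the run there, which yields the words of `dsum` whose run is empty at this
 -- point; the induction supplies those with a longer run. The hypothesis on r excludes the word of
 -- all letters, which `dsum` does not contain.
 dsum-X : ∀ p m r {f} -> Nice f -> ∀ x s -> m N.≤ k -> ¬ r == + m -> All (Below p m) x ->
  dsum p m r (\ v w -> X p (\ v' -> f (w ++ x ++ v')) v s) == dsum p m (r -¹) (\ v w -> f (w ++ x ++ v) s)
 dsum-X p zero r nf x s _ _ _ = refl
 dsum-X p (suc m) r {f} nf x s m<k ne bl = inc-0 (p +1) m r ⊹ e · +0ˡ (C + + 1 * D) · cong2 (\ a b -> a + + 1 * b) ih D≡ · eq C' I · refl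
  where
  xp = x ++ p ∷ []
  C = dsum (p +1) m (r -¹) (\ v w -> X (p +1) (\ v' -> f (w ++ x ++ p ∷ v')) v s)
  C' = dsum (p +1) m (r -¹ -¹) (\ v w -> f (w ++ x ++ p ∷ v) s)
  D = dsum (p +1) m (r -¹) (\ v w -> f (w ++ x ++ v) s)
  I = inc (p +1) m (r -¹) (\ w -> f (w ++ x ++ []) s)
  eq : ∀ a b -> a + + 1 * b == b + a
  eq = solve
  assoc : ∀ v -> xp ++ v == x ++ p ∷ v
  assoc v = ++-assoc x (p ∷ []) v
  ne' : ¬ r -¹ == + m
  ne' e = ne (lin (r & + m & []) (x0 :- 1' := x1 & []) (x0 := 1' :+ x1) e)
  bl' : All (Below (p +1) m) xp
  bl' = ++⁺ (All.map (\ {i} (below a b) -> below (lin (i & p & []) (x0 :< x1 & []) (x0 :< x1 :+ 1') a) (lin (i & p & + m & N & []) (x1 :+ (1' :+ x2) =< x0 :+ x3 & []) (x1 :+ 1' :+ x2 =< x0 :+ x3) b)) bl)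
   (below (lin (p & []) [] (x0 :< x0 :+ 1')) (lin (p & + m & + k' & []) (1' :+ x1 =< 1' :+ x2 & []) (x0 :+ 1' :+ x1 =< x0 :+ (2' :+ x2)) (Z.+≤+ m<k)) ∷ [])
  ih : C == C'
  ih = dsum-cong (p +1) m (r -¹) _ _ (\ v w _ -> X-cong (p +1) _ (\ v' -> f (w ++ xp ++ v')) v s (\ v' -> cong (\ z -> f (w ++ z) s) (sym (assoc v')))) ·
   dsum-X (p +1) m (r -¹) nf xp s (N.<⇒≤ m<k) ne' bl' ·
    dsum-cong (p +1) m (r -¹ -¹) _ _ (\ v w _ -> cong (\ z -> f (w ++ z) s) (assoc v))
  e : dsum (p +1) m (r -¹) (\ v w -> X p (\ v' -> f (w ++ x ++ v')) (p ∷ v) s) == C + + 1 * D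
  e = dsum-cong (p +1) m (r -¹) _ _ (\ v w _ -> X-low p (\ v' -> f (w ++ x ++ v')) v s · cong+ʳ (X (p +1) (\ v' -> f (w ++ x ++ p ∷ v')) v s) (sym (one (f (w ++ x ++ v) s)))) ·
   dsum-lin (p +1) m (r -¹) (+ 1) (\ v w -> X (p +1) (\ v' -> f (w ++ x ++ p ∷ v')) v s) (\ v w -> f (w ++ x ++ v) s)
  D≡ : D == I
  D≡ = dsum-cong (p +1) m (r -¹) _ (\ v w -> f ((v ++ w) ++ x ++ []) s) term ·
   sym (cong+ʳ D′ (full-0 (p +1) m (r -¹) (\ w -> f (w ++ x ++ []) s) ne') · +0 D′) · dsum-inc (p +1) m (r -¹) (\ w -> f (w ++ x ++ []) s)
   where
   D′ = dsum (p +1) m (r -¹) (\ v w -> f ((v ++ w) ++ x ++ []) s)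
   far-x : ∀ {i j} -> Below p (suc m) j -> In (p +1) (m ∸ 1) i -> Far j i
   far-x {i} {j} (below a b) (within l u) = apart-far {k'} N.≤-refl
    ( lin (p & i & j & []) (x2 :< x0 & x0 :+ 1' =< x1 & []) (x2 :+ 1' :< x1) a l
    , lem m u b)
    where
    lem : ∀ m -> i < p +1 + + (m ∸ 1) -> p + + suc m ≤ j + N -> i - j ≤ + k'
    lem zero u b = lin⊥ (i & p & []) (x1 :+ 1' =< x0 & x0 :< x1 :+ 1' :+ 0' & []) l u
    lem (suc m) u b = lin (i & j & p & + m & + k' & []) (x0 :< x2 :+ 1' :+ x3 & x2 :+ (2' :+ x3) =< x1 :+ (2' :+ x4) & []) (x0 :- x1 =< x4) u b
   v-in : ∀ {m v w} -> Split (p +1) m v w -> All (In (p +1) (m ∸ 1)) v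
   v-in {suc m} d = split-v d
   term : ∀ v w -> Split (p +1) m v w -> f (w ++ x ++ v) s == f ((v ++ w) ++ x ++ []) s
   term v w d = cong (\ z -> f z s) (cong (\ z -> w ++ x ++ z) (sym (++-identityʳ v)) · refl) ·
    cong (\ z -> f z s) (sym (++-assoc w x (v ++ []))) ·
    comm-words nf [] v (w ++ x) [] s (All.zipWith (\ (p , q) -> ++⁺ p q) (split-far (N.<⇒≤ m<k) d , All.map (\ q -> All.map (\ y -> far-sym (far-x y q)) bl) (v-in d))) ·
    cong (\ z -> f z s) (cong (v ++_) (++-assoc w x []) · sym (++-assoc v w (x ++ [])))

-- The commutation relation for the inverse product of the labels.

module Star (k' : ℕ) where
 open Z using (_≤_)
 open import Defs using (tr)
 open Base k'
 open Strong k'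
 open Pair k'
 open Words k'
 open Balance k'
 open WordSums k'
 open import Data.List.Properties using (++-identityʳ)

 uw : Word -> Fun -> Fun
 uw [] φ = φ
 uw (i ∷ w) φ = u i (uw w φ)

 uw-linear : ∀ w -> Linear (uw w)
 uw-linear [] .ext φ ψ h = h
 uw-linear [] .lin+ c φ ψ s = refl
 uw-linear [] .lin0 s = refl
 uw-linear (i ∷ w) = ∘-linear (u-linear i) (uw-linear w)

 uw-++ : ∀ v w φ -> uw (v ++ w) φ == uw v (uw w φ)
 uw-++ [] w φ = refl
 uw-++ (i ∷ v) w φ = cong (u i) (uw-++ v w φ)

 u-comm : ∀ {i j} -> Far i j -> ∀ φ s -> u i (u j φ) s == u j (u i φ) s
 u-comm {i} {j} (far a b c) φ s = »»-cong (asc? i s) (asc? j _) (asc? j s) (asc? i _)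
  (\ p q -> subst2 _<_ ej ej1 q , subst2 _<_ (sym ei) (sym ei1) p) (\ q p -> subst2 _<_ ei ei1 p , subst2 _<_ (sym ej) (sym ej1) q)
  (\ _ _ -> cong φ (sw-conj (¬~-suc j) (¬~-suc i) s · cong2 (\ x y -> sw i (i +1) (sw x y s)) (sg-o i a b) (sg-o i (c ∘ ~-sym) (a ∘ ~-pred))))
  where
  ej = swap-o i s a b
  ej1 = swap-o i s (c ∘ ~-sym) (a ∘ ~-pred)
  ei = swap-o j s (a ∘ ~-sym) c
  ei1 = swap-o j s (b ∘ ~-sym) (a ∘ ~-sym ∘ ~-pred)

 uw-nice : ∀ φ -> Nice (\ w -> uw w φ)
 uw-nice φ .per v i m w s = cong (\ f -> f s) (uw-++ v ((i + m * N) ∷ w) φ) · uw-linear v .ext _ _ (u-period i m (uw w φ)) s · cong (\ f -> f s) (sym (uw-++ v (i ∷ w) φ))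
 uw-nice φ .comm v i j w s p = cong (\ f -> f s) (uw-++ v (i ∷ j ∷ w) φ) · uw-linear v .ext _ _ (u-comm p (uw w φ)) s · cong (\ f -> f s) (sym (uw-++ v (j ∷ i ∷ w) φ))

 -- U r is the operator adjoint to multiplication by h_r.

 opaque
  U : ℤ -> Fun -> Fun
  U r φ s = Ub (+ 0) r (\ w -> uw w φ s)

  U-base : ∀ b r φ s -> U r φ s == Ub b r (\ w -> uw w φ s)
  U-base b r φ s = Ub-base (+ 0) b r (uw-nice φ) s

 inc-linear : ∀ p m r {A} -> Linear A -> ∀ (f : Fn) s -> inc p m r (\ w -> A (f w) s) == A (\ s -> inc p m r (\ w -> f w s)) s
 inc-linear p zero r {A} a f s with r Z.≟ + 0
 ... | yes _ = refl
 ... | no _ = sym (a .lin0 s)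
 inc-linear p (suc m) r a f s = inc-linear (p +1) m r a f s ⊹ inc-linear (p +1) m (r -¹) a (\ v -> f (p ∷ v)) s · sym (linear-+ a _ _ s)

 dsum-linear : ∀ p m r {A} -> Linear A -> ∀ (h : Word -> Fn) s -> dsum p m r (\ v w -> A (h v w) s) == A (\ s -> dsum p m r (\ v w -> h v w s)) s
 dsum-linear p zero r a h s = sym (a .lin0 s)
 dsum-linear p (suc m) r a h s = inc-linear (p +1) m r a (h []) s ⊹ dsum-linear (p +1) m (r -¹) a (\ v -> h (p ∷ v)) s · sym (linear-+ a _ _ s)

 Ub-linear : ∀ b r {A} -> Linear A -> ∀ (f : Fn) s -> Ub b r (\ w -> A (f w) s) == A (\ s -> Ub b r (\ w -> f w s)) s
 Ub-linear b r a f s = inc-linear (b +1) k r a f s ⊹ dsum-linear (b +1) k (r -¹) a (\ v w -> f (w ++ b ∷ v)) s · sym (linear-+ a _ _ s)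

 Fam : Set
 Fam = ℤ -> Fn

 FamS : Set
 FamS = ℤ -> Fun

 -- A family is a series in y indexed by the exponent, so `F b` is multiplication by 1 - y `G b`.
 -- Integer exponents let m - 1 be written without cases.
 F : ℤ -> Fam -> Fam
 F b f m w s = f m w s - G b (f (m -¹)) w s

 F₀ F⁺ : ℤ -> FamS -> FamS
 F₀ b φ m s = φ m s - Ξ b (φ (m -¹)) s
 F⁺ b φ m s = φ m s + Ξ b (φ (m -¹)) s

 Es : ℤ -> ℕ -> Fam -> Fam
 Es p zero f = f
 Es p (suc L) f = F p (Es (p +1) L f)

 -- The smallest label is outermost in `Es₀` and innermost in `Hs`; with the signs of `F₀` and `F⁺`
 -- this makes the two products inverse to each other.
 Es₀ Hs : ℤ -> ℕ -> FamS -> FamS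
 Es₀ p zero φ = φ
 Es₀ p (suc L) φ = F₀ p (Es₀ (p +1) L φ)
 Hs p zero φ = φ
 Hs p (suc L) φ = Hs (p +1) L (F⁺ p φ)

 Es₀-ext : ∀ p L φ ψ -> (∀ m s -> φ m s == ψ m s) -> ∀ m s -> Es₀ p L φ m s == Es₀ p L ψ m s
 Es₀-ext p zero φ ψ h = h
 Es₀-ext p (suc L) φ ψ h m s = cong2 _-_ (Es₀-ext (p +1) L φ ψ h m s) (T-linear p .ext _ _ (Es₀-ext (p +1) L φ ψ h (m -¹)) s)

 Es-nice : ∀ p L f -> (∀ m -> Nice (f m)) -> ∀ m -> Nice (Es p L f m)
 Es-nice p zero f h m = h m
 Es-nice p (suc L) f h m .per v i c w s = cong2 _-_ (Es-nice (p +1) L f h m .per v i c w s) (G-nice p (Es-nice (p +1) L f h (m -¹)) .per v i c w s)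
 Es-nice p (suc L) f h m .comm v i j w s q = cong2 _-_ (Es-nice (p +1) L f h m .comm v i j w s q) (G-nice p (Es-nice (p +1) L f h (m -¹)) .comm v i j w s q)

 Es-empty : ∀ p L f m s -> Es p L f m [] s == Es₀ p L (\ m -> f m []) m s
 Es-empty p zero f m s = refl
 Es-empty p (suc L) f m s = cong2 _-_ (Es-empty (p +1) L f m s)
  (cong+ʳ (Ξ p (Es (p +1) L f (m -¹) []) s) (»-0 (neg? p s)) · +0 (Ξ p (Es (p +1) L f (m -¹) []) s) · T-linear p .ext _ _ (Es-empty (p +1) L f (m -¹)) s)

 -- Under the sum over cyclic words each factor 1 - y `G p` loses its derivation by `Ub-X0`, and
 -- what is left, 1 - y `Ξ p`, can be moved outside by linearity.
 Ub-Es : ∀ b r p L f -> (∀ m -> Nice (f m)) -> ∀ m s -> Ub b r (\ w -> Es p L f m w s) == Es₀ p L (\ m s -> Ub b r (\ w -> f m w s)) m s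
 Ub-Es b r p zero f h m s = refl
 Ub-Es b r p (suc L) f h m s = Ub-ext b r _ (\ w -> g m w s + -1ℤ * (Ξ p (g (m -¹) w) s + + 1 * Ng p (X p (g (m -¹)) w) s)) (\ w -> eq (g m w s) (Ξ p (g (m -¹) w) s) (Ng p (X p (g (m -¹)) w) s)) ·
  Ub-lin b r -1ℤ (\ w -> g m w s) (\ w -> Ξ p (g (m -¹) w) s + + 1 * Ng p (X p (g (m -¹)) w) s) ·
  cong2 (\ x y -> x + -1ℤ * y) (Ub-Es b r (p +1) L f h m s) (Ub-lin b r (+ 1) (\ w -> Ξ p (g (m -¹) w) s) (\ w -> Ng p (X p (g (m -¹)) w) s) · cong2 (\ x y -> x + + 1 * y) (Ub-linear b r (T-linear p) (g (m -¹)) s · T-linear p .ext _ _ (Ub-Es b r (p +1) L f h (m -¹)) s)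
    (Ub-linear b r (Ng-linear p) (X p (g (m -¹))) s · Ng-linear p .ext _ (\ _ -> + 0) (Ub-X0 b p r (Es-nice (p +1) L f h (m -¹))) s · »-0 (neg? p s))) ·
  eq' (Es₀ (p +1) L (\ m s -> Ub b r (\ w -> f m w s)) m s) (Ξ p (Es₀ (p +1) L (\ m s -> Ub b r (\ w -> f m w s)) (m -¹)) s)
  where
  g = Es (p +1) L f
  eq : ∀ a t x -> a - (t + x) == a + -[1+ 0 ] * (t + + 1 * x)
  eq = solve
  eq' : ∀ a t -> a + -[1+ 0 ] * (t + + 1 * + 0) == a - t
  eq' = solve

 Es-snoc : ∀ p L f -> Es p (suc L) f == Es p L (F (p + + L) f)
 Es-snoc p zero f = cong (\ z -> F z f) (sym (+0 p))
 Es-snoc p (suc L) f = cong (F p) (Es-snoc (p +1) L f · cong (\ z -> Es (p +1) L (F z f)) (Z.+-assoc p (+ 1) (+ L)))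

 -- A cover starts at a nonnegative and ends at a negative position, so on such a state all covers
 -- lie strictly between `lo` and `hi`, and finitely many labels suffice.
 record Bd (lo hi : ℤ) (s : State) : Set where
  constructor bd
  field
   low  : ∀ j -> j ≤ lo -> hv s j < + 0
   high : ∀ j -> hi ≤ j -> + 0 ≤ hv s j
 open Bd public

 dist : ∀ b d -> d N.< k -> (b - + suc d < b) × (b < b - + suc d + N)
 dist b d d<k = lin (b & + d & []) (0' =< x1 & []) (x0 :- (1' :+ x1) :< x0) 0≤+ , lin (b & + d & N & []) (1' :+ x1 :< x2 & []) (x0 :< x0 :- (1' :+ x1) :+ x2) (Z.+<+ (s≤s d<k))

 mul-sign : ∀ {a c m} -> a + m * N < a + c -> c ≤ + 0 -> m < + 0
 mul-sign {a} {c} {m} p q with m Z.<? + 0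
 ... | yes r = r
 ... | no ¬r = lin⊥ (a & c & m * N & []) (x0 :+ x2 :< x0 :+ x1 & x1 =< 0' & 0' =< x2 & []) p q (subst (_≤ m * N) (Z.*-zeroˡ N) (Z.*-monoʳ-≤-nonNeg N (Z.≮⇒≥ ¬r)))

 Bd-stable : ∀ lo hi b d s -> d N.< k -> Bd lo hi s -> Cover (b - + suc d) b s -> Bd lo hi (sw (b - + suc d) b s)
 Bd-stable lo hi b d s d<k (bd l h) c = bd low′ high′
  where
  a = b - + suc d
  a<b = fst (dist b d d<k)
  nab = ¬~-lt a<b (snd (dist b d d<k))
  lo<a : lo < a
  lo<a = Z.≰⇒> (\ p -> Z.≤⇒≯ (pos c) (l a p))
  b<hi : b < hi
  b<hi = Z.≰⇒> (\ p -> Z.≤⇒≯ (h b p) (neg c))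
  at : ∀ j -> hv (sw a b s) j == hv s (tr k a b j)
  at = hv-sw a b nab s
  low′ : ∀ j -> j ≤ lo -> hv (sw a b s) j < + 0
  low′ j p with cases a b j
  ... | other na nb = subst (_< + 0) (sym (at j · cong (hv s) (tr-o a b na nb))) (l j p)
  ... | is-b m refl = subst (_< + 0) (sym (at j · cong (hv s) (tr-b a b m nab))) (l (a + m * N) (lin (a & b & m * N & lo & []) (x0 :< x1 & x1 :+ x2 =< x3 & []) (x0 :+ x2 =< x3) a<b p))
  ... | is-a m refl = subst (_< + 0) (sym (at j · cong (hv s) (tr-a a b m) · hv-shift s b m)) (lin (hv s b & m & []) (x0 :< 0' & x1 :< 0' & []) (x0 :+ x1 :< 0') (neg c)
      (mul-sign {a} {+ 0} (lin (a & m * N & lo & []) (x0 :+ x1 =< x2 & x2 :< x0 & []) (x0 :+ x1 :< x0 :+ 0') p lo<a) Z.≤-refl))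
  high′ : ∀ j -> hi ≤ j -> + 0 ≤ hv (sw a b s) j
  high′ j p with cases a b j
  ... | other na nb = subst (+ 0 ≤_) (sym (at j · cong (hv s) (tr-o a b na nb))) (h j p)
  ... | is-a m refl = subst (+ 0 ≤_) (sym (at j · cong (hv s) (tr-a a b m))) (h (b + m * N) (lin (a & b & m * N & hi & []) (x0 :< x1 & x3 =< x0 :+ x2 & []) (x3 =< x1 :+ x2) a<b p))
  ... | is-b m refl with m Z.<? + 0
  ...   | yes q = lin⊥ (b & hi & m * N & N & []) (x0 :< x1 & x1 =< x0 :+ x2 & x2 :+ x3 =< 0' & 0' :< x3 & []) b<hi p (mulN-< q) 0<N
  ...   | no ¬q = subst (+ 0 ≤_) (sym (at j · cong (hv s) (tr-b a b m nab) · hv-shift s a m)) (lin (hv s a & m & []) (0' =< x0 & 0' =< x1 & []) (0' =< x0 :+ x1) (pos c) (Z.≮⇒≥ ¬q))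

 sw-adj : ∀ i s j -> Σ ℤ \ j' -> hv (sw i (i +1) s) j == hv s j' × j -¹ ≤ j' × j' ≤ j +1
 sw-adj i s j with cases i (i +1) j
 ... | other a b = j , swap-o i s a b , lin (j & []) [] (x0 :- 1' =< x0) , lin (j & []) [] (x0 =< x0 :+ 1')
 ... | is-a m refl = i +1 + m * N , hv-sw i (i +1) (¬~-suc i) s _ · cong (hv s) (tr-a i (i +1) m) , lin (i & m * N & []) [] (x0 :+ x1 :- 1' =< x0 :+ 1' :+ x1) , lin (i & m * N & []) [] (x0 :+ 1' :+ x1 =< x0 :+ x1 :+ 1')
 ... | is-b m refl = i + m * N , hv-sw i (i +1) (¬~-suc i) s _ · cong (hv s) (tr-b i (i +1) m (¬~-suc i)) , lin (i & m * N & []) [] (x0 :+ 1' :+ x1 :- 1' =< x0 :+ x1) , lin (i & m * N & []) [] (x0 :+ x1 =< x0 :+ 1' :+ x1 :+ 1')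

 -- A weak step moves each value by at most one position, so it costs one unit of slack on both
 -- sides.
 Bd-swap : ∀ i lo hi c s -> Bd (lo + + suc c) (hi - + suc c) s -> Bd (lo + + c) (hi - + c) (sw i (i +1) s)
 Bd-swap i lo hi c s (bd l h) = bd
  (\ j p -> let (j' , e , _ , q) = sw-adj i s j in subst (_< + 0) (sym e) (l j' (lin (j & j' & lo & + c & []) (x0 =< x2 :+ x3 & x1 =< x0 :+ 1' & []) (x1 =< x2 :+ (1' :+ x3)) p q)))
  (\ j p -> let (j' , e , q , _) = sw-adj i s j in subst (+ 0 ≤_) (sym e) (h j' (lin (j & j' & hi & + c & []) (x2 :- x3 =< x0 & x0 :- 1' =< x1 & []) (x2 :- (1' :+ x3) =< x1) p q)))

 Bd-weaken : ∀ lo hi c c' s -> c' N.≤ c -> Bd (lo + + c) (hi - + c) s -> Bd (lo + + c') (hi - + c') s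
 Bd-weaken lo hi c c' s le (bd l h) = bd (\ j p -> l j (lin (j & lo & + c & + c' & []) (x0 =< x1 :+ x3 & x3 =< x2 & []) (x0 =< x1 :+ x2) p (Z.+≤+ le)))
  (\ j p -> h j (lin (j & hi & + c & + c' & []) (x1 :- x3 =< x0 & x3 =< x2 & []) (x1 :- x2 =< x0) p (Z.+≤+ le)))

 uw-cong-Bd : ∀ lo hi c w φ ψ s -> length w N.≤ c -> Bd (lo + + c) (hi - + c) s -> (∀ s -> Bd (lo + + (c ∸ length w)) (hi - + (c ∸ length w)) s -> φ s == ψ s) -> uw w φ s == uw w ψ s
 uw-cong-Bd lo hi c [] φ ψ s le B h = h s B
 uw-cong-Bd lo hi (suc c) (i ∷ w) φ ψ s (s≤s le) B h = u-cong i (uw w φ) (uw w ψ) s (\ _ -> uw-cong-Bd lo hi c w φ ψ _ le (Bd-swap i lo hi c s B) h)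

 -- The range of labels is b + 1, …, b + L with n dividing L.

 module Range (b : ℤ) (M : ℕ) where
  L' : ℕ
  L' = suc (suc (k' N.+ M N.* n)) ∸ 1
  L = suc L'
  lo hi : ℤ
  lo = b +1
  hi = lo + + L'

  -- `L` equals (M + 1) n. The range begins just after b and ends in the class of b, so the pair of
  -- residues b, b + 1 is the only one split by its ends.
  hi~ : b ~ hi
  hi~ = + suc M , lin (b & + k' & + (M N.* n) & []) [] (x0 :+ 1' :+ (1' :+ (x1 :+ x2)) := x0 :+ (2' :+ x1) :+ x2) · cong (\ z -> b + N + z) (Z.pos-* M n) · eq b N (+ M)
   where
   eq : ∀ b N M -> b + N + M * N == b + (+ 1 + M) * N
   eq = solve

  B₀ : State -> Set
  B₀ = Bd lo hi

  Balf : ℤ -> Fam -> Set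
  Balf i f = ∀ m -> Bal B₀ (Bd-stable lo hi) i (f m)

  F-far : ∀ i p f -> ¬ i ~ p -> ¬ i +1 ~ p -> Balf i f -> Balf i (F p f)
  F-far i p f a c h m w s B = cong2 _-_ (h m w s B) (G-far B₀ (Bd-stable lo hi) i (f (m -¹)) (h (m -¹)) p a c w s B) ·
   sym (linear-minus (u-linear i) (f m w) (G p (f (m -¹)) w) s)

  -- Expanding the two factors in y leaves a linear and a quadratic coefficient, which are `G-pair`
  -- and `G-pair²`.
  F-pair : ∀ i f -> Balf i f -> Balf i (F i (F (i +1) f))
  F-pair i f h m w s B = expand (i ∷ w) s · cong2 _-_ (h m w s B) (G-pair B₀ st i (f (m -¹)) (h (m -¹)) w s B) ⊹ G-pair² B₀ st i (f (m -¹ -¹)) (h (m -¹ -¹)) w s B ·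
   sym (u-linear i .ext _ _ (expand w) s · linear-+ (u-linear i) (\ s -> f m w s - (G i f₁ w s + G (i +1) f₁ w s)) (G i (G (i +1) f₂) w) s · cong (\ z -> z + u i (G i (G (i +1) f₂) w) s) (linear-minus (u-linear i) (f m w) (\ s -> G i f₁ w s + G (i +1) f₁ w s) s))
   where
   st = Bd-stable lo hi
   f₁ = f (m -¹)
   f₂ = f (m -¹ -¹)
   G-minus : ∀ f g w s -> G i (\ w s -> f w s - g w s) w s == G i f w s - G i g w s
   G-minus f g w s = linear-minus (T-linear i) (f w) (g w) s ⊹ (»-val (neg? i s) (\ _ -> X-minus i f g w s) · »-minus (neg? i s) (X i f w s) (X i g w s)) · eq (Ξ i (f w) s) (Ξ i (g w) s) (Ng i (X i f w) s) (Ng i (X i g w) s)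
    where
    eq : ∀ a b c d -> a - b + (c - d) == a + c - (b + d)
    eq = solve
   expand : ∀ w s -> F i (F (i +1) f) m w s == f m w s - (G i f₁ w s + G (i +1) f₁ w s) + G i (G (i +1) f₂) w s
   expand w s = cong (\ z -> f m w s - G (i +1) f₁ w s - z) (G-minus f₁ (G (i +1) f₂) w s) · eq (f m w s) (G (i +1) f₁ w s) (G i f₁ w s) (G i (G (i +1) f₂) w s)
    where
    eq : ∀ a x y z -> a - x - (y - z) == a - (y + x) + z
    eq = solve

  Balf-~ : ∀ {i j} f -> (∀ m -> Nice (f m)) -> i ~ j -> Balf i f -> Balf j f
  Balf-~ {i} f nf (c , refl) h m w s B = nf m .per [] i c w s · h m w s B · sym (u-period i c (f m w) s)

  -- Factors in the classes of i and i + 1 stand next to each other and are treated together by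
  -- `F-pair`, all others singly by `F-far`. The two incongruences say that neither end of the range
  -- tears such a pair apart.
  Es-bal : ∀ i L p f -> (∀ m -> Nice (f m)) -> Balf i f -> ¬ i +1 ~ p -> ¬ i +1 ~ p + + L -> Balf i (Es p L f)
  Es-bal i zero p f nf h a c = h
  Es-bal i (suc L) p f nf h a c with i ~? p
  ... | no ne = F-far i p (Es (p +1) L f) ne a (Es-bal i L (p +1) f nf h (ne ∘ ~-pred) (\ e -> c (subst (i +1 ~_) (Z.+-assoc p (+ 1) (+ L)) e)))
  Es-bal i (suc zero) p f nf h a c | yes e = exfalso (c (~-+ (+ 1) e))
  Es-bal i (suc (suc L)) p f nf h a c | yes e = Balf-~ _ (Es-nice p (suc (suc L)) f nf) (~-sym e) (F-pair p (Es (p +1 +1) L f) (Balf-~ _ (Es-nice (p +1 +1) L f nf) e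
    (Es-bal i L (p +1 +1) f nf h (\ e' -> ¬~-suc (p +1) (~-trans (~-sym (~-+ (+ 1) e)) e')) (\ e' -> c (subst (i +1 ~_) (lin (p & + L & []) [] (x0 :+ 1' :+ 1' :+ x1 := x0 :+ (2' :+ x1))) e')))))

  module _ (Φ : FamS) where
   f₀ : Fam
   f₀ m w = uw w (Φ m)

   private
    nf₀ : ∀ m -> Nice (f₀ m)
    nf₀ m = uw-nice (Φ m)
    g g' : Fam
    g = Es lo L f₀
    g' = Es (lo +1) L' f₀
    ng' : ∀ m -> Nice (g' m)
    ng' = Es-nice (lo +1) L' f₀ nf₀

    end~ : ∀ i -> i +1 ~ lo + + L -> i ~ b
    end~ i e = ~-pred (~-trans e (subst (_~ lo) (lin (lo & + L' & []) [] (x0 :+ x1 :+ 1' := x0 :+ (1' :+ x1))) (~-sym (~-+ (+ 1) hi~))))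

    bal-g : ∀ i -> ¬ i ~ b -> Balf i g
    bal-g i ne = Es-bal i L lo f₀ nf₀ (\ m w s _ -> refl) (ne ∘ ~-pred) (ne ∘ end~ i)

    bal-g' : ∀ i -> ¬ i ~ b -> ¬ i ~ lo -> Balf i g'
    bal-g' i ne ne' = Es-bal i L' (lo +1) f₀ nf₀ (\ m w s _ -> refl) (ne' ∘ ~-pred) (\ e -> ne (end~ i (subst (i +1 ~_) (Z.+-assoc lo (+ 1) (+ L')) e)))

    -- At the right end h is nonnegative at `hi` before the step at b and also after it, where the
    -- value comes from `hi` + 1. So `F hi` acts as the identity on both sides.
    top : Balf b (F hi f₀)
    top m w s B = triv (b ∷ w) s (high B hi Z.≤-refl) · u-cong b (f₀ m w) (F hi f₀ m w) s (\ _ -> sym (triv w _ (subst (+ 0 ≤_) (sym e) (high B (hi +1) (lin (hi & []) [] (x0 =< x0 :+ 1'))))))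
     where
     triv : ∀ w s -> + 0 ≤ hv s hi -> F hi f₀ m w s == f₀ m w s
     triv w s p = cong (\ z -> f₀ m w s - z) (Ʃ-zero k (\ d _ -> Tt-no (hi - + suc d) hi (f₀ (m -¹) w) s (\ c -> Z.≤⇒≯ p (neg c))) ⊹ »-no (neg? hi s) (Z.≤⇒≯ p)) · +0 (f₀ m w s)
     e : hv (sw b (b +1) s) hi == hv s (hi +1)
     e = help hi~
      where
      help : ∀ {h} -> b ~ h -> hv (sw b (b +1) s) h == hv s (h +1)
      help (c , refl) = hv-sw b (b +1) (¬~-suc b) s _ · cong (hv s) (tr-a b (b +1) c · lin (b & c * N & []) [] (x0 :+ 1' :+ x1 := x0 :+ x1 :+ 1'))

    bal-b : Balf b g'
    bal-b = subst (Balf b) (sym (Es-snoc (lo +1) (k' N.+ M N.* n) f₀ · cong (\ z -> Es (lo +1) (k' N.+ M N.* n) (F z f₀)) hi≡))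
     (Es-bal b (k' N.+ M N.* n) (lo +1) (F hi f₀) (Es-nice hi 1 f₀ nf₀) top (¬~-suc lo) (\ e -> ¬~-suc b (~-trans hi~ (~-sym (subst (b +1 ~_) hi≡ e)))))
     where
     hi≡ : lo +1 + + (k' N.+ M N.* n) == hi
     hi≡ = Z.+-assoc lo (+ 1) (+ (k' N.+ M N.* n))

    -- At the left end no cover has the label `lo`, while h `lo` is negative, so of `G lo` only the
    -- derivation remains. This remainder is the reason why `g`, unlike `g'`, is not balanced at b.
    g≡ : ∀ m w s -> B₀ s -> g m w s == g' m w s - X lo (g' (m -¹)) w s
    g≡ m w s B = cong (\ z -> g' m w s - z) (Ʃ-zero k (\ d d<k -> Tt-no (lo - + suc d) lo (g' (m -¹) w) s (\ c -> Z.≤⇒≯ (pos c) (low B _ (Z.<⇒≤ (fst (dist lo d d<k)))))) ⊹ »-yes (neg? lo s) (low B lo Z.≤-refl) · +0ˡ _)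

    B+ : ℕ -> State -> Set
    B+ c = Bd (lo + + c) (hi - + c)
    B0 : ∀ {c} {s} -> B+ c s -> B₀ s
    B0 {c} {s} B = subst2 (\ x y -> Bd x y s) (+0 lo) (+0 hi) (Bd-weaken lo hi c 0 s z≤n B)

    uw-bal : ∀ (h : Fam) (Q : ℤ -> Set) -> (∀ i -> Q i -> Balf i h) -> ∀ m w y s c -> All Q w -> length w N.≤ c -> B+ c s -> uw w (h m y) s == h m (w ++ y) s
    uw-bal h Q bq m [] y s c _ _ B = refl
    uw-bal h Q bq m (i ∷ w) y s (suc c) (q ∷ qs) (s≤s le) B = u-cong i (uw w (h m y)) (h m (w ++ y)) s (\ _ -> uw-bal h Q bq m w y _ c qs le (Bd-swap i lo hi c s B)) · sym (bq i q m (w ++ y) s (B0 B))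

    av : ∀ {i} -> In (b +1) k i -> ¬ i ~ b
    av (within l u) = ¬~-gt (lin (b & _ & []) (x0 :+ 1' =< x1 & []) (x0 :< x1) l) (lin (b & _ & + k' & []) (x1 :< x0 :+ 1' :+ (1' :+ x2) & []) (x1 :< x0 :+ (2' :+ x2)) u)
    av' : ∀ {i} -> In (lo +1) k' i -> ¬ i ~ b × ¬ i ~ lo
    av' {i} q@(within l u) = av (in-suc q) , ¬~-gt (lin (lo & i & []) (x0 :+ 1' =< x1 & []) (x0 :< x1) l) (lin (lo & i & + k' & []) (x1 :< x0 :+ 1' :+ x2 & []) (x1 :< x0 :+ (2' :+ x2)) u)

    -- `g'` is balanced at b, so the failure comes only from `X lo`. As `lo` = b + 1, the letter b
    -- has δ = -1 there and leaves the extra term `g' (m − 1) v`; the derivation of the rest of b ∷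
    -- v vanishes because v avoids the class of b.
    step-b : ∀ m v s c -> All (In lo k') v -> B+ (suc c) s -> u b (g m v) s == g m (b ∷ v) s - g' (m -¹) v s - u b (X lo (g' (m -¹)) v) s
    step-b m v s c a B = u-cong b (g m v) (\ s -> g' m v s - X lo (g' (m -¹)) v s) s (\ _ -> g≡ m v _ (B0 (Bd-swap b lo hi c s B))) ·
     linear-minus (u-linear b) (g' m v) (X lo (g' (m -¹)) v) s ·
     eq (u b (g' m v) s) (g' (m -¹) v s) (u b (X lo (g' (m -¹)) v) s) · cong (\ z -> z - g' (m -¹) v s - u b (X lo (g' (m -¹)) v) s) (sym gb)
     where
     eq : ∀ a y z -> a - z == a - (+ 0 - y) - y - z
     eq = solve
     gb : g m (b ∷ v) s == u b (g' m v) s - (+ 0 - g' (m -¹) v s)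
     gb = g≡ m (b ∷ v) s (B0 B) · cong2 _-_ (bal-b m v s (B0 B)) (X-high b (g' (m -¹)) v s · cong (\ z -> z - g' (m -¹) v s) (X-avoid b _ v s (All.map (avoid-in (lin (b & []) [] (x0 :< x0 :+ 1')) (lin (b & + k' & []) [] (x0 :+ 1' :+ x1 :< x0 :+ (2' :+ x1)))) a)))

    term : ∀ m v w s c -> Split lo k v w -> B+ (k N.+ c) s -> uw (w ++ b ∷ v) (g m []) s == g m (w ++ b ∷ v) s + -1ℤ * (g' (m -¹) (w ++ v) s + + 1 * X lo (\ v' -> g' (m -¹) (w ++ b ∷ v')) v s)
    term m v w s c d B = cong (\ f -> f s) (uw-++ w (b ∷ v) (g m [])) · uw-cong-Bd lo hi (k N.+ c) w _ R s lw B inner ·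
      linear-minus (uw-linear w) (\ s -> g m (b ∷ v) s - g' (m -¹) v s) (u b (X lo (g' (m -¹)) v)) s ·
      cong2 _-_ (linear-minus (uw-linear w) (g m (b ∷ v)) (g' (m -¹) v) s · cong2 _-_ (uw-bal g _ bal-g m w (b ∷ v) s (k N.+ c) (All.map (fst ∘ av') (split-w d)) lw B) (w-g' v)) e3 ·
       eq (g m (w ++ b ∷ v) s) (g' (m -¹) (w ++ v) s) (X lo (\ v' -> g' (m -¹) (w ++ b ∷ v')) v s)
     where
     R : Fun
     R s = g m (b ∷ v) s - g' (m -¹) v s - u b (X lo (g' (m -¹)) v) s
     eq : ∀ a y z -> a - y - z == a + -[1+ 0 ] * (y + + 1 * z)
     eq = solve
     len : length v N.+ length w N.< k
     len = split-length d
     lw : length w N.≤ k N.+ c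
     lw = N.≤-trans (N.m≤n+m (length w) (length v)) (N.≤-trans (N.<⇒≤ len) (N.m≤m+n k c))
     rest : suc (length v) N.≤ k N.+ c ∸ length w
     rest = N.m+n≤o⇒m≤o∸n (suc (length v)) (N.≤-trans len (N.m≤m+n k c))
     inner : ∀ s -> B+ (k N.+ c ∸ length w) s -> u b (uw v (g m [])) s == R s
     inner s B' = u-cong b (uw v (g m [])) (g m v) s (\ _ -> uw-bal g _ bal-g m v [] _ (length v) (All.map (av ∘ wk) (split-v d)) N.≤-refl (Bd-swap b lo hi (length v) s (Bd-weaken lo hi _ _ s rest B')) · cong (\ z -> g m z _) (++-identityʳ v)) ·
      step-b m v s (length v) (split-v d) (Bd-weaken lo hi _ _ s rest B')
      where
      wk : ∀ {i} -> In lo k' i -> In lo k i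
      wk {i} (within l u) = within l (lin (lo & i & + k' & []) (x1 :< x0 :+ x2 & []) (x1 :< x0 :+ (1' :+ x2)) u)
     w-g' : ∀ y -> uw w (g' (m -¹) y) s == g' (m -¹) (w ++ y) s
     w-g' y = uw-bal g' _ (\ i (p , q) -> bal-g' i p q) (m -¹) w y s (k N.+ c) (All.map av' (split-w d)) lw B
     e3 : uw w (u b (X lo (g' (m -¹)) v)) s == X lo (\ v' -> g' (m -¹) (w ++ b ∷ v')) v s
     e3 = sym (X-linear (∘-linear (uw-linear w) (u-linear b)) lo (g' (m -¹)) v s) · X-cong lo _ _ v s (\ y ->
      uw-cong-Bd lo hi (k N.+ c) w _ (g' (m -¹) (b ∷ y)) s lw B (\ s B' -> sym (bal-b (m -¹) y s (B0 B'))) · w-g' (b ∷ y))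

   -- Words without b see a balanced `g`. A word w ++ b ∷ v meets the defect of `step-b` once; its
   -- two terms sum, by `dsum-inc` and by `dsum-X`, to the words of `Ub b (r − 1)` without and with
   -- b. Excluding r = k + 1 excludes the full run in both. The slack k + c pays for at most k weak
   -- steps.
   starE : ∀ r m s c -> ¬ r == + suc k -> Bd (lo + + (k N.+ c)) (hi - + (k N.+ c)) s ->
    U r (Es₀ lo L Φ m) s == Es₀ lo L (\ m -> U r (Φ m)) m s - Es₀ lo L (\ m -> U (r -¹) (Φ m)) (m -¹) s
   starE r m s c ne B = U-base b r (Es₀ lo L Φ m) s · Ub-ext b r _ _ (\ w -> uw-linear w .ext _ _ (\ s -> sym (Es-empty lo L f₀ m s)) s) ·
    e1 ⊹ e2 · eq (inc lo k r (\ w -> g m w s)) (dsum lo k (r -¹) (\ v w -> g m (w ++ b ∷ v) s)) I' D' · cong2 _-_ (toE r m) e4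
    where
    m' = m -¹
    I' = inc lo k (r -¹) (\ w -> g' m' w s)
    D' = dsum lo k (r -¹ -¹) (\ v w -> g' m' (w ++ b ∷ v) s)
    eq : ∀ a d x y -> a + (d + -[1+ 0 ] * (x + + 1 * y)) == a + d - (x + y)
    eq = solve
    e1 : inc lo k r (\ w -> uw w (g m []) s) == inc lo k r (\ w -> g m w s)
    e1 = inc-cong lo k r _ _ (\ w a l -> uw-bal g _ bal-g m w [] s (k N.+ c) (All.map av a) (N.≤-trans l (N.m≤m+n k c)) B · cong (\ z -> g m z s) (++-identityʳ w))
    ne' : ¬ r -¹ == + k
    ne' e = ne (lin (r & + k' & []) (x0 :- 1' := 1' :+ x1 & []) (x0 := 2' :+ x1) e)
    D₁ = dsum lo k (r -¹) (\ v w -> g' m' (w ++ v) s)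
    d₁ : D₁ == I'
    d₁ = dsum-cong lo k (r -¹) _ _ (\ v w d -> comm-end (ng' m') v w s (split-far N.≤-refl d)) · sym (cong+ʳ D₂ (full-0 lo k (r -¹) (\ w -> g' m' w s) ne') · +0 D₂) · dsum-inc lo k (r -¹) (\ w -> g' m' w s)
     where
     D₂ = dsum lo k (r -¹) (\ v w -> g' m' (v ++ w) s)
    e2 : dsum lo k (r -¹) (\ v w -> uw (w ++ b ∷ v) (g m []) s) == dsum lo k (r -¹) (\ v w -> g m (w ++ b ∷ v) s) + -1ℤ * (I' + + 1 * D')
    e2 = dsum-cong lo k (r -¹) _ _ (\ v w d -> term m v w s c d B) · dsum-lin lo k (r -¹) -1ℤ (\ v w -> g m (w ++ b ∷ v) s) (\ v w -> g' m' (w ++ v) s + + 1 * X lo (\ v' -> g' m' (w ++ b ∷ v')) v s) ·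
     cong (\ z -> dsum lo k (r -¹) (\ v w -> g m (w ++ b ∷ v) s) + -1ℤ * z) (dsum-lin lo k (r -¹) (+ 1) (\ v w -> g' m' (w ++ v) s) (\ v w -> X lo (\ v' -> g' m' (w ++ b ∷ v')) v s) ·
      cong2 (\ x y -> x + + 1 * y) d₁ (dsum-X lo k (r -¹) (ng' m') (b ∷ []) s N.≤-refl ne' (below (lin (b & []) [] (x0 :< x0 :+ 1')) (lin (b & + k' & []) [] (x0 :+ 1' :+ (1' :+ x1) =< x0 :+ (2' :+ x1))) ∷ [])))
    toE : ∀ r m -> Ub b r (\ w -> g m w s) == Es₀ lo L (\ m -> U r (Φ m)) m s
    toE r m = Ub-Es b r lo L f₀ nf₀ m s · Es₀-ext lo L _ _ (\ m s -> sym (U-base b r (Φ m) s)) m s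
    e4 : I' + D' == Es₀ lo L (\ m -> U (r -¹) (Φ m)) m' s
    e4 = sym (Ub-ext b (r -¹) _ (\ w -> g' m' w s + -1ℤ * X lo (g' (m' -¹)) w s) (\ w -> g≡ m' w s (B0 B) · sym (minus-one (g' m' w s) (X lo (g' (m' -¹)) w s))) ·
     Ub-lin b (r -¹) -1ℤ (\ w -> g' m' w s) (\ w -> X lo (g' (m' -¹)) w s) · cong (\ z -> I' + D' + -1ℤ * z) (Ub-X0 b lo (r -¹) (ng' (m' -¹)) s) · +0 (I' + D')) · toE (r -¹) m'

-- Inversion of the relation, and products of the `U r` at the bottom state.

module StarH (k' : ℕ) where
 open Z using (_≤_)
 open Base k'
 open Strong k'
 open Words k'
 open Balance k'
 open WordSums k'
 open Star k'
 open import Data.List.Properties using (length-++)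

 -- Removing a cover with label b puts a nonnegative value at b, while a second such cover would
 -- require a negative one.
 T-T : ∀ b φ s -> Ξ b (Ξ b φ) s == + 0
 T-T b φ s = Ʃ-zero k (\ d d<k -> Tt-vanish (b - + suc d) b (Ξ b φ) s (\ c -> Ʃ-zero k (\ d' _ -> Tt-no (b - + suc d') b φ _ (\ c' ->
  Z.≤⇒≯ (subst (+ 0 ≤_) (sym (hv-sw-b (¬~-lt (fst (dist b d d<k)) (snd (dist b d d<k))) s)) (pos c)) (neg c')))))

 F⁺-F₀ : ∀ p φ m s -> F⁺ p (F₀ p φ) m s == φ m s
 F⁺-F₀ p φ m s = cong+ʳ (F₀ p φ m s) (linear-minus (T-linear p) (φ (m -¹)) (Ξ p (φ (m -¹ -¹))) s · cong (\ z -> Ξ p (φ (m -¹)) s - z) (T-T p (φ (m -¹ -¹)) s)) · eq (φ m s) (Ξ p (φ (m -¹)) s)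
  where
  eq : ∀ a t -> a - t + (t - + 0) == a
  eq = solve

 F₀-F⁺ : ∀ p φ m s -> F₀ p (F⁺ p φ) m s == φ m s
 F₀-F⁺ p φ m s = cong (\ z -> F⁺ p φ m s - z) (linear-+ (T-linear p) (φ (m -¹)) (Ξ p (φ (m -¹ -¹))) s · cong+ʳ (Ξ p (φ (m -¹)) s) (T-T p (φ (m -¹ -¹)) s)) · eq (φ m s) (Ξ p (φ (m -¹)) s)
  where
  eq : ∀ a t -> a + t - (t + + 0) == a
  eq = solve

 Hs-cong : ∀ (B : State -> Set) -> (∀ b d s -> d N.< k -> B s -> Cover (b - + suc d) b s -> B (sw (b - + suc d) b s)) ->
  ∀ p L φ ψ -> (∀ m s -> B s -> φ m s == ψ m s) -> ∀ m s -> B s -> Hs p L φ m s == Hs p L ψ m s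
 Hs-cong B st p zero φ ψ h = h
 Hs-cong B st p (suc L) φ ψ h = Hs-cong B st (p +1) L _ _ (\ m s b -> h m s b ⊹ T-cong B p _ _ s (\ d d<k -> st p d s d<k b) (h (m -¹)))

 Hs-ext : ∀ p L φ ψ -> (∀ m s -> φ m s == ψ m s) -> ∀ m s -> Hs p L φ m s == Hs p L ψ m s
 Hs-ext p zero φ ψ h = h
 Hs-ext p (suc L) φ ψ h = Hs-ext (p +1) L _ _ (\ m s -> h m s ⊹ T-linear p .ext _ _ (h (m -¹)) s)

 Hs-Es : ∀ p L Φ m s -> Hs p L (Es₀ p L Φ) m s == Φ m s
 Hs-Es p zero Φ m s = refl
 Hs-Es p (suc L) Φ m s = Hs-ext (p +1) L _ _ (F⁺-F₀ p (Es₀ (p +1) L Φ)) m s · Hs-Es (p +1) L Φ m s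

 Es-Hs : ∀ p L Φ m s -> Es₀ p L (Hs p L Φ) m s == Φ m s
 Es-Hs p zero Φ m s = refl
 Es-Hs p (suc L) Φ m s = cong2 _-_ (Es-Hs (p +1) L (F⁺ p Φ) m s) (T-linear p .ext _ _ (Es-Hs (p +1) L (F⁺ p Φ) (m -¹)) s) · F₀-F⁺ p Φ m s

 Es₀-minus : ∀ p L Φ Ψ m s -> Es₀ p L (\ m s -> Φ m s - Ψ (m -¹) s) m s == Es₀ p L Φ m s - Es₀ p L Ψ (m -¹) s
 Es₀-minus p zero Φ Ψ m s = refl
 Es₀-minus p (suc L) Φ Ψ m s = cong2 _-_ (Es₀-minus (p +1) L Φ Ψ m s) (T-linear p .ext _ _ (Es₀-minus (p +1) L Φ Ψ (m -¹)) s · linear-minus (T-linear p) (A (m -¹)) (C (m -¹ -¹)) s) · eq (A m s) (C (m -¹) s) (Ξ p (A (m -¹)) s) (Ξ p (C (m -¹ -¹)) s)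
  where
  A = Es₀ (p +1) L Φ
  C = Es₀ (p +1) L Ψ
  eq : ∀ a b c d -> a - b - (c - d) == a - c - (b - d)
  eq = solve

 opaque
  unfolding U
  U-linear : ∀ r -> Linear (U r)
  U-linear r .ext φ ψ h s = Ub-ext (+ 0) r _ _ (\ w -> uw-linear w .ext φ ψ h s)
  U-linear r .lin+ c φ ψ s = Ub-ext (+ 0) r _ _ (\ w -> uw-linear w .lin+ c φ ψ s) · Ub-lin (+ 0) r c (\ w -> uw w φ s) (\ w -> uw w ψ s)
  U-linear r .lin0 s = Ub-ext (+ 0) r _ (\ w -> + 0 + -1ℤ * + 0) (\ w -> uw-linear w .lin0 s) · Ub-lin (+ 0) r -1ℤ (\ _ -> + 0) (\ _ -> + 0) · eq (Ub (+ 0) r (\ _ -> + 0))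
   where
   eq : ∀ x -> x + -[1+ 0 ] * x == + 0
   eq = solve

  U-cong-words : ∀ r φ ψ s -> (∀ w -> length w N.≤ k -> uw w φ s == uw w ψ s) -> U r φ s == U r ψ s
  U-cong-words r φ ψ s h = inc-cong (+ 1) k r _ _ (\ w _ l -> h w l) ⊹
   dsum-cong (+ 1) k (r -¹) _ _ (\ v w d -> h (w ++ + 0 ∷ v) (subst (N._≤ k) (sym (length-++ w · N.+-comm (length w) (suc (length v)))) (split-length d)))

  U-neg : ∀ r φ s -> r < + 0 -> U r φ s == + 0
  U-neg r φ s l = inc-neg (+ 1) k r _ l ⊹ dsum-neg (+ 1) k (r -¹) (\ v w -> uw (w ++ + 0 ∷ v) φ s) (pred l)
   where
   pred : ∀ {r} -> r < + 0 -> r -¹ < + 0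
   pred {r} = lin (r & []) (x0 :< 0' & []) (x0 :- 1' :< 0')
   inc-neg : ∀ p m r f -> r < + 0 -> inc p m r f == + 0
   inc-neg p zero r f l = »-no (r Z.≟ + 0) (\ { refl -> Z.<-irrefl refl l })
   inc-neg p (suc m) r f l = inc-neg (p +1) m r f l ⊹ inc-neg (p +1) m (r -¹) _ (pred l)
   dsum-neg : ∀ p m r h -> r < + 0 -> dsum p m r h == + 0
   dsum-neg p zero r h l = refl
   dsum-neg p (suc m) r h l = inc-neg (p +1) m r _ l ⊹ dsum-neg (p +1) m (r -¹) _ (pred l)

 Ur : List ℕ -> Fun -> Fun
 Ur [] φ = φ
 Ur (r ∷ β) φ = Ur β (U (+ r) φ)

 Ur-linear : ∀ β -> Linear (Ur β)
 Ur-linear [] = uw-linear []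
 Ur-linear (r ∷ β) = ∘-linear (Ur-linear β) (U-linear (+ r))

 module RangeH (b : ℤ) (M : ℕ) where
  open Range b M public using (L; lo; hi)
  open Range b M using (starE)

  B+ : ℕ -> State -> Set
  B+ c = Bd (lo + + c) (hi - + c)

  -- By `starE`, the inverse product applied to `Θ` is `U r` applied to the inverse product of
  -- `Hs Ψ`, which is Ψ. Applying `Hs` recovers `Θ`.
  starH : ∀ Ψ r m s c -> ¬ r == + suc k -> B+ (k N.+ c) s -> U r (Hs lo L Ψ m) s == Hs lo L (\ m -> U r (Ψ m)) m s + U (r -¹) (Hs lo L Ψ (m -¹)) s
  starH Ψ r m s c ne B = lin (U r (Hs lo L Ψ m) s & Hs lo L (\ m -> U r (Ψ m)) m s & U (r -¹) (Hs lo L Ψ (m -¹)) s & []) (x1 := x0 :- x2 & []) (x0 := x1 :+ x2)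
   (Hs-cong (B+ (k N.+ c)) (Bd-stable _ _) lo L _ (Es₀ lo L Θ) (\ m s B -> U-linear r .ext _ _ (\ s -> sym (Es-Hs lo L Ψ m s)) s · starE (Hs lo L Ψ) r m s c ne B · sym (Es₀-minus lo L (\ m -> U r (Hs lo L Ψ m)) (\ m -> U (r -¹) (Hs lo L Ψ m)) m s)) m s B ·
    Hs-Es lo L Θ m s)
   where
   Θ : FamS
   Θ m s = U r (Hs lo L Ψ m) s - U (r -¹) (Hs lo L Ψ (m -¹)) s

  at0 : Fun -> FamS
  at0 φ m s = (m Z.≟ + 0) » φ s

  Hm : ℤ -> Fun -> Fun
  Hm m φ = Hs lo L (at0 φ) m

  starHm : ∀ φ r m s c -> ¬ r == + suc k -> B+ (k N.+ c) s -> U r (Hm m φ) s == Hm m (U r φ) s + U (r -¹) (Hm (m -¹) φ) s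
  starHm φ r m s c ne B = starH (at0 φ) r m s c ne B · cong (\ z -> z + U (r -¹) (Hm (m -¹) φ) s) (Hs-ext lo L _ _ h m s)
   where
   h : ∀ m s -> U r (at0 φ m) s == at0 (U r φ) m s
   h m s with m Z.≟ + 0
   ... | yes _ = refl
   ... | no _ = U-linear r .lin0 s

  -- The relation is iterated until `U (−1)` = 0; i is the part of m absorbed by r, as in `take`.
  starHm* : ∀ φ r m s c -> r N.≤ k -> B+ (k N.+ c) s -> U (+ r) (Hm m φ) s == Ʃ (suc r) (\ i -> Hm (m - + i) (U (+ (r ∸ i)) φ) s)
  starHm* φ zero m s c _ B = starHm φ (+ 0) m s c (\ ()) B · cong (\ z -> Hm z (U (+ 0) φ) s) (sym (+0 m)) ⊹ U-neg -1ℤ _ s Z.-<+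
  starHm* φ (suc r) m s c r<k B = starHm φ (+ suc r) m s c (\ e -> N.<⇒≢ (s≤s r<k) (Z.+-injective e)) B · cong (\ z -> Hm z (U (+ suc r) φ) s) (sym (+0 m)) ⊹
   (starHm* φ r (m -¹) s c (N.<⇒≤ r<k) B · Ʃ-ext (suc r) (\ i -> cong (\ z -> Hm z (U (+ (r ∸ i)) φ) s) (lin (m & + i & []) [] (x0 :- 1' :- x1 := x0 :- (1' :+ x1)))))

  U-cong-Bd : ∀ r c φ ψ s -> B+ (k N.+ c) s -> (∀ s -> B+ c s -> φ s == ψ s) -> U r φ s == U r ψ s
  U-cong-Bd r c φ ψ s B h = U-cong-words r φ ψ s (\ w l -> uw-cong-Bd lo hi (k N.+ c) w φ ψ s (N.≤-trans l (N.m≤m+n k c)) B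
   (\ s B' -> h s (Bd-weaken lo hi _ c s (N.m+n≤o⇒m≤o∸n c (subst (c N.+ length w N.≤_) (N.+-comm c k) (N.+-monoʳ-≤ c l))) B')))

  Ur-cong-Bd : ∀ β c φ ψ s -> B+ (length β N.* k N.+ c) s -> (∀ s -> B+ c s -> φ s == ψ s) -> Ur β φ s == Ur β ψ s
  Ur-cong-Bd [] c φ ψ s B h = h s B
  Ur-cong-Bd (r ∷ β) c φ ψ s B h = Ur-cong-Bd β (k N.+ c) _ _ s (subst (\ z -> B+ z s) (cong (N._+ c) (N.+-comm k (length β N.* k)) · N.+-assoc (length β N.* k) k c) B) (\ s B' -> U-cong-Bd (+ r) c φ ψ s B' h)

  Hs-bottom : ∀ s -> (∀ b φ -> Ξ b φ s == + 0) -> ∀ p L Φ m -> Hs p L Φ m s == Φ m s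
  Hs-bottom s h p zero Φ m = refl
  Hs-bottom s h p (suc L) Φ m = Hs-bottom s h (p +1) L (F⁺ p Φ) m · cong+ʳ (Φ m s) (h p (Φ (m -¹))) · +0 (Φ m s)

  -- Each `U r` absorbs some i out of m, just as `take` lowers the entry r by i. At a state without
  -- covers `Hm` has only its constant term, so nothing of m may be left over. Each entry of β uses
  -- up k units of slack.
  Ur-Hm : ∀ s -> (∀ b φ -> Ξ b φ s == + 0) -> ∀ β m φ -> All (N._≤ k) β -> B+ (length β N.* k) s -> Ur β (Hm m φ) s == take m β (\ β' -> Ur β' φ s)
  Ur-Hm s h [] m φ _ B = Hs-bottom s h lo L (at0 φ) m
  Ur-Hm s h (r ∷ β) m φ (r≤k ∷ a) B = Ur-cong-Bd β k _ (\ s -> Ʃ (suc r) (\ i -> Hm (m - + i) (U (+ (r ∸ i)) φ) s)) s (subst (\ z -> B+ z s) (N.+-comm k (length β N.* k)) B)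
    (\ s B' -> starHm* φ r m s 0 r≤k (subst (\ z -> B+ z s) (sym (N.+-identityʳ k)) B')) ·
   linear-Ʃ (Ur-linear β) (suc r) (\ i -> Hm (m - + i) (U (+ (r ∸ i)) φ)) s ·
    Ʃ-ext (suc r) (\ i -> Ur-Hm s h β (m - + i) (U (+ (r ∸ i)) φ) a (Bd-weaken lo hi _ _ s (N.m≤n+m (length β N.* k) k) B))

-- `U r` as the trace of a carrier.

module Carrier (k' : ℕ) where
 open Z using (_≤_)
 open import Defs using (nthℤ)
 open Base k'
 open Strong k'
 open Words k'
 open WordSums k'
 open Star k'
 open import Data.List.Properties using (++-assoc; ++-identityʳ; length-++)

 -- st p X is the state with the values X at p, …, p + n − 1.

 opaque
  st : ℤ -> List ℤ -> State
  st p X = mkS (\ i -> gev (+ 1) X (i - p +1))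

  hv-st : ∀ p X j q -> j N.< n -> hv (st p X) (p + + j + q * N) == nthℤ X j + q
  hv-st p X j q j<n = hv-mk (qp (\ i -> cong (gev (+ 1) X) (eq i p N) · step (gev-QP (+ 1) X) (i - p +1))) (p + + j + q * N) ·
   cong (gev (+ 1) X) (lin (p & + j & q * N & []) [] (x0 :+ x1 :+ x2 :- x0 :+ 1' := 1' :+ x1 :+ x2)) · gev-at (+ 1) X q j<n · cong+ʳ (nthℤ X j) (Z.*-identityʳ q)
   where
   eq : ∀ i p N -> i + N - p + + 1 == i - p + + 1 + N
   eq = solve

 hv-st0 : ∀ p X j -> j N.< n -> hv (st p X) (p + + j) == nthℤ X j
 hv-st0 p X j l = cong (hv (st p X)) (sym (+0 (p + + j))) · hv-st p X j (+ 0) l · +0 (nthℤ X j)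

 position : ∀ p i -> Σ ℕ \ j -> Σ ℤ \ q -> j N.< n × i == p + + j + q * N
 position p i with pos-decomp (i - p +1)
 ... | j , q , l , e = j , q , l , lin (i & p & + j & q * N & []) (x0 :- x1 :+ 1' := 1' :+ x2 :+ x3 & []) (x0 := x1 :+ x2 :+ x3) e

 st-ext : ∀ p s X -> (∀ j -> j N.< n -> hv s (p + + j) == nthℤ X j) -> s == st p X
 st-ext p s X h = hv-ext s (st p X) go
  where
  go : ∀ i -> hv s i == hv (st p X) i
  go i with position p i
  ... | j , q , l , refl = hv-shift s (p + + j) q · cong (\ z -> z + q) (h j l) · sym (hv-st p X j q l)

 win : ℤ -> ℕ -> State -> List ℤ
 win p zero s = []
 win p (suc m) s = hv s p ∷ win (p +1) m s

 length-win : ∀ p m s -> length (win p m s) == m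
 length-win p zero s = refl
 length-win p (suc m) s = cong suc (length-win (p +1) m s)

 nth-win : ∀ p m s j -> j N.< m -> nthℤ (win p m s) j == hv s (p + + j)
 nth-win p (suc m) s zero l = cong (hv s) (sym (+0 p))
 nth-win p (suc m) s (suc j) (s≤s l) = nth-win (p +1) m s j l · cong (hv s) (Z.+-assoc p (+ 1) (+ j))

 st-win : ∀ p s -> s == st p (win p n s)
 st-win p s = st-ext p s (win p n s) (\ j l -> sym (nth-win p n s j l))

 nth-++ˡ : ∀ xs {ys} j -> j N.< length xs -> nthℤ (xs ++ ys) j == nthℤ xs j
 nth-++ˡ (x ∷ xs) zero l = refl
 nth-++ˡ (x ∷ xs) (suc j) (s≤s l) = nth-++ˡ xs j l

 nth-++ʳ : ∀ xs {ys} j -> nthℤ (xs ++ ys) (length xs N.+ j) == nthℤ ys j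
 nth-++ʳ [] j = refl
 nth-++ʳ (x ∷ xs) j = nth-++ʳ xs j

 nth-swap : ∀ xs {c x ys} j -> ¬ j == length xs -> ¬ j == suc (length xs) -> nthℤ (xs ++ c ∷ x ∷ ys) j == nthℤ (xs ++ x ∷ c ∷ ys) j
 nth-swap [] zero a b = exfalso (a refl)
 nth-swap [] (suc zero) a b = exfalso (b refl)
 nth-swap [] (suc (suc j)) a b = refl
 nth-swap (z ∷ xs) zero a b = refl
 nth-swap (z ∷ xs) (suc j) a b = nth-swap xs j (a ∘ cong suc) (b ∘ cong suc)

 st-rotate : ∀ p x xs -> length xs == k -> st p (x ∷ xs) == st (p +1) (xs ++ (x +1) ∷ [])
 st-rotate p x xs le = st-ext (p +1) (st p (x ∷ xs)) _ go
  where
  go : ∀ j -> j N.< n -> hv (st p (x ∷ xs)) (p +1 + + j) == nthℤ (xs ++ (x +1) ∷ []) j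
  go j l with j N.≟ k
  ... | yes refl = cong (hv (st p (x ∷ xs))) (lin (p & + k' & []) [] (x0 :+ 1' :+ (1' :+ x1) := x0 :+ (2' :+ x1)) · eq p N) · hv-st p (x ∷ xs) 0 (+ 1) z<s · sym (cong (nthℤ (xs ++ (x +1) ∷ [])) (sym le · sym (N.+-identityʳ (length xs))) · nth-++ʳ xs 0)
   where
   eq : ∀ p N -> p + N == p + + 0 + + 1 * N
   eq = solve
  ... | no ne = cong (hv (st p (x ∷ xs))) (Z.+-assoc p (+ 1) (+ j)) · hv-st0 p (x ∷ xs) (suc j) (s≤s j<k) · sym (nth-++ˡ xs j (subst (j N.<_) (sym le) j<k))
   where
   j<k = N.≤∧≢⇒< (s≤s⁻¹ l) ne

 module _ (p : ℤ) (xs : List ℤ) (c x : ℤ) (ys : List ℤ) (len : length (xs ++ c ∷ x ∷ ys) == n) where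
  private
   s = st p (xs ++ c ∷ x ∷ ys)
   i = p + + length xs
   l1 : suc (length xs) N.< n
   l1 = subst (suc (length xs) N.<_) (sym (length-++ xs) · len) (subst (N._≤ length xs N.+ suc (suc (length ys))) (N.+-suc (length xs) 1 · cong suc (N.+-suc (length xs) 0 · cong suc (N.+-identityʳ _))) (N.+-monoʳ-≤ (length xs) (s≤s z<s)))
   at0 : ∀ {zs} y -> nthℤ (xs ++ y ∷ zs) (length xs) == y
   at0 {zs} y = cong (nthℤ (xs ++ y ∷ zs)) (sym (N.+-identityʳ (length xs))) · nth-++ʳ xs 0
   at1 : ∀ {zs} y z -> nthℤ (xs ++ y ∷ z ∷ zs) (suc (length xs)) == z
   at1 {zs} y z = cong (nthℤ (xs ++ y ∷ z ∷ zs)) (sym (N.+-suc (length xs) 0 · cong suc (N.+-identityʳ (length xs)))) · nth-++ʳ xs 1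
   i+1 : i +1 == p + + suc (length xs)
   i+1 = lin (p & + length xs & []) [] (x0 :+ x1 :+ 1' := x0 :+ (1' :+ x1))
   vi : hv s i == c
   vi = hv-st0 p _ (length xs) (N.<-trans (N.n<1+n _) l1) · at0 c
   vi+1 : hv s (i +1) == x
   vi+1 = cong (hv s) i+1 · hv-st0 p _ (suc (length xs)) l1 · at1 c x

  st-swap : sw i (i +1) s == st p (xs ++ x ∷ c ∷ ys)
  st-swap = st-ext p _ _ go
   where
   go : ∀ j -> j N.< n -> hv (sw i (i +1) s) (p + + j) == nthℤ (xs ++ x ∷ c ∷ ys) j
   go j j<n with j N.≟ length xs | j N.≟ suc (length xs)
   ... | yes refl | _ = swap-i i s · vi+1 · sym (at0 x)
   ... | no _ | yes refl = cong (hv (sw i (i +1) s)) (sym i+1) · swap-i+1 i s · vi · sym (at1 x c)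
   ... | no a | no b = swap-o i s (\ e -> a (inj e (N.<-trans (N.n<1+n _) l1))) (\ e -> b (inj (subst (_~ p + + j) i+1 e) l1)) · hv-st0 p _ j j<n · nth-swap xs j a b
    where
    inj : ∀ {l} -> p + + l ~ p + + j -> l N.< n -> j == l
    inj {l} e l<n = Z.+-injective (lin (p & + j & + l & []) (x0 :+ x2 := x0 :+ x1 & []) (x1 := x2) (~-near e
     (lin (p & + j & + l & N & []) (x2 :< x3 & 0' =< x1 & []) (x0 :+ x2 :- x3 :< x0 :+ x1) (Z.+<+ l<n) 0≤+)
     (lin (p & + j & + l & N & []) (x1 :< x3 & 0' =< x2 & []) (x0 :+ x1 :< x0 :+ x2 :+ x3) (Z.+<+ j<n) 0≤+)))

  opaque
   u-st : ∀ φ -> u i φ s == ((c Z.<? x) » φ (st p (xs ++ x ∷ c ∷ ys)))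
   u-st φ = »-cong (asc? i s) (c Z.<? x) (subst2 _<_ vi vi+1) (subst2 _<_ (sym vi) (sym vi+1)) (\ _ _ -> cong φ st-swap)

 -- A carrier c moves through xs: at each letter x it is dropped and x is
 -- picked up, or, if c < x, it passes x (counted by r).

 Cont : Set
 Cont = ℤ -> List ℤ -> ℤ -> ℤ

 rn : ℤ -> List ℤ -> Cont -> ℤ -> ℤ
 rn c [] K r = K c [] r
 rn c (x ∷ xs) K r = rn x xs (\ e o -> K e (c ∷ o)) r + ((c Z.<? x) » rn c xs (\ e o -> K e (x ∷ o)) (r -¹))

 rn-cong : ∀ c xs (K K' : Cont) r -> (∀ e o r -> e ∈ c ∷ xs -> length o == length xs -> K e o r == K' e o r) -> rn c xs K r == rn c xs K' r
 rn-cong c [] K K' r h = h c [] r (here refl) refl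
 rn-cong c (x ∷ xs) K K' r h = rn-cong x xs _ _ r (\ e o r m l -> h e (c ∷ o) r (there m) (cong suc l)) ⊹
  »-val (c Z.<? x) (\ _ -> rn-cong c xs _ _ (r -¹) (\ e o r m l -> h e (x ∷ o) r (skip m) (cong suc l)))
  where
  skip : ∀ {e} -> e ∈ c ∷ xs -> e ∈ c ∷ x ∷ xs
  skip (here q) = here q
  skip (there m) = there (there m)

 rn-Ʃ : ∀ c xs m (K : ℕ -> Cont) r -> rn c xs (\ e o r -> Ʃ m (\ i -> K i e o r)) r == Ʃ m (\ i -> rn c xs (K i) r)
 rn-Ʃ c [] m K r = refl
 rn-Ʃ c (x ∷ xs) m K r = rn-Ʃ x xs m (\ i e o -> K i e (c ∷ o)) r ⊹ (cong (\ z -> (c Z.<? x) » z) (rn-Ʃ c xs m (\ i e o -> K i e (x ∷ o)) (r -¹)) · »-Ʃ (c Z.<? x) m _) · sym (Ʃ-+ m _ _)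

 rn-» : ∀ {P : Set} (d : Dec P) c xs (K : Cont) r -> rn c xs (\ e o r -> d » K e o r) r == (d » rn c xs K r)
 rn-» (yes p) c xs K r = refl
 rn-» (no ¬p) c [] K r = refl
 rn-» (no ¬p) c (x ∷ xs) K r = rn-» (no ¬p) x xs (\ e o -> K e (c ∷ o)) r ⊹ »-vanish (c Z.<? x) (\ _ -> rn-» (no ¬p) c xs (\ e o -> K e (x ∷ o)) (r -¹))

 inc-» : ∀ {P : Set} (d : Dec P) p m r f -> inc p m r (\ w -> d » f w) == (d » inc p m r f)
 inc-» (yes _) p m r f = refl
 inc-» (no _) p m r f = inc-0 p m r

 fin : Fun -> ℤ -> List ℤ -> Cont
 fin φ q xs e o r = (r Z.≟ + 0) » φ (st q (xs ++ o ++ e ∷ []))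

 -- Position p holds the carrier. If the letter p is in the word, the carrier is exchanged with the
 -- next value, hence passes it; otherwise it stays behind at p and the next value becomes the
 -- carrier.
 inc-rn : ∀ q xs c ys φ r p -> p == q + + length xs -> length (xs ++ c ∷ ys) == n ->
  inc p (length ys) r (\ w -> uw w φ (st q (xs ++ c ∷ ys))) == rn c ys (fin φ q xs) r
 inc-rn q xs c [] φ r p refl len = refl
 inc-rn q xs c (x ∷ ys) φ r p refl len = (inc-ext (p +1) (length ys) r _ _ (\ w -> cong (\ z -> uw w φ (st q z)) (sym (++-assoc xs (c ∷ []) (x ∷ ys)))) ·
   inc-rn q (xs ++ c ∷ []) x ys φ r (p +1) (pl c) (cong length (++-assoc xs (c ∷ []) (x ∷ ys)) · len) · rn-cong x ys _ _ r (\ e o r _ _ -> cong (\ z -> (r Z.≟ + 0) » φ (st q z)) (++-assoc xs (c ∷ []) (o ++ e ∷ [])))) ⊹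
  (inc-ext (p +1) (length ys) (r -¹) _ (\ w -> (c Z.<? x) » uw w φ (st q ((xs ++ x ∷ []) ++ c ∷ ys))) (\ w -> u-st q xs c x ys len (uw w φ) · cong (\ z -> (c Z.<? x) » uw w φ (st q z)) (sym (++-assoc xs (x ∷ []) (c ∷ ys)))) ·
   inc-» (c Z.<? x) (p +1) (length ys) (r -¹) _ · »-val (c Z.<? x) (\ _ ->
   inc-rn q (xs ++ x ∷ []) c ys φ (r -¹) (p +1) (pl x) (cong length (++-assoc xs (x ∷ []) (c ∷ ys)) · length-++ xs · sym (length-++ xs {c ∷ x ∷ ys}) · len) ·
    rn-cong c ys _ _ (r -¹) (\ e o r _ _ -> cong (\ z -> (r Z.≟ + 0) » φ (st q z)) (++-assoc xs (x ∷ []) (o ++ e ∷ [])))))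
  where
  pl : ∀ y -> q + + length xs +1 == q + + length (xs ++ y ∷ [])
  pl y = lin (q & + length xs & []) [] (x0 :+ x1 :+ 1' := x0 :+ (x1 :+ 1')) · cong (\ z -> q + + z) (sym (length-++ xs))

 run : ℤ -> ℕ -> Word
 run p zero = []
 run p (suc d) = p ∷ run (p +1) d

 data Allowed (c : ℤ) : List ℤ -> Set where
  [] : Allowed c []
  _∷_ : ∀ {x xs} -> c < x -> Allowed c xs -> Allowed c (x ∷ xs)

 allowed? : ∀ c xs -> Dec (Allowed c xs)
 allowed? c [] = yes []
 allowed? c (x ∷ xs) = map′ (\ (p , q) -> p ∷ q) (\ { (p ∷ q) -> p , q }) ((c Z.<? x) ×-dec allowed? c xs)

 »-× : ∀ {P Q : Set} {x} (a : Dec P) (b : Dec Q) -> ((a ×-dec b) » x) == (a » b » x)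
 »-× (yes _) (yes _) = refl
 »-× (yes _) (no _) = refl
 »-× (no _) b = refl

 uw-run : ∀ q xs c A o φ p -> p == q + + length xs -> length (xs ++ c ∷ A ++ o) == n ->
  uw (run p (length A)) φ (st q (xs ++ c ∷ A ++ o)) == (allowed? c A » φ (st q (xs ++ A ++ c ∷ o)))
 uw-run q xs c [] o φ p refl len = refl
 uw-run q xs c (a ∷ A) o φ p refl len = u-st q xs c a (A ++ o) len (uw (run (p +1) (length A)) φ) · »-val (c Z.<? a) (\ _ ->
   cong (\ z -> uw (run (p +1) (length A)) φ (st q z)) (sym (++-assoc xs (a ∷ []) (c ∷ A ++ o))) ·
   uw-run q (xs ++ a ∷ []) c A o φ (p +1) (lin (q & + length xs & []) [] (x0 :+ x1 :+ 1' := x0 :+ (x1 :+ 1')) · cong (\ z -> q + + z) (sym (length-++ xs))) (cong length (++-assoc xs (a ∷ []) (c ∷ A ++ o)) · length-++ xs · sym (length-++ xs {c ∷ a ∷ A ++ o}) · len) ·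
    cong (\ z -> allowed? c A » φ (st q z)) (++-assoc xs (a ∷ []) (A ++ c ∷ o))) · sym (»-× (c Z.<? a) (allowed? c A)) · »-cong ((c Z.<? a) ×-dec allowed? c A) (allowed? c (a ∷ A)) (\ (x , y) -> x ∷ y) (\ { (x ∷ y) -> x , y }) (\ _ _ -> refl)

 Σc : ℕ -> (ℤ -> ℤ) -> ℤ
 Σc R f = Ʃ (R N.+ R) (\ t -> f (+ t - + R))

 Σc-pick : ∀ R a g -> - + R ≤ a -> a < + R -> Σc R (\ c -> (a Z.≟ c) » g c) == g a
 Σc-pick R a g l u with a + + R in eq
 ... | -[1+ t ] = exfalso (absurd (subst (+ 0 ≤_) eq (lin (a & + R & []) (0' :- x1 =< x0 & []) (0' =< x0 :+ x1) (subst (_≤ a) (sym (+0ˡ (- + R))) l))))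
  where
  absurd : ¬ (+ 0 ≤ -[1+ t ])
  absurd ()
 ... | + t = Ʃ-pick (R N.+ R) t (Z.drop‿+<+ (lin (a & + R & + t & []) (x0 :< x1 & x0 :+ x1 := x2 & []) (x2 :< x1 :+ x1) u eq)) (\ i _ ne -> »-no (a Z.≟ + i - + R) (\ e -> ne (Z.+-injective (lin (a & + R & + t & + i & []) (x0 :+ x1 := x2 & x0 := x3 :- x1 & []) (x3 := x2) eq e)))) ·
   »-yes (a Z.≟ + t - + R) e · cong g (sym e)
  where
  e : a == + t - + R
  e = lin (a & + R & + t & []) (x0 :+ x1 := x2 & []) (x0 := x2 :- x1) eq

 -- The final carrier e is a value of the state and re-enters as e - 1; `R` must cover all these
 -- candidates.
 Fits : ℕ -> ℤ -> Set
 Fits R x = - + R ≤ x -¹ × x -¹ < + R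

 tfin : Fun -> ℤ -> List ℤ -> ℤ -> Cont
 tfin φ q A c e o r = (r Z.≟ + 0) » (e -¹ Z.≟ c) » φ (st q (A ++ o))

 module _ (p : ℤ) (R : ℕ) (φ : Fun) where
  private b = p -¹

  rn-pick : ∀ y ys r (Q : ℤ -> Set) (Q? : ∀ c -> Dec (Q c)) (g : ℤ -> List ℤ -> ℤ) -> All (Fits R) (y ∷ ys) ->
   rn y ys (\ e o r -> (r Z.≟ + 0) » Q? (e -¹) » g (e -¹) o) r == Σc R (\ c -> Q? c » rn y ys (\ e o r -> (r Z.≟ + 0) » (e -¹ Z.≟ c) » g c o) r)
  rn-pick y ys r Q Q? g fits = rn-cong y ys _ (\ e o r -> Ʃ (R N.+ R) (\ t -> Q? (+ t - + R) » (r Z.≟ + 0) » (e -¹ Z.≟ + t - + R) » g (+ t - + R) o)) r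
    (\ e o r m _ -> sym (Ʃ-ext (R N.+ R) (\ t -> shuffle (Q? (+ t - + R)) (r Z.≟ + 0) (e -¹ Z.≟ + t - + R)) · Σc-pick R (e -¹) (\ c -> (r Z.≟ + 0) » Q? c » g c o) (fst (All.lookup fits m)) (snd (All.lookup fits m)))) ·
   rn-Ʃ y ys (R N.+ R) _ r · Ʃ-ext (R N.+ R) (\ t -> rn-» (Q? (+ t - + R)) y ys _ r)
   where
   shuffle : ∀ {P Q S : Set} {x} (a : Dec P) (b : Dec Q) (c : Dec S) -> (a » b » c » x) == (c » b » a » x)
   shuffle (yes _) b c = »-comm b c _
   shuffle (no _) b c = sym (cong (\ z -> c » z) (»-0 b) · »-0 c)

  -- `A` holds the values next to the run of letters starting at b. The carrier e reached at the end
  -- of the period sits at b as e - 1, since h grows by 1 per period, and must then pass all of `A`: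
  -- this is `allowed?`.
  dsum-rn : ∀ A B v₀ P r -> length (A ++ B) == n -> suc P == length A -> v₀ == run p P -> All (Fits R) B ->
   dsum (p + + P) (length B) r (\ v w -> uw (w ++ b ∷ v₀ ++ v) φ (st p (A ++ B))) == Σc R (\ c -> allowed? c A » rn c B (tfin φ b A c) r)
  dsum-rn A [] v₀ P r len eP ev _ = sym (Ʃ-zero (R N.+ R) (\ t _ -> »-vanish (allowed? (+ t - + R) A) (\ _ -> »-vanish (r Z.≟ + 0) (\ _ -> »-no (+ t - + R -¹ Z.≟ + t - + R) (\ e -> lin⊥ (+ t - + R & []) (x0 :- 1' := x0 & []) e)))))
  dsum-rn A (y ∷ ys) v₀ P r len eP ev (fy ∷ fys) = drop ⊹ pass · sym (Ʃ-ext (R N.+ R) (\ t -> »-+ (allowed? (+ t - + R) A) _ _) · Ʃ-+ (R N.+ R) _ _)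
   where
   pA : p + + P +1 == p + + length A
   pA = lin (p & + P & []) [] (x0 :+ x1 :+ 1' := x0 :+ (1' :+ x1)) · cong (\ z -> p + + z) eP
   lenA1 : length (A ++ y ∷ []) == suc (length A)
   lenA1 = length-++ A · N.+-comm (length A) 1
   lenA : ∀ (o : List ℤ) -> length o == length ys -> suc (length (A ++ o)) == n
   lenA o lo = cong suc (length-++ A · cong (length A N.+_) lo) · sym (N.+-suc (length A) (length ys)) · sym (length-++ A) · len
   drop : inc (p + + P +1) (length ys) r (\ w -> uw (w ++ b ∷ v₀ ++ []) φ (st p (A ++ y ∷ ys))) == Σc R (\ c -> allowed? c A » rn y ys (\ e o -> tfin φ b A c e (c ∷ o)) r)
   drop = inc-ext (p + + P +1) (length ys) r _ _ (\ w -> cong (\ z -> uw (w ++ z) φ (st p (A ++ y ∷ ys))) (cong (b ∷_) (++-identityʳ v₀ · ev)) · cong (\ f -> f (st p (A ++ y ∷ ys))) (uw-++ w (b ∷ run p P) φ)) ·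
    inc-rn p A y ys (uw (b ∷ run p P) φ) r (p + + P +1) pA len · rn-cong y ys _ _ r (\ e o r _ lo -> cong (\ z -> (r Z.≟ + 0) » z) (final e o lo)) · rn-pick y ys r (\ c -> Allowed c A) (\ c -> allowed? c A) (\ c o -> φ (st b (A ++ c ∷ o))) (fy ∷ fys)
    where
    final : ∀ e o -> length o == length ys -> uw (b ∷ run p P) φ (st p (A ++ o ++ e ∷ [])) == (allowed? (e -¹) A » φ (st b (A ++ (e -¹) ∷ o)))
    final e o lo = cong (uw (b ∷ run p P) φ) (sym (st-rotate b (e -¹) (A ++ o) (N.suc-injective (lenA o lo)) · cong2 st (lin (p & []) [] (x0 :- 1' :+ 1' := x0)) (++-assoc A o _ · cong (\ z -> A ++ o ++ z ∷ []) (lin (e & []) [] (x0 :- 1' :+ 1' := x0))))) ·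
     cong (\ z -> uw z φ (st b ((e -¹) ∷ A ++ o))) (run≡ (length A) eP) · uw-run b [] (e -¹) A o φ b (sym (+0 b)) (lenA o lo)
     where
     run≡ : ∀ l -> suc P == l -> b ∷ run p P == run b l
     run≡ l refl = cong (\ z -> b ∷ run z P) (lin (p & []) [] (x0 := x0 :- 1' :+ 1'))
   pass : dsum (p + + P +1) (length ys) (r -¹) (\ v w -> uw (w ++ b ∷ v₀ ++ (p + + P) ∷ v) φ (st p (A ++ y ∷ ys))) == Σc R (\ c -> allowed? c A » (c Z.<? y) » rn c ys (\ e o -> tfin φ b A c e (y ∷ o)) (r -¹))
   pass = dsum-cong (p + + P +1) (length ys) (r -¹) _ _ (\ v w _ -> cong2 (\ z l -> uw (w ++ b ∷ z) φ (st p l)) (sym (++-assoc v₀ ((p + + P) ∷ []) v)) (sym (++-assoc A (y ∷ []) ys))) ·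
    cong (\ z -> dsum z (length ys) (r -¹) (\ v w -> uw (w ++ b ∷ (v₀ ++ (p + + P) ∷ []) ++ v) φ (st p ((A ++ y ∷ []) ++ ys)))) (lin (p & + P & []) [] (x0 :+ x1 :+ 1' := x0 :+ (1' :+ x1))) ·
    dsum-rn (A ++ y ∷ []) ys (v₀ ++ (p + + P) ∷ []) (suc P) (r -¹) (cong length (++-assoc A (y ∷ []) ys) · len) (cong suc eP · sym lenA1) (cong (\ z -> z ++ (p + + P) ∷ []) ev · run-snoc p P) fys ·
    Ʃ-ext (R N.+ R) (\ t -> snoc? (+ t - + R) A · cong (\ z -> allowed? (+ t - + R) A » (+ t - + R Z.<? y) » z) (rn-cong (+ t - + R) ys _ _ (r -¹) (\ e o r _ _ -> cong (\ z -> (r Z.≟ + 0) » (e -¹ Z.≟ + t - + R) » φ (st b z)) (++-assoc A (y ∷ []) o))))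
    where
    run-snoc : ∀ p P -> run p P ++ (p + + P) ∷ [] == run p (suc P)
    run-snoc p zero = cong (_∷ []) (+0 p)
    run-snoc p (suc P) = cong (p ∷_) (cong (\ z -> run (p +1) P ++ z ∷ []) (sym (Z.+-assoc p (+ 1) (+ P))) · run-snoc (p +1) P)
    snoc? : ∀ c A {x} -> (allowed? c (A ++ y ∷ []) » x) == (allowed? c A » (c Z.<? y) » x)
    snoc? c A = »-cong (allowed? c (A ++ y ∷ [])) (allowed? c A ×-dec (c Z.<? y)) (to A) (\ (p , q) -> from A p q) (\ _ _ -> refl) · »-× (allowed? c A) (c Z.<? y)
     where
     to : ∀ A -> Allowed c (A ++ y ∷ []) -> Allowed c A × c < y
     to [] (q ∷ []) = [] , q
     to (a ∷ A) (q ∷ qs) = q ∷ fst (to A qs) , snd (to A qs)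
     from : ∀ A -> Allowed c A -> c < y -> Allowed c (A ++ y ∷ [])
     from [] [] q = q ∷ []
     from (a ∷ A) (q ∷ qs) q' = q ∷ from A qs q'

  -- The carrier closes up after one period, so the initial value c must be e - 1. Words without b
  -- drop c at once; words with b let it pass the first value.
  trace : ∀ r X -> length X == n -> All (Fits R) X -> U r φ (st p X) == Σc R (\ c -> rn c X (tfin φ b [] c) r)
  trace r (x ∷ xs) len (fx ∷ fs) = U-base b r φ (st p (x ∷ xs)) · cong (\ z -> inc z k r (\ w -> uw w φ (st p (x ∷ xs))) + dsum z k (r -¹) (\ v w -> uw (w ++ b ∷ v) φ (st p (x ∷ xs)))) b+1 ·
   cong (\ l -> inc p l r (\ w -> uw w φ (st p (x ∷ xs))) + dsum p l (r -¹) (\ v w -> uw (w ++ b ∷ v) φ (st p (x ∷ xs)))) (sym lk) ·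
   i ⊹ d · sym (Ʃ-+ (R N.+ R) _ _)
   where
   b+1 : b +1 == p
   b+1 = lin (p & []) [] (x0 :- 1' :+ 1' := x0)
   lk : length xs == k
   lk = N.suc-injective len
   i : inc p (length xs) r (\ w -> uw w φ (st p (x ∷ xs))) == Σc R (\ c -> rn x xs (\ e o -> tfin φ b [] c e (c ∷ o)) r)
   i = inc-rn p [] x xs φ r p (sym (+0 p)) len · rn-cong x xs _ _ r (\ e o r _ lo -> cong (\ z -> (r Z.≟ + 0) » φ z)
     (sym (st-rotate b (e -¹) o (lo · lk) · cong2 st b+1 (cong (\ z -> o ++ z ∷ []) (lin (e & []) [] (x0 :- 1' :+ 1' := x0)))))) ·
    rn-pick x xs r (\ c -> Allowed c []) (\ c -> allowed? c []) (\ c o -> φ (st b (c ∷ o))) (fx ∷ fs)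
   d : dsum p (length xs) (r -¹) (\ v w -> uw (w ++ b ∷ v) φ (st p (x ∷ xs))) == Σc R (\ c -> (c Z.<? x) » rn c xs (\ e o -> tfin φ b [] c e (x ∷ o)) (r -¹))
   d = cong (\ z -> dsum z (length xs) (r -¹) (\ v w -> uw (w ++ b ∷ v) φ (st p (x ∷ xs)))) (sym (+0 p)) · dsum-rn (x ∷ []) xs [] 0 (r -¹) len refl refl fs ·
    Ʃ-ext (R N.+ R) (\ t -> »-cong (allowed? (+ t - + R) (x ∷ [])) (+ t - + R Z.<? x) (\ { (q ∷ []) -> q }) (\ q -> q ∷ []) (\ _ _ -> refl))

-- The Yang-Baxter relation and the commutation of the `U r`.

module Symm (k' : ℕ) where
 open Z using (_≤_)
 open Base k'
 open Strong k'
 open Words k' using (one; minus-one)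
 open Star k' using (U)
 open Carrier k'

 opaque
  lt : ℤ -> ℤ -> ℤ
  lt x y = (x Z.<? y) » + 1

  lt-» : ∀ x y z -> ((x Z.<? y) » z) == lt x y * z
  lt-» x y z = »-*1 (x Z.<? y) z

  lt-asym : ∀ x y -> lt x y * lt y x == + 0
  lt-asym x y with x Z.<? y
  ... | no _ = Z.*-zeroˡ (lt y x)
  ... | yes p = one (lt y x) · »-no (y Z.<? x) (Z.<-asym p)

  lt-pred : ∀ x y -> lt x y == lt (x -¹) (y -¹)
  lt-pred x y = »-cong (x Z.<? y) (x -¹ Z.<? y -¹) (Z.+-monoˡ-< -1ℤ) (lin (x & y & []) (x0 :- 1' :< x1 :- 1' & []) (x0 :< x1)) (\ _ _ -> refl)

 rn-+ : ∀ c xs (A B : Cont) r -> rn c xs (\ e o r -> A e o r + B e o r) r == rn c xs A r + rn c xs B r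
 rn-+ c [] A B r = refl
 rn-+ c (x ∷ xs) A B r = rn-+ x xs (\ e o -> A e (c ∷ o)) (\ e o -> B e (c ∷ o)) r ⊹ (cong (\ z -> (c Z.<? x) » z) (rn-+ c xs (\ e o -> A e (x ∷ o)) (\ e o -> B e (x ∷ o)) (r -¹)) · »-+ (c Z.<? x) _ _) · +-interchange (rn x xs (\ e o -> A e (c ∷ o)) r) (rn x xs (\ e o -> B e (c ∷ o)) r) _ _

 rn-cong∈ : ∀ c xs (K K' : Cont) r -> (∀ e o r -> e ∈ c ∷ xs -> length o == length xs -> All (_∈ c ∷ xs) o -> K e o r == K' e o r) -> rn c xs K r == rn c xs K' r
 rn-cong∈ c [] K K' r h = h c [] r (here refl) refl []
 rn-cong∈ c (x ∷ xs) K K' r h = rn-cong∈ x xs _ _ r (\ e o r m l a -> h e (c ∷ o) r (there m) (cong suc l) (here refl ∷ All.map there a)) ⊹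
  »-val (c Z.<? x) (\ _ -> rn-cong∈ c xs _ _ (r -¹) (\ e o r m l a -> h e (x ∷ o) r (skip m) (cong suc l) (there (here refl) ∷ All.map skip a)))
  where
  skip : ∀ {e} -> e ∈ c ∷ xs -> e ∈ c ∷ x ∷ xs
  skip (here q) = here q
  skip (there m) = there (there m)

 Cont² : Set
 Cont² = ℤ -> ℤ -> List ℤ -> ℤ -> ℤ -> ℤ

 infixl 9 _⋆_
 _⋆_ : Cont² -> ℤ -> Cont²
 (K ⋆ y) e e' o r s = K e e' (y ∷ o) r s

 -- Both carriers advance together: c meets the next value and c' meets what c has left behind. This
 -- interleaving makes the Yang-Baxter relation provable one letter at a time.
 rn2 : ℤ -> ℤ -> List ℤ -> Cont² -> ℤ -> ℤ -> ℤ
 rn2 c c' [] K r s = K c c' [] r s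
 rn2 c c' (x ∷ xs) K r s = rn2 x c xs (K ⋆ c') r s + lt c' c * rn2 x c' xs (K ⋆ c) r (s -¹)
  + lt c x * (rn2 c x xs (K ⋆ c') (r -¹) s + lt c' x * rn2 c c' xs (K ⋆ x) (r -¹) (s -¹))

 rn-rn2 : ∀ c c' xs (K : Cont²) r s -> rn c xs (\ e o r -> rn c' o (\ e' o' s -> K e e' o' r s) s) r == rn2 c c' xs K r s
 rn-rn2 c c' [] K r s = refl
 rn-rn2 c c' (x ∷ xs) K r s = (rn-+ x xs (\ e o r -> rn c o (\ e' o' s -> (K ⋆ c') e e' o' r s) s) _ r · rn-rn2 x c xs (K ⋆ c') r s ⊹ (rn-» (c' Z.<? c) x xs _ r · lt-» c' c _ · cong (\ z -> lt c' c * z) (rn-rn2 x c' xs (K ⋆ c) r (s -¹)))) ⊹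
  (lt-» c x _ · cong (\ z -> lt c x * z) (rn-+ c xs (\ e o r -> rn x o (\ e' o' s -> (K ⋆ c') e e' o' r s) s) _ (r -¹) · rn-rn2 c x xs (K ⋆ c') (r -¹) s ⊹ (rn-» (c' Z.<? x) c xs _ (r -¹) · lt-» c' x _ · cong (\ z -> lt c' x * z) (rn-rn2 c c' xs (K ⋆ x) (r -¹) (s -¹)))))

 rn2-cong : ∀ c c' xs (K K' : Cont²) -> (∀ e e' o r s -> K e e' o r s == K' e e' o r s) -> ∀ r s -> rn2 c c' xs K r s == rn2 c c' xs K' r s
 rn2-cong c c' [] K K' h r s = h c c' [] r s
 rn2-cong c c' (x ∷ xs) K K' h r s = cong2 (\ a b -> a + lt c' c * b) (go x c c' r s) (go x c' c r (s -¹)) ⊹ cong2 (\ a b -> lt c x * (a + lt c' x * b)) (go c x c' (r -¹) s) (go c c' x (r -¹) (s -¹))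
  where
  go : ∀ a b y r s -> rn2 a b xs (K ⋆ y) r s == rn2 a b xs (K' ⋆ y) r s
  go a b y = rn2-cong a b xs (K ⋆ y) (K' ⋆ y) (\ e e' o -> h e e' (y ∷ o))

 rn2-lin : ∀ c c' xs (A B : Cont²) d r s -> rn2 c c' xs (\ e e' o r s -> A e e' o r s + d * B e e' o r s) r s == rn2 c c' xs A r s + d * rn2 c c' xs B r s
 rn2-lin c c' [] A B d r s = refl
 rn2-lin c c' (x ∷ xs) A B d r s = cong2 (\ a b -> a + lt c' c * b) (go x c c' r s) (go x c' c r (s -¹)) ⊹ cong2 (\ a b -> lt c x * (a + lt c' x * b)) (go c x c' (r -¹) s) (go c c' x (r -¹) (s -¹)) ·
  eq (lt c' c) d (P A) (P' A) (P B) (P' B) ⊹ cong (\ z -> lt c x * z) (eq (lt c' x) d (Q A) (Q' A) (Q B) (Q' B)) ·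
   eq (lt c x) d (P A + lt c' c * P' A) (Q A + lt c' x * Q' A) (P B + lt c' c * P' B) (Q B + lt c' x * Q' B)
  where
  go : ∀ a b y r s -> rn2 a b xs (\ e e' o r s -> (A ⋆ y) e e' o r s + d * (B ⋆ y) e e' o r s) r s == rn2 a b xs (A ⋆ y) r s + d * rn2 a b xs (B ⋆ y) r s
  go a b y r s = rn2-lin a b xs (A ⋆ y) (B ⋆ y) d r s
  P P' Q Q' : Cont² -> ℤ
  P A = rn2 x c xs (A ⋆ c') r s
  P' A = rn2 x c' xs (A ⋆ c) r (s -¹)
  Q A = rn2 c x xs (A ⋆ c') (r -¹) s
  Q' A = rn2 c c' xs (A ⋆ x) (r -¹) (s -¹)
  eq : ∀ l d a a' b b' -> (a + d * b) + l * (a' + d * b') == (a + l * a') + d * (b + l * b')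
  eq = solve

 shiftʳ shiftˢ swp : Cont² -> Cont²
 shiftʳ K e e' o r s = K e e' o (r -¹) s
 shiftˢ K e e' o r s = K e e' o r (s -¹)
 swp K e e' o s r = K e e' o r s

 rn2-shiftʳ : ∀ c c' xs K r s -> rn2 c c' xs (shiftʳ K) r s == rn2 c c' xs K (r -¹) s
 rn2-shiftʳ c c' [] K r s = refl
 rn2-shiftʳ c c' (x ∷ xs) K r s = cong2 (\ a b -> a + lt c' c * b) (rn2-shiftʳ x c xs (K ⋆ c') r s) (rn2-shiftʳ x c' xs (K ⋆ c) r (s -¹)) ⊹ cong2 (\ a b -> lt c x * (a + lt c' x * b)) (rn2-shiftʳ c x xs (K ⋆ c') (r -¹) s) (rn2-shiftʳ c c' xs (K ⋆ x) (r -¹) (s -¹))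

 rn2-shiftˢ : ∀ c c' xs K r s -> rn2 c c' xs (shiftˢ K) r s == rn2 c c' xs K r (s -¹)
 rn2-shiftˢ c c' [] K r s = refl
 rn2-shiftˢ c c' (x ∷ xs) K r s = cong2 (\ a b -> a + lt c' c * b) (rn2-shiftˢ x c xs (K ⋆ c') r s) (rn2-shiftˢ x c' xs (K ⋆ c) r (s -¹)) ⊹ cong2 (\ a b -> lt c x * (a + lt c' x * b)) (rn2-shiftˢ c x xs (K ⋆ c') (r -¹) s) (rn2-shiftˢ c c' xs (K ⋆ x) (r -¹) (s -¹))

 -- The Yang–Baxter relation: the R-matrix 1 + (z' − z) [e' < e] (swap)
 -- exchanges the weights z, z' of the two carriers.

 Rm : Cont² -> Cont²
 Rm K e e' o r s = K e e' o r s + lt e' e * (K e' e o r (s -¹) - K e' e o (r -¹) s)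

 ybe : ∀ c c' xs K r s -> rn2 c c' xs (Rm K) r s ==
  rn2 c c' xs (swp K) s r + lt c' c * (rn2 c' c xs (swp K) (s -¹) r - rn2 c' c xs (swp K) s (r -¹))
 ybe c c' [] K r s = refl
 ybe c c' (x ∷ xs) K r s = cong2 (\ a b -> a + lt c' c * b) (ybe x c xs (K ⋆ c') r s) (ybe x c' xs (K ⋆ c) r (s -¹)) ⊹ cong2 (\ a b -> lt c x * (a + lt c' x * b)) (ybe c x xs (K ⋆ c') (r -¹) s) (ybe c c' xs (K ⋆ x) (r -¹) (s -¹)) ·
  -- The induction step is a polynomial identity in the values of `lt` and of the shorter runs,
  -- modulo the two products killed by `lt-asym`.
  alg (lt c' c) (lt c x) (lt c' x) (lt x c) (lt c c') (Z x c c' r s) (Z c x c' r (s -¹)) (Z c x c' (r -¹) s) (Z x c' c r (s -¹)) (Z c' x c r (s -¹ -¹)) (Z c' x c (r -¹) (s -¹)) (Z c c' x (r -¹) (s -¹)) (Z c' c x (r -¹) (s -¹ -¹)) (Z c' c x (r -¹ -¹) (s -¹)) (Z x c' c (r -¹) s) y₁ y₂ y₃ ·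
   cong2 (\ a b -> Rhs + a * y₁ - b * (y₂ - y₃)) (lt-asym c x) (lt-asym c' c) · zero2 Rhs y₁ (y₂ - y₃)
  where
  Z : ℤ -> ℤ -> ℤ -> ℤ -> ℤ -> ℤ
  Z a b o r s = rn2 a b xs (swp K ⋆ o) s r
  y₁ = Z x c c' (r -¹) (s -¹) - Z x c c' (r -¹ -¹) s
  y₂ = Z x c c' (r -¹) (s -¹)
  y₃ = Z x c c' (r -¹ -¹) s
  Rhs = rn2 c c' (x ∷ xs) (swp K) s r + lt c' c * (rn2 c' c (x ∷ xs) (swp K) (s -¹) r - rn2 c' c (x ∷ xs) (swp K) s (r -¹))
  zero2 : ∀ a b c -> a + + 0 * b - + 0 * c == a
  zero2 = solve
  alg : ∀ a b d e f z1 z2 z3 z4 z5 z6 z7 z8 z9 z10 y1 y2 y3 ->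
   (z1 + b * (z2 - z3)) + a * (z4 + d * (z5 - z6)) + b * ((z3 + e * y1) + d * (z7 + a * (z8 - z9)))
   == (z1 + a * z10 + b * (z2 + d * z7)) + a * ((z4 + f * y2 + d * (z5 + b * z8)) - (z10 + f * y3 + d * (z6 + b * z9))) + (b * e) * y1 - (a * f) * (y2 - y3)
  alg = solve

 -- Commutation of the operators U r by taking traces.

 Θ : Fun -> ℤ -> ℤ -> ℤ -> Cont²
 Θ φ q c c' e e' o r s = (r Z.≟ + 0) » (e -¹ Z.≟ c) » (s Z.≟ + 0) » (e' -¹ Z.≟ c') » φ (st q o)

 module _ (φ : Fun) (q : ℤ) (X : List ℤ) where
  private
   m m~ : ℤ -> ℤ -> ℤ -> ℤ -> ℤ -> ℤ -> ℤ
   m c c' p p' r s = rn2 c c' X (Θ φ q p p') r s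
   m~ c c' p p' r s = rn2 c c' X (swp (Θ φ q p p')) s r

   Θ-swap : ∀ p p' e e' o r s -> lt e' e * Θ φ q p p' e' e o r s == lt p p' * Θ φ q p' p e e' o r s
   Θ-swap p p' e e' o r s = go (e' -¹ Z.≟ p) (e -¹ Z.≟ p') (r Z.≟ + 0) (s Z.≟ + 0)
    where
    go : ∀ {A C : Set} (a : Dec (e' -¹ == p)) (b : Dec (e -¹ == p')) (r : Dec A) (s : Dec C) -> lt e' e * (r » a » s » b » φ (st q o)) == lt p p' * (r » b » s » a » φ (st q o))
    go (yes refl) (yes refl) r s = cong (\ z -> z * (r » s » φ (st q o))) (lt-pred e' e)
    go (yes _) (no _) r s = cong (\ z -> lt e' e * z) (cong (\ z -> r » z) (»-0 s) · »-0 r) · Z.*-zeroʳ (lt e' e) · sym (cong (\ z -> lt p p' * z) (»-0 r) · Z.*-zeroʳ (lt p p'))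
    go (no _) (yes _) r s = cong (\ z -> lt e' e * z) (»-0 r) · Z.*-zeroʳ (lt e' e) · sym (cong (\ z -> lt p p' * z) (cong (\ z -> r » z) (»-0 s) · »-0 r) · Z.*-zeroʳ (lt p p'))
    go (no _) (no _) r s = cong (\ z -> lt e' e * z) (»-0 r) · Z.*-zeroʳ (lt e' e) · sym (cong (\ z -> lt p p' * z) (»-0 r) · Z.*-zeroʳ (lt p p'))

   key : ∀ c c' p p' r s -> m c c' p p' r s + lt p p' * (m c c' p' p r (s -¹) - m c c' p' p (r -¹) s)
    == m~ c c' p p' r s + lt c' c * (m~ c' c p p' r (s -¹) - m~ c' c p p' (r -¹) s)
   key c c' p p' r s = sym (rn2-cong c c' X (Rm (Θ φ q p p')) (\ e e' o r s -> Θ φ q p p' e e' o r s + lt p p' * (shiftˢ (Θ φ q p' p) e e' o r s + -1ℤ * shiftʳ (Θ φ q p' p) e e' o r s)) pt r s ·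
     rn2-lin c c' X (Θ φ q p p') (\ e e' o r s -> shiftˢ (Θ φ q p' p) e e' o r s + -1ℤ * shiftʳ (Θ φ q p' p) e e' o r s) (lt p p') r s ·
      cong (\ z -> m c c' p p' r s + lt p p' * z) (rn2-lin c c' X (shiftˢ (Θ φ q p' p)) (shiftʳ (Θ φ q p' p)) -1ℤ r s · cong2 (\ a b -> a + -1ℤ * b) (rn2-shiftˢ c c' X (Θ φ q p' p) r s) (rn2-shiftʳ c c' X (Θ φ q p' p) r s) · minus-one (m c c' p' p r (s -¹)) (m c c' p' p (r -¹) s))) ·
    ybe c c' X (Θ φ q p p') r s
    where
    dist⁻ : ∀ l a b -> l * (a - b) == l * a - l * b
    dist⁻ = solve
    pt : ∀ e e' o r s -> Rm (Θ φ q p p') e e' o r s == Θ φ q p p' e e' o r s + lt p p' * (shiftˢ (Θ φ q p' p) e e' o r s + -1ℤ * shiftʳ (Θ φ q p' p) e e' o r s)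
    pt e e' o r s = cong+ʳ (Θ φ q p p' e e' o r s) (dist⁻ (lt e' e) (Θ φ q p p' e' e o r (s -¹)) (Θ φ q p p' e' e o (r -¹) s) · cong2 _-_ (Θ-swap p p' e e' o r (s -¹)) (Θ-swap p p' e e' o (r -¹) s) ·
     sym (dist⁻ (lt p p') (Θ φ q p' p e e' o r (s -¹)) (Θ φ q p' p e e' o (r -¹) s)) · cong (\ z -> lt p p' * z) (sym (minus-one (Θ φ q p' p e e' o r (s -¹)) (Θ φ q p' p e e' o (r -¹) s))))

   -- For the exit values c', c both corrections in `key` carry the factor `lt c' c`, which
   -- multiplication by `lt c c'` annihilates.
   off : ∀ c c' r s -> lt c c' * m c c' c' c r s == lt c c' * m~ c c' c' c r s
   off c c' r s = sym (drop (lt c c') (lt c' c) (m c c' c' c r s) _ (lt-asym c c')) · cong (\ z -> lt c c' * z) (key c c' c' c r s) · drop (lt c c') (lt c' c) (m~ c c' c' c r s) _ (lt-asym c c')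
    where
    eq : ∀ a b x y -> a * (x + b * y) == a * x + (a * b) * y
    eq = solve
    drop : ∀ a b x y -> a * b == + 0 -> a * (x + b * y) == a * x
    drop a b x y z = eq a b x y · cong (\ w -> a * x + w * y) z · +0 (a * x)

  -- In the sum of `key` over closed pairs the corrections of the two sides coincide, by `off`,
  -- after exchanging the names c and c' on one side. They cancel and leave the equality of the
  -- traces.
  trace² : ∀ R r s -> Σc R (\ c -> Σc R (\ c' -> m c c' c c' r s)) == Σc R (\ c -> Σc R (\ c' -> m~ c c' c c' r s))
  trace² R r s = lin (T1 & T2 & D & []) (x0 :+ x2 := x1 :+ x2 & []) (x0 := x1) (sym (ΣΣ-+ f₁ d₁) · ΣΣ-ext {\ c c' -> f₁ c c' + d₁ c c'} {\ c c' -> f₂ c c' + d₂ c c'} (\ c c' -> key c c' c c' r s) · ΣΣ-+ f₂ d₂ · cong+ʳ T2 (Ʃ-swap (R N.+ R) (R N.+ R) (\ i j -> d₂ (+ i - + R) (+ j - + R)) · ΣΣ-ext {\ c c' -> d₂ c' c} {d₁} (\ c c' -> sym (off2 c c'))))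
   where
   f₁ f₂ d₁ d₂ : ℤ -> ℤ -> ℤ
   f₁ c c' = m c c' c c' r s
   f₂ c c' = m~ c c' c c' r s
   d₁ c c' = lt c c' * (m c c' c' c r (s -¹) - m c c' c' c (r -¹) s)
   d₂ c c' = lt c' c * (m~ c' c c c' r (s -¹) - m~ c' c c c' (r -¹) s)
   T1 = Σc R (\ c -> Σc R (\ c' -> m c c' c c' r s))
   T2 = Σc R (\ c -> Σc R (\ c' -> m~ c c' c c' r s))
   D = Σc R (\ c -> Σc R (\ c' -> lt c c' * (m c c' c' c r (s -¹) - m c c' c' c (r -¹) s)))
   dist⁻ : ∀ l a b -> l * (a - b) == l * a - l * b
   dist⁻ = solve
   off2 : ∀ c c' -> lt c c' * (m c c' c' c r (s -¹) - m c c' c' c (r -¹) s) == lt c c' * (m~ c c' c' c r (s -¹) - m~ c c' c' c (r -¹) s)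
   off2 c c' = dist⁻ (lt c c') (m c c' c' c r (s -¹)) (m c c' c' c (r -¹) s) · cong2 _-_ (off c c' r (s -¹)) (off c c' (r -¹) s) · sym (dist⁻ (lt c c') (m~ c c' c' c r (s -¹)) (m~ c c' c' c (r -¹) s))
   ΣΣ-ext : ∀ {f g : ℤ -> ℤ -> ℤ} -> (∀ c c' -> f c c' == g c c') -> Σc R (\ c -> Σc R (f c)) == Σc R (\ c -> Σc R (g c))
   ΣΣ-ext h = Ʃ-ext (R N.+ R) (\ t -> Ʃ-ext (R N.+ R) (\ t' -> h (+ t - + R) (+ t' - + R)))
   ΣΣ-+ : ∀ (f g : ℤ -> ℤ -> ℤ) -> Σc R (\ c -> Σc R (\ c' -> f c c' + g c c')) == Σc R (\ c -> Σc R (f c)) + Σc R (\ c -> Σc R (g c))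
   ΣΣ-+ f g = Ʃ-ext (R N.+ R) (\ t -> Ʃ-+ (R N.+ R) _ _) · Ʃ-+ (R N.+ R) _ _

 bound : List ℤ -> ℕ
 bound X = sum (map Z.∣_∣ X)

 bound-∈ : ∀ X {x} -> x ∈ X -> - + bound X ≤ x × x ≤ + bound X
 bound-∈ (y ∷ X) {x} (here refl) = lin (x & + Z.∣ x ∣ & + bound X & []) (0' =< x2 & 0' :- x1 =< x0 & []) (0' :- (x1 :+ x2) =< x0) 0≤+ (neg-abs x) ⟨sub⟩ , lin (x & + Z.∣ x ∣ & + bound X & []) (0' =< x2 & x0 =< x1 & []) (x0 =< x1 :+ x2) 0≤+ (abs x)
  where
  _⟨sub⟩ : + 0 - + bound (x ∷ X) ≤ x -> - + bound (x ∷ X) ≤ x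
  _⟨sub⟩ = subst (_≤ x) (+0ˡ _)
  abs : ∀ x -> x ≤ + Z.∣ x ∣
  abs (+ _) = Z.≤-refl
  abs -[1+ _ ] = Z.-≤+
  neg-abs : ∀ x -> + 0 - + Z.∣ x ∣ ≤ x
  neg-abs (+ zero) = Z.≤-refl
  neg-abs (+ suc _) = Z.-≤+
  neg-abs -[1+ _ ] = Z.≤-refl
 bound-∈ (y ∷ X) {x} (there p) = subst (_≤ x) (+0ˡ _) (lin (x & + Z.∣ y ∣ & + bound X & []) (0' =< x1 & 0' :- x2 =< x0 & []) (0' :- (x1 :+ x2) =< x0) 0≤+ (subst (_≤ x) (sym (+0ˡ _)) (fst (bound-∈ X p)))) ,
  lin (x & + Z.∣ y ∣ & + bound X & []) (0' =< x1 & x0 =< x2 & []) (x0 =< x1 :+ x2) 0≤+ (snd (bound-∈ X p))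

 -- The lower bound has two units of room: the first carrier is one below some value, it becomes a
 -- value of the state that the second operator meets, and the second carrier may be one lower
 -- still.
 U² : ∀ R r s φ p X -> length X == n -> All (\ x -> + 0 - + R + + 2 ≤ x × x ≤ + R) X ->
  U r (U s φ) (st p X) == Σc R (\ c -> Σc R (\ c' -> rn2 c c' X (Θ φ (p -¹ -¹) c c') r s))
 U² R r s φ p X len fits = trace p R (U s φ) r X len (All.map fit fits) · Ʃ-ext (R N.+ R) (\ t -> go (+ t - + R))
  where
  fit : ∀ {x} -> + 0 - + R + + 2 ≤ x × x ≤ + R -> Fits R x
  fit {x} (a , b) = subst (_≤ x -¹) (+0ˡ _) (lin (x & + R & []) (0' :- x1 :+ 2' =< x0 & []) (0' :- x1 =< x0 :- 1') a) , lin (x & + R & []) (x0 =< x1 & []) (x0 :- 1' :< x1) b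
  go : ∀ c -> rn c X (tfin (U s φ) (p -¹) [] c) r == Σc R (\ c' -> rn2 c c' X (Θ φ (p -¹ -¹) c c') r s)
  go c = rn-cong∈ c X _ _ r pt · rn-Ʃ c X (R N.+ R) _ r · Ʃ-ext (R N.+ R) (\ t -> rn-rn2 c (+ t - + R) X _ r s)
   where
   pt : ∀ e o r -> e ∈ c ∷ X -> length o == length X -> All (_∈ c ∷ X) o ->
    tfin (U s φ) (p -¹) [] c e o r == Σc R (\ c' -> rn c' o (\ e' o' s -> Θ φ (p -¹ -¹) c c' e e' o' r s) s)
   pt e o r e∈ lo a = cong (\ z -> (r Z.≟ + 0) » z) (»-val (e -¹ Z.≟ c) (\ q -> trace (p -¹) R φ s o (lo · len) (All.map (fo q e∈) a))) ·
    cong (\ z -> (r Z.≟ + 0) » z) (»-Ʃ (e -¹ Z.≟ c) (R N.+ R) _) · »-Ʃ (r Z.≟ + 0) (R N.+ R) _ ·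
     Ʃ-ext (R N.+ R) (\ t -> sym (rn-» (r Z.≟ + 0) (+ t - + R) o (\ e' o' s -> (e -¹ Z.≟ c) » tfin φ (p -¹ -¹) [] (+ t - + R) e' o' s) s · cong (\ z -> (r Z.≟ + 0) » z) (rn-» (e -¹ Z.≟ c) (+ t - + R) o (tfin φ (p -¹ -¹) [] (+ t - + R)) s)))
    where
    fo : e -¹ == c -> e ∈ c ∷ X -> ∀ {y} -> y ∈ c ∷ X -> Fits R y
    fo q _ (there y∈) = fit (All.lookup fits y∈)
    fo q (here refl) (here refl) = lin⊥ (e & []) (x0 :- 1' := x0 & []) q
    fo q (there e∈) {y} (here refl) with All.lookup fits e∈
    ... | l , u = subst (_≤ y -¹) (+0ˡ _) (lin (e & y & + R & []) (0' :- x2 :+ 2' =< x0 & x0 :- 1' := x1 & []) (0' :- x2 =< x1 :- 1') l q) , lin (e & y & + R & []) (x0 =< x2 & x0 :- 1' := x1 & []) (x1 :- 1' :< x2) u q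

 U-comm : ∀ r s φ t -> U r (U s φ) t == U s (U r φ) t
 U-comm r s φ t = subst (\ t -> U r (U s φ) t == U s (U r φ) t) (sym (st-win (+ 1) t)) (U² R r s φ (+ 1) X len fits · trace² φ q X R r s ·
  Ʃ-ext (R N.+ R) (\ i -> Ʃ-ext (R N.+ R) (\ j -> rn2-cong (+ i - + R) (+ j - + R) X (swp (Θ φ q (+ i - + R) (+ j - + R))) (Θ φ q (+ i - + R) (+ j - + R)) (\ e e' o s r -> reorder (r Z.≟ + 0) (e -¹ Z.≟ + i - + R) (s Z.≟ + 0) (e' -¹ Z.≟ + j - + R)) s r)) · sym (U² R s r φ (+ 1) X len fits))
  where
  X = win (+ 1) n t
  q = + 1 -¹ -¹
  len = length-win (+ 1) n t
  R = bound X N.+ 2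
  fits : All (\ x -> + 0 - + R + + 2 ≤ x × x ≤ + R) X
  fits = All.tabulate (\ {x} m -> lin (x & + bound X & []) (0' :- x1 =< x0 & []) (0' :- (x1 :+ 2') :+ 2' =< x0) (subst (_≤ x) (sym (+0ˡ _)) (fst (bound-∈ X m))) , lin (x & + bound X & []) (x0 =< x1 & []) (x0 =< x1 :+ 2') (snd (bound-∈ X m)))
  reorder : ∀ {A B C D : Set} {x} (a : Dec A) (b : Dec B) (c : Dec C) (d : Dec D) -> (a » b » c » d » x) == (c » b » a » d » x)
  reorder (yes _) b c d = »-comm b c _
  reorder (no _) b c d = sym (cong (\ z -> c » z) (»-0 b) · »-0 c)

-- Coxeter length and charge of a state.

module Length (k' : ℕ) where
 open Z using (_≤_)
 open import Defs using (nthℤ)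
 open Base k'
 open Strong k'
 open Words k' using (Word)
 open WordSums k' using (inc; dsum; Ub)
 open Star k'
 open Carrier k'
 open import Data.List.Properties using (++-assoc; length-++)

 shift-invariant : ∀ {A : Set} (f : ℤ -> A) -> (∀ p -> f p == f (p +1)) -> ∀ p q -> f p == f q
 shift-invariant f h p q with Z.<-cmp p q
 ... | tri≈ _ refl _ = refl
 ... | tri< l _ _ with gap l
 ...   | e , refl = up p (suc e)
  where
  up : ∀ p m -> f p == f (p + + m)
  up p zero = cong f (sym (+0 p))
  up p (suc m) = h p · up (p +1) m · cong f (Z.+-assoc p (+ 1) (+ m))
 shift-invariant f h p q | tri> _ _ l with gap l
 ... | e , refl = sym (up q (suc e))
  where
  up : ∀ p m -> f p == f (p + + m)
  up p zero = cong f (sym (+0 p))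
  up p (suc m) = h p · up (p +1) m · cong f (Z.+-assoc p (+ 1) (+ m))

 -- The Coxeter length: positions i < j < i + n contribute
 -- (h i − h j)⁺ + (h j − h (i + n))⁺ = gl (h i − h j).

 gl : ℤ -> ℤ
 gl (+ d) = + d
 gl -[1+ d ] = + d

 gl-flip : ∀ D -> gl D == gl (-1ℤ - D)
 gl-flip (+ zero) = refl
 gl-flip (+ suc d) = refl
 gl-flip -[1+ d ] = refl

 gl-up : ∀ c x -> c < x -> gl (x - c) == gl (c - x) +1
 gl-up c x l with gap l
 ... | m , refl = cong gl (lin (c & + suc m & []) [] (x0 :+ x1 :- x0 := x1)) · cong (\ z -> + z) (N.+-comm 1 m) · cong (\ z -> gl z +1) (sym (e c (+ suc m)))
  where
  e : ∀ c m -> c - (c + m) == - m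
  e = solve

 len : List ℤ -> ℤ
 len [] = + 0
 len (x ∷ xs) = ƩL xs (\ y -> gl (x - y)) + len xs

 len-snoc : ∀ xs z -> len (xs ++ z ∷ []) == len xs + ƩL xs (\ y -> gl (y - z))
 len-snoc [] z = refl
 len-snoc (x ∷ xs) z = ƩL-++ xs (z ∷ []) _ ⊹ len-snoc xs z · eq (ƩL xs (\ y -> gl (x - y))) (gl (x - z)) (len xs) (ƩL xs (\ y -> gl (y - z)))
  where
  eq : ∀ a g l b -> a + (g + + 0) + (l + b) == a + l + (g + b)
  eq = solve

 len-rotate : ∀ x xs -> len (x ∷ xs) == len (xs ++ (x +1) ∷ [])
 len-rotate x xs = sym (len-snoc xs (x +1) · Z.+-comm (len xs) _ · cong (\ z -> z + len xs) (ƩL-ext xs (\ y -> gl-flip (y - (x +1)) · cong gl (eq x y))))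
  where
  eq : ∀ x y -> -[1+ 0 ] - (y - (x + + 1)) == x - y
  eq = solve

 len-swap : ∀ c x ys -> c < x -> len (x ∷ c ∷ ys) == len (c ∷ x ∷ ys) +1
 len-swap c x ys l = cong (\ z -> z + ƩL ys (\ y -> gl (x - y)) + (ƩL ys (\ y -> gl (c - y)) + len ys)) (gl-up c x l) · eq (gl (c - x)) (ƩL ys (\ y -> gl (x - y))) (ƩL ys (\ y -> gl (c - y))) (len ys)
  where
  eq : ∀ g a b l -> g + + 1 + a + (b + l) == g + b + (a + l) + + 1
  eq = solve

 win-snoc : ∀ p m s -> win p (suc m) s == win p m s ++ hv s (p + + m) ∷ []
 win-snoc p zero s = cong (\ z -> hv s z ∷ []) (sym (+0 p))
 win-snoc p (suc m) s = cong (hv s p ∷_) (win-snoc (p +1) m s · cong (\ z -> win (p +1) m s ++ hv s z ∷ []) (Z.+-assoc p (+ 1) (+ m)))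

 hv-N : ∀ s p -> hv s (p + N) == hv s p +1
 hv-N s p = cong (\ z -> hv s (p + z)) (sym (Z.*-identityˡ N)) · hv-shift s p (+ 1)

 win-shift : ∀ p s -> win (p +1) n s == win (p +1) k s ++ (hv s p +1) ∷ []
 win-shift p s = win-snoc (p +1) k s · cong (\ z -> win (p +1) k s ++ z ∷ []) (cong (hv s) (lin (p & + k' & []) [] (x0 :+ 1' :+ (1' :+ x1) := x0 :+ (2' :+ x1))) · hv-N s p)

 -- The charge is constant along weak steps and vanishes on states of affine permutations; it tells
 -- the identity from its translates.
 Len Chg : State -> ℤ
 Len s = len (win (+ 1) n s)
 Chg s = ƩL (win (+ 1) n s) (\ x -> x)

 Len-at : ∀ p s -> Len s == len (win p n s)
 Len-at p s = shift-invariant (\ p -> len (win p n s)) (\ p -> len-rotate (hv s p) (win (p +1) k s) · cong len (sym (win-shift p s))) (+ 1) p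

 Chg-at : ∀ p s -> Chg s + (p -¹) == ƩL (win p n s) (\ x -> x)
 Chg-at p s = lin (Chg s & p & ƩL (win p n s) (\ x -> x) & []) (x0 :- 1' := x2 :- x1 & []) (x0 :+ (x1 :- 1') := x2) (shift-invariant (\ p -> ƩL (win p n s) (\ x -> x) - p) inv (+ 1) p)
  where
  inv : ∀ p -> ƩL (win p n s) (\ x -> x) - p == ƩL (win (p +1) n s) (\ x -> x) - (p +1)
  inv p = eq (hv s p) (ƩL (win (p +1) k s) (\ x -> x)) p · cong (\ z -> z - (p +1)) (sym (cong (\ l -> ƩL l (\ x -> x)) (win-shift p s) · ƩL-++ (win (p +1) k s) _ (\ x -> x)))
   where
   eq : ∀ h a p -> h + a - p == a + (h + + 1 + + 0) - (p + + 1)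
   eq = solve

 win-st : ∀ p m X -> m N.≤ n -> length X == n -> ∀ xs ys -> X == xs ++ ys -> length ys == m -> win (p + + length xs) m (st p X) == ys
 win-st p zero X _ lX xs [] e ly = refl
 win-st p (suc m) X m≤ lX xs (y ∷ ys) refl ly = cong2 _∷_ (hv-st0 p X (length xs) l< · cong (nthℤ X) (sym (N.+-identityʳ (length xs))) · nth-++ʳ xs 0)
  (cong (\ z -> win z m (st p X)) (lin (p & + length xs & []) [] (x0 :+ x1 :+ 1' := x0 :+ (x1 :+ 1')) · cong (\ z -> p + + z) (sym (length-++ xs))) ·
   win-st p m X (N.<⇒≤ m≤) lX (xs ++ y ∷ []) ys (sym (++-assoc xs (y ∷ []) ys)) (N.suc-injective ly))
  where
  l< : length xs N.< n
  l< = subst (length xs N.<_) (sym (length-++ xs) · lX) (N.m<m+n (length xs) z<s)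

 win-st0 : ∀ p X -> length X == n -> win p n (st p X) == X
 win-st0 p X lX = cong (\ z -> win z n (st p X)) (sym (+0 p)) · win-st p n X N.≤-refl lX [] X refl lX

 record Good (d : ℤ) (s : State) : Set where
  constructor good
  field
   isLen : Len s == d
   isChg : Chg s == + 0
 open Good public

 swap-good : ∀ i s d -> Asc i s -> Good d s -> Good (d +1) (sw i (i +1) s)
 swap-good i s d A (good l c) = good
  (Len-at i s' · cong len w' · len-swap (hv s i) (hv s (i +1)) R A · cong (\ z -> z +1) (sym (Len-at i s) · l))
  (lin (Chg s & Chg s' & i & []) (x0 :+ (x2 :- 1') := x1 :+ (x2 :- 1') & x0 := 0' & []) (x1 := 0')
   (Chg-at i s · eq (hv s i) (hv s (i +1)) (ƩL R (\ x -> x)) · sym (Chg-at i s' · cong (\ l -> ƩL l (\ x -> x)) w')) c)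
  where
  s' = sw i (i +1) s
  R = win (i +1 +1) k' s
  eq : ∀ a b c -> a + (b + c) == b + (a + c)
  eq = solve
  rest : ∀ m p -> i +1 < p -> p + + m ≤ i + N -> win p m s' == win p m s
  rest zero p _ _ = refl
  rest (suc m) p l u = cong2 _∷_ (swap-far i s l (lin (p & + m & i & N & []) (x0 :+ (1' :+ x1) =< x2 :+ x3 & 0' =< x1 & []) (x0 :< x2 :+ x3) u 0≤+))
   (rest m (p +1) (lin (p & i & []) (x1 :+ 1' :< x0 & []) (x1 :+ 1' :< x0 :+ 1') l) (lin (p & + m & i & N & []) (x0 :+ (1' :+ x1) =< x2 :+ x3 & []) (x0 :+ 1' :+ x1 =< x2 :+ x3) u))
  w' : win i n s' == hv s (i +1) ∷ hv s i ∷ R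
  w' = cong2 _∷_ (swap-i i s) (cong2 _∷_ (swap-i+1 i s) (rest k' (i +1 +1) (lin (i & []) [] (x0 :+ 1' :< x0 :+ 1' :+ 1')) (lin (i & + k' & []) [] (x0 :+ 1' :+ 1' :+ x1 =< x0 :+ (2' :+ x1)))))

 uw-good : ∀ w φ ψ d s -> Good d s -> (∀ s -> Good (d + + length w) s -> φ s == ψ s) -> uw w φ s == uw w ψ s
 uw-good [] φ ψ d s g h = h s (subst (\ z -> Good z s) (sym (+0 d)) g)
 uw-good (i ∷ w) φ ψ d s g h = u-cong i (uw w φ) (uw w ψ) s (\ A -> uw-good w φ ψ (d +1) _ (swap-good i s d A g) (\ s g' -> h s (subst (\ z -> Good z s) (Z.+-assoc d (+ 1) (+ length w)) g')))

 inc-cong-len : ∀ p m r f g -> (∀ w -> + length w == r -> f w == g w) -> inc p m r f == inc p m r g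
 inc-cong-len p zero r f g h = »-val (r Z.≟ + 0) (\ e -> h [] (sym e))
 inc-cong-len p (suc m) r f g h = inc-cong-len (p +1) m r f g h ⊹ inc-cong-len (p +1) m (r -¹) _ _ (\ w e -> h (p ∷ w) (lin (+ length w & r & []) (x0 := x1 :- 1' & []) (1' :+ x0 := x1) e))

 dsum-cong-len : ∀ p m r f g -> (∀ v w -> + length v + + length w == r -> f v w == g v w) -> dsum p m r f == dsum p m r g
 dsum-cong-len p zero r f g h = refl
 dsum-cong-len p (suc m) r f g h = inc-cong-len (p +1) m r (f []) (g []) (\ w e -> h [] w (+0ˡ _ · e)) ⊹
  dsum-cong-len (p +1) m (r -¹) _ _ (\ v w e -> h (p ∷ v) w (lin (+ length v & + length w & r & []) (x0 :+ x1 := x2 :- 1' & []) (1' :+ x0 :+ x1 := x2) e))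

 opaque
  unfolding U
  -- The words in `U r` have r letters, and every letter raises the length by 1 and keeps the
  -- charge.
  U-good : ∀ r φ ψ d s -> Good d s -> (∀ s -> Good (d + r) s -> φ s == ψ s) -> U r φ s == U r ψ s
  U-good r φ ψ d s g h = inc-cong-len (+ 1) k r _ _ (\ w e -> uw-good w φ ψ d s g (\ s g' -> h s (subst (\ z -> Good (d + z) s) e g'))) ⊹
   dsum-cong-len (+ 1) k (r -¹) _ _ (\ v w e -> uw-good (w ++ + 0 ∷ v) φ ψ d s g (\ s g' -> h s (subst (\ z -> Good (d + z) s) (cong +_ (length-++ w) · lin (+ length v & + length w & r & []) (x0 :+ x1 := x2 :- 1' & []) (x1 :+ (1' :+ x0) := x2) e) g')))

-- Products of the `U r` at the identity separate functions.

module Sep (k' : ℕ) where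
 open Z using (_≤_)
 open import Defs using (nthℤ)
 open Base k'
 open Strong k'
 open Star k' using (U)
 open StarH k' using (Ur)
 open Carrier k'
 open Symm k' using (bound; bound-∈)
 open Length k'
 open import Data.List.Properties using (length-++)
 open import Data.Nat.Induction using (<-rec)

 nth-∈ : ∀ X j -> j N.< length X -> nthℤ X j ∈ X
 nth-∈ (x ∷ X) zero l = here refl
 nth-∈ (x ∷ X) (suc j) (s≤s l) = there (nth-∈ X j l)

 bd-win : State -> ℕ
 bd-win s = bound (win (+ 1) n s)

 hv-bound : ∀ s j q -> j N.< n -> - + bd-win s + q ≤ hv s (+ 1 + + j + q * N) × hv s (+ 1 + + j + q * N) ≤ + bd-win s + q
 hv-bound s j q l = subst (\ z -> - + bd-win s + q ≤ z × z ≤ + bd-win s + q) (sym (hv-shift s (+ 1 + + j) q)) (Z.+-monoˡ-≤ q (fst b) , Z.+-monoˡ-≤ q (snd b))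
  where
  b : - + bd-win s ≤ hv s (+ 1 + + j) × hv s (+ 1 + + j) ≤ + bd-win s
  b = bound-∈ (win (+ 1) n s) (subst (_∈ win (+ 1) n s) (nth-win (+ 1) n s j l) (nth-∈ (win (+ 1) n s) j (subst (j N.<_) (sym (length-win (+ 1) n s)) l)))

 hv-large : ∀ s B j -> bd-win s N.< B -> + 1 + + B * N ≤ j -> + 0 < hv s j
 hv-large s B j b p with position (+ 1) j
 ... | i , q , l , refl with q Z.<? + B
 ...   | yes q< = lin⊥ (+ i & N & q * N & + B * N & []) (1' :+ x3 =< 1' :+ x0 :+ x2 & x2 :+ x1 =< x3 & x0 :< x1 & []) p (mulN-< q<) (Z.+<+ l)
 ...   | no ¬q = lin (hv s (+ 1 + + i + q * N) & + bd-win s & + B & q & []) (0' :- x1 :+ x3 =< x0 & x2 =< x3 & x1 :< x2 & []) (0' :< x0) (subst (\ z -> z + q ≤ hv s (+ 1 + + i + q * N)) (sym (+0ˡ (- + bd-win s))) (fst (hv-bound s i q l))) (Z.≮⇒≥ ¬q) (Z.+<+ b)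

 hv-small : ∀ s B j -> bd-win s N.< B -> j ≤ + 1 - + B * N -> hv s j < + 0
 hv-small s B j b p with position (+ 1) j
 ... | i , q , l , refl with - + B Z.<? q
 ...   | yes q< = lin⊥ (+ i & N & q * N & + B * N & - + B * N & []) (1' :+ x0 :+ x2 =< 1' :- x3 & x4 :+ x1 =< x2 & 0' =< x0 & 0' :< x1 & x4 := 0' :- x3 & []) p (mulN-< q<) 0≤+ 0<N (eq (+ B) N)
  where
  eq : ∀ b n -> - b * n == + 0 - b * n
  eq = solve
 ...   | no ¬q = lin (hv s (+ 1 + + i + q * N) & + bd-win s & + B & q & []) (x0 =< x1 :+ x3 & x3 =< 0' :- x2 & x1 :< x2 & []) (x0 :< 0') (snd (hv-bound s i q l)) (subst (q ≤_) (sym (+0ˡ _)) (Z.≮⇒≥ ¬q)) (Z.+<+ b)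

 -- Every state has the form st p (Y ++ 0 ∷ []) with Y nonnegative: the last
 -- entry sits at the last position where the state is ≤ 0.

 last≤0 : ∀ s m p -> hv s p ≤ + 0 -> (∀ j -> p + + m ≤ j -> + 0 < hv s j) -> Σ ℤ \ M -> hv s M ≤ + 0 × (∀ j -> M < j -> + 0 < hv s j)
 last≤0 s zero p h t = exfalso (Z.≤⇒≯ h (t p (Z.≤-reflexive (+0 p))))
 last≤0 s (suc m) p h t with + 0 Z.<? hv s (p + + m)
 ... | no ¬l = p + + m , Z.≮⇒≥ ¬l , (\ j q -> t j (lin (p & + m & j & []) (x0 :+ x1 :< x2 & []) (x0 :+ (1' :+ x1) =< x2) q))
 ... | yes l = last≤0 s m p h t'
  where
  t' : ∀ j -> p + + m ≤ j -> + 0 < hv s j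
  t' j q with p + + m Z.≟ j
  ... | yes refl = l
  ... | no ne = t j (lin (p & + m & j & []) (x0 :+ x1 :< x2 & []) (x0 :+ (1' :+ x1) =< x2) (Z.≤∧≢⇒< q ne))

 record Normal (s : State) : Set where
  constructor normal
  field
   p : ℤ
   Y : List ℤ
   lenY : length Y == k
   nonneg : All (+ 0 ≤_) Y
   s≡ : s == st p (Y ++ + 0 ∷ [])
 open Normal

 normalize : ∀ s -> Normal s
 normalize s with last≤0 s (B N.* n N.+ B N.* n) (+ 1 - + B * N) (Z.<⇒≤ (hv-small s B _ N.≤-refl Z.≤-refl)) (\ j q -> hv-large s B j N.≤-refl (subst (_≤ j) top q))
  where
  B = suc (bd-win s)
  eq : ∀ x -> + 1 - x + (x + x) == + 1 + x
  eq = solve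
  top : + 1 - + B * N + + (B N.* n N.+ B N.* n) == + 1 + + B * N
  top = cong (\ z -> + 1 - + B * N + (z + z)) (Z.pos-* B n) · eq (+ B * N)
 ... | M , M≤0 , above = normal (M - + k) (win (M - + k) k s) (length-win (M - + k) k s) (nn k (M - + k) (lin (M & + k' & []) [] (x0 :< x0 :- (1' :+ x1) :+ (2' :+ x1))))
   (st-win (M - + k) s · cong (st (M - + k)) (win-snoc (M - + k) k s · cong (\ z -> win (M - + k) k s ++ z ∷ []) (cong (hv s) (lin (M & + k & []) [] (x0 :- x1 :+ x1 := x0)) · M≡0)))
  where
  M≡0 : hv s M == + 0
  M≡0 = lin (hv s M & hv s (M + N) & []) (x0 =< 0' & 0' :< x1 & x1 := x0 :+ 1' & []) (x0 := 0') M≤0 (above (M + N) (lin (M & N & []) (0' :< x1 & []) (x0 :< x0 :+ x1) 0<N)) (hv-N s M)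
  nn : ∀ m q -> M < q + N -> All (+ 0 ≤_) (win q m s)
  nn zero q l = []
  nn (suc m) q l = lin (hv s q & hv s (q + N) & []) (0' :< x1 & x1 := x0 :+ 1' & []) (0' =< x0) (above (q + N) l) (hv-N s q) ∷ nn m (q +1) (lin (M & q & N & []) (x0 :< x1 :+ x2 & []) (x0 :< x1 :+ 1' :+ x2) l)

 Lo : State -> ℤ -> Set
 Lo s j = ∀ {d} -> d N.< n -> hv s j ≤ hv s (j + + suc d)

 Lo? : ∀ s j -> Dec (Lo s j)
 Lo? s j = N.allUpTo? (\ d -> hv s j Z.≤? hv s (j + + suc d)) n

 Lo-all : ∀ s j -> Lo s j -> ∀ j' -> j < j' -> hv s j ≤ hv s j'
 Lo-all s j h j' l with position (j +1) j'
 ... | d , q , d<n , refl with q Z.<? + 0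
 ...   | yes q< = lin⊥ (j & + d & q * N & N & []) (x0 :< x0 :+ 1' :+ x1 :+ x2 & x2 :+ x3 =< 0' & x1 :< x3 & []) l (mulN-< q<) (Z.+<+ d<n)
 ...   | no ¬q = lin (hv s j & hv s (j + + suc d) & q & hv s (j +1 + + d + q * N) & []) (x0 =< x1 & 0' =< x2 & x3 := x1 :+ x2 & []) (x0 =< x3) (h d<n) (Z.≮⇒≥ ¬q)
     (hv-shift s (j +1 + + d) q · cong (\ z -> hv s z + q) (Z.+-assoc j (+ 1) (+ d)))

 -- The number of weak right-to-left minima per period, the measure in which `U r` is triangular.
 -- Comparing with the next n positions suffices for `Lo`, because h grows by 1 per period.
 zcAt : ℤ -> State -> ℤ
 zcAt p s = Ʃ n (\ j -> Lo? s (p + + j) » + 1)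

 zc : State -> ℤ
 zc = zcAt (+ 1)

 zc-at : ∀ p s -> zc s == zcAt p s
 zc-at p s = shift-invariant (\ p -> zcAt p s) inv (+ 1) p
  where
  f : ℤ -> ℤ
  f j = Lo? s j » + 1
  perL : ∀ p -> f p == f (p + N)
  perL p = »-cong (Lo? s p) (Lo? s (p + N)) (\ h {d} l -> subst2 _≤_ (sym (hv-N s p)) (sym (e d)) (Z.+-monoˡ-≤ (+ 1) (h l))) (\ h {d} l -> lin (hv s p & hv s (p + + suc d) & []) (x0 :+ 1' =< x1 :+ 1' & []) (x0 =< x1) (subst2 _≤_ (hv-N s p) (e d) (h l))) (\ _ _ -> refl)
   where
   e : ∀ d -> hv s (p + N + + suc d) == hv s (p + + suc d) +1
   e d = cong (hv s) (lin (p & N & + suc d & []) [] (x0 :+ x1 :+ x2 := x0 :+ x2 :+ x1)) · hv-N s (p + + suc d)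
  inv : ∀ p -> zcAt p s == zcAt (p +1) s
  inv p = (cong f (+0 p) · perL p · cong f (lin (p & + k' & []) [] (x0 :+ (2' :+ x1) := x0 :+ 1' :+ (1' :+ x1)))) ⊹ Ʃ-ext k (\ j -> cong f (sym (Z.+-assoc p (+ 1) (+ j)))) ·
   Z.+-comm (f (p +1 + + k)) _ · sym (Ʃ-last k (\ j -> f (p +1 + + j)))

 posn : List ℤ -> ℕ
 posn [] = 0
 posn (+ zero ∷ Y) = posn Y
 posn (+ suc _ ∷ Y) = suc (posn Y)
 posn (-[1+ _ ] ∷ Y) = posn Y

 posn-≤ : ∀ Y -> posn Y N.≤ length Y
 posn-≤ [] = z≤n
 posn-≤ (+ zero ∷ Y) = N.m≤n⇒m≤1+n (posn-≤ Y)
 posn-≤ (+ suc _ ∷ Y) = s≤s (posn-≤ Y)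
 posn-≤ (-[1+ _ ] ∷ Y) = N.m≤n⇒m≤1+n (posn-≤ Y)

 posn-snoc : ∀ Y -> posn (Y ++ + 0 ∷ []) == posn Y
 posn-snoc [] = refl
 posn-snoc (+ zero ∷ Y) = posn-snoc Y
 posn-snoc (+ suc _ ∷ Y) = cong suc (posn-snoc Y)
 posn-snoc (-[1+ _ ] ∷ Y) = posn-snoc Y

 count-zeros : ∀ Z (f : ℕ -> ℤ) -> (∀ j -> + 0 ≤ f j) -> (∀ j -> j N.< length Z -> nthℤ Z j == + 0 -> f j == + 1) -> All (+ 0 ≤_) Z -> + length Z - + posn Z ≤ Ʃ (length Z) f
 count-zeros [] f _ _ _ = Z.≤-refl
 count-zeros (+ zero ∷ Z) f f≥ f1 (_ ∷ nz) = lin (+ length Z & + posn Z & f 0 & Ʃ (length Z) (f ∘ suc) & []) (x0 :- x1 =< x3 & x2 := 1' & []) (1' :+ x0 :- x1 =< x2 :+ x3) (count-zeros Z (f ∘ suc) (f≥ ∘ suc) (\ j l -> f1 (suc j) (s≤s l)) nz) (f1 0 z<s refl)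
 count-zeros (+ suc _ ∷ Z) f f≥ f1 (_ ∷ nz) = lin (+ length Z & + posn Z & f 0 & Ʃ (length Z) (f ∘ suc) & []) (x0 :- x1 =< x3 & 0' =< x2 & []) (1' :+ x0 :- (1' :+ x1) =< x2 :+ x3) (count-zeros Z (f ∘ suc) (f≥ ∘ suc) (\ j l -> f1 (suc j) (s≤s l)) nz) (f≥ 0)
 count-zeros (-[1+ _ ] ∷ Z) f f≥ f1 (() ∷ nz)

 »1-≥0 : ∀ {P : Set} (d : Dec P) -> + 0 ≤ (d » + 1)
 »1-≥0 (yes _) = Z.+≤+ z≤n
 »1-≥0 (no _) = Z.≤-refl

 »1-≤1 : ∀ {P : Set} (d : Dec P) -> (d » + 1) ≤ + 1
 »1-≤1 (yes _) = Z.≤-refl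
 »1-≤1 (no _) = Z.+≤+ z≤n

 module _ (p : ℤ) (Y : List ℤ) (lY : length Y == k) (nn : All (+ 0 ≤_) Y) where
  private
   X = Y ++ + 0 ∷ []
   s = st p X
   lX : length X == n
   lX = length-++ Y · N.+-comm (length Y) 1 · cong suc lY
   allX : ∀ Y -> All (+ 0 ≤_) Y -> All (+ 0 ≤_) (Y ++ + 0 ∷ [])
   allX [] [] = Z.≤-refl ∷ []
   allX (y ∷ Y) (h ∷ hs) = h ∷ allX Y hs
   nnX : ∀ j -> j N.< n -> + 0 ≤ nthℤ X j
   nnX j l = All.lookup (allX Y nn) (nth-∈ X j (subst (j N.<_) (sym lX) l))
   zeroLo : ∀ j -> j N.< n -> nthℤ X j == + 0 -> Lo s (p + + j)
   zeroLo j l e {d} d<n with position p (p + + j + + suc d)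
   ... | i , q , i<n , eq with q Z.<? + 0
   ...   | yes q< = lin⊥ (p & + j & + d & + i & q * N & N & []) (x0 :+ x1 :+ (1' :+ x2) := x0 :+ x3 :+ x4 & x4 :+ x5 =< 0' & x3 :< x5 & 0' =< x1 & 0' =< x2 & []) eq (mulN-< q<) (Z.+<+ i<n) 0≤+ 0≤+
   ...   | no ¬q = subst2 _≤_ (sym (hv-st0 p X j l · e)) (sym (cong (hv s) eq · hv-st p X i q i<n)) (Z.+-mono-≤ {+ 0} {_} {+ 0} (nnX i i<n) (Z.≮⇒≥ ¬q))

  -- Each zero of the normal form is such a minimum, since all values from position p on are
  -- nonnegative.
  zc-normal : + n - + posn Y ≤ zc s
  zc-normal = subst2 (\ a b -> + a - + b ≤ zc s) lX (posn-snoc Y) (subst (+ length X - + posn X ≤_) (cong (\ l -> Ʃ l (\ j -> Lo? s (p + + j) » + 1)) lX · sym (zc-at p s))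
   (count-zeros X (\ j -> Lo? s (p + + j) » + 1) (\ j -> »1-≥0 (Lo? s (p + + j))) (\ j l e -> »-yes (Lo? s (p + + j)) (zeroLo j (subst (j N.<_) lX l) e)) (allX Y nn)))

 -- The runs contributing to rn; the flag true marks a passed letter.

 data Run : ℤ -> List ℤ -> ℤ -> List ℤ -> List Bool -> Set where
  end  : ∀ {c} -> Run c [] c [] []
  drop : ∀ {c x xs e o fl} -> Run x xs e o fl -> Run c (x ∷ xs) e (c ∷ o) (false ∷ fl)
  pass : ∀ {c x xs e o fl} -> c < x -> Run c xs e o fl -> Run c (x ∷ xs) e (x ∷ o) (true ∷ fl)

 #p : List Bool -> ℕ
 #p [] = 0
 #p (true ∷ fl) = suc (#p fl)
 #p (false ∷ fl) = #p fl

 rn-vanish : ∀ c xs K r -> (∀ e o fl -> Run c xs e o fl -> K e o (r - + #p fl) == + 0) -> rn c xs K r == + 0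
 rn-vanish c [] K r h = cong (K c []) (sym (+0 r)) · h c [] [] end
 rn-vanish c (x ∷ xs) K r h = rn-vanish x xs _ r (\ e o fl R -> h e (c ∷ o) (false ∷ fl) (drop R)) ⊹
  »-vanish (c Z.<? x) (\ l -> rn-vanish c xs _ (r -¹) (\ e o fl R -> cong (K e (x ∷ o)) (lin (r & + #p fl & []) [] (x0 :- 1' :- x1 := x0 :- (1' :+ x1))) · h e (x ∷ o) (true ∷ fl) (pass l R)))

 -- The carrier 0 cannot pass a zero, so it is replaced by an equal one, and it can pass every
 -- positive entry. The run that always passes when possible reproduces `Y`; the hypothesis disposes
 -- of all others.
 rn-single : ∀ Y K r -> All (+ 0 ≤_) Y -> (∀ e o fl -> Run (+ 0) Y e o fl -> ¬ o == Y -> K e o (r - + #p fl) == + 0) -> rn (+ 0) Y K r == K (+ 0) Y (r - + posn Y)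
 rn-single [] K r _ h = cong (K (+ 0) []) (sym (+0 r))
 rn-single (+ zero ∷ Y) K r (_ ∷ nn) h = rn-single Y _ r nn (\ e o fl R ne -> h e (+ 0 ∷ o) (false ∷ fl) (drop R) (\ { refl -> ne refl })) ⊹ refl · +0 (K (+ 0) (+ 0 ∷ Y) (r - + posn Y))
 rn-single (y@(+ suc _) ∷ Y) K r (_ ∷ nn) h = rn-vanish y Y _ r (\ e o fl R -> h e (+ 0 ∷ o) (false ∷ fl) (drop R) (\ ())) ⊹
  (»-yes (+ 0 Z.<? y) (Z.+<+ z<s) · rn-single Y _ (r -¹) nn (\ e o fl R ne -> cong (K e (y ∷ o)) (lin (r & + #p fl & []) [] (x0 :- 1' :- x1 := x0 :- (1' :+ x1))) · h e (y ∷ o) (true ∷ fl) (pass (Z.+<+ z<s) R) (\ { refl -> ne refl }))) ·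
  +0ˡ _ · cong (K (+ 0) (y ∷ Y)) (lin (r & + posn Y & []) [] (x0 :- 1' :- x1 := x0 :- (1' :+ x1)))
 rn-single (-[1+ _ ] ∷ Y) K r (() ∷ nn) h

 nthB : List Bool -> ℕ -> Bool
 nthB [] _ = true
 nthB (b ∷ fl) zero = b
 nthB (b ∷ fl) (suc j) = nthB fl j

 record DropAt (o : List ℤ) (fl : List Bool) (j : ℕ) (y : ℤ) : Set where
  constructor dropAt
  field
   inside : j N.< length o
   dropped : nthB fl j == false
   value : nthℤ o j == y

 dropS : ∀ {o fl j y z b} -> DropAt o fl j y -> DropAt (z ∷ o) (b ∷ fl) (suc j) y
 dropS (dropAt a b c) = dropAt (s≤s a) b c

 fate : ∀ {c xs e o fl} -> Run c xs e o fl -> (Σ ℕ \ j -> DropAt o fl j c) ⊎ e == c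
 fate end = inr refl
 fate (drop R) = inl (0 , dropAt z<s refl refl)
 fate (pass _ R) with fate R
 ... | inl (j , d) = inl (suc j , dropS d)
 ... | inr e = inr e

 -- The carrier that passed the letter is smaller than it and is either dropped further right or
 -- leaves as e, which returns in the next period. Either way the letter is not a minimum.
 passed : ∀ {c xs e o fl} -> Run c xs e o fl -> ∀ j -> j N.< length o -> nthB fl j == true -> (Σ ℕ \ j' -> j N.< j' × j' N.< length o × nthℤ o j' < nthℤ o j) ⊎ e < nthℤ o j
 passed (pass l R) zero _ _ with fate R
 ... | inl (j , dropAt a _ c) = inl (suc j , s≤s z≤n , s≤s a , subst (_< _) (sym c) l)
 ... | inr refl = inr l
 passed (drop R) (suc j) (s≤s q) t with passed R j q t
 ... | inl (j' , a , b , c) = inl (suc j' , s≤s a , s≤s b , c)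
 ... | inr x = inr x
 passed (pass _ R) (suc j) (s≤s q) t with passed R j q t
 ... | inl (j' , a , b , c) = inl (suc j' , s≤s a , s≤s b , c)
 ... | inr x = inr x

 run-length : ∀ {c xs e o fl} -> Run c xs e o fl -> length o == length xs
 run-length end = refl
 run-length (drop R) = cong suc (run-length R)
 run-length (pass _ R) = cong suc (run-length R)

 run-end : ∀ {c xs e o fl} -> Run c xs e o fl -> e == c ⊎ e ∈ xs
 run-end end = inl refl
 run-end (drop R) with run-end R
 ... | inl refl = inr (here refl)
 ... | inr m = inr (there m)
 run-end (pass _ R) with run-end R
 ... | inl e = inl e
 ... | inr m = inr (there m)

 -- A nonnegative carrier passes only letters above it, which are positive. If it starts as 0 and
 -- leaves positive, some positive letter was picked up instead of passed.
 few : ∀ {c Y e o fl} -> Run c Y e o fl -> + 0 ≤ c -> All (+ 0 ≤_) Y -> #p fl N.≤ posn Y × (c == + 0 -> + 0 < e -> #p fl N.< posn Y)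
 few end _ _ = z≤n , (\ { refl p -> exfalso (Z.<-irrefl refl p) })
 few {Y = + zero ∷ Y} (drop R) c≥ (h ∷ nn) = let (a , b) = few R h nn in a , (\ _ -> b refl)
 few {Y = + suc _ ∷ Y} (drop R) c≥ (h ∷ nn) = let (a , b) = few R h nn in N.m≤n⇒m≤1+n a , (\ _ _ -> s≤s a)
 few {Y = + zero ∷ Y} (pass l R) c≥ (h ∷ nn) = exfalso (Z.≤⇒≯ c≥ l)
 few {Y = + suc _ ∷ Y} (pass l R) c≥ (h ∷ nn) = let (a , b) = few R c≥ nn in s≤s a , (\ p q -> s≤s (b p q))

 -- A positive letter that is not passed becomes the carrier, and since the final carrier is not
 -- positive it has to be dropped again.
 allpassed : ∀ {c Y e o fl} -> Run c Y e o fl -> e ≤ + 0 -> c ≤ + 0 -> All (+ 0 ≤_) Y ->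
  (posn Y N.≤ #p fl × (c == + 0 -> o == Y)) ⊎ (Σ ℕ \ j -> Σ ℤ \ y -> DropAt o fl j y × + 0 < y)
 allpassed end _ _ _ = inl (z≤n , (\ _ -> refl))
 allpassed {Y = + zero ∷ Y} (drop R) e≤ c≤ (h ∷ nn) with allpassed R e≤ Z.≤-refl nn
 ... | inl (a , b) = inl (a , (\ { refl -> cong (+ 0 ∷_) (b refl) }))
 ... | inr (j , y , d , l) = inr (suc j , y , dropS d , l)
 allpassed {Y = y@(+ suc _) ∷ Y} (drop R) e≤ c≤ (h ∷ nn) with fate R
 ... | inl (j , d) = inr (suc j , y , dropS d , Z.+<+ z<s)
 ... | inr refl = exfalso (Z.≤⇒≯ e≤ (Z.+<+ z<s))
 allpassed {Y = + zero ∷ Y} (pass q R) e≤ c≤ (h ∷ nn) with allpassed R e≤ c≤ nn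
 ... | inl (a , b) = inl (N.m≤n⇒m≤1+n a , (\ { refl -> exfalso (Z.<-irrefl refl q) }))
 ... | inr (j , y , d , l) = inr (suc j , y , dropS d , l)
 allpassed {Y = y₀@(+ suc _) ∷ Y} (pass q R) e≤ c≤ (h ∷ nn) with allpassed R e≤ c≤ nn
 ... | inl (a , b) = inl (s≤s a , (\ z -> cong (y₀ ∷_) (b z)))
 ... | inr (j , y , d , l) = inr (suc j , y , dropS d , l)

 count-≤ : ∀ (o : List ℤ) fl (f : ℕ -> ℤ) -> length o == length fl -> (∀ j -> f j ≤ + 1) -> (∀ j -> j N.< length o -> nthB fl j == true -> f j == + 0) -> Ʃ (length o) f ≤ + length o - + #p fl
 count-≤ [] [] f _ _ _ = Z.≤-refl
 count-≤ (x ∷ o) (b ∷ fl) f l f≤ f0 = go b refl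
  where
  ih = count-≤ o fl (f ∘ suc) (N.suc-injective l) (f≤ ∘ suc) (\ j q -> f0 (suc j) (s≤s q))
  go : ∀ b' -> b' == b -> f 0 + Ʃ (length o) (f ∘ suc) ≤ + suc (length o) - + #p (b ∷ fl)
  go true refl = lin (f 0 & Ʃ (length o) (f ∘ suc) & + length o & + #p fl & []) (x0 := 0' & x1 =< x2 :- x3 & []) (x0 :+ x1 =< 1' :+ x2 :- (1' :+ x3)) (f0 0 z<s refl) ih
  go false refl = lin (f 0 & Ʃ (length o) (f ∘ suc) & + length o & + #p fl & []) (x0 =< 1' & x1 =< x2 :- x3 & []) (x0 :+ x1 =< 1' :+ x2 :- x3) (f≤ 0) ih

 count-< : ∀ (o : List ℤ) fl (f : ℕ -> ℤ) -> length o == length fl -> (∀ j -> f j ≤ + 1) -> (∀ j -> j N.< length o -> nthB fl j == true -> f j == + 0) ->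
  ∀ j -> j N.< length o -> nthB fl j == false -> f j == + 0 -> Ʃ (length o) f < + length o - + #p fl
 count-< (x ∷ o) (false ∷ fl) f l f≤ f0 zero _ _ z = lin (f 0 & Ʃ (length o) (f ∘ suc) & + length o & + #p fl & []) (x0 := 0' & x1 =< x2 :- x3 & []) (x0 :+ x1 :< 1' :+ x2 :- x3) z (count-≤ o fl (f ∘ suc) (N.suc-injective l) (f≤ ∘ suc) (\ j q -> f0 (suc j) (s≤s q)))
 count-< (x ∷ o) (true ∷ fl) f l f≤ f0 (suc j) (s≤s q) nb z = lin (f 0 & Ʃ (length o) (f ∘ suc) & + length o & + #p fl & []) (x0 := 0' & x1 :< x2 :- x3 & []) (x0 :+ x1 :< 1' :+ x2 :- (1' :+ x3)) (f0 0 z<s refl) (count-< o fl (f ∘ suc) (N.suc-injective l) (f≤ ∘ suc) (\ j q -> f0 (suc j) (s≤s q)) j q nb z)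
 count-< (x ∷ o) (false ∷ fl) f l f≤ f0 (suc j) (s≤s q) nb z = lin (f 0 & Ʃ (length o) (f ∘ suc) & + length o & + #p fl & []) (x0 =< 1' & x1 :< x2 :- x3 & []) (x0 :+ x1 :< 1' :+ x2 :- x3) (f≤ 0) (count-< o fl (f ∘ suc) (N.suc-injective l) (f≤ ∘ suc) (\ j q -> f0 (suc j) (s≤s q)) j q nb z)

 run-flags : ∀ {c xs e o fl} -> Run c xs e o fl -> length o == length fl
 run-flags end = refl
 run-flags (drop R) = cong suc (run-flags R)
 run-flags (pass _ R) = cong suc (run-flags R)

 module _ (q : ℤ) (Y : List ℤ) (lY : length Y == k) (nn : All (+ 0 ≤_) Y) where

  -- Passed letters are never minima, so `posn Y` passes leave at most n - `posn Y` minima. In every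
  -- case but the distinguished one, either the number of passes is wrong by `few` or `allpassed`,
  -- or some dropped letter also lies above a later value and the bound is strict.
  run-zc : ∀ {c e o fl} -> Run c (+ 0 ∷ Y) e o fl -> e -¹ == c -> #p fl == posn Y -> (c == -1ℤ × o == -1ℤ ∷ Y) ⊎ zc (st q o) < + n - + posn Y
  run-zc {c} {e} {o} {fl} R ec r≡ = finish R (classify R)
   where
   v' = st q o
   lo : length o == n
   lo = run-length R · cong suc lY
   at : ∀ j -> j N.< length o -> hv v' (q + + j) == nthℤ o j
   at j l = hv-st0 q o j (subst (j N.<_) lo l)
   E : Σ ℤ \ J -> q + N ≤ J × hv v' J == e
   E with fate R
   ... | inr e≡ = lin⊥ (e & c & []) (x0 := x1 & x0 :- 1' := x1 & []) e≡ ec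
   ... | inl (j , dropAt a _ v) = q + + j + N , lin (q & + j & N & []) (0' =< x1 & []) (x0 :+ x2 =< x0 :+ x1 :+ x2) 0≤+ , hv-N v' (q + + j) · lin (hv v' (q + + j) & nthℤ o j & c & e & []) (x0 := x1 & x1 := x2 & x3 :- 1' := x2 & []) (x0 :+ 1' := x3) (at j a) v ec
   f : ℕ -> ℤ
   f j = Lo? v' (q + + j) » + 1
   notLo : ∀ j -> j N.< length o -> (J : ℤ) -> q + + j < J -> hv v' J < nthℤ o j -> f j == + 0
   notLo j l J lt h = »-no (Lo? v' (q + + j)) (\ lo' -> Z.≤⇒≯ (Lo-all v' (q + + j) lo' J lt) (subst (hv v' J <_) (sym (at j l)) h))
   viaE : ∀ j -> j N.< length o -> e < nthℤ o j -> f j == + 0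
   viaE j l h = notLo j l (fst E) (lin (q & + j & N & fst E & []) (x1 :< x2 & x0 :+ x2 =< x3 & []) (x0 :+ x1 :< x3) (Z.+<+ (subst (j N.<_) lo l)) (fst (snd E))) (subst (_< nthℤ o j) (sym (snd (snd E))) h)
   viaW : ∀ j j' -> j N.< length o -> j N.< j' -> j' N.< length o -> nthℤ o j' < nthℤ o j -> f j == + 0
   viaW j j' l jj l' h = notLo j l (q + + j') (Z.+-monoʳ-< q (Z.+<+ jj)) (subst (_< nthℤ o j) (sym (at j' l')) h)
   f0 : ∀ j -> j N.< length o -> nthB fl j == true -> f j == + 0
   f0 j l t with passed R j l t
   ... | inl (j' , a , b , h) = viaW j j' l a b h
   ... | inr h = viaE j l h
   strict : ∀ j -> j N.< length o -> nthB fl j == false -> f j == + 0 -> zc v' < + n - + posn Y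
   strict j l nb z = subst2 _<_ {Ʃ (length o) f} {zc v'} {+ length o - + #p fl} {+ n - + posn Y} (cong (\ l -> Ʃ l f) lo · sym (zc-at q v')) (cong2 (\ a b -> + a - + b) lo r≡) (count-< o fl f (run-flags R) (\ j -> »1-≤1 (Lo? v' (q + + j))) f0 j l nb z)
   posDrop : e ≤ + 0 -> ∀ j y -> DropAt o fl j y -> + 0 < y -> zc v' < + n - + posn Y
   posDrop e≤ j y (dropAt l nb v) y> = strict j l nb (viaE j l (subst (e <_) (sym v) (Z.≤-<-trans e≤ y>)))
   classify : Run c (+ 0 ∷ Y) e o fl -> e ≤ + 0 ⊎ + 0 < e
   classify _ with e Z.≤? + 0
   ... | yes p = inl p
   ... | no ¬p = inr (Z.≰⇒> ¬p)
   finish : Run c (+ 0 ∷ Y) e o fl -> e ≤ + 0 ⊎ + 0 < e -> (c == -1ℤ × o == -1ℤ ∷ Y) ⊎ zc v' < + n - + posn Y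
   finish (drop R') (inl e≤) with allpassed R' e≤ Z.≤-refl nn
   ... | inr (j , y , d , l) = inr (posDrop e≤ (suc j) y (dropS d) l)
   ... | inl (_ , oY) = inl (c≡ , cong2 _∷_ c≡ (oY refl))
    where
    e≥ : + 0 ≤ e
    e≥ with run-end R'
    ... | inl refl = Z.≤-refl
    ... | inr m = All.lookup nn m
    c≡ : c == -1ℤ
    c≡ = sym ec · cong (\ z -> z -¹) (Z.≤-antisym e≤ e≥)
   finish (drop R') (inr e>) with c Z.≟ + 0
   ... | yes refl = exfalso (N.<-irrefl r≡ (snd (few R' Z.≤-refl nn) refl e>))
   ... | no ne with fate R'
   ...   | inr refl = exfalso (Z.<-irrefl refl e>)
   ...   | inl (j , dropAt a b v) = inr (strict 0 z<s refl (viaW 0 (suc j) z<s z<s (s≤s a) (subst (_< c) (sym v) (Z.≤∧≢⇒< (lin (e & c & []) (0' :< x0 & x0 :- 1' := x1 & []) (0' =< x1) e> ec) (ne ∘ sym)))))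
   finish (pass l R') (inl e≤) with allpassed R' e≤ (Z.<⇒≤ l) nn
   ... | inr (j , y , d , y>) = inr (posDrop e≤ (suc j) y (dropS d) y>)
   ... | inl (a , _) = exfalso (N.<-irrefl (sym r≡) (s≤s a))
   finish (pass l R') (inr e>) = lin⊥ (e & c & []) (x0 :- 1' := x1 & x1 :< 0' & 0' :< x0 & []) ec l e>

 idS : State
 idS = st (+ 1) (replicate n (+ 0))

 posn-0 : ∀ Y -> All (+ 0 ≤_) Y -> posn Y == 0 -> Y == replicate (length Y) (+ 0)
 posn-0 [] _ _ = refl
 posn-0 (+ zero ∷ Y) (_ ∷ nn) e = cong (+ 0 ∷_) (posn-0 Y nn e)
 posn-0 (-[1+ _ ] ∷ Y) (() ∷ nn) e

 -- A positive y contributes y to the right of itself but only y - 1 when 0 stands before it; a zero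
 -- contributes 0 both ways.
 len-lift : ∀ Y -> All (+ 0 ≤_) Y -> len (Y ++ + 0 ∷ []) == len (+ 0 ∷ Y) + + posn Y
 len-lift Y nn = len-snoc Y (+ 0) · cong+ʳ (len Y) (go Y nn) · eq (len Y) (ƩL Y (\ y -> gl (+ 0 - y))) (+ posn Y)
  where
  eq : ∀ a b c -> a + (b + c) == b + a + c
  eq = solve
  go : ∀ Y -> All (+ 0 ≤_) Y -> ƩL Y (\ y -> gl (y - + 0)) == ƩL Y (\ y -> gl (+ 0 - y)) + + posn Y
  go [] [] = refl
  go (+ zero ∷ Y) (_ ∷ nn) = cong+ʳ (+ 0) (go Y nn) · sym (Z.+-assoc (+ 0) (ƩL Y (\ y -> gl (+ 0 - y))) (+ posn Y))
  go (+ suc m ∷ Y) (_ ∷ nn) = cong (\ z -> gl z) (+0 (+ suc m)) ⊹ go Y nn · eq' (+ m) (ƩL Y (\ y -> gl (+ 0 - y))) (+ posn Y)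
   where
   eq' : ∀ m b c -> + 1 + m + (b + c) == m + b + (+ 1 + c)
   eq' = solve
  go (-[1+ _ ] ∷ Y) (() ∷ nn)

 Good? : ∀ d s -> Dec (Good d s)
 Good? d s = map′ (\ (a , b) -> good a b) (\ { (good a b) -> a , b }) ((Len s Z.≟ d) ×-dec (Chg s Z.≟ + 0))

 -- Separation: with r the number of positive entries in the normal form of v,
 -- the operator U r evaluated at st p (0 ∷ Y) gives φ v plus values of φ at
 -- states with smaller zc.

 Separated : ℕ -> Set
 Separated d = ∀ φ -> (∀ β -> All (N._≤ k) β -> sum β == d -> Ur β φ idS == + 0) -> ∀ v -> Good (+ d) v -> φ v == + 0

 separate : ∀ d -> (∀ {d'} -> d' N.< d -> Separated d') -> Separated d
 separate d rec φ hyp v gv = fuel Z.∣ zc v ∣ v gv (Z.≤-reflexive (sym (Z.0≤i⇒+∣i∣≡i (zc≥0 v))))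
  where
  zc≥0 : ∀ v -> + 0 ≤ zc v
  zc≥0 v = go n
   where
   go : ∀ m -> + 0 ≤ Ʃ m (\ j -> Lo? v (+ 1 + + j) » + 1)
   go m = sum≥0 m (\ j -> Lo? v (+ 1 + + j) » + 1) (\ j -> »1-≥0 (Lo? v (+ 1 + + j)))
    where
    sum≥0 : ∀ m (f : ℕ -> ℤ) -> (∀ j -> + 0 ≤ f j) -> + 0 ≤ Ʃ m f
    sum≥0 zero f h = Z.≤-refl
    sum≥0 (suc m) f h = Z.+-mono-≤ {+ 0} {_} {+ 0} (h 0) (sum≥0 m (f ∘ suc) (h ∘ suc))
  -- Cutting φ off outside length d and charge 0 makes the induction on `zc` available for every
  -- state that a run produces.
  φd : Fun
  φd s = Good? (+ d) s » φ s
  fuel : ∀ m v -> Good (+ d) v -> zc v ≤ + m -> φ v == + 0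
  smaller : ∀ m v v' -> zc v ≤ + m -> zc v' < zc v -> φd v' == + 0
  smaller zero v v' a b = lin⊥ (zc v & zc v' & []) (x0 =< 0' & x1 :< x0 & 0' =< x1 & []) a b (zc≥0 v')
  smaller (suc m) v v' a b = »-vanish (Good? (+ d) v') (\ g -> fuel m v' g (lin (zc v & zc v' & + m & []) (x0 =< 1' :+ x2 & x1 :< x0 & []) (x1 =< x2) a b))
  fuel m v gv zv = by (normalize v)
   where
   by : Normal v -> φ v == + 0
   by (normal p Y lY nn refl) = case (posn Y) refl
    where
    q = p -¹
    r = posn Y
    -- Moving the last 0 to the front lowers the length by r, so the induction on d applies at `v⁻`.
    v⁻ = st p (+ 0 ∷ Y)
    lX : length (+ 0 ∷ Y) == n
    lX = cong suc lY
    lX' : length (Y ++ + 0 ∷ []) == n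
    lX' = length-++ Y · N.+-comm (length Y) 1 · cong suc lY
    Lv : Len v == Len v⁻ + + r
    Lv = Len-at p v · cong len (win-st0 p _ lX') · len-lift Y nn · cong (\ z -> z + + r) (sym (Len-at p v⁻ · cong len (win-st0 p _ lX)))
    Cv : Chg v⁻ == + 0
    Cv = lin (Chg v & Chg v⁻ & p & []) (x0 :+ (x2 :- 1') := x1 :+ (x2 :- 1') & x0 := 0' & []) (x1 := 0') (Chg-at p v · cong (\ l -> ƩL l (\ x -> x)) (win-st0 p _ lX') · ƩL-++ Y _ (\ x -> x) · Z.+-comm (ƩL Y (\ x -> x)) (+ 0) · sym (Chg-at p v⁻ · cong (\ l -> ƩL l (\ x -> x)) (win-st0 p _ lX))) (isChg gv)
    Len≥0 : ∀ xs -> + 0 ≤ len xs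
    Len≥0 [] = Z.≤-refl
    Len≥0 (x ∷ xs) = Z.+-mono-≤ {+ 0} {_} {+ 0} (s≥0 xs) (Len≥0 xs)
     where
     gl≥0 : ∀ D -> + 0 ≤ gl D
     gl≥0 (+ _) = Z.+≤+ z≤n
     gl≥0 -[1+ _ ] = Z.+≤+ z≤n
     s≥0 : ∀ xs -> + 0 ≤ ƩL xs (\ y -> gl (x - y))
     s≥0 [] = Z.≤-refl
     s≥0 (y ∷ xs) = Z.+-mono-≤ {+ 0} {_} {+ 0} (gl≥0 (x - y)) (s≥0 xs)
    case : ∀ r' -> r' == r -> φ v == + 0
    -- Without positive entries all values are 0, charge 0 forces p = 1, and v is the identity; the
    -- empty β then gives the claim.
    case zero r0 = cong φ v≡id · hyp [] [] (sym d≡0)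
     where
     Y0 : Y == replicate k (+ 0)
     Y0 = posn-0 Y nn (sym r0) · cong (\ l -> replicate l (+ 0)) lY
     rep : ∀ m -> replicate m (+ 0) ++ + 0 ∷ [] == replicate (suc m) (+ 0)
     rep zero = refl
     rep (suc m) = cong (+ 0 ∷_) (rep m)
     X0 : Y ++ + 0 ∷ [] == replicate n (+ 0)
     X0 = cong (_++ + 0 ∷ []) Y0 · rep k
     Σ0 : ∀ m -> ƩL (replicate m (+ 0)) (\ x -> x) == + 0
     Σ0 zero = refl
     Σ0 (suc m) = +0ˡ _ · Σ0 m
     len0 : ∀ m -> len (replicate m (+ 0)) == + 0
     len0 zero = refl
     len0 (suc m) = z m ⊹ len0 m
      where
      z : ∀ m -> ƩL (replicate m (+ 0)) (\ y -> gl (+ 0 - y)) == + 0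
      z zero = refl
      z (suc m) = +0ˡ _ · z m
     p≡1 : p == + 1
     p≡1 = lin (Chg v & p & ƩL (win p n v) (\ x -> x) & []) (x0 :+ (x1 :- 1') := x2 & x0 := 0' & x2 := 0' & []) (x1 := 1') (Chg-at p v) (isChg gv) (cong (\ l -> ƩL l (\ x -> x)) (win-st0 p _ lX' · X0) · Σ0 n)
     v≡id : v == idS
     v≡id = cong2 st p≡1 X0
     d≡0 : d == 0
     d≡0 = Z.+-injective (sym (isLen gv) · Len-at p v · cong len (win-st0 p _ lX' · X0) · len0 n)
    case (suc r') e = sym (»-yes (Good? (+ d) v) gv · refl) · sym tr · ψ0
     where
     r≤d : + 0 ≤ Len v⁻
     r≤d = subst (+ 0 ≤_) (sym (Len-at p v⁻ · refl)) (Len≥0 (win p n v⁻))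
     d⁻ = d ∸ r
     r≤ : r N.≤ d
     r≤ = Z.drop‿+≤+ (lin (Len v & Len v⁻ & + r & + d & []) (x0 := x1 :+ x2 & x0 := x3 & 0' =< x1 & []) (x2 =< x3) Lv (isLen gv) r≤d)
     d≡ : + d⁻ + + r == + d
     d≡ = cong +_ (N.m∸n+n≡m r≤)
     g⁻ : Good (+ d⁻) v⁻
     g⁻ = good (lin (Len v & Len v⁻ & + r & + d & + d⁻ & []) (x0 := x1 :+ x2 & x0 := x3 & x4 :+ x2 := x3 & []) (x1 := x4) Lv (isLen gv) d≡) Cv
     ψ0 : U (+ r) φd v⁻ == + 0
     ψ0 = U-good (+ r) φd φ (+ d⁻) v⁻ g⁻ (\ s g -> »-yes (Good? (+ d) s) (subst (\ z -> Good z s) d≡ g)) ·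
      rec (N.∸-monoʳ-< {d} (subst (0 N.<_) e z<s) r≤) (U (+ r) φ) (\ β a sm -> hyp (r ∷ β) (subst (r N.≤_) lY (posn-≤ Y) ∷ a) (cong (r N.+_) sm · N.m+[n∸m]≡n r≤)) v⁻ g⁻
     B = suc (bound (+ 0 ∷ Y))
     fits : All (Fits B) (+ 0 ∷ Y)
     fits = All.tabulate (\ {x} m -> subst (_≤ x -¹) (+0ˡ _) (lin (x & + bound (+ 0 ∷ Y) & []) (0' :- x1 =< x0 & []) (0' :- (1' :+ x1) =< x0 :- 1') (subst (_≤ x) (sym (+0ˡ _)) (fst (bound-∈ (+ 0 ∷ Y) m)))) , lin (x & + bound (+ 0 ∷ Y) & []) (x0 =< x1 & []) (x0 :- 1' :< 1' :+ x1) (snd (bound-∈ (+ 0 ∷ Y) m)))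
     v≡ : st q (-1ℤ ∷ Y) == v
     v≡ = st-rotate q -1ℤ Y lY · cong (\ z -> st z (Y ++ + 0 ∷ [])) (lin (p & []) [] (x0 :- 1' :+ 1' := x0))
     dies : ∀ c e o fl -> Run c (+ 0 ∷ Y) e o fl -> ¬ (c == -1ℤ × o == -1ℤ ∷ Y) -> tfin φd q [] c e o (+ r - + #p fl) == + 0
     dies c e o fl R ne = »-vanish (+ r - + #p fl Z.≟ + 0) (\ r0 -> »-vanish (e -¹ Z.≟ c) (\ ec -> go (run-zc q Y lY nn R ec (Z.+-injective (lin (+ r & + #p fl & []) (x0 :- x1 := 0' & []) (x1 := x0) r0)))))
      where
      go : (c == -1ℤ × o == -1ℤ ∷ Y) ⊎ zc (st q o) < + n - + posn Y -> φd (st q o) == + 0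
      go (inl x) = exfalso (ne x)
      go (inr l) = smaller m v (st q o) zv (Z.<-≤-trans l (zc-normal p Y lY nn))
     g : ℤ -> ℤ
     g c = rn c (+ 0 ∷ Y) (tfin φd q [] c) (+ r)
     tr : U (+ r) φd v⁻ == φd v
     tr = trace p B φd (+ r) (+ 0 ∷ Y) lX fits · Ʃ-ext (B N.+ B) (\ t -> only (+ t - + B)) · Σc-pick B -1ℤ g (Z.-≤- z≤n) Z.-<+ · main
      where
      only : ∀ c -> g c == ((-1ℤ Z.≟ c) » g c)
      only c with -1ℤ Z.≟ c
      ... | yes _ = refl
      ... | no ne = rn-vanish c (+ 0 ∷ Y) (tfin φd q [] c) (+ r) (\ e o fl R -> dies c e o fl R (\ (a , _) -> ne (sym a)))
      main : g -1ℤ == φd v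
      main = rn-single Y (\ e o -> tfin φd q [] -1ℤ e (-1ℤ ∷ o)) (+ r) nn (\ e o fl R ne -> dies -1ℤ e (-1ℤ ∷ o) (false ∷ fl) (drop R) (\ { (_ , refl) -> ne refl })) ⊹
        rn-vanish -1ℤ Y (\ e o -> tfin φd q [] -1ℤ e (+ 0 ∷ o)) (+ r -¹) (\ e o fl R -> cong (tfin φd q [] -1ℤ e (+ 0 ∷ o)) (lin (+ r & + #p fl & []) [] (x0 :- 1' :- x1 := x0 :- (1' :+ x1))) · dies -1ℤ e (+ 0 ∷ o) (true ∷ fl) (pass Z.-<+ R) (\ { (_ , ()) })) ·
       +0 _ · »-yes (+ r - + r Z.≟ + 0) (Z.+-inverseʳ (+ r)) · cong φd v≡

 separation : ∀ d -> Separated d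
 separation = <-rec Separated (\ d rec -> separate d (\ {d'} l -> rec l))

-- From windows to states.

module Win (k' : ℕ) where
 open Z using (_≤_)
 open import Defs
 open Hidden
 open Base k'
 open Carrier k'
 open Length k' using (Chg; hv-N)
 open Sep k' using (idS)
 open import Data.Nat.Combinatorics using (_C_; nCk+nC[k+1]≡[n+1]C[k+1]; nC1≡n)
 open import Data.List.Relation.Unary.AllPairs using (AllPairs; []; _∷_)
 open import Data.Nat.Induction using (<-rec)

 eV : Window k -> ℤ -> ℤ
 eV u = gev N (toList u)

 ev-eV : ∀ u i -> ev k u i == eV u i
 ev-eV u i = sym (gev-def N (toList u) i)

 eV-shift : ∀ u i m -> eV u (i + m * N) == eV u i + m * N
 eV-shift u = QP-mul (gev-QP N (toList u))

 eV-at : ∀ u r -> r N.< n -> eV u (+ suc r) == nthℤ (toList u) r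
 eV-at u r l = cong (eV u) (sym (+0 (+ suc r))) · gev-at N (toList u) (+ 0) l · +0 (nthℤ (toList u) r)

 eV-mulT : ∀ {a b} -> ¬ a ~ b -> ∀ u j -> eV (mulT k u (a , b)) j == eV u (tr k a b j)
 eV-mulT {a} {b} ne u j = gev-mk {N} {\ j -> ev k u (tr k a b j)} (qp (\ i -> ev-eV u (tr k a b (i + N)) · cong (eV u) (cong (\ z -> tr k a b (i + z)) (sym (Z.*-identityˡ N)) · tr-shift a b ne i (+ 1)) · eV-shift u (tr k a b i) (+ 1) · sym (ev-eV u (tr k a b i)) ⊹ Z.*-identityˡ N)) j · ev-eV u (tr k a b j)

 opaque
  fl : ℤ -> ℤ
  fl x = (x -¹) /ℕ n

  fl-spec : ∀ x -> Σ ℕ \ r -> r N.< n × x == + suc r + fl x * N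
  fl-spec x = (x -¹) %ℕ n , DM.n%ℕd<d (x -¹) n , lin (x & + ((x -¹) %ℕ n) & (x -¹) /ℕ n * N & []) (x0 :- 1' := x1 :+ x2 & []) (x0 := 1' :+ x1 :+ x2) (divMod-≡ (x -¹))

  fl-unique : ∀ {x r} q -> r N.< n -> x == + suc r + q * N -> fl x == q
  fl-unique {x} {r} q l e = quot-unique q l (lin (x & + r & q * N & []) (x0 := 1' :+ x1 :+ x2 & []) (x0 :- 1' := x1 :+ x2) e)

 fl-shift : ∀ x m -> fl (x + m * N) == fl x + m
 fl-shift x m with fl-spec x
 ... | r , l , e = fl-unique (fl x + m) l (cong (\ z -> z + m * N) e · eq (+ suc r) (fl x) m N)
  where
  eq : ∀ r q m N -> r + q * N + m * N == r + (q + m) * N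
  eq = solve

 fl-lt : ∀ {x y} -> fl x < fl y -> x < y
 fl-lt {x} {y} l with fl-spec x | fl-spec y
 ... | r , r< , e | r' , _ , e' = lin (x & y & + r & + r' & fl x * N & fl y * N & []) (x0 := 1' :+ x2 :+ x4 & x1 := 1' :+ x3 :+ x5 & x2 :+ x4 :< x5 & 0' =< x3 & []) (x0 :< x1) e e' (Z.<-≤-trans (lin (+ r & fl x * N & N & []) (x0 :< x2 & []) (x0 :+ x1 :< x1 :+ x2) (Z.+<+ r<)) (mulN-< l)) 0≤+

 fl-mono : ∀ {x y} -> x < y -> fl x ≤ fl y
 fl-mono l = Z.≮⇒≥ (\ q -> Z.<-asym l (fl-lt q))

 sh : Window k -> State
 sh u = mkS (\ j -> fl (eV u j))

 hv-sh : ∀ u j -> hv (sh u) j == fl (eV u j)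
 hv-sh u = hv-mk (qp (\ i -> cong fl (step (gev-QP N (toList u)) i · cong+ʳ (eV u i) (sym (Z.*-identityˡ N))) · fl-shift (eV u i) (+ 1)))

 record Aff (u : Window k) : Set where
  field
   inj  : ∀ i j -> eV u i ~ eV u j -> i ~ j
   surj : ∀ x -> Σ ℤ \ i -> eV u i == x
 open Aff public

 eV-inj : ∀ {u} -> Aff u -> ∀ {i j} -> eV u i == eV u j -> i == j
 eV-inj {u} A {i} {j} e with inj A i j (subst (eV u i ~_) e ~-refl)
 ... | m , refl = sym (+0 i) · cong (\ z -> i + z * N) (sym m0)
  where
  m0 : m == + 0
  m0 = Z.*-cancelʳ-≡ m (+ 0) N (lin (eV u i & m * N & + 0 * N & []) (x0 := x0 :+ x1 & x2 := 0' & []) (x1 := x2) (e · eV-shift u i m) (Z.*-zeroˡ N))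

 -- Membership in W⁰ by positions: values in the same block of n, those with equal `fl`, increase
 -- from left to right. `Bad` states the failure by a witness, because this witness has to be
 -- followed along weak steps.
 W0 Bad : Window k -> Set
 W0 u = ∀ i j -> i < j -> fl (eV u i) == fl (eV u j) -> eV u i < eV u j
 Bad u = Σ ℤ \ i -> Σ ℤ \ j -> i < j × fl (eV u i) == fl (eV u j) × eV u j < eV u i

 W0-bwd : ∀ {u} -> W0 u -> ∀ {i j} -> i < j -> eV u j < eV u i -> fl (eV u j) < fl (eV u i)
 W0-bwd {u} w {i} {j} l lt = Z.≤∧≢⇒< (fl-mono lt) (\ e -> Z.<-asym lt (w i j l (sym e)))

 -- The positions with h = 0 are those of the values 1, ..., n, and in W⁰ these values stand in
 -- increasing order. Strong induction on the value puts each of them at the same position in u and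
 -- v; periodicity does the rest.
 sh-injective : ∀ u v -> Aff u -> Aff v -> W0 u -> W0 v -> sh u == sh v -> u == v
 sh-injective u v Au Av wu wv e = gev-ext N u v (\ i -> every i)
  where
  h : ∀ i -> fl (eV u i) == fl (eV v i)
  h i = sym (hv-sh u i) · cong (\ s -> hv s i) e · hv-sh v i
  P : ℕ -> Set
  P r = r N.< n -> ∀ i -> (eV u i == + suc r -> eV v i == + suc r) × (eV v i == + suc r -> eV u i == + suc r)
  f0 : ∀ {x r} -> r N.< n -> x == + suc r -> fl x == + 0
  f0 {x} {r} l q = fl-unique (+ 0) l (q · sym (+0 (+ suc r)))
  small : ∀ {x} -> fl x == + 0 -> Σ ℕ \ r -> r N.< n × x == + suc r
  small {x} q with fl-spec x
  ... | r , l , eq = r , l , eq · cong (\ z -> + suc r + z * N) q · +0 (+ suc r)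
  one-way : ∀ (a b : Window k) -> Aff a -> Aff b -> W0 a -> W0 b -> (∀ i -> fl (eV a i) == fl (eV b i)) -> ∀ r -> (∀ r' -> r' N.< r -> ∀ i -> (eV a i == + suc r' -> eV b i == + suc r') × (eV b i == + suc r' -> eV a i == + suc r')) -> r N.< n -> ∀ i -> eV a i == + suc r -> eV b i == + suc r
  one-way a b Aa Ab wa wb hh r ih l i ai with small {eV b i} (sym (hh i) · f0 l ai)
  ... | r₁ , l₁ , bi with N.<-cmp r₁ r
  ...   | tri≈ _ refl _ = bi
  ...   | tri< q _ _ = exfalso (N.<⇒≢ q (N.suc-injective (Z.+-injective (sym (snd (ih r₁ q i) bi) · ai))))
  ...   | tri> _ _ q with surj Ab (+ suc r)
  ...     | j , bj with small {eV a j} (hh j · f0 l bj)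
  ...       | r₂ , l₂ , aj with N.<-cmp r₂ r
  ...         | tri< q₂ _ _ = exfalso (N.<⇒≢ q₂ (N.suc-injective (Z.+-injective (sym (fst (ih r₂ q₂ j) aj) · bj))))
  ...         | tri≈ _ refl _ = cong (eV b) (eV-inj Aa (ai · sym aj)) · bj
  ...         | tri> _ _ q₂ with Z.<-cmp i j
  ...           | tri≈ _ refl _ = bj
  ...           | tri< ij _ _ = lin⊥ (eV b i & eV b j & + r & + r₁ & []) (x0 :< x1 & x0 := 1' :+ x3 & x1 := 1' :+ x2 & x2 :< x3 & []) (wb i j ij (f0 l₁ bi · sym (f0 l bj))) bi bj (Z.+<+ q)
  ...           | tri> _ _ ji = lin⊥ (eV a i & eV a j & + r & + r₂ & []) (x1 :< x0 & x0 := 1' :+ x2 & x1 := 1' :+ x3 & x2 :< x3 & []) (wa j i ji (f0 l₂ aj · sym (f0 l ai))) ai aj (Z.+<+ q₂)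
  rec : ∀ r -> P r
  rec = <-rec P (\ r ih l i -> one-way u v Au Av wu wv h r (\ r' q -> ih q (N.<-trans q l)) l i , one-way v u Av Au wv wu (\ i -> sym (h i)) r (\ r' q i -> let (x , y) = ih q (N.<-trans q l) i in y , x) l i)
  every : ∀ i -> eV u i == eV v i
  every i with fl-spec (eV u i)
  ... | r , l , eq = lin (eV u i & eV v i & eV v (i + m * N) & m * N & + r & fl (eV u i) * N & []) (x0 := 1' :+ x4 :+ x5 & x3 := 0' :- x5 & x2 := x1 :+ x3 & x2 := 1' :+ x4 & []) (x0 := x1) eq me (eV-shift v i m)
    (fst (rec r l (i + m * N)) (eV-shift u i m · lin (eV u i & m * N & + r & fl (eV u i) * N & []) (x0 := 1' :+ x2 :+ x3 & x1 := 0' :- x3 & []) (x0 :+ x1 := 1' :+ x2) eq me))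
   where
   m = - fl (eV u i)
   me : m * N == + 0 - fl (eV u i) * N
   me = e' (fl (eV u i)) N
    where
    e' : ∀ a b -> - a * b == + 0 - a * b
    e' = solve

 ltℤ⇒ : ∀ {x y} -> T (ltℤ x y) -> x < y
 ltℤ⇒ {x} {y} t = Z.≰⇒> (\ le -> notT (Z.≤⇒≤ᵇ le) t)
  where
  notT : ∀ {b} -> T b -> ¬ T (not b)
  notT {true} _ ()

 ⇒ltℤ : ∀ {x y} -> x < y -> T (ltℤ x y)
 ⇒ltℤ {x} {y} l with y Z.≤ᵇ x in e
 ... | false = _
 ... | true = exfalso (Z.<⇒≱ l (Z.≤ᵇ⇒≤ (subst T (sym e) _)))

 and-upTo⇒ : ∀ f m -> T (and (applyUpTo f m)) -> ∀ j -> j N.< m -> T (f j)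
 and-upTo⇒ f (suc m) t zero _ = fst (split∧ {f 0} t)
 and-upTo⇒ f (suc m) t (suc j) (s≤s l) = and-upTo⇒ (f ∘ suc) m (snd (split∧ {f 0} t)) j l

 ⇒and-upTo : ∀ f m -> (∀ j -> j N.< m -> T (f j)) -> T (and (applyUpTo f m))
 ⇒and-upTo f zero h = _
 ⇒and-upTo f (suc m) h = join (h 0 z<s) (⇒and-upTo (f ∘ suc) m (\ j l -> h (suc j) (s≤s l)))
  where
  join : ∀ {a b} -> T a -> T b -> T (a ∧ b)
  join {true} {true} _ _ = _

 invAt-found : ∀ {u} -> Aff u -> ∀ i v -> eV u i == v -> invAt k u v == i
 invAt-found {u} A i v e with pos-decomp i
 ... | r , q , l , refl = invAt-go k u v · go (toList u) 1 r lr before at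
  where
  xs = toList u
  len-toList : ∀ {m} (w : Vec ℤ m) -> length (toList w) == m
  len-toList [] = refl
  len-toList (x ∷ w) = cong suc (len-toList w)
  lr : r N.< length xs
  lr = subst (r N.<_) (sym (len-toList u)) l
  at : v == nthℤ xs r + q * N
  at = sym e · gev-at N xs q l
  before : ∀ s -> s N.< r -> ¬ v ~ nthℤ xs s
  before s s<r ne = N.<⇒≢ s<r (N.suc-injective (Z.+-injective (~-near eq (lin (+ suc s & + suc r & N & []) (x0 =< x1 & 0' :< x2 & []) (x0 :- x2 :< x1) (Z.+≤+ (s≤s (N.<⇒≤ s<r))) 0<N) (lin (+ s & + r & N & []) (x1 :< x2 & 0' =< x0 & []) (1' :+ x1 :< 1' :+ x0 :+ x2) (Z.+<+ l) 0≤+))))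
   where
   eq : + suc s ~ + suc r
   eq = inj A (+ suc s) (+ suc r) (subst2 _~_ (sym (eV-at u s (N.<-trans s<r l))) (sym (eV-at u r l)) (~-trans (~-sym ne) (~-sym (q , at))))
  go : ∀ xs r₀ r -> r N.< length xs -> (∀ s -> s N.< r -> ¬ v ~ nthℤ xs s) -> v == nthℤ xs r + q * N -> invGo k v r₀ xs == + (r₀ N.+ r) + q * N
  go (x ∷ xs) r₀ zero _ _ v≡ rewrite rem-true {v} {x} (~-sym (q , v≡)) = cong2 (\ a b -> + a + b * N) (sym (N.+-identityʳ r₀)) (quot-unique {v - x} {0} q z<s (lin (v & x & q * N & []) (x0 := x1 :+ x2 & []) (x0 :- x1 := 0' :+ x2) v≡))
  go (x ∷ xs) r₀ (suc r) (s≤s l) bf v≡ rewrite rem-false {v} {x} (bf 0 z<s) = go xs (suc r₀) r l (\ s q -> bf (suc s) (s≤s q)) v≡ · cong (\ z -> + z + q * N) (sym (N.+-suc r₀ r))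

 inW0⇒W0 : ∀ {u} -> Aff u -> T (inW0 k u) -> W0 u
 inW0⇒W0 {u} A t i j l e with fl-spec (eV u i) | fl-spec (eV u j) | Z.<-cmp (eV u i) (eV u j)
 ... | _ | _ | tri< q _ _ = q
 ... | _ | _ | tri≈ _ q _ = exfalso (Z.<-irrefl (eV-inj A q) l)
 ... | r , r< , ei | r' , r'< , ej | tri> _ _ q = lin⊥ (i & j & m * N & []) (x0 :< x1 & x1 :+ x2 :< x0 :+ x2 & []) l (subst2 _<_ (found j r' ej′) (cong (\ z -> invAt k u (+ suc z)) gapr · found i r ei) (chain (r ∸ suc r') r' (subst (N._≤ k) (sym gapr) (s≤s⁻¹ r<))))
  where
  m = - fl (eV u i)
  ej′ : eV u j == + suc r' + fl (eV u i) * N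
  ej′ = ej · cong (\ z -> + suc r' + z * N) (sym e)
  r'<r : r' N.< r
  r'<r = Z.drop‿+<+ (lin (eV u i & eV u j & + r & + r' & fl (eV u i) * N & []) (x1 :< x0 & x0 := 1' :+ x2 :+ x4 & x1 := 1' :+ x3 :+ x4 & []) (x3 :< x2) q ei ej′)
  gapr : suc r' N.+ (r ∸ suc r') == r
  gapr = N.m+[n∸m]≡n r'<r
  eqm : ∀ r a b -> r + a * b + - a * b == r
  eqm = solve
  found : ∀ i' r -> eV u i' == + suc r + fl (eV u i) * N -> invAt k u (+ suc r) == i' + m * N
  found i' r e' = invAt-found A (i' + m * N) (+ suc r) (eV-shift u i' m · cong (\ z -> z + m * N) e' · eqm (+ suc r) (fl (eV u i)) N)
  one : ∀ a -> a N.< k -> invAt k u (+ suc a) < invAt k u (+ suc (suc a))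
  one a l = ltℤ⇒ (and-upTo⇒ (\ j -> ltℤ (invAt k u (+ suc j)) (invAt k u (+ suc (suc j)))) k t a l)
  chain : ∀ d a -> suc a N.+ d N.≤ k -> invAt k u (+ suc a) < invAt k u (+ suc (suc (a N.+ d)))
  chain zero a l = subst (\ z -> invAt k u (+ suc a) < invAt k u (+ suc (suc z))) (sym (N.+-identityʳ a)) (one a (subst (\ z -> suc z N.≤ k) (N.+-identityʳ a) l))
  chain (suc d) a l = Z.<-trans (one a (N.≤-trans (s≤s (N.m≤m+n a (suc d))) l)) (subst (\ z -> invAt k u (+ suc (suc a)) < invAt k u (+ suc (suc z))) (sym (N.+-suc a d)) (chain d (suc a) (subst (\ z -> suc z N.≤ k) (N.+-suc a d) l)))

 fl-small : ∀ r -> r N.< n -> fl (+ suc r) == + 0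
 fl-small r l = fl-unique (+ 0) l (sym (+0 (+ suc r)))

 W0⇒inW0 : ∀ {u} -> Aff u -> W0 u -> T (inW0 k u)
 W0⇒inW0 {u} A w = ⇒and-upTo (\ j -> ltℤ (invAt k u (+ suc j)) (invAt k u (+ suc (suc j)))) k step′
  where
  step′ : ∀ j -> j N.< k -> T (ltℤ (invAt k u (+ suc j)) (invAt k u (+ suc (suc j))))
  step′ j l with surj A (+ suc j) | surj A (+ suc (suc j))
  ... | i , e | i' , e' = ⇒ltℤ (subst2 _<_ (sym (invAt-found A i (+ suc j) e)) (sym (invAt-found A i' (+ suc (suc j)) e')) lt)
   where
   lt : i < i'
   lt with Z.<-cmp i i'
   ... | tri< q _ _ = q
   ... | tri≈ _ refl _ = exfalso (N.<⇒≢ (N.n<1+n j) (N.suc-injective (Z.+-injective (sym e · e'))))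
   ... | tri> _ _ q = lin⊥ (eV u i & eV u i' & + j & []) (x1 :< x0 & x0 := 1' :+ x2 & x1 := 2' :+ x2 & []) (w i' i q (cong fl e' · fl-small (suc j) (s≤s l) · sym (cong fl e · fl-small j (N.m≤n⇒m≤1+n l)))) e e'

 Aff-mulT : ∀ {a b} -> ¬ a ~ b -> ∀ {u} -> Aff u -> Aff (mulT k u (a , b))
 Aff-mulT {a} {b} ne {u} A = record
  { inj  = \ i j e -> tr-~⁻ a b ne (inj A _ _ (subst2 _~_ (eV-mulT ne u i) (eV-mulT ne u j) e))
  ; surj = \ x -> let (i , e) = surj A x in tr k a b i , trans (eV-mulT ne u (tr k a b i)) (cong (eV u) (tr-invol a b ne i) · e) }

 mulT-invol : ∀ {a b} -> ¬ a ~ b -> ∀ u -> mulT k (mulT k u (a , b)) (a , b) == u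
 mulT-invol {a} {b} ne u = gev-ext N _ _ (\ j -> eV-mulT ne (mulT k u (a , b)) j · eV-mulT ne u (tr k a b j) · cong (eV u) (tr-invol a b ne j))

 sh-mulT : ∀ {a b} -> ¬ a ~ b -> ∀ u -> sh (mulT k u (a , b)) == sw a b (sh u)
 sh-mulT {a} {b} ne u = hv-ext _ _ (\ j -> hv-sh (mulT k u (a , b)) j · cong fl (eV-mulT ne u j) · sym (hv-sh u (tr k a b j)) · sym (hv-sw a b ne (sh u) j))

 unique-nth : ∀ (xs : List ℤ) -> AllPairs (\ x y -> ¬ x == y) (map (\ x -> x %ℕ n) xs) -> ∀ r r' -> r N.< length xs -> r' N.< length xs -> nthℤ xs r %ℕ n == nthℤ xs r' %ℕ n -> r == r'
 unique-nth (x ∷ xs) (p ∷ ps) = go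
  where
  hit : ∀ xs -> All (\ y -> ¬ x %ℕ n == y) (map (\ x -> x %ℕ n) xs) -> ∀ r -> r N.< length xs -> ¬ x %ℕ n == nthℤ xs r %ℕ n
  hit (y ∷ ys) (q ∷ qs) zero _ e = q e
  hit (y ∷ ys) (q ∷ qs) (suc r) (s≤s l) e = hit ys qs r l e
  go : ∀ r r' -> r N.< length (x ∷ xs) -> r' N.< length (x ∷ xs) -> nthℤ (x ∷ xs) r %ℕ n == nthℤ (x ∷ xs) r' %ℕ n -> r == r'
  go zero zero _ _ e = refl
  go zero (suc r') _ (s≤s l) e = exfalso (hit xs p r' l e)
  go (suc r) zero (s≤s l) _ e = exfalso (hit xs p r l (sym e))
  go (suc r) (suc r') (s≤s l) (s≤s l') e = cong suc (unique-nth xs ps r r' l l' e)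

 length-toList : ∀ {m} {A : Set} (w : Vec A m) -> length (toList w) == m
 length-toList [] = refl
 length-toList (x ∷ w) = cong suc (length-toList w)

 module FromPerm (u : Window k) (P : IsAffPerm k u) where
  private
   xs = toList u
   res : ℕ -> ℕ
   res r = nthℤ xs r %ℕ n

   res-inj : ∀ r r' -> r N.< n -> r' N.< n -> res r == res r' -> r == r'
   res-inj r r' l l' = unique-nth xs (fst P) r r' (subst (r N.<_) (sym (length-toList u)) l) (subst (r' N.<_) (sym (length-toList u)) l')

   -- Pigeonhole on n + 1 residues, that of x and those of the n entries: two entries cannot
   -- coincide, so x coincides with one.
   res-surj : ∀ x -> x N.< n -> Σ ℕ \ r -> r N.< n × res r == x
   res-surj x l with FP.pigeonhole (N.n<1+n n) f
    where
    f : Fin (suc n) -> Fin n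
    f Fin.zero = fromℕ< l
    f (Fin.suc r) = fromℕ< (DM.n%ℕd<d (nthℤ xs (toℕ r)) n)
   ... | Fin.zero , Fin.suc r , _ , e = toℕ r , FP.toℕ<n r , sym (FP.toℕ-fromℕ< (DM.n%ℕd<d (nthℤ xs (toℕ r)) n)) · cong toℕ (sym e) · FP.toℕ-fromℕ< l
   ... | Fin.suc r , Fin.suc r' , s≤s q , e = exfalso (N.<⇒≢ q (res-inj (toℕ r) (toℕ r') (FP.toℕ<n r) (FP.toℕ<n r') (sym (FP.toℕ-fromℕ< (DM.n%ℕd<d (nthℤ xs (toℕ r)) n)) · cong toℕ e · FP.toℕ-fromℕ< (DM.n%ℕd<d (nthℤ xs (toℕ r')) n))))
   ... | Fin.zero , Fin.zero , () , _

   at-~ : ∀ r q -> r N.< n -> nthℤ xs r ~ eV u (+ suc r + q * N)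
   at-~ r q l = q , gev-at N xs q l

  aff : Aff u
  aff .inj i j e with pos-decomp i | pos-decomp j
  ... | r , q , l , refl | r' , q' , l' , refl with res-inj r r' l l' (~-rem (~-trans (at-~ r q l) (~-trans e (~-sym (at-~ r' q' l')))))
  ...   | refl = ~-trans (~-sym (~-shift (+ suc r) q)) (~-shift (+ suc r) q')
  aff .surj x with res-surj (x %ℕ n) (DM.n%ℕd<d x n)
  ... | r , l , e with rem-~ {nthℤ xs r} {x} e
  ...   | q , e' = + suc r + q * N , gev-at N xs q l · sym e'

  private
   rs : ℕ -> ℕ
   rs r = fst (fl-spec (nthℤ xs r))
   rs< : ∀ r -> rs r N.< n
   rs< r = fst (snd (fl-spec (nthℤ xs r)))
   rs-eq : ∀ r -> nthℤ xs r == + suc (rs r) + fl (nthℤ xs r) * N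
   rs-eq r = snd (snd (fl-spec (nthℤ xs r)))

   rs-inj : ∀ r r' -> r N.< n -> r' N.< n -> rs r == rs r' -> r == r'
   rs-inj r r' l l' e = res-inj r r' l l' (~-rem (~-trans (~-sym (fl (nthℤ xs r) , rs-eq r)) (subst (\ z -> + suc z ~ nthℤ xs r') (sym e) (fl (nthℤ xs r') , rs-eq r'))))

   rs-surj : ∀ x -> x N.< n -> Σ ℕ \ r -> r N.< n × rs r == x
   rs-surj x l with res-surj (+ suc x %ℕ n) (DM.n%ℕd<d (+ suc x) n)
   ... | r , l' , e with rem-~ {+ suc x} {nthℤ xs r} (sym e)
   ...   | q , e' = r , l' , fst (divMod-unique (fl (nthℤ xs r)) q (rs< r) l (lin (nthℤ xs r & + rs r & + x & fl (nthℤ xs r) * N & q * N & []) (x0 := 1' :+ x1 :+ x3 & x0 := 1' :+ x2 :+ x4 & []) (x1 :+ x3 := x2 :+ x4) (rs-eq r) e'))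

   sum-rs : Ʃ n (\ j -> + rs j) == Ʃ n (\ r -> + r)
   sum-rs = Ʃ-cong n (\ j l -> sym (Ʃ-pick n {\ r -> (rs j N.≟ r) » + r} (rs j) (rs< j) (\ i _ ne -> »-no (rs j N.≟ i) (\ e -> ne (sym e))) · »-yes (rs j N.≟ rs j) refl)) ·
    Ʃ-swap n n (\ j r -> (rs j N.≟ r) » + r) · Ʃ-cong n (\ r l -> pick r (rs-surj r l))
    where
    pick : ∀ r -> (Σ ℕ \ j -> j N.< n × rs j == r) -> Ʃ n (\ j -> (rs j N.≟ r) » + r) == + r
    pick r (j , l , e) = Ʃ-pick n {\ j -> (rs j N.≟ r) » + r} j l (\ i l' ne -> »-no (rs i N.≟ r) (\ e' -> ne (rs-inj i j l' l (e' · sym e)))) · »-yes (rs j N.≟ r) e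

   gauss : ∀ m -> + (suc m C 2) == Ʃ m (\ r -> + suc r)
   gauss zero = refl
   gauss (suc m) = cong +_ (sym (nCk+nC[k+1]≡[n+1]C[k+1] (suc m) 1) · cong (N._+ (suc m C 2)) (nC1≡n (suc m)) · N.+-comm (suc m) (suc m C 2)) ·
    Z.pos-+ (suc m C 2) (suc m) · cong (\ z -> z + + suc m) (gauss m) · sym (Ʃ-last m (\ r -> + suc r))

   sum-nth : ∀ ys -> sumℤ ys == Ʃ (length ys) (nthℤ ys)
   sum-nth [] = refl
   sum-nth (y ∷ ys) = cong+ʳ y (sum-nth ys)

  -- The residues of the entries are a permutation of 1, ..., n, whose sum is already the prescribed
  -- one; the quotients must sum to 0.
  charge : Chg (sh u) == + 0
  charge = go n (+ 1) · Ʃ-cong n at · zero!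
   where
   go : ∀ m p -> ƩL (win p m (sh u)) (\ x -> x) == Ʃ m (\ j -> hv (sh u) (p + + j))
   go zero p = refl
   go (suc m) p = cong (hv (sh u)) (sym (+0 p)) ⊹ (go m (p +1) · Ʃ-ext m (\ j -> cong (hv (sh u)) (Z.+-assoc p (+ 1) (+ j))))
   at : ∀ j -> j N.< n -> hv (sh u) (+ 1 + + j) == fl (nthℤ xs j)
   at j l = hv-sh u (+ suc j) · cong fl (eV-at u j l)
   S = Ʃ n (\ j -> fl (nthℤ xs j))
   total : Ʃ n (nthℤ xs) == Ʃ n (\ r -> + suc r)
   total = sym (sum-nth xs · cong (\ z -> Ʃ z (nthℤ xs)) (length-toList u)) · snd P · gauss n
   split : Ʃ n (nthℤ xs) == Ʃ n (\ j -> + suc (rs j)) + S * N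
   split = Ʃ-ext n rs-eq · Ʃ-+ n (\ j -> + suc (rs j)) (\ j -> fl (nthℤ xs j) * N) · cong+ʳ (Ʃ n (\ j -> + suc (rs j))) (Ʃ-ext n (\ j -> Z.*-comm (fl (nthℤ xs j)) N) · Ʃ-* n N (\ j -> fl (nthℤ xs j)) · Z.*-comm N S)
   plus1 : ∀ (f : ℕ -> ℕ) -> Ʃ n (\ j -> + suc (f j)) == Ʃ n (\ _ -> + 1) + Ʃ n (\ j -> + f j)
   plus1 f = Ʃ-+ n (\ _ -> + 1) (\ j -> + f j)
   zero! : S == + 0
   zero! = Z.*-cancelʳ-≡ S (+ 0) N (lin (Ʃ n (nthℤ xs) & Ʃ n (\ r -> + suc r) & S * N & []) (x0 := x1 & x0 := x1 :+ x2 & []) (x2 := 0') total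
    (split · cong (\ z -> z + S * N) (plus1 rs · cong+ʳ (Ʃ n (\ _ -> + 1)) sum-rs · sym (plus1 (\ r -> r)))) · sym (Z.*-zeroˡ N))

 eV-idW : ∀ i -> eV (idW k) i == i
 eV-idW = gev-mk {N} {\ i -> i} (qp (\ i -> refl))

 Aff-idW : Aff (idW k)
 Aff-idW = record { inj = \ i j -> subst2 _~_ (eV-idW i) (eV-idW j) ; surj = \ x -> x , eV-idW x }

 W0-idW : W0 (idW k)
 W0-idW i j l _ = subst2 _<_ (sym (eV-idW i)) (sym (eV-idW j)) l

 sh-idW : sh (idW k) == idS
 sh-idW = st-ext (+ 1) (sh (idW k)) (replicate n (+ 0)) (\ j l -> hv-sh (idW k) (+ suc j) · cong fl (eV-idW (+ suc j)) · fl-small j l · sym (nth-rep n j))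
  where
  nth-rep : ∀ m j -> nthℤ (replicate m (+ 0)) j == + 0
  nth-rep zero j = refl
  nth-rep (suc m) zero = refl
  nth-rep (suc m) (suc j) = nth-rep m j

 hv-idS : ∀ j -> hv idS j == fl j
 hv-idS j = cong (\ s -> hv s j) (sym sh-idW) · hv-sh (idW k) j · cong fl (eV-idW j)

 fl-neg : ∀ {j} -> j ≤ + 0 -> fl j < + 0
 fl-neg {j} l = Z.≰⇒> contra
  where
  contra : ¬ + 0 ≤ fl j
  contra q with fl-spec j
  ... | r , _ , e = lin⊥ (j & + r & fl j * N & []) (x0 =< 0' & x0 := 1' :+ x1 :+ x2 & 0' =< x1 & 0' =< x2 & []) l e 0≤+ (subst (_≤ fl j * N) (Z.*-zeroˡ N) (Z.*-monoʳ-≤-nonNeg N q))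

 fl-pos : ∀ {j} -> + 1 ≤ j -> + 0 ≤ fl j
 fl-pos {j} l = Z.≮⇒≥ contra
  where
  contra : ¬ fl j < + 0
  contra q with fl-spec j
  ... | r , r< , e = lin⊥ (j & + r & fl j * N & N & []) (1' =< x0 & x0 := 1' :+ x1 :+ x2 & x1 :< x3 & x2 :+ x3 =< 0' & []) l e (Z.+<+ r<) (subst (fl j * N + N ≤_) (Z.*-zeroˡ N) (mulN-< q))

 fl-neg⁻ : ∀ {j} -> fl j < + 0 -> j ≤ + 0
 fl-neg⁻ {j} q = Z.≮⇒≥ (\ l -> Z.<⇒≱ q (fl-pos (Z.i<j⇒suc[i]≤j l)))

 fl-pos⁻ : ∀ {j} -> + 0 ≤ fl j -> + 0 < j
 fl-pos⁻ {j} q = Z.≰⇒> (\ l -> Z.<⇒≱ (fl-neg l) q)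

-- Cyclically increasing label sequences as the words of `Ub`.

module Cyc (k' : ℕ) where
 open import Defs
 open Hidden
 open Tab using (bi; bi-∧; Ʃ-seqs; seqs-letters; Letters; T⇒≡; ¬T⇒≡)
 open Base k'
 open Words k' using (Word)
 open WordSums k' using (inc; inc-ext; dsum; Ub)
 open Carrier k' using (run)
 import Data.List.Properties
 open import Data.List.Properties using (++-assoc; map-++)
 open import Data.List.Relation.Unary.Any as Any using (here)
 open import Data.List.Relation.Unary.Any.Properties using (any⁺; any⁻; lookup-index)
 open import Data.List.Membership.Propositional.Properties using (∈-++⁺ʳ; ∈-++⁺ˡ; ∈-++⁻)
 import Data.Nat.DivMod as ND

 subs : List ℕ -> ℤ -> (List ℕ -> ℤ) -> ℤ
 subs [] m g = (m Z.≟ + 0) » g []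
 subs (z ∷ Z) m g = subs Z m g + subs Z (m -¹) (\ v -> g (z ∷ v))

 subs-ext : ∀ Z m {g h} -> (∀ w -> g w == h w) -> subs Z m g == subs Z m h
 subs-ext [] m e = cong (\ z -> (m Z.≟ + 0) » z) (e [])
 subs-ext (z ∷ Z) m e = subs-ext Z m e ⊹ subs-ext Z (m -¹) (\ w -> e (z ∷ w))

 subs-neg : ∀ Z m g -> m < + 0 -> subs Z m g == + 0
 subs-neg [] m g l = »-no (m Z.≟ + 0) (\ e -> Z.<-irrefl e l)
 subs-neg (z ∷ Z) m g l = subs-neg Z m g l ⊹ subs-neg Z (m -¹) (\ v -> g (z ∷ v)) (lin (m & []) (x0 :< 0' & []) (x0 :- 1' :< 0') l)

 subs-0 : ∀ Z g -> subs Z (+ 0) g == g []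
 subs-0 [] g = refl
 subs-0 (z ∷ Z) g = subs-0 Z g ⊹ subs-neg Z -1ℤ (\ v -> g (z ∷ v)) Z.-<+ · +0 (g [])

 si : ℕ -> List ℕ -> Bool
 si t [] = true
 si t (x ∷ xs) = (t N.≤ᵇ x) ∧ si (suc x) xs

 strictInc-si : ∀ xs -> strictInc xs == si 0 xs
 strictInc-si [] = refl
 strictInc-si (x ∷ xs) = go x xs
  where
  go : ∀ x xs -> strictInc (x ∷ xs) == si (suc x) xs
  go x [] = refl
  go x (y ∷ ys) = cong (\ z -> (x N.<ᵇ y) ∧ z) (go y ys)

 bi-≤ : ∀ t r -> bi (t N.≤ᵇ r) == ((r N.≟ t) » + 1) + bi (suc t N.≤ᵇ r)
 bi-≤ t r with N.<-cmp r t
 ... | tri≈ _ refl _ = cong bi (T⇒≡ (N.≤⇒≤ᵇ {t} N.≤-refl)) · sym (»-yes (t N.≟ t) {+ 1} refl ⊹ cong bi (¬T⇒≡ (\ q -> N.<-irrefl refl (N.≤ᵇ⇒≤ (suc t) t q))))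
 ... | tri< l ne _ = cong bi (¬T⇒≡ (\ q -> N.<⇒≱ l (N.≤ᵇ⇒≤ t r q))) · sym (»-no (r N.≟ t) {+ 1} ne ⊹ cong bi (¬T⇒≡ (\ q -> N.<-asym l (N.≤ᵇ⇒≤ (suc t) r q))))
 ... | tri> _ ne l = cong bi (T⇒≡ (N.≤⇒≤ᵇ (N.<⇒≤ l))) · sym (»-no (r N.≟ t) {+ 1} ne ⊹ cong bi (T⇒≡ (N.≤⇒≤ᵇ l)))

 -- Words increasing for a ranking ρ of the letters are subwords of the list of all letters in order of rank.
 module Ranked (Q : ℕ) (ρ σ : ℕ -> ℕ) (ρ< : ∀ x -> x N.< Q -> ρ x N.< Q) (σ< : ∀ t -> t N.< Q -> σ t N.< Q)
  (ρσ : ∀ t -> t N.< Q -> ρ (σ t) == t) (σρ : ∀ x -> x N.< Q -> σ (ρ x) == x) where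

  ranked : ∀ c t (τ : ℕ -> ℕ) -> t N.+ c == Q -> (∀ i -> τ i == σ (t N.+ i)) -> ∀ p g ->
   ƩL (seqs p Q) (\ L -> bi (si t (map ρ L)) * g L) == subs (applyUpTo τ c) (+ p) g
  ranked c t τ e τ≡ zero g = +0 (+ 1 * g []) · Z.*-identityˡ (g []) · sym (subs-0 (applyUpTo τ c) g)
  ranked zero t τ e τ≡ (suc p) g = Ʃ-seqs p Q (\ L -> bi (si t (map ρ L)) * g L) · Ʃ-zero Q (\ x l -> ƩL-zero (seqs p Q) (\ r _ ->
   cong (\ b -> bi (b ∧ si (suc (ρ x)) (map ρ r)) * g (x ∷ r)) (¬T⇒≡ (\ q -> N.<⇒≱ (ρ< x l) (N.≤-trans (N.≤-reflexive (sym e · N.+-identityʳ t)) (N.≤ᵇ⇒≤ t (ρ x) q))))))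
  ranked (suc c) t τ e τ≡ (suc p) g = Ʃ-seqs p Q (\ L -> bi (si t (map ρ L)) * g L) · Ʃ-ext Q (\ x -> ƩL-ext (seqs p Q) (\ r -> row x r) · ƩL-+ (seqs p Q) (\ r -> (ρ x N.≟ t) » A x r) (\ r -> bi (si (suc t) (map ρ (x ∷ r))) * g (x ∷ r))) ·
   Ʃ-+ Q (\ x -> ƩL (seqs p Q) (\ r -> (ρ x N.≟ t) » A x r)) (\ x -> ƩL (seqs p Q) (\ r -> bi (si (suc t) (map ρ (x ∷ r))) * g (x ∷ r))) ·
   Z.+-comm (Ʃ Q (\ x -> ƩL (seqs p Q) (\ r -> (ρ x N.≟ t) » A x r))) _ ·
   (sym (Ʃ-seqs p Q (\ L -> bi (si (suc t) (map ρ L)) * g L)) · ranked c (suc t) (τ ∘ suc) e' τ' (suc p) g) ⊹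
    (picked · ranked c (suc t) (τ ∘ suc) e' τ' p (\ v -> g (τ 0 ∷ v)))
   where
   e' : suc t N.+ c == Q
   e' = sym (N.+-suc t c) · e
   τ' : ∀ i -> τ (suc i) == σ (suc t N.+ i)
   τ' i = τ≡ (suc i) · cong σ (N.+-suc t i)
   t< : t N.< Q
   t< = subst (t N.<_) e (N.m<m+n t z<s)
   τ0 : τ 0 == σ t
   τ0 = τ≡ 0 · cong σ (N.+-identityʳ t)
   A : ℕ -> List ℕ -> ℤ
   A x r = bi (si (suc (ρ x)) (map ρ r)) * g (x ∷ r)
   eq : ∀ a b c d -> (a + b) * c * d == a * (c * d) + b * c * d
   eq = solve
   row : ∀ x r -> bi (si t (map ρ (x ∷ r))) * g (x ∷ r) == ((ρ x N.≟ t) » A x r) + bi (si (suc t) (map ρ (x ∷ r))) * g (x ∷ r)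
   row x r = cong (\ z -> z * g (x ∷ r)) (bi-∧ (t N.≤ᵇ ρ x) (si (suc (ρ x)) (map ρ r)) · cong (\ z -> z * bi (si (suc (ρ x)) (map ρ r))) (bi-≤ t (ρ x))) ·
    eq ((ρ x N.≟ t) » + 1) (bi (suc t N.≤ᵇ ρ x)) (bi (si (suc (ρ x)) (map ρ r))) (g (x ∷ r)) ·
    sym (»-*1 (ρ x N.≟ t) (A x r)) ⊹ cong (\ z -> z * g (x ∷ r)) (sym (bi-∧ (suc t N.≤ᵇ ρ x) (si (suc (ρ x)) (map ρ r))))
   picked : Ʃ Q (\ x -> ƩL (seqs p Q) (\ r -> (ρ x N.≟ t) » A x r)) == ƩL (seqs p Q) (\ r -> bi (si (suc t) (map ρ r)) * g (τ 0 ∷ r))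
   picked = Ʃ-pick Q {\ x -> ƩL (seqs p Q) (\ r -> (ρ x N.≟ t) » A x r)} (σ t) (σ< t t<) (\ x l ne -> ƩL-zero (seqs p Q) (\ r _ -> »-no (ρ x N.≟ t) (\ q -> ne (sym (σρ x l) · cong σ q)))) ·
    ƩL-ext (seqs p Q) (\ r -> »-yes (ρ (σ t) N.≟ t) (ρσ t t<) · cong2 (\ a b -> bi (si (suc a) (map ρ r)) * g (b ∷ r)) (ρσ t t<) (sym τ0))

 any⇒∈ : ∀ x L -> T (any (\ y -> y N.≡ᵇ x) L) -> x ∈ L
 any⇒∈ x L t = Any.map (\ {y} q -> sym (N.≡ᵇ⇒≡ y x q)) (any⁻ (\ y -> y N.≡ᵇ x) L t)

 ∈⇒any : ∀ x L -> x ∈ L -> T (any (\ y -> y N.≡ᵇ x) L)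
 ∈⇒any x L p = any⁺ (\ y -> y N.≡ᵇ x) (Any.map (\ {y} q -> N.≡⇒≡ᵇ y x (sym q)) p)

 record Missing (L : List ℕ) (i r : ℕ) : Set where
  field
   from : i N.≤ r
   to   : r N.≤ n
   has  : ∀ x -> i N.≤ x -> x N.< r -> x ∈ L
   lacks  : r N.< n -> ¬ r ∈ L

 mmGo-missing : ∀ L c i (τ : ℕ -> ℕ) -> i N.+ c == n -> (∀ x -> τ x == i N.+ x) -> Missing L i (mmGo k L (applyUpTo τ c))
 mmGo-missing L zero i τ e τ≡ = record { from = N.≤-reflexive e' ; to = N.≤-refl ; has = \ x a b -> exfalso (N.<⇒≱ b (subst (N._≤ x) e' a)) ; lacks = \ l -> exfalso (N.<-irrefl refl l) }
  where
  e' = sym (N.+-identityʳ i) · e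
 mmGo-missing L (suc c) i τ e τ≡ with any (\ y -> y N.≡ᵇ τ 0) L in q
 ... | false = subst (Missing L i) (sym τ0) (record { from = N.≤-refl ; to = subst (i N.≤_) e (N.m≤m+n i (suc c)) ; has = \ x a b -> exfalso (N.<⇒≱ b a) ; lacks = \ _ p -> subst T (cong (\ z -> any (\ y -> y N.≡ᵇ z) L) (sym τ0) · q) (∈⇒any i L p) })
  where
  τ0 : τ 0 == i
  τ0 = τ≡ 0 · N.+-identityʳ i
 ... | true = record { from = N.<⇒≤ (from ih) ; to = to ih ; lacks = lacks ih ; has = hs }
  where
  open Missing
  ih = mmGo-missing L c (suc i) (τ ∘ suc) (sym (N.+-suc i c) · e) (\ x -> τ≡ (suc x) · N.+-suc i x)
  hs : ∀ x -> i N.≤ x -> x N.< mmGo k L (applyUpTo (τ ∘ suc) c) -> x ∈ L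
  hs x a b with N.m≤n⇒m<n∨m≡n a
  ... | inl l = has ih x l b
  ... | inr refl = any⇒∈ i L (subst T (sym q · cong (\ z -> any (\ y -> y N.≡ᵇ z) L) (τ≡ 0 · N.+-identityʳ i)) _)

 missing : ∀ L -> Missing L 0 (minMissing k L)
 missing L = subst (Missing L 0) (sym (minMissing-go k L)) (mmGo-missing L n 0 (\ x -> x) refl (\ x -> refl))

 missing-unique : ∀ L j -> j N.< n -> (∀ i -> i N.< j -> i ∈ L) -> ¬ j ∈ L -> minMissing k L == j
 missing-unique L j j< h nj with N.<-cmp (minMissing k L) j
 ... | tri≈ _ e _ = e
 ... | tri< l _ _ = exfalso (Missing.lacks (missing L) (N.<-trans l j<) (h _ l))
 ... | tri> _ _ l = exfalso (nj (Missing.has (missing L) j z≤n l))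

 missing-short : ∀ L -> length L N.≤ k -> minMissing k L N.< n
 missing-short L l = N.≤∧≢⇒< (Missing.to (missing L)) contra
  where
  contra : ¬ minMissing k L == n
  contra e = let (i , j , lt , q) = FP.pigeonhole (s≤s l) (\ i -> Any.index (mem i)) in N.<⇒≢ lt (lookup-index (mem i) · cong (List.lookup L) q · sym (lookup-index (mem j)))
   where
   mem : ∀ (i : Fin n) -> toℕ i ∈ L
   mem i = Missing.has (missing L) (toℕ i) z≤n (subst (toℕ i N.<_) (sym e) (FP.toℕ<n i))

 subs-vanish : ∀ {P : ℕ -> Set} Z m g -> All P Z -> (∀ w -> All P w -> g w == + 0) -> subs Z m g == + 0
 subs-vanish [] m g a h = »-vanish (m Z.≟ + 0) (\ _ -> h [] [])
 subs-vanish (z ∷ Z) m g (p ∷ a) h = subs-vanish Z m g a h ⊹ subs-vanish Z (m -¹) (\ v -> g (z ∷ v)) a (\ w b -> h (z ∷ w) (p ∷ b))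

 subsR : List ℕ -> ℤ -> (ℤ -> List ℕ -> ℤ) -> ℤ
 subsR [] m K = K m []
 subsR (z ∷ Z) m K = subsR Z m K + subsR Z (m -¹) (\ r v -> K r (z ∷ v))

 subs-++ : ∀ Z Y m g -> subs (Z ++ Y) m g == subsR Z m (\ r w -> subs Y r (\ y -> g (w ++ y)))
 subs-++ [] Y m g = refl
 subs-++ (z ∷ Z) Y m g = subs-++ Z Y m g ⊹ subs-++ Z Y (m -¹) (\ v -> g (z ∷ v))

 subsR-cong : ∀ {P : ℕ -> Set} Z m K K' -> All P Z -> (∀ r w -> All P w -> K r w == K' r w) -> subsR Z m K == subsR Z m K'
 subsR-cong [] m K K' a h = h m [] []
 subsR-cong (z ∷ Z) m K K' (p ∷ a) h = subsR-cong Z m K K' a h ⊹ subsR-cong Z (m -¹) _ _ a (\ r w b -> h r (z ∷ w) (p ∷ b))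

 subsR-shift : ∀ Z m j g -> subsR Z m (\ r w -> (r Z.≟ j) » g w) == subs Z (m - j) g
 subsR-shift [] m j g = »-cong (m Z.≟ j) (m - j Z.≟ + 0) (\ e -> lin (m & j & []) (x0 := x1 & []) (x0 :- x1 := 0') e) (\ e -> lin (m & j & []) (x0 :- x1 := 0' & []) (x0 := x1) e) (\ _ _ -> refl)
 subsR-shift (z ∷ Z) m j g = subsR-shift Z m j g ⊹ (subsR-shift Z (m -¹) j (\ v -> g (z ∷ v)) · cong (\ r -> subs Z r (\ v -> g (z ∷ v))) (lin (m & j & []) [] (x0 :- 1' :- x1 := x0 :- x1 :- 1')))

 All-upTo : ∀ {P : ℕ -> Set} (τ : ℕ -> ℕ) c -> (∀ i -> i N.< c -> P (τ i)) -> All P (applyUpTo τ c)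
 All-upTo τ zero h = []
 All-upTo τ (suc c) h = h 0 z<s ∷ All-upTo (τ ∘ suc) c (\ i l -> h (suc i) (s≤s l))

 -- If j is the least missing letter, all of 0, ..., j - 1 occur and j does not. In the order
 -- rotated to begin after j these are the last letters, so the end of the word is forced.
 missing-tail : ∀ j -> j N.< n -> ∀ (f : List ℕ -> ℤ) c i (τ : ℕ -> ℕ) pre r -> i N.+ c == j -> (∀ x -> τ x == i N.+ x) -> (∀ x -> x N.< i -> x ∈ pre) -> (∀ x -> i N.≤ x -> x N.≤ j -> ¬ x ∈ pre) ->
  subs (applyUpTo τ (suc c)) r (\ y -> (minMissing k (pre ++ y) N.≟ j) » f (pre ++ y)) == ((r Z.≟ + c) » f (pre ++ applyUpTo τ c))
 missing-tail j j< f zero i τ pre r e τ≡ lo hi = »-val (r Z.≟ + 0) (\ _ -> »-yes (minMissing k (pre ++ []) N.≟ j) {f (pre ++ [])} mm) ⊹ »-vanish (r -¹ Z.≟ + 0) (\ _ -> »-no (minMissing k (pre ++ τ 0 ∷ []) N.≟ j) {f (pre ++ τ 0 ∷ [])} bad) · +0 ((r Z.≟ + 0) » f (pre ++ []))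
  where
  i≡j = sym (N.+-identityʳ i) · e
  unpre : ∀ {x} -> x ∈ pre ++ [] -> x ∈ pre
  unpre = subst (_ ∈_) (Data.List.Properties.++-identityʳ pre)
  mm : minMissing k (pre ++ []) == j
  mm = missing-unique (pre ++ []) j j< (\ x l -> ∈-++⁺ˡ (lo x (subst (x N.<_) (sym i≡j) l))) (\ p -> hi j (N.≤-reflexive i≡j) N.≤-refl (unpre p))
  bad : ¬ minMissing k (pre ++ τ 0 ∷ []) == j
  bad q = Missing.lacks (missing (pre ++ τ 0 ∷ [])) (subst (N._< n) (sym q) j<) (subst (_∈ pre ++ τ 0 ∷ []) (sym q) (∈-++⁺ʳ pre (here (sym i≡j · sym (τ≡ 0 · N.+-identityʳ i)))))
 missing-tail j j< f (suc c) i τ pre r e τ≡ lo hi = skip ⊹ pick · +0ˡ ((r -¹ Z.≟ + c) » f ((pre ++ τ 0 ∷ []) ++ applyUpTo (τ ∘ suc) c)) · »-cong (r -¹ Z.≟ + c) (r Z.≟ + suc c) (\ q -> lin (r & + c & []) (x0 :- 1' := x1 & []) (x0 := 1' :+ x1) q) (\ q -> lin (r & + c & []) (x0 := 1' :+ x1 & []) (x0 :- 1' := x1) q) (\ _ _ -> cong f (++-assoc pre (τ 0 ∷ []) (applyUpTo (τ ∘ suc) c)))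
  where
  τ0 : τ 0 == i
  τ0 = τ≡ 0 · N.+-identityʳ i
  i<j : i N.< j
  i<j = subst (i N.<_) e (N.m<m+n i z<s)
  e' : suc i N.+ c == j
  e' = sym (N.+-suc i c) · e
  τ' : ∀ x -> τ (suc x) == suc i N.+ x
  τ' x = τ≡ (suc x) · N.+-suc i x
  skip : subs (applyUpTo (τ ∘ suc) (suc c)) r (\ y -> (minMissing k (pre ++ y) N.≟ j) » f (pre ++ y)) == + 0
  skip = subs-vanish {i N.<_} (applyUpTo (τ ∘ suc) (suc c)) r _ (All-upTo (τ ∘ suc) (suc c) (\ x _ -> subst (i N.<_) (sym (τ' x)) (s≤s (N.m≤m+n i x)))) (\ w a -> »-no (minMissing k (pre ++ w) N.≟ j) (\ q -> no-i w a (∈-++⁻ pre (Missing.has (missing (pre ++ w)) i z≤n (subst (i N.<_) (sym q) i<j)))))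
   where
   no-i : ∀ w -> All (i N.<_) w -> ¬ (i ∈ pre ⊎ i ∈ w)
   no-i w a (inl p) = hi i N.≤-refl (N.<⇒≤ i<j) p
   no-i w a (inr p) = N.<-irrefl refl (All.lookup a p)
  lo' : ∀ x -> x N.< suc i -> x ∈ pre ++ τ 0 ∷ []
  lo' x (s≤s l) with N.m≤n⇒m<n∨m≡n l
  ... | inl q = ∈-++⁺ˡ (lo x q)
  ... | inr refl = ∈-++⁺ʳ pre (here (sym τ0))
  hi' : ∀ x -> suc i N.≤ x -> x N.≤ j -> ¬ x ∈ pre ++ τ 0 ∷ []
  hi' x l l' p with ∈-++⁻ pre p
  ... | inl q = hi x (N.<⇒≤ l) l' q
  ... | inr (here q) = N.<⇒≢ l (sym (q · τ0))
  pick : subs (applyUpTo (τ ∘ suc) (suc c)) (r -¹) (\ y -> (minMissing k (pre ++ τ 0 ∷ y) N.≟ j) » f (pre ++ τ 0 ∷ y)) == ((r -¹ Z.≟ + c) » f ((pre ++ τ 0 ∷ []) ++ applyUpTo (τ ∘ suc) c))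
  pick = subs-ext (applyUpTo (τ ∘ suc) (suc c)) (r -¹) (\ y -> cong (\ z -> (minMissing k z N.≟ j) » f z) (sym (++-assoc pre (τ 0 ∷ []) y))) ·
   missing-tail j j< f c (suc i) (τ ∘ suc) (pre ++ τ 0 ∷ []) (r -¹) e' τ' lo' hi'

 rank : ℕ -> ℕ -> ℕ
 rank j x = (x N.+ n ∸ suc j) N.% n

 applyUpTo-+ : ∀ (τ : ℕ -> ℕ) a b -> applyUpTo τ (a N.+ b) == applyUpTo τ a ++ applyUpTo (\ i -> τ (a N.+ i)) b
 applyUpTo-+ τ zero b = refl
 applyUpTo-+ τ (suc a) b = cong (τ 0 ∷_) (applyUpTo-+ (τ ∘ suc) a b)

 applyUpTo-cong : ∀ (τ τ' : ℕ -> ℕ) a -> (∀ i -> i N.< a -> τ i == τ' i) -> applyUpTo τ a == applyUpTo τ' a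
 applyUpTo-cong τ τ' zero h = refl
 applyUpTo-cong τ τ' (suc a) h = cong2 _∷_ (h 0 z<s) (applyUpTo-cong (τ ∘ suc) (τ' ∘ suc) a (\ i l -> h (suc i) (s≤s l)))

 module At (j c : ℕ) (e : j N.+ c == k) where
  σ : ℕ -> ℕ
  σ t = (t N.+ suc j) N.% n

  ρ-low : ∀ x -> x N.≤ j -> rank j x == c N.+ x
  ρ-low x l = cong (\ z -> (x N.+ suc z ∸ suc j) N.% n) (sym e) · cong (\ z -> (z ∸ suc j) N.% n) (cong (x N.+_) (N.+-comm (suc j) c) · sym (N.+-assoc x c (suc j))) · cong (N._% n) (N.m+n∸n≡m (x N.+ c) (suc j)) · ND.m<n⇒m%n≡m (s≤s (subst (x N.+ c N.≤_) e (N.+-monoˡ-≤ c l))) · N.+-comm x c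

  ρ-high : ∀ i -> i N.< c -> rank j (suc j N.+ i) == i
  ρ-high i l = cong (N._% n) (cong (N._∸ suc j) (N.+-assoc (suc j) i n) · N.m+n∸m≡n (suc j) (i N.+ n)) · ND.[m+n]%n≡m%n i n · ND.m<n⇒m%n≡m (N.m≤n⇒m≤1+n (N.≤-trans l (subst (c N.≤_) e (N.m≤n+m c j))))

  σ-low : ∀ t -> t N.< c -> σ t == suc j N.+ t
  σ-low t l = ND.m<n⇒m%n≡m (subst2 N._<_ (N.+-comm (suc j) t) (cong suc e) (N.+-monoʳ-< (suc j) l)) · N.+-comm t (suc j)

  σ-high : ∀ i -> i N.≤ j -> σ (c N.+ i) == i
  σ-high i l = cong (N._% n) (cong (N._+ suc j) (N.+-comm c i) · N.+-assoc i c (suc j) · cong (i N.+_) (N.+-comm c (suc j) · cong suc e)) · ND.[m+n]%n≡m%n i n · ND.m<n⇒m%n≡m (s≤s (N.≤-trans l (subst (j N.≤_) e (N.m≤m+n j c))))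

  view : ∀ a b x -> x N.< a N.+ b -> x N.< a ⊎ Σ ℕ \ i -> i N.< b × x == a N.+ i
  view a b x l with N.<-≤-connex x a
  ... | inl q = inl q
  ... | inr q = inr (x ∸ a , N.+-cancelˡ-< a (x ∸ a) b (subst (N._< a N.+ b) (sym (N.m+[n∸m]≡n q)) l) , sym (N.m+[n∸m]≡n q))

  n≡ : n == c N.+ suc j
  n≡ = cong suc (sym e) · N.+-comm (suc j) c

  σρ : ∀ x -> x N.< n -> σ (rank j x) == x
  σρ x l with view (suc j) c x (subst (x N.<_) (cong suc (sym e)) l)
  ... | inl (s≤s q) = cong σ (ρ-low x q) · σ-high x q
  ... | inr (i , q , refl) = cong σ (ρ-high i q) · σ-low i q

  ρσ : ∀ t -> t N.< n -> rank j (σ t) == t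
  ρσ t l with view c (suc j) t (subst (t N.<_) n≡ l)
  ... | inl q = cong (rank j) (σ-low t q) · ρ-high t q
  ... | inr (i , s≤s q , refl) = cong (rank j) (σ-high i q) · ρ-low i q

  sum-at : ∀ m f -> ƩL (seqs m n) (\ L -> bi (si 0 (map (rank j) L)) * ((minMissing k L N.≟ j) » f L)) == subs (applyUpTo (suc j N.+_) c) (+ m - + j) (\ w -> f (w ++ upTo j))
  sum-at m f = Ranked.ranked n (rank j) σ (\ x _ -> ND.m%n<n (x N.+ n ∸ suc j) n) (\ t _ -> ND.m%n<n (t N.+ suc j) n) ρσ σρ n 0 σ refl (\ _ -> refl) m (\ L -> (minMissing k L N.≟ j) » f L) ·
   cong (\ Z -> subs Z (+ m) (\ L -> (minMissing k L N.≟ j) » f L)) letters ·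
   subs-++ (applyUpTo (suc j N.+_) c) (upTo (suc j)) (+ m) (\ L -> (minMissing k L N.≟ j) » f L) ·
   subsR-cong {j N.<_} (applyUpTo (suc j N.+_) c) (+ m) _ _ (All-upTo (suc j N.+_) c (\ i _ -> s≤s (N.m≤m+n j i))) (\ r w a -> missing-tail j j<n f j 0 (\ x -> x) w r refl (\ _ -> refl) (\ _ ()) (\ x _ x≤j p -> N.<⇒≱ (All.lookup a p) x≤j)) ·
   subsR-shift (applyUpTo (suc j N.+_) c) (+ m) (+ j) (\ w -> f (w ++ upTo j))
   where
   j<n : j N.< n
   j<n = s≤s (subst (j N.≤_) e (N.m≤m+n j c))
   letters : applyUpTo σ n == applyUpTo (suc j N.+_) c ++ upTo (suc j)
   letters = cong (applyUpTo σ) n≡ · applyUpTo-+ σ c (suc j) · cong2 _++_ (applyUpTo-cong σ (suc j N.+_) c σ-low) (applyUpTo-cong (\ i -> σ (c N.+ i)) (\ x -> x) (suc j) (\ i l -> σ-high i (s≤s⁻¹ l)))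

 map-run : ∀ (τ : ℕ -> ℕ) d P -> (∀ i -> + τ i == P + + i) -> map +_ (applyUpTo τ d) == run P d
 map-run τ zero P h = refl
 map-run τ (suc d) P h = cong2 _∷_ (h 0 · +0 P) (map-run (τ ∘ suc) d (P +1) (\ i -> h (suc i) · sym (Z.+-assoc P (+ 1) (+ i))))

 subs-inc : ∀ (τ : ℕ -> ℕ) c P m g -> (∀ i -> + τ i == P + + i) -> subs (applyUpTo τ c) m (\ w -> g (map +_ w)) == inc P c m g
 subs-inc τ zero P m g h = refl
 subs-inc τ (suc c) P m g h = subs-inc (τ ∘ suc) c (P +1) m g h' ⊹ (subs-ext (applyUpTo (τ ∘ suc) c) (m -¹) (\ w -> cong (\ z -> g (z ∷ map +_ w)) (h 0 · +0 P)) · subs-inc (τ ∘ suc) c (P +1) (m -¹) (\ v -> g (P ∷ v)) h')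
  where
  h' : ∀ i -> + τ (suc i) == P +1 + + i
  h' i = h (suc i) · sym (Z.+-assoc P (+ 1) (+ i))

 dsum-Ʃ : ∀ P c r h -> dsum P c r h == Ʃ c (\ d -> inc (P + + suc d) (c ∸ suc d) (r - + d) (h (run P d)))
 dsum-Ʃ P zero r h = refl
 dsum-Ʃ P (suc c) r h = cong (\ z -> inc (P +1) c z (h [])) (sym (+0 r)) ⊹
  (dsum-Ʃ (P +1) c (r -¹) (\ v -> h (P ∷ v)) · Ʃ-ext c (\ d -> cong2 (\ a b -> inc a (c ∸ suc d) b (h (P ∷ run (P +1) d))) (Z.+-assoc P (+ 1) (+ suc d)) (lin (r & + d & []) [] (x0 :- 1' :- x1 := x0 :- (1' :+ x1)))))

 -- Sort the words by their least missing letter j: they are w followed by 0, ..., j - 1, with w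
 -- increasing in j + 1, ..., k. The case j = 0 gives the words of `Ub` without 0, and j = d + 1
 -- those in which a run of length d follows the letter 0.
 cyc-sum : ∀ m f -> 1 N.≤ m -> m N.≤ k -> ƩL (seqs m n) (\ L -> bi (cycInc k L) * f (map +_ L)) == Ub (+ 0) (+ m) f
 cyc-sum m f 1≤m m≤k = seqs-letters m n _ _ step1 · ƩL-Ʃ-swap (seqs m n) n (\ L j -> bi (si 0 (map (rank j) L)) * ((minMissing k L N.≟ j) » f (map +_ L))) · Ʃ-cong n at · collect
  where
  step1 : ∀ L -> Letters n L -> length L == m -> bi (cycInc k L) * f (map +_ L) == Ʃ n (\ j -> bi (si 0 (map (rank j) L)) * ((minMissing k L N.≟ j) » f (map +_ L)))
  step1 L a refl = cong (\ z -> bi z * f (map +_ L)) cyc≡ · sym (Ʃ-pick n {\ j -> bi (si 0 (map (rank j) L)) * ((minMissing k L N.≟ j) » f (map +_ L))} (minMissing k L) (missing-short L m≤k) (\ i _ ne -> cong (\ z -> bi (si 0 (map (rank i) L)) * z) (»-no (minMissing k L N.≟ i) (\ q -> ne (sym q))) · Z.*-zeroʳ (bi (si 0 (map (rank i) L)))) · cong (\ z -> bi (si 0 (map (rank (minMissing k L)) L)) * z) (»-yes (minMissing k L N.≟ minMissing k L) refl))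
   where
   alls : ∀ L -> Letters n L -> all (\ x -> x N.<ᵇ n) L == true
   alls [] [] = refl
   alls (x ∷ L) (l ∷ a) = cong2 _∧_ (T⇒≡ (N.<⇒<ᵇ l)) (alls L a)
   cyc≡ : cycInc k L == si 0 (map (rank (minMissing k L)) L)
   cyc≡ = cong2 (\ x y -> x ∧ (length L N.≤ᵇ k) ∧ y ∧ strictInc (map (rank (minMissing k L)) L)) (T⇒≡ (N.≤⇒≤ᵇ 1≤m)) (alls L a) ·
    cong (\ y -> y ∧ strictInc (map (rank (minMissing k L)) L)) (T⇒≡ (N.≤⇒≤ᵇ m≤k)) · strictInc-si (map (rank (minMissing k L)) L)
  at : ∀ j -> j N.< n -> ƩL (seqs m n) (\ L -> bi (si 0 (map (rank j) L)) * ((minMissing k L N.≟ j) » f (map +_ L))) == inc (+ suc j) (k ∸ j) (+ m - + j) (\ w -> f (w ++ map +_ (upTo j)))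
  at j (s≤s l) = At.sum-at j (k ∸ j) (N.m+[n∸m]≡n l) m (\ L -> f (map +_ L)) ·
   subs-ext (applyUpTo (suc j N.+_) (k ∸ j)) (+ m - + j) (\ w -> cong f (map-++ +_ w (upTo j))) · subs-inc (suc j N.+_) (k ∸ j) (+ suc j) (+ m - + j) (\ w -> f (w ++ map +_ (upTo j))) (\ i -> refl)
  collect : Ʃ n (\ j -> inc (+ suc j) (k ∸ j) (+ m - + j) (\ w -> f (w ++ map +_ (upTo j)))) == Ub (+ 0) (+ m) f
  collect = (cong (\ z -> inc (+ 1) k z (\ w -> f (w ++ []))) (+0 (+ m)) · inc-ext (+ 1) k (+ m) _ _ (\ w -> cong f (Data.List.Properties.++-identityʳ w))) ⊹
   sym (dsum-Ʃ (+ 1) k (+ m -¹) (\ v w -> f (w ++ + 0 ∷ v)) · Ʃ-ext k (\ d -> cong (\ z -> inc (+ 1 + + suc d) (k ∸ suc d) z (\ w -> f (w ++ + 0 ∷ run (+ 1) d))) (lin (+ m & + d & []) [] (x0 :- 1' :- x1 := x0 :- (1' :+ x1))) ·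
    inc-ext (+ 1 + + suc d) (k ∸ suc d) (+ m - + suc d) _ _ (\ w -> cong (\ z -> f (w ++ + 0 ∷ z)) (sym (map-run suc d (+ 1) (\ i -> refl))))))

-- The numbers K as values of the `U r` at the identity.

module Weak (k' : ℕ) where
 open import Defs
 open Tab using (bi; T⇒≡; ¬T⇒≡)
 open Base k'
 open Strong k' using (Fun; Asc; asc?)
 open Words k' using (Word; Linear; ext)
 open WordSums k' using (Ub)
 open Star k' using (uw; U)
 open StarH k' using (U-linear; Ur; Ur-linear)
 open Symm k' using (U-comm)
 open Sep k' using (idS)
 open Win k'
 open Cyc k' using (cyc-sum)
 open import Data.Maybe using (Maybe; just; nothing)
 import Data.Nat.ListAction as NL

 adjacent-order : ∀ i {p q} -> p < q -> tr k i (i +1) p < tr k i (i +1) q ⊎ Σ ℤ \ m -> p == i + m * N × q == i +1 + m * N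
 adjacent-order i {p} {q} l with cases i (i +1) p | cases i (i +1) q
 ... | is-a m refl | is-a m' refl = inl (subst2 _<_ (sym (tr-a i (i +1) m)) (sym (tr-a i (i +1) m')) (lin (i & m * N & m' * N & []) (x0 :+ x1 :< x0 :+ x2 & []) (x0 :+ 1' :+ x1 :< x0 :+ 1' :+ x2) l))
 ... | is-b m refl | is-b m' refl = inl (subst2 _<_ (sym (tr-b i (i +1) m (¬~-suc i))) (sym (tr-b i (i +1) m' (¬~-suc i))) (lin (i & m * N & m' * N & []) (x0 :+ 1' :+ x1 :< x0 :+ 1' :+ x2 & []) (x0 :+ x1 :< x0 :+ x2) l))
 ... | is-b m refl | is-a m' refl = inl (subst2 _<_ (sym (tr-b i (i +1) m (¬~-suc i))) (sym (tr-a i (i +1) m')) (lin (i & m * N & m' * N & []) (x0 :+ 1' :+ x1 :< x0 :+ x2 & []) (x0 :+ x1 :< x0 :+ 1' :+ x2) l))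
 ... | is-a m refl | is-b m' refl with Z.<-cmp m m'
 ...   | tri≈ _ refl _ = inr (m , refl , refl)
 ...   | tri< q _ _ = inl (subst2 _<_ (sym (tr-a i (i +1) m)) (sym (tr-b i (i +1) m' (¬~-suc i))) (lin (i & m * N & m' * N & N & []) (x1 :+ x3 =< x2 & 2' =< x3 & []) (x0 :+ 1' :+ x1 :< x0 :+ x2) (mulN-< q) (Z.+≤+ (s≤s z<s))))
 ...   | tri> _ _ q = lin⊥ (i & m * N & m' * N & N & []) (x2 :+ x3 =< x1 & 2' =< x3 & x0 :+ x1 :< x0 :+ 1' :+ x2 & []) (mulN-< q) (Z.+≤+ (s≤s z<s)) l
 adjacent-order i {p} {q} l | is-a m refl | other na nb = inl (subst2 _<_ (sym (tr-a i (i +1) m)) (sym (tr-o i (i +1) na nb)) (Z.≤∧≢⇒< (lin (i & m * N & q & []) (x0 :+ x1 :< x2 & []) (x0 :+ 1' :+ x1 =< x2) l) (\ e -> nb (m , sym e))))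
 adjacent-order i {p} {q} l | is-b m refl | other na nb = inl (subst2 _<_ (sym (tr-b i (i +1) m (¬~-suc i))) (sym (tr-o i (i +1) na nb)) (lin (i & m * N & q & []) (x0 :+ 1' :+ x1 :< x2 & []) (x0 :+ x1 :< x2) l))
 adjacent-order i {p} {q} l | other na nb | is-a m refl = inl (subst2 _<_ (sym (tr-o i (i +1) na nb)) (sym (tr-a i (i +1) m)) (lin (i & m * N & p & []) (x2 :< x0 :+ x1 & []) (x2 :< x0 :+ 1' :+ x1) l))
 adjacent-order i {p} {q} l | other na nb | is-b m refl = inl (subst2 _<_ (sym (tr-o i (i +1) na nb)) (sym (tr-b i (i +1) m (¬~-suc i))) (Z.≤∧≢⇒< (lin (i & m * N & p & []) (x2 :< x0 :+ 1' :+ x1 & []) (x2 =< x0 :+ x1) l) (\ e -> na (m , e))))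
 adjacent-order i {p} {q} l | other na nb | other na' nb' = inl (subst2 _<_ (sym (tr-o i (i +1) na nb)) (sym (tr-o i (i +1) na' nb')) l)

 module Step (v : Window k) (A : Aff v) (i : ℤ) where
  v' : Window k
  v' = mulT k v (i , i +1)

  ev' : ∀ j -> eV v' j == eV v (tr k i (i +1) j)
  ev' = eV-mulT (¬~-suc i) v

  ev'-tr : ∀ j -> eV v' (tr k i (i +1) j) == eV v j
  ev'-tr j = ev' (tr k i (i +1) j) · cong (eV v) (tr-invol i (i +1) (¬~-suc i) j)

  -- The step at i changes the relative order of positions only for the translates of the pair i, i
  -- + 1, and these form an ascent, not an inversion.
  bad-step : eV v i < eV v (i +1) -> Bad v -> Bad v'
  bad-step up (p , q , l , e , d) with adjacent-order i l
  ... | inl l' = tr k i (i +1) p , tr k i (i +1) q , l' , cong fl (ev'-tr p) · e · cong fl (sym (ev'-tr q)) , subst2 _<_ (sym (ev'-tr q)) (sym (ev'-tr p)) d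
  ... | inr (m , refl , refl) = lin⊥ (eV v i & eV v (i +1) & m * N & []) (x0 :< x1 & x1 :+ x2 :< x0 :+ x2 & []) up (subst2 _<_ (eV-shift v (i +1) m) (eV-shift v i m) d)

  tie-step : eV v i < eV v (i +1) -> fl (eV v i) == fl (eV v (i +1)) -> Bad v'
  tie-step up e = i , i +1 , lin (i & []) [] (x0 :< x0 :+ 1') , cong fl ea · sym e · cong fl (sym eb) , subst2 _<_ (sym eb) (sym ea) up
   where
   ea = ev' i · cong (eV v) (tr-a0 i (i +1))
   eb = ev' (i +1) · cong (eV v) (tr-b0 i (i +1) (¬~-suc i))

  W0-step : W0 v -> fl (eV v i) < fl (eV v (i +1)) -> W0 v'
  W0-step w up p q l e with adjacent-order i l
  ... | inl l' = subst2 _<_ (sym (ev' p)) (sym (ev' q)) (w _ _ l' (cong fl (sym (ev' p)) · e · cong fl (ev' q)))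
  ... | inr (m , refl , refl) = exfalso (Z.<-irrefl (sym same) up)
   where
   same : fl (eV v (i +1)) == fl (eV v i)
   same = lin (fl (eV v (i +1)) & fl (eV v i) & m & []) (x0 :+ x2 := x1 :+ x2 & []) (x0 := x1)
    (sym (fl-shift (eV v (i +1)) m) · cong fl (sym (ev' (i + m * N) · cong (eV v) (tr-a i (i +1) m) · eV-shift v (i +1) m)) ·
    e · cong fl (ev' (i +1 + m * N) · cong (eV v) (tr-b i (i +1) m (¬~-suc i)) · eV-shift v i m) · fl-shift (eV v i) m)

  asc⇒ : Asc i (sh v) -> fl (eV v i) < fl (eV v (i +1))
  asc⇒ = subst2 _<_ (hv-sh v i) (hv-sh v (i +1))

  ⇒asc : fl (eV v i) < fl (eV v (i +1)) -> Asc i (sh v)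
  ⇒asc = subst2 _<_ (sym (hv-sh v i)) (sym (hv-sh v (i +1)))

 module Compatible (g : Window k -> ℤ) (φ : Fun) (onW0 : ∀ v -> Aff v -> W0 v -> g v == φ (sh v)) (onBad : ∀ v -> Aff v -> Bad v -> g v == + 0) where
  val : Maybe (Window k) -> ℤ
  val nothing = + 0
  val (just v) = g v

  end-step : ∀ v i is -> val (chainEnd k v (i ∷ is)) == ((eV v (+ i) Z.<? eV v (+ i +1)) » val (chainEnd k (mulT k v (+ i , + i +1)) is))
  end-step v i is = cong (\ b -> val (if b then chainEnd k (mulT k v (+ i , + suc i)) is else nothing)) lenUp≡ ·
   cong (\ z -> val (if ltℤ (eV v (+ i)) (eV v z) then chainEnd k (mulT k v (+ i , z)) is else nothing)) (cong +_ (N.+-comm 1 i)) · decide (eV v (+ i) Z.<? eV v (+ i +1))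
   where
   and-true : ∀ b -> b ∧ true == b
   and-true true = refl
   and-true false = refl
   gap1 : + suc i - + i == + 1
   gap1 = lin (+ i & []) [] (1' :+ x0 :- x0 := 1')
   lenUp≡ : lenUp k v (+ i) (+ suc i) == ltℤ (eV v (+ i)) (eV v (+ suc i))
   lenUp≡ = cong (\ z -> ltℤ (ev k v (+ i)) (ev k v (+ suc i)) ∧ all (\ j -> not (ltℤ (ev k v (+ i)) (ev k v (+ i + + j)) ∧ ltℤ (ev k v (+ i + + j)) (ev k v (+ suc i)))) (applyUpTo suc (Z.∣ z ∣ ∸ 1))) gap1 · and-true (ltℤ (ev k v (+ i)) (ev k v (+ suc i))) · cong2 ltℤ (ev-eV v (+ i)) (ev-eV v (+ suc i))
   decide : ∀ (d : Dec (eV v (+ i) < eV v (+ i +1))) -> val (if ltℤ (eV v (+ i)) (eV v (+ i +1)) then chainEnd k (mulT k v (+ i , + i +1)) is else nothing) == (d » val (chainEnd k (mulT k v (+ i , + i +1)) is))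
   decide (yes l) = cong (\ b -> val (if b then chainEnd k (mulT k v (+ i , + i +1)) is else nothing)) (T⇒≡ (⇒ltℤ l))
   decide (no nl) = cong (\ b -> val (if b then chainEnd k (mulT k v (+ i , + i +1)) is else nothing)) (¬T⇒≡ (\ t -> nl (ltℤ⇒ t)))

  end-bad : ∀ L v -> Aff v -> Bad v -> val (chainEnd k v L) == + 0
  end-bad [] v A b = onBad v A b
  end-bad (i ∷ is) v A b = end-step v i is · »-vanish (eV v (+ i) Z.<? eV v (+ i +1)) (\ up -> end-bad is _ (Aff-mulT (¬~-suc (+ i)) A) (Step.bad-step v A (+ i) up b))

  -- An ascent between values with equal h leaves W⁰, and by `end-bad` such a chain contributes 0.
  -- The remaining ascents are strict in h, which are those that `u i` follows.
  end-W0 : ∀ L v -> Aff v -> W0 v -> val (chainEnd k v L) == uw (map +_ L) φ (sh v)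
  end-W0 [] v A w = onW0 v A w
  end-W0 (i ∷ is) v A w = end-step v i is · go (asc? (+ i) (sh v)) (eV v (+ i) Z.<? eV v (+ i +1))
   where
   A' = Aff-mulT (¬~-suc (+ i)) A
   go : ∀ (a : Dec (Asc (+ i) (sh v))) (d : Dec (eV v (+ i) < eV v (+ i +1))) -> (d » val (chainEnd k (mulT k v (+ i , + i +1)) is)) == (a » uw (map +_ is) φ (sw (+ i) (+ i +1) (sh v)))
   go (yes a) (yes _) = end-W0 is _ A' (Step.W0-step v A (+ i) w (Step.asc⇒ v A (+ i) a)) · cong (uw (map +_ is) φ) (sh-mulT (¬~-suc (+ i)) v)
   go (yes a) (no nu) = exfalso (nu (fl-lt (Step.asc⇒ v A (+ i) a)))
   go (no na) (yes up) = end-bad is _ A' (Step.tie-step v A (+ i) up (Z.≤-antisym (fl-mono up) (Z.≮⇒≥ (\ q -> na (Step.⇒asc v A (+ i) q)))))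
   go (no na) (no nu) = refl

 δS : State -> Fun
 δS t s = VP.≡-dec Z._≟_ s t » + 1

 Part : ℕ -> Set
 Part m = 1 N.≤ m × m N.≤ k

 opaque
  unfolding U
  U-cyc : ∀ m φ s -> Part m -> ƩL (seqs m n) (\ L -> bi (cycInc k L) * uw (map +_ L) φ s) == U (+ m) φ s
  U-cyc m φ s (a , b) = cyc-sum m (\ w -> uw w φ s) a b

 +-sum : ∀ {X : Set} (f : X -> ℕ) xs -> + NL.sum (map f xs) == ƩL xs (\ x -> + f x)
 +-sum f [] = refl
 +-sum f (x ∷ xs) = Z.pos-+ (f x) (NL.sum (map f xs)) · cong+ʳ (+ f x) (+-sum f xs)

 U*  : List ℕ -> Fun -> Fun
 U* [] φ = φ
 U* (m ∷ ms) φ = U (+ m) (U* ms φ)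

 module _ (v : Window k) (Av : Aff v) (wv : W0 v) where
  -- Both halves go through one induction: a chain of the first part may end outside W⁰, and there
  -- the later parts must be known to contribute 0.
  Kfrom-U : ∀ ms -> All Part ms -> (∀ u -> Aff u -> W0 u -> + Kfrom k ms u v == U* ms (δS (sh v)) (sh u)) × (∀ u -> Aff u -> Bad u -> + Kfrom k ms u v == + 0)
  Kfrom-U [] [] = on , off
   where
   ind : ∀ u (d : Dec (u == v)) -> + (if Relation.Nullary.Dec.does d then 1 else 0) == (d » + 1)
   ind u (yes _) = refl
   ind u (no _) = refl
   on : ∀ u -> Aff u -> W0 u -> + Kfrom k [] u v == δS (sh v) (sh u)
   on u Au wu = ind u (VP.≡-dec Z._≟_ u v) · »-cong (VP.≡-dec Z._≟_ u v) (VP.≡-dec Z._≟_ (sh u) (sh v)) (cong sh) (sh-injective u v Au Av wu wv) (\ _ _ -> refl)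
   off : ∀ u -> Aff u -> Bad u -> + Kfrom k [] u v == + 0
   off u Au (i , j , l , e , d) = ind u (VP.≡-dec Z._≟_ u v) · »-no (VP.≡-dec Z._≟_ u v) (\ { refl -> Z.<-asym d (wv i j l e) })
  Kfrom-U (m ∷ ms) (p ∷ ps) = (\ u Au wu -> expand u · ƩL-ext (seqs m n) (\ L -> cong (\ z -> bi (cycInc k L) * z) (end-W0 L u Au wu)) · U-cyc m (U* ms (δS (sh v))) (sh u) p)
   , (\ u Au b -> expand u · ƩL-zero (seqs m n) (\ L _ -> cong (\ z -> bi (cycInc k L) * z) (end-bad L u Au b) · Z.*-zeroʳ (bi (cycInc k L))))
   where
   ih = Kfrom-U ms ps
   open Compatible (\ u -> + Kfrom k ms u v) (U* ms (δS (sh v))) (fst ih) (snd ih)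
   kst : ∀ b me -> + Kstep k ms b me v == bi b * val me
   kst false me = sym (Z.*-zeroˡ (val me))
   kst true nothing = refl
   kst true (just u) = sym (Z.*-identityˡ (+ Kfrom k ms u v))
   expand : ∀ u -> + Kfrom k (m ∷ ms) u v == ƩL (seqs m n) (\ L -> bi (cycInc k L) * val (chainEnd k u L))
   expand u = +-sum (\ L -> Kstep k ms (cycInc k L) (chainEnd k u L) v) (seqs m n) · ƩL-ext (seqs m n) (\ L -> kst (cycInc k L) (chainEnd k u L))

 Ur-comm : ∀ ms m φ s -> U m (Ur ms φ) s == Ur ms (U m φ) s
 Ur-comm [] m φ s = refl
 Ur-comm (r ∷ ms) m φ s = Ur-comm ms m (U (+ r) φ) s · ext (Ur-linear ms) _ _ (U-comm m (+ r) φ) s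

 -- K follows the first part of the partition first, so it is outermost in `U*`, while `Ur` applies
 -- it innermost. Commutation of the `U r` reconciles the two orders.
 U*-Ur : ∀ ms φ s -> U* ms φ s == Ur ms φ s
 U*-Ur [] φ s = refl
 U*-Ur (m ∷ ms) φ s = ext (U-linear (+ m)) _ _ (U*-Ur ms φ) s · Ur-comm ms (+ m) φ s

 Kmat-U : ∀ ms v -> All Part ms -> Aff v -> W0 v -> + Kmat k ms v == Ur ms (δS (sh v)) idS
 Kmat-U ms v p A w = fst (Kfrom-U v A w ms p) (idW k) Aff-idW W0-idW · cong (U* ms (δS (sh v))) sh-idW · U*-Ur ms (δS (sh v)) idS

-- Edges of the 0-Bruhat graph as covers of states.

module Edge (k' : ℕ) where
 open Z using (_≤_)
 open import Defs
 open Base k'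
 open Strong k' using (Cover; cover; pos; neg; btw; gap)
 open Star k' using (dist)
 open Win k'

 T-∧ : ∀ {a b} -> T a -> T b -> T (a ∧ b)
 T-∧ {true} {true} _ _ = _

 T-∧ˡ : ∀ {a b} -> T (a ∧ b) -> T a
 T-∧ˡ {true} _ = _

 T-∧ʳ : ∀ {a b} -> T (a ∧ b) -> T b
 T-∧ʳ {true} t = t

 T-not : ∀ {a} -> ¬ T a -> T (not a)
 T-not {true} h = exfalso (h _)
 T-not {false} h = _

 T-not⁻ : ∀ {a} -> T (not a) -> ¬ T a
 T-not⁻ {false} _ ()

 all-upTo⇒ : ∀ (P : ℕ -> Bool) τ m -> T (all P (applyUpTo τ m)) -> ∀ j -> j N.< m -> T (P (τ j))
 all-upTo⇒ P τ (suc m) t zero _ = T-∧ˡ t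
 all-upTo⇒ P τ (suc m) t (suc j) (s≤s l) = all-upTo⇒ P (τ ∘ suc) m (T-∧ʳ {P (τ 0)} t) j l

 ⇒all-upTo : ∀ (P : ℕ -> Bool) τ m -> (∀ j -> j N.< m -> T (P (τ j))) -> T (all P (applyUpTo τ m))
 ⇒all-upTo P τ zero h = _
 ⇒all-upTo P τ (suc m) h = T-∧ (h 0 z<s) (⇒all-upTo P (τ ∘ suc) m (\ j l -> h (suc j) (s≤s l)))

 record Up (v : Window k) (a b : ℤ) : Set where
  constructor mkUp
  field
   low   : eV v a ≤ + 0
   high  : + 0 < eV v b
   empty : ∀ j -> a < j -> j < b -> ¬ (eV v a < eV v j × eV v j < eV v b)

 module _ (v : Window k) (b : ℤ) (d : ℕ) where
  private
   a = b - + suc d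
   width : b - a == + suc d
   width = lin (b & + d & []) [] (x0 :- (x0 :- (1' :+ x1)) := 1' :+ x1)
   Q : ℕ -> Bool
   Q j = not (ltℤ (ev k v a) (ev k v (a + + j)) ∧ ltℤ (ev k v (a + + j)) (ev k v b))

  zeroStep⇒Up : T (zeroStep k v (a , b)) -> Up v a b
  zeroStep⇒Up t = mkUp (subst (_≤ + 0) (ev-eV v a) (Z.≤ᵇ⇒≤ (T-∧ˡ t₃))) (subst (+ 0 <_) (ev-eV v b) (ltℤ⇒ (T-∧ˡ t₄))) none
   where
   t₂ = T-∧ʳ {ltℤ a b} t
   t₃ = T-∧ʳ {(b - a) Z.≤ᵇ + k} t₂
   t₄ = T-∧ʳ {ev k v a Z.≤ᵇ + 0} t₃
   t₅ = T-∧ʳ {ltℤ (+ 0) (ev k v b)} t₄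
   t₆ = T-∧ʳ {ltℤ (ev k v a) (ev k v b)} t₅
   none : ∀ j -> a < j -> j < b -> ¬ (eV v a < eV v j × eV v j < eV v b)
   none j l l' (p , q) with gap l
   ... | e , refl = T-not⁻ (all-upTo⇒ Q suc (Z.∣ b - a ∣ ∸ 1) t₆ e (subst (\ z -> e N.< Z.∣ z ∣ ∸ 1) (sym width) (Z.drop‿+<+ (lin (b & + d & + e & []) (x0 :- (1' :+ x1) :+ (1' :+ x2) :< x0 & []) (x2 :< x1) l')))) 
    (T-∧ (⇒ltℤ (subst2 _<_ (sym (ev-eV v a)) (sym (ev-eV v (a + + suc e))) p)) (⇒ltℤ (subst2 _<_ (sym (ev-eV v (a + + suc e))) (sym (ev-eV v b)) q)))

  Up⇒zeroStep : d N.< k -> Up v a b -> T (zeroStep k v (a , b))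
  Up⇒zeroStep d<k (mkUp lo hi em) = T-∧ (⇒ltℤ (lin (b & + d & []) (0' =< x1 & []) (x0 :- (1' :+ x1) :< x0) 0≤+)) (T-∧ (Z.≤⇒≤ᵇ (subst (_≤ + k) (sym width) (Z.+≤+ d<k))) (T-∧ (Z.≤⇒≤ᵇ (subst (_≤ + 0) (sym (ev-eV v a)) lo)) (T-∧ (⇒ltℤ (subst (+ 0 <_) (sym (ev-eV v b)) hi))
   (T-∧ (⇒ltℤ (subst2 _<_ (sym (ev-eV v a)) (sym (ev-eV v b)) (Z.≤-<-trans lo hi))) (⇒all-upTo Q suc (Z.∣ b - a ∣ ∸ 1) none)))))
   where
   none : ∀ j -> j N.< Z.∣ b - a ∣ ∸ 1 -> T (Q (suc j))
   none j l = T-not (\ t -> em (a + + suc j) (lin (a & + j & []) (0' =< x1 & []) (x0 :< x0 :+ (1' :+ x1)) 0≤+) (lin (b & + d & + j & []) (x2 :< x1 & []) (x0 :- (1' :+ x1) :+ (1' :+ x2) :< x0) (Z.+<+ (subst (\ z -> j N.< Z.∣ z ∣ ∸ 1) width l)))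
    (subst2 _<_ (ev-eV v a) (ev-eV v (a + + suc j)) (ltℤ⇒ (T-∧ˡ t)) , subst2 _<_ (ev-eV v (a + + suc j)) (ev-eV v b) (ltℤ⇒ (T-∧ʳ {ltℤ (ev k v a) (ev k v (a + + suc j))} t))))

 zeroStep-width : ∀ v a b -> T (zeroStep k v (a , b)) -> Σ ℕ \ d -> d N.< k × a == b - + suc d
 zeroStep-width v a b t with gap {a} {b} (ltℤ⇒ (T-∧ˡ t))
 ... | d , e = d , Z.drop‿+≤+ (subst (_≤ + k) (lin (a & b & + d & []) (x1 := x0 :+ (1' :+ x2) & []) (x1 :- x0 := 1' :+ x2) e) (Z.≤ᵇ⇒≤ (T-∧ˡ (T-∧ʳ {ltℤ a b} t)))) , lin (a & b & + d & []) (x1 := x0 :+ (1' :+ x2) & []) (x0 := x1 :- (1' :+ x2)) e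

 module _ (v : Window k) (A : Aff v) (w0 : W0 v) (b : ℤ) (d : ℕ) (d<k : d N.< k) where
  private
   a = b - + suc d
   a<b = fst (dist b d d<k)
   b<a+N = snd (dist b d d<k)
   ne : ¬ a ~ b
   ne = ¬~-lt a<b b<a+N
   v' = mulT k v (a , b)
   va : eV v' a == eV v b
   va = eV-mulT ne v a · cong (eV v) (tr-a0 a b)
   vb : eV v' b == eV v a
   vb = eV-mulT ne v b · cong (eV v) (tr-b0 a b ne)
   vo : ∀ j -> a < j -> j < b -> eV v' j == eV v j
   vo j l l' = eV-mulT ne v j · cong (eV v) (tr-o a b (¬~-lt l (Z.<-trans l' b<a+N)) (¬~-gt l' (Z.<-trans b<a+N (Z.+-monoˡ-< N l))))

  -- A position between a and b has its value below v(a) or above v(b). In both cases the smaller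
  -- value stands further to the right, so `W0-bwd` makes the inequality strict in h.
  Up⇒Cover : Up v a b -> Cover a b (sh v')
  Up⇒Cover (mkUp lo hi em) = cover (subst (+ 0 ≤_) (sym ha) (fl-pos (Z.i<j⇒suc[i]≤j hi))) (subst (_< + 0) (sym hb) (fl-neg lo)) bt
   where
   ha : hv (sh v') a == fl (eV v b)
   ha = hv-sh v' a · cong fl va
   hb : hv (sh v') b == fl (eV v a)
   hb = hv-sh v' b · cong fl vb
   bt : ∀ j -> a < j -> j < b -> hv (sh v') j < hv (sh v') b ⊎ hv (sh v') a < hv (sh v') j
   bt j l l' with Z.<-cmp (eV v j) (eV v a)
   ... | tri< q _ _ = inl (subst2 _<_ (sym hj) (sym hb) (W0-bwd w0 l q))
    where hj = hv-sh v' j · cong fl (vo j l l')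
   ... | tri≈ _ q _ = exfalso (Z.<-irrefl (sym (eV-inj A q)) l)
   ... | tri> _ _ q with Z.<-cmp (eV v b) (eV v j)
   ...   | tri< q' _ _ = inr (subst2 _<_ (sym ha) (sym hj) (W0-bwd w0 l' q'))
    where hj = hv-sh v' j · cong fl (vo j l l')
   ...   | tri≈ _ q' _ = exfalso (Z.<-irrefl (sym (eV-inj A q')) l')
   ...   | tri> _ _ q' = exfalso (em j l l' (q , q'))

  module FromCover (c : Cover a b (sh v)) where
   private
    h = \ j -> fl (eV v j)
    h≥ : + 0 ≤ h a
    h≥ = subst (+ 0 ≤_) (hv-sh v a) (pos c)
    h< : h b < + 0
    h< = subst (_< + 0) (hv-sh v b) (neg c)
    bt : ∀ j -> a < j -> j < b -> h j < h b ⊎ h a < h j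
    bt j l l' with btw c j l l'
    ... | inl q = inl (subst2 _<_ (hv-sh v j) (hv-sh v b) q)
    ... | inr q = inr (subst2 _<_ (hv-sh v a) (hv-sh v j) q)
    h-sh : ∀ j m -> h (j + m * N) == h j + m
    h-sh j m = cong fl (eV-shift v j m) · fl-shift (eV v j) m

   down-Up : Up v' a b
   down-Up = mkUp (subst (_≤ + 0) (sym va) (fl-neg⁻ h<)) (subst (+ 0 <_) (sym vb) (fl-pos⁻ h≥)) none
    where
    none : ∀ j -> a < j -> j < b -> ¬ (eV v' a < eV v' j × eV v' j < eV v' b)
    none j l l' (p , q) with bt j l l'
    ... | inl r = Z.<-asym (fl-lt r) (subst2 _<_ va (vo j l l') p)
    ... | inr r = Z.<-asym (fl-lt r) (subst2 _<_ (vo j l l') vb q)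

   private
    -- The delicate case pairs a translate of a or b with an unrelated position. If the order were
    -- wrong, that position would lie, after translation, between a and b with h equal to h b or h
    -- a, against the strict `btw`. For a translate of a against one of b the signs of h decide.
    reorder : ∀ {p q} -> p < q -> h (tr k a b p) == h (tr k a b q) -> tr k a b p < tr k a b q
    reorder {p} {q} l e with cases a b p | cases a b q
    ... | is-a m refl | is-a m' refl = subst2 _<_ (sym (tr-a a b m)) (sym (tr-a a b m')) (lin (a & b & m * N & m' * N & []) (x0 :+ x2 :< x0 :+ x3 & []) (x1 :+ x2 :< x1 :+ x3) l)
    ... | is-b m refl | is-b m' refl = subst2 _<_ (sym (tr-b a b m ne)) (sym (tr-b a b m' ne)) (lin (a & b & m * N & m' * N & []) (x1 :+ x2 :< x1 :+ x3 & []) (x0 :+ x2 :< x0 :+ x3) l)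
    ... | is-b m refl | is-a m' refl = subst2 _<_ (sym (tr-b a b m ne)) (sym (tr-a a b m')) (lin (a & b & m * N & m' * N & []) (x1 :+ x2 :< x0 :+ x3 & x0 :< x1 & []) (x0 :+ x2 :< x1 :+ x3) l a<b)
    ... | is-a m refl | is-b m' refl = lin⊥ (a & b & m * N & m' * N & N & []) (x0 :+ x2 :< x1 :+ x3 & x1 :< x0 :+ x4 & x3 :+ x4 =< x2 & []) l b<a+N
      (mulN-< (lin (h a & h b & m & m' & []) (x1 :+ x2 := x0 :+ x3 & 0' =< x0 & x1 :< 0' & []) (x3 :< x2) (sym (h-sh b m) · cong h (sym (tr-a a b m)) · e · cong h (tr-b a b m' ne) · h-sh a m') h≥ h<))
    ... | is-b m refl | other na nb = subst2 _<_ (sym (tr-b a b m ne)) (sym (tr-o a b na nb)) (lin (a & b & m * N & q & []) (x1 :+ x2 :< x3 & x0 :< x1 & []) (x0 :+ x2 :< x3) l a<b)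
    ... | other na nb | is-a m refl = subst2 _<_ (sym (tr-o a b na nb)) (sym (tr-a a b m)) (lin (a & b & m * N & p & []) (x3 :< x0 :+ x2 & x0 :< x1 & []) (x3 :< x1 :+ x2) l a<b)
    ... | other na nb | other na' nb' = subst2 _<_ (sym (tr-o a b na nb)) (sym (tr-o a b na' nb')) l
    ... | is-a m refl | other na nb = subst2 _<_ (sym (tr-a a b m)) (sym (tr-o a b na nb)) (Z.≰⇒> (\ g -> between (Z.≤∧≢⇒< g (\ z -> nb (m , z)))))
     where
     qe : q == q + - m * N + m * N
     qe = ring q m N
      where
      ring : ∀ q m n -> q == q + - m * n + m * n
      ring = solve
     hq : h (q + - m * N) == h b
     hq = lin (h (q + - m * N) & h b & h q & m & []) (x2 := x0 :+ x3 & x2 := x1 :+ x3 & []) (x0 := x1) (cong h qe · h-sh (q + - m * N) m) (cong h (sym (tr-o a b na nb)) · sym e · cong h (tr-a a b m) · h-sh b m)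
     between : ¬ q < b + m * N
     between g with bt (q + - m * N) (lin (a & q & q + - m * N & m * N & []) (x0 :+ x3 :< x1 & x1 := x2 :+ x3 & []) (x0 :< x2) l qe) (lin (b & q & q + - m * N & m * N & []) (x1 :< x0 :+ x3 & x1 := x2 :+ x3 & []) (x2 :< x0) g qe)
     ... | inl r = Z.<-irrefl hq r
     ... | inr r = Z.<-asym (Z.<-≤-trans h< h≥) (subst (h a <_) hq r)
    ... | other na nb | is-b m refl = subst2 _<_ (sym (tr-o a b na nb)) (sym (tr-b a b m ne)) (Z.≰⇒> (\ g -> between (Z.≤∧≢⇒< g (\ z -> na (m , sym z)))))
     where
     pe : p == p + - m * N + m * N
     pe = ring p m N
      where
      ring : ∀ q m n -> q == q + - m * n + m * n
      ring = solve
     hp : h (p + - m * N) == h a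
     hp = lin (h (p + - m * N) & h a & h p & m & []) (x2 := x0 :+ x3 & x2 := x1 :+ x3 & []) (x0 := x1) (cong h pe · h-sh (p + - m * N) m) (cong h (sym (tr-o a b na nb)) · e · cong h (tr-b a b m ne) · h-sh a m)
     between : ¬ a + m * N < p
     between g with bt (p + - m * N) (lin (a & p & p + - m * N & m * N & []) (x0 :+ x3 :< x1 & x1 := x2 :+ x3 & []) (x0 :< x2) g pe) (lin (b & p & p + - m * N & m * N & []) (x1 :< x0 :+ x3 & x1 := x2 :+ x3 & []) (x2 :< x0) l pe)
     ... | inl r = Z.<-asym (Z.<-≤-trans h< h≥) (subst (_< h b) hp r)
     ... | inr r = Z.<-irrefl (sym hp) r

   down-W0 : W0 v'
   down-W0 p q l e = subst2 _<_ (sym (eV-mulT ne v p)) (sym (eV-mulT ne v q)) (w0 _ _ (reorder l e') e')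
    where
    e' = cong fl (sym (eV-mulT ne v p)) · e · cong fl (eV-mulT ne v q)

-- Coefficients of the fundamental quasisymmetric functions.

module Fc where
 open Z using (_≤_)
 open import Defs
 open Hidden
 open Tab using (bi; T⇒≡; ¬T⇒≡)
 open import Data.Bool.Properties using (∧-assoc; ∧-comm; ∧-identityʳ)
 open import Data.List.Relation.Binary.Permutation.Propositional.Properties using (↭-reverse)
 open import Data.List using (_ʳ++_)
 open import Data.List.Properties using (++-assoc; ++-identityʳ; length-++; length-replicate; length-reverse; reverse-++; reverse-involutive; unfold-reverse)

 -- The block condition on the reversed label word: labels decrease weakly inside each block.

 Blocks : ℤ -> ℤ -> ℕ -> List ℕ -> List ℤ -> Bool
 Blocks hi t zero [] [] = true
 Blocks hi t zero [] (_ ∷ _) = false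
 Blocks hi t zero (m ∷ ra) bs = Blocks hi hi m ra bs
 Blocks hi t (suc r) ra [] = false
 Blocks hi t (suc r) ra (b ∷ bs) = (b Z.≤ᵇ t) ∧ Blocks hi b r ra bs

 rel : ℕ -> ℤ -> ℕ -> ℤ -> Bool
 rel i b i' b' = if ltℤ b' b then i N.<ᵇ i' else true

 fwd bwd : ℕ -> ℤ -> List ℕ -> List ℤ -> Bool
 fwd i b [] [] = true
 fwd i b [] (_ ∷ _) = false
 fwd i b (_ ∷ _) [] = false
 fwd i b (i' ∷ is) (b' ∷ bs) = rel i b i' b' ∧ fwd i' b' is bs
 bwd i b [] [] = true
 bwd i b [] (_ ∷ _) = false
 bwd i b (_ ∷ _) [] = false
 bwd i b (i' ∷ is) (b' ∷ bs) = rel i' b' i b ∧ bwd i' b' is bs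

 fwd₀ : List ℕ -> List ℤ -> Bool
 fwd₀ [] [] = true
 fwd₀ [] (_ ∷ _) = false
 fwd₀ (_ ∷ _) [] = false
 fwd₀ (i ∷ is) (b ∷ bs) = fwd i b is bs

 fwd-rev : ∀ is bs i b js cs -> length is == length bs -> fwd₀ (is ʳ++ (i ∷ js)) (bs ʳ++ (b ∷ cs)) == bwd i b is bs ∧ fwd i b js cs
 fwd-rev [] [] i b js cs e = refl
 fwd-rev (i' ∷ is) (b' ∷ bs) i b js cs e = fwd-rev is bs i' b' (i ∷ js) (b ∷ cs) (N.suc-injective e) ·
  sym (∧-assoc (bwd i' b' is bs) (rel i' b' i b) (fwd i b js cs)) · cong (_∧ fwd i b js cs) (∧-comm (bwd i' b' is bs) (rel i' b' i b))

 coGo-sum : ∀ p c ys -> sum (coGo p c ys) == c N.+ length ys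
 coGo-sum p c [] = refl
 coGo-sum p c (y ∷ ys) with ltℤ y p
 ... | true = cong (c N.+_) (coGo-sum y 1 ys)
 ... | false = coGo-sum y (suc c) ys · sym (N.+-suc c (length ys))

 compOf-sum : ∀ bs -> sum (compOf bs) == length bs
 compOf-sum [] = refl
 compOf-sum (b ∷ bs) = cong sum (compOf-go b bs) · coGo-sum b 1 bs

 module _ (P : ℕ -> Bool) where
  desc : ℤ -> ℕ -> List ℤ -> Bool
  desc p q [] = true
  desc p q (y ∷ ys) = (if ltℤ y p then P q else true) ∧ desc y (suc q) ys

  cdGo-∷ : ∀ acc c y ys -> cdGo acc (c ∷ coGo y 1 ys) == (acc N.+ c) ∷ cdGo (acc N.+ c) (coGo y 1 ys)
  cdGo-∷ acc c y ys = go y 1 ys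
   where
   go : ∀ y c' ys -> cdGo acc (c ∷ coGo y c' ys) == (acc N.+ c) ∷ cdGo (acc N.+ c) (coGo y c' ys)
   go y c' [] = refl
   go y c' (z ∷ zs) with ltℤ z y
   ... | true = refl
   ... | false = go z (suc c') zs

  all-desc : ∀ acc p c ys -> all P (cdGo acc (coGo p c ys)) == desc p (acc N.+ c) ys
  all-desc acc p c [] = refl
  all-desc acc p c (y ∷ ys) with ltℤ y p
  ... | true = cong (all P) (cdGo-∷ acc c y ys) · cong (P (acc N.+ c) ∧_) (all-desc (acc N.+ c) y 1 ys · cong (\ z -> desc y z ys) (N.+-comm (acc N.+ c) 1))
  ... | false = all-desc acc y (suc c) ys · cong (\ z -> desc y z ys) (N.+-suc acc c)

 module _ (idx : List ℕ) where
  private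
   P : ℕ -> Bool
   P j = nthℕ idx (j ∸ 1) N.<ᵇ nthℕ idx j

  desc-fwd : ∀ q i is p ys -> (∀ r -> nthℕ idx (q N.+ r) == nthℕ (i ∷ is) r) -> (length is N.≡ᵇ length ys) ∧ desc P p (suc q) ys == fwd i p is ys
  desc-fwd q i [] p [] h = refl
  desc-fwd q i (_ ∷ _) p [] h = refl
  desc-fwd q i [] p (_ ∷ _) h = refl
  desc-fwd q i (i' ∷ is) p (y ∷ ys) h = sym (∧-assoc L A (desc P y (suc (suc q)) ys)) · cong (_∧ desc P y (suc (suc q)) ys) (∧-comm L A) · ∧-assoc A L (desc P y (suc (suc q)) ys) ·
   cong2 _∧_ (cong (\ z -> if ltℤ y p then z else true) (cong2 N._<ᵇ_ (cong (nthℕ idx) (sym (N.+-identityʳ q)) · h 0) (cong (nthℕ idx) (N.+-comm 1 q) · h 1)))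
    (desc-fwd (suc q) i' is y ys (\ r -> cong (nthℕ idx) (sym (N.+-suc q r)) · h (suc r)))
   where
   L = length is N.≡ᵇ length ys
   A = if ltℤ y p then P (suc q) else true

  cond-fwd : ∀ bs -> (length idx N.≡ᵇ sum (compOf bs)) ∧ all P (compDes (compOf bs)) == fwd₀ idx bs
  cond-fwd bs = cong2 (\ x y -> (length idx N.≡ᵇ x) ∧ all P y) (compOf-sum bs) (compDes-go (compOf bs)) · go idx refl bs
   where
   go : ∀ is -> idx == is -> ∀ bs -> (length is N.≡ᵇ length bs) ∧ all P (cdGo 0 (compOf bs)) == fwd₀ is bs
   go [] e [] = refl
   go (_ ∷ _) e [] = refl
   go [] e (_ ∷ _) = refl
   go (i ∷ is) e (b ∷ bs) = cong ((length is N.≡ᵇ length bs) ∧_) (cong (\ z -> all P (cdGo 0 z)) (compOf-go b bs) · all-desc P 0 b 1 bs) · desc-fwd 0 i is b bs (\ r -> cong (\ z -> nthℕ z r) e)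

 ridx : List ℕ -> List ℕ
 ridx [] = []
 ridx (m ∷ ra) = replicate m (length ra) ++ ridx ra

 length-ridx : ∀ ra -> length (ridx ra) == sum ra
 length-ridx [] = refl
 length-ridx (m ∷ ra) = length-++ (replicate m (length ra)) · cong2 N._+_ (length-replicate m) (length-ridx ra)

 index : ∀ (τ : ℕ -> ℕ) xs -> List ℕ
 index τ xs = concat (zipWith replicate xs (applyUpTo τ (length xs)))

 index-snoc : ∀ τ xs m -> index τ (xs ++ m ∷ []) == index τ xs ++ replicate m (τ (length xs))
 index-snoc τ [] m = ++-identityʳ (replicate m (τ 0))
 index-snoc τ (x ∷ xs) m = cong (replicate x (τ 0) ++_) (index-snoc (τ ∘ suc) xs m) · sym (++-assoc (replicate x (τ 0)) (index (τ ∘ suc) xs) _)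

 replicate-snoc : ∀ m (x : ℕ) -> replicate m x ++ x ∷ [] == x ∷ replicate m x
 replicate-snoc zero x = refl
 replicate-snoc (suc m) x = cong (x ∷_) (replicate-snoc m x)

 reverse-replicate : ∀ m (x : ℕ) -> reverse (replicate m x) == replicate m x
 reverse-replicate zero x = refl
 reverse-replicate (suc m) x = unfold-reverse x (replicate m x) · cong (_++ x ∷ []) (reverse-replicate m x) · replicate-snoc m x

 index-ridx : ∀ ra -> index (\ i -> i) (reverse ra) == reverse (ridx ra)
 index-ridx [] = refl
 index-ridx (m ∷ ra) = cong (index (\ i -> i)) (unfold-reverse m ra) · index-snoc (\ i -> i) (reverse ra) m · cong2 (\ x y -> x ++ replicate m y) (index-ridx ra) (length-reverse ra) ·
  cong (reverse (ridx ra) ++_) (sym (reverse-replicate m (length ra))) · sym (reverse-++ (replicate m (length ra)) (ridx ra))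

 module _ (hi : ℤ) where
  Blocks-0 : ∀ t ra bs -> Blocks hi t 0 ra bs == Blocks hi hi 0 ra bs
  Blocks-0 t [] [] = refl
  Blocks-0 t [] (_ ∷ _) = refl
  Blocks-0 t (_ ∷ _) bs = refl

  -- Equal indices forbid a descent of the labels, which read backwards means weak decrease. At a
  -- new block the index has strictly dropped and any label is allowed; the bound `hi` expresses
  -- this.
  bwd-Blocks : ∀ r ra v b bs -> length ra N.≤ v -> All (_≤ hi) bs -> bwd v b (replicate r v ++ ridx ra) bs == Blocks hi b r ra bs
  bwd-Blocks zero [] v b [] l a = refl
  bwd-Blocks zero [] v b (_ ∷ _) l a = refl
  bwd-Blocks zero (zero ∷ ra) v b bs l a = bwd-Blocks zero ra v b bs (N.<⇒≤ l) a · Blocks-0 b ra bs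
  bwd-Blocks zero (suc m ∷ ra) v b [] l a = refl
  bwd-Blocks zero (suc m ∷ ra) v b (b' ∷ bs) l (p ∷ a) = cong2 _∧_ (cong (\ z -> if ltℤ b b' then z else true) (T⇒≡ (N.<⇒<ᵇ l)) · same (ltℤ b b') · sym (T⇒≡ (Z.≤⇒≤ᵇ p))) (bwd-Blocks m ra (length ra) b' bs N.≤-refl a)
   where
   same : ∀ x -> (if x then true else true) == true
   same true = refl
   same false = refl
  bwd-Blocks (suc r) ra v b [] l a = refl
  bwd-Blocks (suc r) ra v b (b' ∷ bs) l (p ∷ a) = cong2 _∧_ (cong (\ z -> if not (b' Z.≤ᵇ b) then z else true) (¬T⇒≡ (\ t -> N.<-irrefl refl (N.<ᵇ⇒< v v t))) · same (b' Z.≤ᵇ b)) (bwd-Blocks r ra v b' bs l a)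
   where
   same : ∀ x -> (if not x then false else true) == x
   same true = refl
   same false = refl

  -- The labels are reversed because `Ξ` descends from the end of the path.
  Fcoeff-Blocks : ∀ {m} (a : Vec ℕ m) bs -> All (_≤ hi) bs -> length bs == size a -> Fcoeff (compOf (reverse bs)) a == bi (Blocks hi hi 0 (reverse (toList a)) bs)
  Fcoeff-Blocks {m} a bs al len = cong bi (cong-idx idx≡ · cond-fwd (reverse is) (reverse bs) · main is bs (len' · sym len) al (bwd-Blocks 0 ra (length ra) hi bs N.≤-refl al))
   where
   ra = reverse (toList a)
   is = ridx ra
   lenV : ∀ {m} (a : Vec ℕ m) -> length (toList a) == m
   lenV [] = refl
   lenV (x ∷ a) = cong suc (lenV a)
   cong-idx : ∀ {x y} -> x == y -> (length x N.≡ᵇ sum (compOf (reverse bs))) ∧ all (\ j -> nthℕ x (j ∸ 1) N.<ᵇ nthℕ x j) (compDes (compOf (reverse bs))) == (length y N.≡ᵇ sum (compOf (reverse bs))) ∧ all (\ j -> nthℕ y (j ∸ 1) N.<ᵇ nthℕ y j) (compDes (compOf (reverse bs)))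
   cong-idx refl = refl
   idx≡ : concat (zipWith replicate (toList a) (upTo m)) == reverse is
   idx≡ = cong (\ z -> concat (zipWith replicate (toList a) (upTo z))) (sym (lenV a)) · cong (index (\ i -> i)) (sym (reverse-involutive (toList a))) · index-ridx ra
   len' : length is == size a
   len' = length-ridx ra · SP.sum-↭ (↭-reverse (toList a))
   main : ∀ is bs -> length is == length bs -> All (_≤ hi) bs -> bwd (length ra) hi is bs == Blocks hi hi 0 ra bs -> fwd₀ (reverse is) (reverse bs) == Blocks hi hi 0 ra bs
   main [] [] e a h = h
   main (i ∷ is) (b ∷ bs) e (p ∷ a) h = fwd-rev is bs i b [] [] (N.suc-injective e) · ∧-identityʳ (bwd i b is bs) · cong (\ z -> (if not z then i N.<ᵇ length ra else true) ∧ bwd i b is bs) (sym (T⇒≡ (Z.≤⇒≤ᵇ p))) · h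

 Fcoeff-length : ∀ {m} (a : Vec ℕ m) bs -> ¬ length bs == size a -> Fcoeff (compOf bs) a == + 0
 Fcoeff-length {m} a bs ne = cong (\ z -> bi (z ∧ all (\ j -> nthℕ idx (j ∸ 1) N.<ᵇ nthℕ idx j) (compDes (compOf bs)))) (¬T⇒≡ (\ t -> ne (sym (compOf-sum bs) · sym (N.≡ᵇ⇒≡ (length idx) (sum (compOf bs)) t) · len a (\ i -> i))))
  where
  idx = concat (zipWith replicate (toList a) (upTo m))
  len : ∀ {m} (a : Vec ℕ m) (τ : ℕ -> ℕ) -> length (concat (zipWith replicate (toList a) (applyUpTo τ m))) == size a
  len [] τ = refl
  len (x ∷ a) τ = length-++ (replicate x (τ 0)) · cong2 N._+_ (length-replicate x) (len a (τ ∘ suc))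

-- Counting paths by products of the `Hm`.

module Count (k' : ℕ) where
 open Z using (_≤_)
 open import Defs
 open Tab using (bi; T⇒≡; ¬T⇒≡)
 open Base k'
 open Strong k' using (Fun; Cover; pos; neg; Cover?; Tt; Tt-def; Ξ)
 open Words k' using (ext; lin0; linear-+; T-linear)
 open Star k' using (F⁺; Hs; FamS; Bd; low; high; Bd-stable; dist)
 open StarH k' using (T-T; module RangeH)
 open Carrier k' using (»-×)
 open Win k'
 open Weak k' using (δS)
 open Edge k'
 open Fc
 open import Data.List using (_ʳ++_)
 open import Data.List.Relation.Binary.Permutation.Propositional.Properties using (↭-reverse)
 import Data.Product.Properties as PP
 import Data.List.Relation.Unary.All.Properties as AllP
 import Data.List.Relation.Unary.Any.Properties as AnyP
 open import Data.List.Relation.Unary.AllPairs using (_∷_)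

 Edges : Set
 Edges = List (ℤ × ℤ)

 _≟E_ : (c c' : Edges) -> Dec (c == c')
 _≟E_ = LP.≡-dec (PP.≡-dec Z._≟_ Z._≟_)

 ƩL-unique : ∀ {A : Set} (xs : List A) f {y} -> Unique xs -> y ∈ xs -> (∀ x -> x ∈ xs -> ¬ x == y -> f x == + 0) -> ƩL xs f == f y
 ƩL-unique (x ∷ xs) f (p ∷ _) (here refl) h = cong+ʳ (f x) (ƩL-zero xs (\ z z∈ -> h z (there z∈) (\ e -> All.lookup p z∈ (sym e)))) · +0 (f x)
 ƩL-unique (x ∷ xs) f {y} (p ∷ ps) (there m) h = h x (here refl) (All.lookup p m) ⊹ ƩL-unique xs f ps m (\ z z∈ -> h z (there z∈)) · +0ˡ (f y)

 Chain : Edges -> State -> State -> Set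
 Chain [] s s' = s == s'
 Chain ((a , b) ∷ c) s s' = Cover a b s × Chain c (sw a b s) s'

 Chain? : ∀ c s s' -> Dec (Chain c s s')
 Chain? [] s s' = VP.≡-dec Z._≟_ s s'
 Chain? ((a , b) ∷ c) s s' = Cover? a b s ×-dec Chain? c (sw a b s) s'

 chain-snoc : ∀ c {s s'} a b -> Chain c s s' -> Cover a b s' -> Chain (c ++ (a , b) ∷ []) s (sw a b s')
 chain-snoc [] a b refl C = C , refl
 chain-snoc (_ ∷ c) a b (C' , ch) C = C' , chain-snoc c a b ch C

 Wide : ℤ × ℤ -> Set
 Wide (a , b) = Σ ℕ \ d -> d N.< k × a == b - + suc d

 module _ {w : Window k} where
  path-chain : ∀ ω u -> Aff u -> W0 u -> PathFromTo k u ω w -> Chain (reverse ω) (sh w) (sh u) × All Wide ω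
  path-chain [] u A w0 refl = refl , []
  path-chain ((a , b) ∷ ω) u A w0 (z , i , p) with zeroStep-width u a b z
  ... | d , d<k , refl = subst2 (\ c s -> Chain c (sh w) s) (sym (LP.unfold-reverse (a , b) ω)) back (chain-snoc (reverse ω) a b (fst ih) (Up⇒Cover u A w0 b d d<k (zeroStep⇒Up u b d z))) , (d , d<k , refl) ∷ snd ih
   where
   ne : ¬ a ~ b
   ne = ¬~-lt (fst (dist b d d<k)) (snd (dist b d d<k))
   A' = Aff-mulT ne A
   ih = path-chain ω (mulT k u (a , b)) A' (inW0⇒W0 A' i) p
   back : sw a b (sh (mulT k u (a , b))) == sh u
   back = cong (sw a b) (sh-mulT ne u) · sw-invol ne (sh u)

  chain-path : ∀ u -> Aff u -> W0 u -> ∀ c v es -> Aff v -> W0 v -> All Wide c -> Chain c (sh v) (sh u) -> PathFromTo k v es w -> PathFromTo k u (c ʳ++ es) w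
  chain-path u A w0 [] v es Av wv [] e p = subst (\ z -> PathFromTo k z es w) (sh-injective v u Av A wv w0 e) p
  chain-path u A w0 ((a , b) ∷ c) v es Av wv ((d , d<k , refl) ∷ ws) (C , ch) p = chain-path u A w0 c (mulT k v (a , b)) ((a , b) ∷ es) (Aff-mulT ne Av) (down-W0) ws (subst (\ s -> Chain c s (sh u)) (sym (sh-mulT ne v)) ch)
    (Up⇒zeroStep _ b d d<k down-Up , subst (\ z -> T (inW0 k z)) (sym (mulT-invol ne v)) (W0⇒inW0 Av wv) , subst (\ z -> PathFromTo k z es w) (sym (mulT-invol ne v)) p)
   where
   open FromCover v Av wv b d d<k C
   ne : ¬ a ~ b
   ne = ¬~-lt (fst (dist b d d<k)) (snd (dist b d d<k))

 Hs-snoc : ∀ p L φ m s -> Hs p (suc L) φ m s == F⁺ (p + + L) (Hs p L φ) m s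
 Hs-snoc p zero φ m s = cong (\ z -> F⁺ z φ m s) (sym (+0 p))
 Hs-snoc p (suc L) φ m s = Hs-snoc (p +1) L (F⁺ p φ) m s · cong (\ z -> F⁺ z (Hs (p +1) L (F⁺ p φ)) m s) (Z.+-assoc p (+ 1) (+ L))

 module InRange (b : ℤ) (M : ℕ) where
  open RangeH b M

  wk : ℕ -> ℕ -> Fun -> Fun
  wk i zero Φ s = Φ s
  wk i (suc m) Φ s = Ʃ i (\ j -> Ξ (lo + + j) (wk (suc j) m Φ) s)

  private
   H : ℕ -> ℤ -> Fun -> Fun
   H i m Φ = Hs lo i (at0 Φ) m

   H-neg : ∀ i m Φ s -> m < + 0 -> H i m Φ s == + 0
   H-neg zero m Φ s l = »-no (m Z.≟ + 0) (\ e -> Z.<-irrefl e l)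
   H-neg (suc i) m Φ s l = Hs-snoc lo i (at0 Φ) m s · H-neg i m Φ s l ⊹ (T-linear (lo + + i) .ext _ _ (\ s -> H-neg i (m -¹) Φ s (lin (m & []) (x0 :< 0' & []) (x0 :- 1' :< 0') l)) s · T-linear (lo + + i) .lin0 s)

   H-0 : ∀ i Φ s -> H i (+ 0) Φ s == Φ s
   H-0 zero Φ s = refl
   H-0 (suc i) Φ s = Hs-snoc lo i (at0 Φ) (+ 0) s · H-0 i Φ s ⊹ (T-linear (lo + + i) .ext _ _ (\ s -> H-neg i -1ℤ Φ s Z.-<+) s · T-linear (lo + + i) .lin0 s) · +0 (Φ s)

  -- Two equal labels in a block contribute Ξ b (Ξ b φ) = 0, so weakly and strictly decreasing words agree.
  wk-H : ∀ m i Φ s -> wk i m Φ s == H i (+ m) Φ s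
  wk-H zero i Φ s = sym (H-0 i Φ s)
  wk-H (suc m) zero Φ s = refl
  wk-H (suc m) (suc i) Φ s = Ʃ-last i (\ j -> Ξ (lo + + j) (wk (suc j) m Φ) s) · wk-H (suc m) i Φ s ⊹ top · sym (Hs-snoc lo i (at0 Φ) (+ suc m) s)
   where
   top : Ξ (lo + + i) (wk (suc i) m Φ) s == Ξ (lo + + i) (H i (+ suc m -¹) Φ) s
   top = T-linear (lo + + i) .ext _ _ (\ s -> wk-H m (suc i) Φ s · Hs-snoc lo i (at0 Φ) (+ m) s) s ·
    linear-+ (T-linear (lo + + i)) (H i (+ m) Φ) (Ξ (lo + + i) (H i (+ m -¹) Φ)) s · cong+ʳ (Ξ (lo + + i) (H i (+ m) Φ) s) (T-T (lo + + i) (H i (+ m -¹) Φ) s) · +0 (Ξ (lo + + i) (H i (+ m) Φ) s)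

  edge : ℕ -> ℕ -> ℤ × ℤ
  edge j d = lo + + j - + suc d , lo + + j

  -- All sequences of ℓ candidate edges in the range, whether or not they form a chain. This fixed
  -- index set is the common ground of the given list of paths and the expanded operators.
  CS : ℕ -> (Edges -> ℤ) -> ℤ
  CS zero F = F []
  CS (suc ℓ) F = Ʃ L (\ j -> Ʃ k (\ d -> CS ℓ (\ c -> F (edge j d ∷ c))))

  In : ℤ × ℤ -> Set
  In e = Σ ℕ \ j -> Σ ℕ \ d -> j N.< L × d N.< k × e == edge j d

  CS-cong : ∀ ℓ F G -> (∀ c -> All In c -> length c == ℓ -> F c == G c) -> CS ℓ F == CS ℓ G
  CS-cong zero F G h = h [] [] refl
  CS-cong (suc ℓ) F G h = Ʃ-cong L (\ j j< -> Ʃ-cong k (\ d d< -> CS-cong ℓ _ _ (\ c a e -> h (edge j d ∷ c) ((j , d , j< , d< , refl) ∷ a) (cong suc e))))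

  CS-0 : ∀ ℓ -> CS ℓ (\ _ -> + 0) == + 0
  CS-0 zero = refl
  CS-0 (suc ℓ) = Ʃ-zero L (\ j _ -> Ʃ-zero k (\ d _ -> CS-0 ℓ))

  CS-zero : ∀ ℓ F -> (∀ c -> All In c -> length c == ℓ -> F c == + 0) -> CS ℓ F == + 0
  CS-zero ℓ F h = CS-cong ℓ F (\ _ -> + 0) h · CS-0 ℓ

  CS-» : ∀ {P : Set} (d : Dec P) ℓ F -> CS ℓ (\ c -> d » F c) == (d » CS ℓ F)
  CS-» (yes _) ℓ F = refl
  CS-» (no _) ℓ F = CS-0 ℓ

  ƩL-CS : ∀ {A : Set} (xs : List A) ℓ (F : A -> Edges -> ℤ) -> ƩL xs (\ x -> CS ℓ (F x)) == CS ℓ (\ c -> ƩL xs (\ x -> F x c))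
  ƩL-CS xs zero F = refl
  ƩL-CS xs (suc ℓ) F = ƩL-Ʃ-swap xs L (\ x j -> Ʃ k (\ d -> CS ℓ (\ c -> F x (edge j d ∷ c)))) · Ʃ-ext L (\ j -> ƩL-Ʃ-swap xs k (\ x d -> CS ℓ (\ c -> F x (edge j d ∷ c))) · Ʃ-ext k (\ d -> ƩL-CS xs ℓ (\ x c -> F x (edge j d ∷ c))))

  CS-pick : ∀ ω -> All In ω -> ∀ F -> CS (length ω) (\ c -> (ω ≟E c) » F c) == F ω
  CS-pick [] a F = refl
  CS-pick (e ∷ ω) ((j , d , j< , d< , refl) ∷ a) F = Ʃ-pick L {\ i -> Ʃ k (\ d' -> CS (length ω) (\ c -> ((e ∷ ω) ≟E (edge i d' ∷ c)) » F (edge i d' ∷ c)))} j j< (\ i _ ne -> Ʃ-zero k (\ d' _ -> CS-zero (length ω) _ (\ c _ _ -> »-no ((e ∷ ω) ≟E (edge i d' ∷ c)) {F (edge i d' ∷ c)} (\ q -> ne (sym (lab (cong snd (LP.∷-injectiveˡ q)))))))) ·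
   Ʃ-pick k {\ d' -> CS (length ω) (\ c -> ((e ∷ ω) ≟E (edge j d' ∷ c)) » F (edge j d' ∷ c))} d d< (\ d' _ ne -> CS-zero (length ω) _ (\ c _ _ -> »-no ((e ∷ ω) ≟E (edge j d' ∷ c)) {F (edge j d' ∷ c)} (\ q -> ne (sym (wid (cong fst (LP.∷-injectiveˡ q))))))) ·
   CS-cong (length ω) _ (\ c -> (ω ≟E c) » F (e ∷ c)) (\ c _ _ -> »-cong ((e ∷ ω) ≟E (e ∷ c)) (ω ≟E c) LP.∷-injectiveʳ (cong (e ∷_)) (\ _ _ -> refl)) · CS-pick ω a (\ c -> F (e ∷ c))
   where
   lab : ∀ {i} -> lo + + j == lo + + i -> j == i
   lab {i} q = Z.+-injective (lin (lo & + j & + i & []) (x0 :+ x1 := x0 :+ x2 & []) (x1 := x2) q)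
   wid : ∀ {d'} -> lo + + j - + suc d == lo + + j - + suc d' -> d == d'
   wid {d'} q = Z.+-injective (lin (lo & + j & + d & + d' & []) (x0 :+ x1 :- (1' :+ x2) := x0 :+ x1 :- (1' :+ x3) & []) (x2 := x3) q)

  In-Wide : ∀ {e} -> In e -> Wide e
  In-Wide (j , d , _ , d< , refl) = d , d< , refl

  In-label : ∀ {e} -> In e -> snd e ≤ hi
  In-label (j , d , j< , _ , refl) = Z.+-monoʳ-≤ lo (Z.+≤+ (s≤s⁻¹ j<))

  chain-In : ∀ c s s' -> All Wide c -> Bd lo hi s -> Chain c s s' -> All In c
  chain-In [] s s' [] B ch = []
  chain-In ((a , b) ∷ c) s s' ((d , d<k , refl) ∷ ws) B (C , ch) = go (Z.i≤j⇒i-j≤0 lo<) ∷ chain-In c _ s' ws (Bd-stable lo hi b d s d<k B C) ch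
   where
   b<hi : b < hi
   b<hi = Z.≰⇒> (\ q -> Z.<⇒≱ (neg C) (high B b q))
   lo<a : lo < a
   lo<a = Z.≰⇒> (\ q -> Z.<⇒≱ (low B a q) (pos C))
   lo< : lo ≤ b
   lo< = lin (lo & b & + d & []) (x0 :< x1 :- (1' :+ x2) & 0' =< x2 & []) (x0 =< x1) lo<a 0≤+
   go : lo - b ≤ + 0 -> In (a , b)
   go _ with b - lo in eq
   ... | + j = j , d , N.m≤n⇒m≤1+n (Z.drop‿+<+ (lin (lo & b & + j & + (L ∸ 1) & []) (x1 :< x0 :+ x3 & x1 :- x0 := x2 & []) (x2 :< x3) b<hi eq)) , d<k , cong (\ z -> z - + suc d , z) (lin (lo & b & + j & []) (x1 :- x0 := x2 & []) (x1 := x0 :+ x2) eq)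
   ... | -[1+ j ] = exfalso (impossible (subst (+ 0 ≤_) eq (Z.i≤j⇒0≤j-i lo<)))
    where
    impossible : ¬ + 0 ≤ -[1+ j ]
    impossible ()

  module _ (t : State) where
   -- One factor `Hm m` for each variable with exponent m: a block of m labels that increase along
   -- the path. The list is the reversed exponent vector, so the last variable acts first at the
   -- upper end.
   Sfun : List ℕ -> Fun
   Sfun [] = δS t
   Sfun (m ∷ ra) = Hm (+ m) (Sfun ra)

   private
    labels-step : ∀ ℓ (g : List ℤ -> ℤ) s -> CS (suc ℓ) (\ c -> Chain? c s t » g (labels c)) == Ʃ L (\ j -> Ξ (lo + + j) (\ s' -> CS ℓ (\ c -> Chain? c s' t » g (lo + + j ∷ labels c))) s)
    labels-step ℓ g s = Ʃ-ext L (\ j -> Ʃ-ext k (\ d -> CS-cong ℓ _ (\ c -> Cover? (lo + + j - + suc d) (lo + + j) s » Chain? c (sw (lo + + j - + suc d) (lo + + j) s) t » g (lo + + j ∷ labels c)) (\ c _ _ -> »-× (Cover? (lo + + j - + suc d) (lo + + j) s) (Chain? c (sw (lo + + j - + suc d) (lo + + j) s) t)) ·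
     CS-» (Cover? (lo + + j - + suc d) (lo + + j) s) ℓ (\ c -> Chain? c (sw (lo + + j - + suc d) (lo + + j) s) t » g (lo + + j ∷ labels c)) · sym (Tt-def (lo + + j - + suc d) (lo + + j) (\ s' -> CS ℓ (\ c -> Chain? c s' t » g (lo + + j ∷ labels c))) s)))

   blocks-sum : ∀ ra r i τ s -> i N.≤ L -> τ == lo + + i -¹ -> CS (r N.+ sum ra) (\ c -> Chain? c s t » bi (Blocks hi τ r ra (labels c))) == wk i r (Sfun ra) s
   blocks-sum [] zero i τ s l e = refl
   blocks-sum (m ∷ ra) zero i τ s l e = blocks-sum ra m L hi s N.≤-refl (lin (lo & + (L ∸ 1) & []) [] (x0 :+ x1 := x0 :+ (1' :+ x1) :- 1')) · wk-H m L (Sfun ra) s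
   blocks-sum ra (suc r) i τ s l e = labels-step ℓ (\ bs -> bi (Blocks hi τ (suc r) ra bs)) s ·
    cong (\ z -> Ʃ z term) (sym (N.m+[n∸m]≡n l)) · Ʃ-split i (L ∸ i) term ·
    -- The labels up to τ = lo + i - 1 continue the block; the larger ones violate its order and
    -- drop out.
    Ʃ-cong i inside ⊹ Ʃ-zero (L ∸ i) (\ j _ -> outside j) · +0 (wk i (suc r) (Sfun ra) s)
    where
    ℓ = r N.+ sum ra
    term : ℕ -> ℤ
    term j = Ξ (lo + + j) (\ s' -> CS ℓ (\ c -> Chain? c s' t » bi ((lo + + j Z.≤ᵇ τ) ∧ Blocks hi (lo + + j) r ra (labels c)))) s
    inside : ∀ j -> j N.< i -> term j == Ξ (lo + + j) (wk (suc j) r (Sfun ra)) s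
    inside j j< = T-linear (lo + + j) .ext _ _ (\ s' -> CS-cong ℓ _ (\ c -> Chain? c s' t » bi (Blocks hi (lo + + j) r ra (labels c))) (\ c _ _ -> cong (\ z -> Chain? c s' t » bi (z ∧ Blocks hi (lo + + j) r ra (labels c))) (T⇒≡ (Z.≤⇒≤ᵇ (subst (lo + + j ≤_) (sym e) (lin (lo & + j & + i & []) (x1 :< x2 & []) (x0 :+ x1 =< x0 :+ x2 :- 1') (Z.+<+ j<)))))) ·
     blocks-sum ra r (suc j) (lo + + j) s' (N.≤-trans j< l) (lin (lo & + j & []) [] (x0 :+ x1 := x0 :+ (1' :+ x1) :- 1'))) s
    outside : ∀ j -> term (i N.+ j) == + 0
    outside j = T-linear (lo + + (i N.+ j)) .ext _ (\ _ -> + 0) (\ s' -> CS-zero ℓ _ (\ c _ _ -> cong (\ z -> Chain? c s' t » bi (z ∧ Blocks hi (lo + + (i N.+ j)) r ra (labels c))) (¬T⇒≡ (\ q -> big (Z.≤ᵇ⇒≤ q))) · »-0 (Chain? c s' t))) s · T-linear (lo + + (i N.+ j)) .lin0 s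
     where
     big : ¬ lo + + (i N.+ j) ≤ τ
     big q = lin⊥ (lo & + i & + j & []) (x0 :+ (x1 :+ x2) =< x0 :+ x1 :- 1' & 0' =< x2 & []) (subst (lo + + (i N.+ j) ≤_) e q) 0≤+

  module _ (u w : Window k) (Au : Aff u) (wu : W0 u) (Aw : Aff w) (ww : W0 w) (Bw : Bd lo hi (sh w))
   (paths : List Edges) (uniq : Unique paths) (sound : All (\ ω -> PathFromTo k u ω w) paths) (complete : ∀ ω -> PathFromTo k u ω w -> ω ∈ paths)
   {m : ℕ} (a : Vec ℕ m) where
   private
    ra = reverse (toList a)
    ℓ = size a
    F : Edges -> ℤ
    F c = Chain? c (sh w) (sh u) » bi (Blocks hi hi 0 ra (labels c))

    path-term : ∀ ω -> ω ∈ paths -> Fcoeff (D ω) a == CS ℓ (\ c -> (reverse ω ≟E c) » F c)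
    path-term ω ω∈ with length ω N.≟ ℓ
    ... | no ne = Fcoeff-length a (labels ω) (\ q -> ne (sym (LP.length-map snd ω) · q)) · sym (CS-zero ℓ _ (\ c _ lc -> »-no (reverse ω ≟E c) (\ { refl -> ne (sym (LP.length-reverse ω) · lc) })))
    ... | yes e = cong (\ z -> Fcoeff (compOf z) a) (sym (cong reverse (LP.reverse-map snd ω) · LP.reverse-involutive (labels ω))) ·
      Fcoeff-Blocks hi a (labels (reverse ω)) (AllP.map⁺ (All.map In-label inR)) (LP.length-map snd (reverse ω) · le) ·
      sym (»-yes (Chain? (reverse ω) (sh w) (sh u)) (fst ch)) · sym (cong (\ z -> CS z (\ c -> (reverse ω ≟E c) » F c)) (sym le) · CS-pick (reverse ω) inR F)
     where
     le : length (reverse ω) == ℓ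
     le = LP.length-reverse ω · e
     ch = path-chain ω u Au wu (All.lookup sound ω∈)
     inR = chain-In (reverse ω) (sh w) (sh u) (All.tabulate (\ x∈ -> All.lookup (snd ch) (AnyP.reverse⁻ x∈))) Bw (fst ch)

    code-term : ∀ c -> All In c -> ƩL paths (\ ω -> (reverse ω ≟E c) » F c) == F c
    code-term c inR with Chain? c (sh w) (sh u)
    ... | no _ = ƩL-zero paths (\ ω _ -> »-0 (reverse ω ≟E c))
    ... | yes ch = ƩL-unique paths (\ ω -> (reverse ω ≟E c) » bi (Blocks hi hi 0 ra (labels c))) uniq (complete (reverse c) (chain-path u Au wu c w [] Aw ww (All.map In-Wide inR) ch refl))
      (\ ω _ ne -> »-no (reverse ω ≟E c) (\ q -> ne (sym (LP.reverse-involutive ω) · cong reverse q))) · »-yes (reverse (reverse c) ≟E c) (LP.reverse-involutive c)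

   -- Each path is found among the candidate sequences as its reversal. Conversely each chain comes
   -- from exactly one entry of the list, which contains it by `complete` and contains it once by
   -- `uniq`.
   count : ƩL paths (\ ω -> Fcoeff (D ω) a) == Sfun (sh u) ra (sh w)
   count = ƩL-cong paths path-term · ƩL-CS paths ℓ (\ ω c -> (reverse ω ≟E c) » F c) · CS-cong ℓ _ F (\ c inR _ -> code-term c inR) ·
    cong (\ z -> CS z F) (sym (SP.sum-↭ (↭-reverse (toList a)))) · blocks-sum (sh u) ra 0 L hi (sh w) N.≤-refl (lin (lo & + (L ∸ 1) & []) [] (x0 :+ x1 := x0 :+ (1' :+ x1) :- 1')) · refl

-- Convolutions of functions of exponent vectors.

module Conv where
 open Z using (_≤_)
 open import Defs
 open Cauchy using (module Box)
 open import Data.List.Relation.Binary.Permutation.Propositional.Properties using (↭-reverse)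
 open import Data.List.Properties using (unfold-reverse)

 takes : List ℕ -> List ℕ -> (List ℕ -> ℤ) -> ℤ
 takes [] ν K = K ν
 takes (m ∷ ra) ν K = take (+ m) ν (\ ν' -> takes ra ν' K)

 take-bounded : ∀ c m ν K K' -> All (N._≤ c) ν -> (∀ ν' -> length ν' == length ν -> All (N._≤ c) ν' -> K ν' == K' ν') -> take m ν K == take m ν K'
 take-bounded c m [] K K' a h = cong (\ z -> (m Z.≟ + 0) » z) (h [] refl [])
 take-bounded c m (q ∷ ν) K K' (p ∷ a) h = Ʃ-ext (suc q) (\ i -> take-bounded c (m - + i) ν _ _ a (\ ν' e b -> h ((q ∸ i) ∷ ν') (cong suc e) (N.≤-trans (N.m∸n≤m q i) p ∷ b)))

 take-ext : ∀ m ν {K K'} -> (∀ ν' -> K ν' == K' ν') -> take m ν K == take m ν K'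
 take-ext m ν h = Box.take-cong 0 m ν h

 take-Ʃ : ∀ m ν c (K : ℕ -> List ℕ -> ℤ) -> take m ν (\ ν' -> Ʃ c (\ i -> K i ν')) == Ʃ c (\ i -> take m ν (K i))
 take-Ʃ m [] c K = »-Ʃ (m Z.≟ + 0) c (\ i -> K i [])
 take-Ʃ m (q ∷ ν) c K = Ʃ-ext (suc q) (\ i -> take-Ʃ (m - + i) ν c (\ j ν' -> K j ((q ∸ i) ∷ ν'))) · Ʃ-swap (suc q) c (\ i j -> take (m - + i) ν (\ ν' -> K j ((q ∸ i) ∷ ν')))

 -- cv ν F sums F β (ν − β) over the vectors β ≤ ν.

 cv : List ℕ -> (List ℕ -> List ℕ -> ℤ) -> ℤ
 cv [] F = F [] []
 cv (q ∷ ν) F = Ʃ (suc q) (\ y -> cv ν (\ β γ -> F (y ∷ β) ((q ∸ y) ∷ γ)))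

 cv-ext : ∀ ν {F G} -> (∀ β γ -> F β γ == G β γ) -> cv ν F == cv ν G
 cv-ext [] h = h [] []
 cv-ext (q ∷ ν) {F} {G} h = Ʃ-ext (suc q) {\ y -> cv ν (\ β γ -> F (y ∷ β) ((q ∸ y) ∷ γ))} {\ y -> cv ν (\ β γ -> G (y ∷ β) ((q ∸ y) ∷ γ))} (\ y -> cv-ext ν (\ β γ -> h (y ∷ β) ((q ∸ y) ∷ γ)))

 cv-Ʃ : ∀ ν c (F : ℕ -> List ℕ -> List ℕ -> ℤ) -> cv ν (\ β γ -> Ʃ c (\ i -> F i β γ)) == Ʃ c (\ i -> cv ν (F i))
 cv-Ʃ [] c F = refl
 cv-Ʃ (q ∷ ν) c F = Ʃ-ext (suc q) (\ y -> cv-Ʃ ν c (\ i β γ -> F i (y ∷ β) ((q ∸ y) ∷ γ))) · Ʃ-swap (suc q) c (\ y i -> cv ν (\ β γ -> F i (y ∷ β) ((q ∸ y) ∷ γ)))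

 cv-0 : ∀ ν -> cv ν (\ _ _ -> + 0) == + 0
 cv-0 [] = refl
 cv-0 (q ∷ ν) = Ʃ-zero (suc q) {\ y -> cv ν (\ _ _ -> + 0)} (\ _ _ -> cv-0 ν)

 Ʃ-triangle : ∀ q (f : ℕ -> ℕ -> ℤ) -> Ʃ (suc q) (\ i -> Ʃ (suc (q ∸ i)) (f i)) == Ʃ (suc q) (\ y -> Ʃ (suc (q ∸ y)) (\ i -> f i y))
 Ʃ-triangle q f = Ʃ-cong (suc q) (\ i l -> cut i (f i) l) · Ʃ-swap (suc q) (suc q) (\ i y -> (i N.+ y N.≤? q) » f i y) ·
  Ʃ-ext (suc q) (\ y -> Ʃ-ext (suc q) {\ i -> (i N.+ y N.≤? q) » f i y} {\ i -> (y N.+ i N.≤? q) » f i y} (\ i -> »-cong (i N.+ y N.≤? q) (y N.+ i N.≤? q) (subst (N._≤ q) (N.+-comm i y)) (subst (N._≤ q) (N.+-comm y i)) (\ _ _ -> refl))) · sym (Ʃ-cong (suc q) (\ y l -> cut y (\ i -> f i y) l))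
  where
  cut : ∀ i g -> i N.< suc q -> Ʃ (suc (q ∸ i)) g == Ʃ (suc q) (\ y -> (i N.+ y N.≤? q) » g y)
  cut i g (s≤s l) = sym (cong (\ z -> Ʃ z (\ y -> (i N.+ y N.≤? q) » g y)) (sym (cong suc (N.m∸n+n≡m l))) · Ʃ-split (suc (q ∸ i)) i (\ y -> (i N.+ y N.≤? q) » g y) ·
   Ʃ-cong (suc (q ∸ i)) {\ y -> (i N.+ y N.≤? q) » g y} {g} (\ y l' -> »-yes (i N.+ y N.≤? q) (subst (i N.+ y N.≤_) (N.m+[n∸m]≡n l) (N.+-monoʳ-≤ i (s≤s⁻¹ l')))) ⊹
    Ʃ-zero i (\ y _ -> »-no (i N.+ (suc (q ∸ i) N.+ y) N.≤? q) (\ b -> N.<⇒≱ (N.≤-trans (s≤s (N.≤-trans (N.≤-reflexive (sym (N.m+[n∸m]≡n l))) (N.+-monoʳ-≤ i (N.m≤m+n (q ∸ i) y)))) (N.≤-reflexive (sym (N.+-suc i (q ∸ i N.+ y))))) b)) · +0 (Ʃ (suc (q ∸ i)) g))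

 -- In each entry, first removing i and then splitting the rest, or first splitting and then
 -- removing i from the second part, are the two orders of one triangular double sum.
 take-cv : ∀ m ν F -> take m ν (\ ν' -> cv ν' F) == cv ν (\ β γ -> take m γ (F β))
 take-cv m [] F = refl
 take-cv m (q ∷ ν) F = Ʃ-ext (suc q) (\ i -> take-Ʃ (m - + i) ν (suc (q ∸ i)) (\ y ν' -> cv ν' (\ β γ -> F (y ∷ β) ((q ∸ i ∸ y) ∷ γ))) · Ʃ-ext (suc (q ∸ i)) (\ y -> take-cv (m - + i) ν (\ β γ -> F (y ∷ β) ((q ∸ i ∸ y) ∷ γ)))) ·
  Ʃ-triangle q (\ i y -> cv ν (\ β γ -> take (m - + i) γ (\ γ' -> F (y ∷ β) ((q ∸ i ∸ y) ∷ γ')))) ·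
  Ʃ-ext (suc q) (\ y -> Ʃ-ext (suc (q ∸ y)) (\ i -> cv-ext ν (\ β γ -> take-ext (m - + i) γ (\ γ' -> cong (\ z -> F (y ∷ β) (z ∷ γ')) (comm q i y)))) · sym (cv-Ʃ ν (suc (q ∸ y)) (\ i β γ -> take (m - + i) γ (\ γ' -> F (y ∷ β) ((q ∸ y ∸ i) ∷ γ')))))
  where
  comm : ∀ q i y -> q ∸ i ∸ y == q ∸ y ∸ i
  comm q i y = N.∸-+-assoc q i y · cong (q N.∸_) (N.+-comm i y) · sym (N.∸-+-assoc q y i)

 module _ (B : ℕ) where
  open Box B using (Mat)

  -- What the successive removals take away altogether is γ = ν - β, and `Mat ra γ` counts the ways
  -- of distributing it over the steps.
  takes-cv : ∀ ra ν K -> takes ra ν K == cv ν (\ β γ -> K β * Mat ra γ)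
  takes-cv [] [] K = sym (Z.*-identityʳ (K []))
  takes-cv [] (q ∷ ν) K = takes-cv [] ν (\ β -> K (q ∷ β)) · sym (Ʃ-pick (suc q) {\ y -> cv ν (\ β γ -> K (y ∷ β) * Mat [] ((q ∸ y) ∷ γ))} q N.≤-refl
    (\ y l ne -> cv-ext ν (\ β γ -> cong (\ z -> K (y ∷ β) * z) (»-no (q ∸ y N.+ sum γ N.≟ 0) {+ 1} (\ e -> N.<⇒≱ (N.m<n⇒0<n∸m (N.≤∧≢⇒< (s≤s⁻¹ l) ne)) (N.≤-reflexive (N.m+n≡0⇒m≡0 (q ∸ y) e)))) · Z.*-zeroʳ (K (y ∷ β))) · cv-0 ν) ·
   cv-ext ν (\ β γ -> cong (\ z -> K (q ∷ β) * ((z N.+ sum γ N.≟ 0) » + 1)) (N.n∸n≡0 q)))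
  takes-cv (m ∷ ra) ν K = take-ext (+ m) ν (\ ν' -> takes-cv ra ν' K) · take-cv (+ m) ν (\ β γ -> K β * Mat ra γ) · cv-ext ν (\ β γ -> Box.take-* B (K β) (+ m) γ (Mat ra))

  take-snoc : ∀ m ν q K -> take m (ν ++ q ∷ []) K == Ʃ (suc q) (\ i -> take (m - + i) ν (\ ν' -> K (ν' ++ (q ∸ i) ∷ [])))
  take-snoc m [] q K = refl
  take-snoc m (x ∷ ν) q K = Ʃ-ext (suc x) (\ i -> take-snoc (m - + i) ν q (\ ν' -> K ((x ∸ i) ∷ ν'))) · Ʃ-swap (suc x) (suc q) (\ i j -> take (m - + i - + j) ν (\ ν' -> K ((x ∸ i) ∷ ν' ++ (q ∸ j) ∷ []))) ·
   Ʃ-ext (suc q) (\ j -> Ʃ-ext (suc x) (\ i -> cong (\ z -> take z ν (\ ν' -> K ((x ∸ i) ∷ ν' ++ (q ∸ j) ∷ []))) (lin (m & + i & + j & []) [] (x0 :- x1 :- x2 := x0 :- x2 :- x1))))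

  take-reverse : ∀ m ν K -> take m (reverse ν) K == take m ν (\ ν' -> K (reverse ν'))
  take-reverse m [] K = refl
  take-reverse m (q ∷ ν) K = cong (\ z -> take m z K) (unfold-reverse q ν) · take-snoc m (reverse ν) q K ·
   Ʃ-ext (suc q) (\ i -> take-reverse (m - + i) ν (\ ν' -> K (ν' ++ (q ∸ i) ∷ [])) · take-ext (m - + i) ν (\ ν' -> cong K (sym (unfold-reverse (q ∸ i) ν'))))

  -- Undoes the reversal of the exponent vector that `Sch-SC` introduces.
  Mat-reverse : ∀ ra ν -> Mat ra (reverse ν) == Mat ra ν
  Mat-reverse [] ν = cong (\ z -> (z N.≟ 0) » + 1) (SP.sum-↭ (↭-reverse ν))
  Mat-reverse (m ∷ ra) ν = take-reverse (+ m) ν (Mat ra) · take-ext (+ m) ν (Mat-reverse ra)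

 below-Ʃ : ∀ {m} x (a : Vec ℕ m) f -> ƩL (below (x ∷ a)) f == Ʃ (suc x) (\ y -> ƩL (below a) (\ b -> f (y ∷ b)))
 below-Ʃ x a f = ƩL-concatMap (\ y -> map (y Vec.∷_) (below a)) (List.upTo (suc x)) f · ƩL-applyUpTo (\ y -> y) (suc x) (\ y -> ƩL (map (y Vec.∷_) (below a)) f) · Ʃ-ext (suc x) (\ y -> ƩL-map (y Vec.∷_) (below a) f)

 below-bounded : ∀ {m} c (a : Vec ℕ m) f g -> All (N._≤ c) (toList a) -> (∀ b -> All (N._≤ c) (toList b) -> f b == g b) -> ƩL (below a) f == ƩL (below a) g
 below-bounded c [] f g _ h = cong (\ z -> z + + 0) (h [] [])
 below-bounded c (x ∷ a) f g (p ∷ ps) h = below-Ʃ x a f · Ʃ-cong (suc x) (\ y l -> below-bounded c a _ _ ps (\ b q -> h (y ∷ b) (N.≤-trans (s≤s⁻¹ l) p ∷ q))) · sym (below-Ʃ x a g)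

 below-cv : ∀ {m} (a : Vec ℕ m) F -> ƩL (below a) (\ b -> F (toList b) (toList (Vec.zipWith N._∸_ a b))) == cv (toList a) F
 below-cv [] F = +0 (F [] [])
 below-cv (x ∷ a) F = below-Ʃ x a (\ b -> F (toList b) (toList (Vec.zipWith N._∸_ (x ∷ a) b))) · Ʃ-ext (suc x) (\ y -> below-cv a (\ β γ -> F (y ∷ β) ((x ∸ y) ∷ γ)))

-- Sorting exponents, and the coefficients of dual k-Schur functions.

module Norm (k' : ℕ) where
 open import Defs
 open Tab using (WD; T⇒≡; ¬T⇒≡)
 open Tab2 using (IsPart; isPart)
 open Base k'
 open Strong k' using (Fun)
 open Words k' using (ext)
 open WordSums k' using (inc; dsum; inc-0)
 open Star k' using (uw; U)
 open StarH k' using (Ur; Ur-linear)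
 open Symm k' using (U-comm)
 open Length k' using (inc-cong-len; dsum-cong-len)
 open Sep k' using (idS)
 open Win k'
 open Weak k'
 open Edge k' using (T-∧; T-∧ˡ)
 open import Data.List.Relation.Binary.Permutation.Propositional using (_↭_; prep; swap) renaming (refl to ↭-refl; trans to ↭-trans)
 open import Data.List.Relation.Binary.Permutation.Propositional.Properties using (All-resp-↭)
 open import Data.Nat using (_⊓_)

 opaque
  unfolding U
  U-zero : ∀ φ s -> U (+ 0) φ s == φ s
  U-zero φ s = inc-zero (+ 1) k (\ w -> uw w φ s) ⊹ (dsum-cong-len (+ 1) k -1ℤ (\ v w -> uw (w ++ + 0 ∷ v) φ s) (\ _ _ -> + 0) (\ _ _ ()) · dsum-0 (+ 1) k -1ℤ) · +0 (φ s)
   where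
   dsum-0 : ∀ p m r -> dsum p m r (\ _ _ -> + 0) == + 0
   dsum-0 p zero r = refl
   dsum-0 p (suc m) r = inc-0 (p +1) m r ⊹ dsum-0 (p +1) m (r -¹)
   inc-zero : ∀ p m f -> inc p m (+ 0) f == f []
   inc-zero p zero f = refl
   inc-zero p (suc m) f = inc-zero (p +1) m f ⊹ (inc-cong-len (p +1) m -1ℤ (\ v -> f (p ∷ v)) (\ _ -> + 0) (\ _ ()) · inc-0 (p +1) m -1ℤ) · +0 (f [])

 Ur-↭ : ∀ {xs ys} -> xs ↭ ys -> ∀ φ s -> Ur xs φ s == Ur ys φ s
 Ur-↭ ↭-refl φ s = refl
 Ur-↭ (prep x p) φ s = Ur-↭ p (U (+ x) φ) s
 Ur-↭ (swap {ys = ys} x y p) φ s = Ur-↭ p (U (+ y) (U (+ x) φ)) s · ext (Ur-linear ys) _ _ (U-comm (+ y) (+ x) φ) s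
 Ur-↭ (↭-trans p q) φ s = Ur-↭ p φ s · Ur-↭ q φ s

 insert-↭ : ∀ x ys -> insertDesc x ys ↭ x ∷ ys
 insert-↭ x [] = ↭-refl
 insert-↭ x (y ∷ ys) with y N.≤ᵇ x
 ... | true = ↭-refl
 ... | false = ↭-trans (prep y (insert-↭ x ys)) (swap y x ↭-refl)

 sort-↭ : ∀ xs -> sortDesc xs ↭ xs
 sort-↭ [] = ↭-refl
 sort-↭ (x ∷ xs) = ↭-trans (insert-↭ x (sortDesc xs)) (prep x (sort-↭ xs))

 insert-WD : ∀ x m ys -> x N.≤ m -> WD m ys -> WD m (insertDesc x ys)
 insert-WD x m [] l _ = l , _
 insert-WD x m (y ∷ ys) l (a , b) with y N.≤ᵇ x in e
 ... | true = l , N.≤ᵇ⇒≤ y x (subst T (sym e) _) , b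
 ... | false = a , insert-WD x y ys (N.<⇒≤ (N.≰⇒> (\ q -> subst T e (N.≤⇒≤ᵇ q)))) b

 sort-WD : ∀ m xs -> All (N._≤ m) xs -> WD m (sortDesc xs)
 sort-WD m [] [] = _
 sort-WD m (x ∷ xs) (p ∷ a) = insert-WD x m (sortDesc xs) p (sort-WD m xs a)

 positives norm : List ℕ -> List ℕ
 positives = filterᵇ (\ x -> 1 N.≤ᵇ x)
 norm β = sortDesc (positives β)

 positives-All : ∀ {P : ℕ -> Set} β -> All P β -> All P (positives β)
 positives-All [] [] = []
 positives-All (zero ∷ β) (_ ∷ a) = positives-All β a
 positives-All (suc x ∷ β) (p ∷ a) = p ∷ positives-All β a

 positives-1 : ∀ β -> All (1 N.≤_) (positives β)
 positives-1 [] = []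
 positives-1 (zero ∷ β) = positives-1 β
 positives-1 (suc x ∷ β) = s≤s z≤n ∷ positives-1 β

 sum-norm : ∀ β -> sum (norm β) == sum β
 sum-norm β = SP.sum-↭ (sort-↭ (positives β)) · go β
  where
  go : ∀ β -> sum (positives β) == sum β
  go [] = refl
  go (zero ∷ β) = go β
  go (suc x ∷ β) = cong (suc x N.+_) (go β)

 norm-All : ∀ {P : ℕ -> Set} β -> All P β -> All P (norm β)
 norm-All β a = All-resp-↭ (Data.List.Relation.Binary.Permutation.Propositional.↭-sym (sort-↭ (positives β))) (positives-All β a)

 norm-1 : ∀ β -> All (1 N.≤_) (norm β)
 norm-1 β = All-resp-↭ (Data.List.Relation.Binary.Permutation.Propositional.↭-sym (sort-↭ (positives β))) (positives-1 β)

 norm-Part : ∀ β -> All (N._≤ k) β -> All Part (norm β)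
 norm-Part β a = All.zip (norm-1 β , norm-All β a)

 norm-WD : ∀ m β -> All (N._≤ m) β -> WD m (norm β)
 norm-WD m β a = sort-WD m (positives β) (positives-All β a)

 Ur-norm : ∀ β φ s -> Ur (norm β) φ s == Ur β φ s
 Ur-norm β φ s = Ur-↭ (sort-↭ (positives β)) φ s · go β φ
  where
  go : ∀ β φ -> Ur (positives β) φ s == Ur β φ s
  go [] φ = refl
  go (zero ∷ β) φ = go β φ · ext (Ur-linear β) _ _ (\ s -> sym (U-zero φ s)) s
  go (suc x ∷ β) φ = go β (U (+ suc x) φ)

 T-all : ∀ {P : ℕ -> Set} (p : ℕ -> Bool) xs -> (∀ {x} -> P x -> T (p x)) -> All P xs -> T (all p xs)
 T-all p [] h [] = _
 T-all p (x ∷ xs) h (q ∷ a) = T-∧ (h q) (T-all p xs h a)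

 partition-T : ∀ m la -> All (1 N.≤_) la -> WD m la -> T (isPartition la)
 partition-T m la a w = T-∧ (T-all (\ x -> 1 N.≤ᵇ x) la N.≤⇒≤ᵇ a) (go m la w)
  where
  go : ∀ m la -> WD m la -> T (weakDec la)
  go m [] _ = _
  go m (x ∷ []) _ = _
  go m (x ∷ y ∷ r) (_ , a , b) = T-∧ (N.≤⇒≤ᵇ a) (go x (y ∷ r) (a , b))

 kBounded-T : ∀ la -> All (N._≤ k) la -> T (kBounded k la)
 kBounded-T la a = T-all (\ x -> x N.≤ᵇ k) la N.≤⇒≤ᵇ a

 _≟L_ : (xs ys : List ℕ) -> Dec (xs == ys)
 _≟L_ = LP.≡-dec N._≟_

 parts-pick : ∀ f n m μ (F : List ℕ -> ℤ) -> n N.≤ f -> All (1 N.≤_) μ -> WD m μ -> sum μ == n -> ƩL (partsMax f n m) (\ la -> (μ ≟L la) » F la) == F μ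
 parts-pick zero zero m [] F _ _ _ _ = +0 (F [])
 parts-pick (suc f) zero m [] F _ _ _ _ = +0 (F [])
 parts-pick zero zero m (zero ∷ μ) F _ (() ∷ _)
 parts-pick (suc f) zero m (zero ∷ μ) F _ (() ∷ _)
 parts-pick zero zero m (suc x ∷ μ) F _ _ _ ()
 parts-pick (suc f) zero m (suc x ∷ μ) F _ _ _ ()
 parts-pick (suc f) (suc n) m (suc x ∷ μ) F (s≤s l) (_ ∷ a) (x≤m , w) e = ƩL-concatMap (\ p -> map (p ∷_) (partsMax f (suc n ∸ p) p)) (applyUpTo suc (suc n ⊓ m)) (\ la -> ((suc x ∷ μ) ≟L la) » F la) ·
  ƩL-applyUpTo suc (suc n ⊓ m) (\ p -> ƩL (map (p ∷_) (partsMax f (suc n ∸ p) p)) (\ la -> ((suc x ∷ μ) ≟L la) » F la)) ·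
  Ʃ-pick (suc n ⊓ m) {\ i -> ƩL (map (suc i ∷_) (partsMax f (n ∸ i) (suc i))) (\ la -> ((suc x ∷ μ) ≟L la) » F la)} x (N.⊓-glb x<n x≤m)
   (\ i _ ne -> ƩL-map (suc i ∷_) (partsMax f (n ∸ i) (suc i)) (\ la -> ((suc x ∷ μ) ≟L la) » F la) · ƩL-zero (partsMax f (n ∸ i) (suc i)) (\ la _ -> »-no ((suc x ∷ μ) ≟L (suc i ∷ la)) {F (suc i ∷ la)} (\ q -> ne (sym (N.suc-injective (LP.∷-injectiveˡ q)))))) ·
  ƩL-map (suc x ∷_) (partsMax f (n ∸ x) (suc x)) (\ la -> ((suc x ∷ μ) ≟L la) » F la) ·
  ƩL-ext (partsMax f (n ∸ x) (suc x)) (\ la -> »-cong ((suc x ∷ μ) ≟L (suc x ∷ la)) (μ ≟L la) {F (suc x ∷ la)} LP.∷-injectiveʳ (cong (suc x ∷_)) (\ _ _ -> refl)) ·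
   parts-pick f (n ∸ x) (suc x) μ (\ la -> F (suc x ∷ la)) (N.≤-trans (N.m∸n≤m n x) l) a w (sym (N.m+n∸m≡n x (sum μ)) · cong (N._∸ x) (N.suc-injective e))
  where
  x<n : suc x N.≤ suc n
  x<n = subst (suc x N.≤_) e (N.m≤m+n (suc x) (sum μ))
 parts-pick zero (suc n) m μ F () _ _ _

 -- The exponent vector occurs only in the monomial function of its sorted nonzero part, whose
 -- coefficient is a product of the `U r` at the identity. This product ignores order and zeros, so
 -- it can be formed from the vector itself.
 dual-U : ∀ v -> Aff v -> W0 v -> ∀ {m} (a : Vec ℕ m) -> All (N._≤ k) (toList a) -> dualKSchurCoeff k v a == Ur (toList a) (δS (sh v)) idS
 dual-U v A w a al = ƩL-ext (partitions (size a)) term · parts-pick (size a) (size a) (size a) μ (\ mu -> if kBounded k mu then + Kmat k mu v else + 0) N.≤-refl (norm-1 β) (norm-WD (size a) β (below-sum β)) (sum-norm β) ·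
  cong (\ b -> if b then + Kmat k μ v else + 0) (T⇒≡ (kBounded-T μ (norm-All β al))) · Kmat-U μ v (norm-Part β al) A w · Ur-norm β (δS (sh v)) idS
  where
  β = toList a
  μ = norm β
  below-sum : ∀ xs -> All (N._≤ sum xs) xs
  below-sum [] = []
  below-sum (x ∷ xs) = N.m≤m+n x (sum xs) ∷ All.map (\ q -> N.≤-trans q (N.m≤n+m (sum xs) x)) (below-sum xs)
  ind : ∀ {mu} (d : Dec (μ == mu)) x -> x * (if Relation.Nullary.Dec.does d then + 1 else + 0) == (d » x)
  ind (yes _) x = Z.*-identityʳ x
  ind (no _) x = Z.*-zeroʳ x
  term : ∀ mu -> (if kBounded k mu then + Kmat k mu v * mCoeff mu a else + 0) == ((μ ≟L mu) » (if kBounded k mu then + Kmat k mu v else + 0))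
  term mu with kBounded k mu
  ... | true = ind (μ ≟L mu) (+ Kmat k mu v)
  ... | false = sym (»-0 (μ ≟L mu))

-- Comparison of the two sides as functions of the upper endpoint.

module Final (k' : ℕ) where
 open Z using (_≤_)
 open import Defs
 open Cauchy using (module Box)
 open Tab using (WD)
 open Tab2 using (isPart; partsMax-sound; schur-cauchy)
 open Base k'
 open Strong k' using (Fun; pos; neg; Tt-no; Ξ)
 open Words k' using (Linear; ext; lin+; lin0; linear-minus)
 open Star k' using (Bd; bd; dist; Bd-weaken)
 open StarH k' using (Ur; Ur-linear; module RangeH)
 open Length k' using (gl; len; Len; Good; good)
 open Carrier k' using (win)
 open Sep k' using (idS; bd-win; hv-large; hv-small; separation)
 open Win k'
 open Weak k'
 open Count k'
 open Conv
 open Norm k'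
 open import Data.List.Relation.Unary.Any using (any?)

 linear-ƩL : ∀ {A} -> Linear A -> ∀ {X : Set} (xs : List X) (c : X -> ℤ) (f : X -> Fun) s -> A (\ s -> ƩL xs (\ x -> c x * f x s)) s == ƩL xs (\ x -> c x * A (f x) s)
 linear-ƩL a [] c f s = lin0 a s
 linear-ƩL {A} a (x ∷ xs) c f s = ext a _ _ (\ s -> Z.+-comm (c x * f x s) (ƩL xs (\ x -> c x * f x s))) s · lin+ a (c x) (\ s -> ƩL xs (\ x -> c x * f x s)) (f x) s ·
  cong (\ z -> z + c x * A (f x) s) (linear-ƩL a xs c f s) · Z.+-comm (ƩL xs (\ x -> c x * A (f x) s)) (c x * A (f x) s)

 Len-nat : ∀ s -> Σ ℕ \ d -> Len s == + d
 Len-nat s = go (win (+ 1) n s)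
  where
  gl-nat : ∀ D -> Σ ℕ \ d -> gl D == + d
  gl-nat (+ d) = d , refl
  gl-nat -[1+ d ] = d , refl
  add : ∀ {x y} -> (Σ ℕ \ d -> x == + d) -> (Σ ℕ \ d -> y == + d) -> Σ ℕ \ d -> x + y == + d
  add (d , refl) (d' , refl) = d N.+ d' , refl
  row : ∀ (g : ℤ -> ℤ) ys -> Σ ℕ \ d -> ƩL ys (\ y -> gl (g y)) == + d
  row g [] = 0 , refl
  row g (y ∷ ys) = add (gl-nat (g y)) (row g ys)
  go : ∀ xs -> Σ ℕ \ d -> len xs == + d
  go [] = 0 , refl
  go (x ∷ xs) = add (row (\ y -> x - y) xs) (go xs)

 T-idS : ∀ b φ -> Ξ b φ idS == + 0
 T-idS b φ = Ʃ-zero k (\ d d<k -> Tt-no (b - + suc d) b φ idS (\ c -> Z.<-asym (fst (dist b d d<k)) (fl-lt (subst2 _<_ (hv-idS b) (hv-idS (b - + suc d)) (Z.<-≤-trans (neg c) (pos c))))))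

 Bd-idS : ∀ {lo hi} -> lo ≤ + 0 -> + 1 ≤ hi -> Bd lo hi idS
 Bd-idS l h = bd (\ j p -> subst (_< + 0) (sym (hv-idS j)) (fl-neg (Z.≤-trans p l))) (\ j p -> subst (+ 0 ≤_) (sym (hv-idS j)) (fl-pos (Z.≤-trans h p)))

 module Main (u w : Window k) (Pu : IsAffPerm k u) (u∈ : T (inW0 k u)) (Pw : IsAffPerm k w) (w∈ : T (inW0 k w))
  (paths : List Edges) (uniq : Unique paths) (sound : All (\ ω -> PathFromTo k u ω w) paths) (complete : ∀ ω -> PathFromTo k u ω w -> ω ∈ paths)
  (Ws : List ℕ -> List (Window k)) (c : List ℕ -> Window k -> ℤ)
  (expand : ∀ la -> T (isPartition la) -> Unique (Ws la) × All (\ v -> IsAffPerm k v × T (inW0 k v)) (Ws la)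
   × (∀ mu -> T (isPartition mu) -> T (kBounded k mu) -> prodMCoeff k u la mu == sumℤ (map (\ v -> c la v * + Kmat k mu v) (Ws la))))
  (support : ∀ la -> T (isPartition la) -> ¬ (w ∈ Ws la) -> c la w == + 0)
  {m : ℕ} (a : Vec ℕ m) where

  Au = FromPerm.aff u Pu
  wu = inW0⇒W0 Au u∈
  Aw = FromPerm.aff w Pw
  ww = inW0⇒W0 Aw w∈

  d = fst (Len-nat (sh w))
  ra = reverse (toList a)

  -- The range of labels leaves room for w and for d blocks of weak steps from the identity.
  Bn = suc (bd-win (sh w)) N.+ d

  X : ℤ
  X = + Bn * N

  -- With 2 `Bn` + 1 periods the range runs from 1 - `X` to 1 + `X` + k, around the sign change of
  -- the identity.
  open RangeH (- X) (Bn N.+ Bn)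
  open InRange (- X) (Bn N.+ Bn)

  lo≡ : lo == + 1 - X
  lo≡ = Z.+-comm (- X) (+ 1)

  hi≡ : hi == + 1 + X + + k
  hi≡ = cong (\ z -> - X +1 + z) (cong (\ z -> + suc k' + z) (Z.pos-* (Bn N.+ Bn) n) · refl) · eq (+ Bn) N (+ k)
   where
   eq : ∀ B N k -> - (B * N) + + 1 + (k + (B + B) * N) == + 1 + B * N + k
   eq = solve

  Bd-w : Bd lo hi (sh w)
  Bd-w = bd (\ j p -> hv-small (sh w) Bn j lt (subst (j ≤_) lo≡ p))
   (\ j p -> Z.<⇒≤ (hv-large (sh w) Bn j lt (Z.≤-trans (lin (X & + k & []) (0' =< x1 & []) (1' :+ x0 =< 1' :+ x0 :+ x1) 0≤+) (subst (_≤ j) hi≡ p))))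
   where
   lt : bd-win (sh w) N.< Bn
   lt = N.m≤m+n (suc (bd-win (sh w))) d

  room : + 1 + + (d N.* k) ≤ X
  room = Z.≤-trans (Z.+≤+ le) (Z.≤-reflexive (Z.pos-* Bn n))
   where
   le : suc (d N.* k) N.≤ Bn N.* n
   le = N.≤-trans (s≤s (N.≤-trans (N.*-monoʳ-≤ d (N.n≤1+n k)) (N.m≤n+m (d N.* n) k))) (N.*-monoˡ-≤ n {suc d} {Bn} (s≤s (N.m≤n+m d (bd-win (sh w)))))

  Bd-id : ∀ l -> l N.≤ d -> B+ (l N.* k) idS
  Bd-id l le = Bd-weaken lo hi (d N.* k) (l N.* k) idS (N.*-monoˡ-≤ k le) (Bd-idS
   (subst (\ z -> z + + (d N.* k) ≤ + 0) (sym lo≡) (lin (X & + (d N.* k) & []) (1' :+ x1 =< x0 & []) (1' :- x0 :+ x1 =< 0') room))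
   (subst (\ z -> + 1 ≤ z - + (d N.* k)) (sym hi≡) (lin (X & + (d N.* k) & + k & []) (1' :+ x1 =< x0 & 0' =< x2 & []) (1' =< 1' :+ x0 :+ x2 :- x1) room 0≤+)))

  δu : Fun
  δu = δS (sh u)

  Ur-Sfun : ∀ rs β -> All (N._≤ k) β -> length β N.≤ d -> Ur β (Sfun (sh u) rs) idS == takes rs β (\ β' -> Ur β' δu idS)
  Ur-Sfun [] β al le = refl
  Ur-Sfun (r ∷ rs) β al le = Ur-Hm idS T-idS β (+ r) (Sfun (sh u) rs) al (Bd-id (length β) le) ·
   take-bounded k (+ r) β _ _ al (\ β' e al' -> Ur-Sfun rs β' al' (subst (N._≤ d) (sym e) le))

  P = partitions (size a)

  isP : ∀ la -> la ∈ P -> T (isPartition la)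
  isP la la∈ with partsMax-sound (size a) (size a) (size a) la∈
  ... | isPart p w _ _ = partition-T (size a) la p w

  -- The right side with w made variable, a combination of indicator functions of states. Separation
  -- is applied to its difference from the path count.
  Rhs : Fun
  Rhs s = ƩL P (\ la -> schurCoeff la a * ƩL (Ws la) (\ v -> c la v * δS (sh v) s))

  -- The Cauchy identity enters here: S_λ at the exponent a, paired with the factor S_λ of the
  -- product, sums to `Mat`, and `takes-cv` reads the resulting convolution as removing the entries
  -- of a from ν.
  product-side : ∀ ν -> All Part ν -> T (isPartition ν) -> ƩL P (\ la -> schurCoeff la a * prodMCoeff k u la ν) == takes ra ν (\ β -> Ur β δu idS)
  product-side ν pν ν∈ = ƩL-ext P (\ la -> cong (\ z -> schurCoeff la a * z) (below-bounded k νv _ (\ b -> Ur (toList b) δu idS * schurCoeff la (diff b)) bν (\ b bb -> cong (\ z -> z * schurCoeff la (diff b)) (dual-U u Au wu b bb))) · sym (ƩL-* (below νv) (schurCoeff la a) (\ b -> Ur (toList b) δu idS * schurCoeff la (diff b)))) ·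
   ƩL-swap P (below νv) (\ la b -> schurCoeff la a * (Ur (toList b) δu idS * schurCoeff la (diff b))) ·
   ƩL-ext (below νv) (\ b -> ƩL-ext P (\ la -> alg (schurCoeff la a) (Ur (toList b) δu idS) (schurCoeff la (diff b))) · ƩL-* P (Ur (toList b) δu idS) (\ la -> schurCoeff la a * schurCoeff la (diff b)) ·
    cong (\ z -> Ur (toList b) δu idS * z) (schur-cauchy a (diff b) · Mat-reverse (size a) ra (toList (diff b)))) ·
   below-cv νv (\ β γ -> Ur β δu idS * Mat ra γ) · cong (\ z -> cv z (\ β γ -> Ur β δu idS * Mat ra γ)) toList-fromList · sym (takes-cv (size a) ra ν (\ β -> Ur β δu idS))
   where
   open Box (size a) using (Mat)
   νv = Vec.fromList ν
   toList-fromList : toList νv == ν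
   toList-fromList = VP.toList∘fromList ν
   diff : Vec ℕ (length ν) -> Vec ℕ (length ν)
   diff b = Vec.zipWith N._∸_ νv b
   bν : All (N._≤ k) (toList νv)
   bν = subst (All (N._≤ k)) (sym toList-fromList) (All.map snd pν)
   alg : ∀ x y z -> x * (y * z) == y * (x * z)
   alg = solve

  Rhs-Ur : ∀ ν -> All Part ν -> T (isPartition ν) -> Ur ν Rhs idS == ƩL P (\ la -> schurCoeff la a * prodMCoeff k u la ν)
  Rhs-Ur ν pν ν∈ = linear-ƩL (Ur-linear ν) P (\ la -> schurCoeff la a) (\ la s -> ƩL (Ws la) (\ v -> c la v * δS (sh v) s)) idS ·
   ƩL-cong P (\ la la∈ -> cong (\ z -> schurCoeff la a * z) (let (_ , good-v , eq) = expand la (isP la la∈) in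
    trans (linear-ƩL (Ur-linear ν) (Ws la) (c la) (\ v -> δS (sh v)) idS)
    (ƩL-cong (Ws la) (\ v v∈ -> let (Pv , v0) = All.lookup good-v v∈ in cong (\ z -> c la v * z) (sym (Kmat-U ν v pν (FromPerm.aff v Pv) (inW0⇒W0 (FromPerm.aff v Pv) v0)))) ·
    sym (eq ν ν∈ (kBounded-T ν (All.map snd pν))))))

  -- Normalising β gives a k-bounded partition ν, to which the expansion hypothesis applies. It has
  -- at most d parts because its size is d, and the range was chosen with slack for d blocks of weak
  -- steps.
  agree : ∀ β -> All (N._≤ k) β -> sum β == d -> Ur β (\ s -> Sfun (sh u) ra s - Rhs s) idS == + 0
  agree β al sm = sym (Ur-norm β _ idS) · linear-minus (Ur-linear ν) (Sfun (sh u) ra) Rhs idS ·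
   cong2 _-_ (Ur-Sfun ra ν (All.map snd pν) short) (Rhs-Ur ν pν ν∈ · product-side ν pν ν∈) · Z.+-inverseʳ (takes ra ν (\ β -> Ur β δu idS))
   where
   ν = norm β
   pν = norm-Part β al
   ν∈ : T (isPartition ν)
   ν∈ = partition-T k ν (norm-1 β) (norm-WD k β al)
   len-sum : ∀ xs -> All (1 N.≤_) xs -> length xs N.≤ sum xs
   len-sum [] [] = z≤n
   len-sum (x ∷ xs) (p ∷ ps) = N.+-mono-≤ p (len-sum xs ps)
   short : length ν N.≤ d
   short = subst (length ν N.≤_) (sum-norm β · sm) (len-sum ν (norm-1 β))

  coefficient : ∀ la -> la ∈ P -> ƩL (Ws la) (\ v -> c la v * δS (sh v) (sh w)) == c la w
  coefficient la la∈ with expand la (isP la la∈) | any? (VP.≡-dec Z._≟_ w) (Ws la)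
  ... | un , good-v , _ | yes w∈Ws = ƩL-unique (Ws la) (\ v -> c la v * δS (sh v) (sh w)) un w∈Ws (\ v v∈ ne -> off v (All.lookup good-v v∈) ne) · cong (\ z -> c la w * z) (»-yes (VP.≡-dec Z._≟_ (sh w) (sh w)) refl) · Z.*-identityʳ (c la w)
   where
   off : ∀ v -> IsAffPerm k v × T (inW0 k v) -> ¬ v == w -> c la v * δS (sh v) (sh w) == + 0
   off v (Pv , v0) ne = cong (\ z -> c la v * z) (»-no (VP.≡-dec Z._≟_ (sh w) (sh v)) (\ e -> ne (sh-injective v w Av Aw (inW0⇒W0 Av v0) ww (sym e)))) · Z.*-zeroʳ (c la v)
    where Av = FromPerm.aff v Pv
  ... | un , good-v , _ | no w∉ = ƩL-zero (Ws la) (\ v v∈ -> off v v∈ (All.lookup good-v v∈)) · sym (support la (isP la la∈) w∉)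
   where
   off : ∀ v -> v ∈ Ws la -> IsAffPerm k v × T (inW0 k v) -> c la v * δS (sh v) (sh w) == + 0
   off v v∈ (Pv , v0) = cong (\ z -> c la v * z) (»-no (VP.≡-dec Z._≟_ (sh w) (sh v)) (\ e -> w∉ (subst (_∈ Ws la) (sh-injective v w Av Aw (inW0⇒W0 Av v0) ww (sym e)) v∈))) · Z.*-zeroʳ (c la v)
    where Av = FromPerm.aff v Pv

  result : ƩL paths (\ ω -> Fcoeff (D ω) a) == ƩL P (\ la -> c la w * schurCoeff la a)
  result = count u w Au wu Aw ww Bd-w paths uniq sound complete a ·
   lin (Sfun (sh u) ra (sh w) & Rhs (sh w) & []) (x0 :- x1 := 0' & []) (x0 := x1) (separation d (\ s -> Sfun (sh u) ra s - Rhs s) agree (sh w) (good (snd (Len-nat (sh w))) (FromPerm.charge w Pw))) ·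
   ƩL-cong P (\ la la∈ -> cong (\ z -> schurCoeff la a * z) (coefficient la la∈) · Z.*-comm (schurCoeff la a) (c la w))

open import Defs
open import Data.Nat using (_≤_)
open import Relation.Binary.PropositionalEquality using (_≡_)

theorem4p5 : (k : ℕ) → 1 ≤ k →
    (u w : Window k) → IsAffPerm k u → T (inW0 k u) → IsAffPerm k w → T (inW0 k w) →
    (paths : List (List (ℤ × ℤ))) → Unique paths →
    All (λ ω → PathFromTo k u ω w) paths →
    (∀ ω → PathFromTo k u ω w → ω ∈ paths) →
    (Ws : List ℕ → List (Window k)) → (c : List ℕ → Window k → ℤ) →
    (∀ la → T (isPartition la) →
    Unique (Ws la)
    × All (λ v → IsAffPerm k v × T (inW0 k v)) (Ws la)
    × (∀ mu → T (isPartition mu) → T (kBounded k mu) →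
    prodMCoeff k u la mu ≡ sumℤ (map (λ v → c la v * + Kmat k mu v) (Ws la)))) →
    (∀ la → T (isPartition la) → ¬ (w ∈ Ws la) → c la w ≡ + 0) →
    (N : ℕ) (a : Vec ℕ N) →
    sumℤ (map (λ ω → Fcoeff (D ω) a) paths)
    ≡ sumℤ (map (λ la → c la w * schurCoeff la a) (partitions (size a)))
theorem4p5 (suc k') _ u w Pu u∈ Pw w∈ paths uniq sound complete Ws c expand support N a =
  Final.Main.result k' u w Pu u∈ Pw w∈ paths uniq sound complete Ws c expand support a
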